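{- Let $n\geq 0$ and let $\mathbb B$ be a structure with a finite domain and a finite relational signature $\tau$. Then the following are equivalent. \begin{enumerate} \item $\mathrm{Pol}(\mathbb B)$ contains operations that form an elevator chain of length $n+1$ and, for all $\ell,k\geq 1$, a $k$-absorptive operation of arity $\ell k$. \item $\mathbb B$ has caterpillar duality and $\mathrm{CSP}(\mathbb B)$ is closed under $(n+1)$-foldings of caterpillars. \item The canonical s$_n$lam Datalog program for $\mathbb B$ solves $\mathrm{CSP}(\mathbb B)$. \item Some s$_n$lam Datalog program solves $\mathrm{CSP}(\mathbb B)$. \item $\mathbb B$ has caterpillar duality and $\overline{\mathrm{CSP}(\mathbb B)}$ (the class of finite $\tau$-structures that have no homomorphism to $\mathbb B$) is closed under $n$-fixed unfoldings of caterpillars. \item $\mathbb B$ has $n$-fixed unfolded caterpillar duality. \item If $\mathrm{Pol}(\mathbb B)$ does not satisfy a minor condition $\Sigma$, then $\Sigma$ implies (for finite clones) $\mathrm{HM}(n)$. \item Every minor condition that holds in $\mathrm{Pol}(\mathbb T_{n+2})$ also holds in $\mathrm{Pol}(\mathbb B)$. \item There is a minion homomorphism from $\mathrm{Pol}(\mathbb T_{n+2})$ to $\mathrm{Pol}(\mathbb B)$. \item There is a primitive positive construction of $\mathbb B$ in $\mathbb T_{n+2}$. \item $\mathbb B$ is homomorphically equivalent to a structure $\mathbb B'$ such that $\mathrm{Pol}(\mathbb B')$ contains operations that form an elevator chain of length $n+1$ and binary operations $\sqcup$ and $\sqcap$ such that $(B',\sqcup,\sqcap)$ is a (distributive) lattice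 (the equivalence holds both with "lattice" and with "distributive lattice"). \end{enumerate}
   Context: **Basics.** All structures have finite domains and relational signatures (relation symbols of arity at least 1). $\mathbb A\to\mathbb B$ means there is a homomorphism. $\mathrm{CSP}(\mathbb B)$ is the class of finite $\tau$-structures $\mathbb A$ with $\mathbb A\to\mathbb B$. $\mathrm{Pol}(\mathbb B)$ is the set of all homomorphisms $\mathbb B^m\to\mathbb B$, $m\ge1$. $\mathbb T_m$ is the transitive tournament: the digraph on $\{0,\dots,m-1\}$ with edges $(i,j)$ for $i<j$. $\mathbb B$ has a primitive positive (pp-)construction in $\mathbb A$ if $\mathbb B$ is homomorphically equivalent to a structure with domain $A^d$ (some $d\ge1$) in which each relation of arity $r$, viewed as a $dr$-ary relation on $A$, is definable in $\mathbb A$ by a pp-formula (atomic formulas including equality, conjunction, existential quantification). **Minions, minor conditions.** For $f\colon A^n\to B$ and $\sigma\colon[n]\to[m]$ the minor $f_\sigma\colon A^m\to B$ is $f_\sigma(a_1,\dots,a_m)=f(a_{\sigma(1)},\dots,a_{\sigma(n)})$. A minion is a set of functions $A^n\to B$ ($n\geq 1$) closed under minors; a minion homomorphism is an arity-preserving map $\xi$ with $\xi(f_\sigma)=\xi(f)_\sigma$. A minor condition is a finite set of identities $f(x_1,\dots,x_n)\approx g(y_1,\dots,y_m)$ with $f,g$ function symbols and variables not necessarily distinct; a minion satisfies it if the symbols can be interpreted by elements of the minion of the right arity such that all identities hold for all assignments of the variables. $\Sigma$ implies (for finite clones) $\Sigma'$ if every clone over a finite domain satisfying $\Sigma$ satisfies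 $\Sigma'$. $\mathrm{HM}(n)$, $n\ge1$: $p_0(x)\approx p_1(x,y,y)$; $p_i(x,x,y)\approx p_{i+1}(x,y,y)$ for $1\le i\le n-1$; $p_n(x,x,y)\approx p_{n+1}(y)$. $\mathrm{HM}(0)$: $p_0(x)\approx p_1(y)$. Elevator condition $\mathrm{Ele}(n)$, $n\ge1$ ($e_0,e_{n+1}$ of arity $n$, $e_1,\dots,e_n$ of arity $n+2$): $e_0(x_1,\dots,x_n)\approx e_1(x_1,z,z,x_2,\dots,x_n)$; for $i\in[n-1]$: $e_i(x_1,\dots,x_{i-1},y,y,x_i,x_{i+1},x_{i+2},\dots,x_n)\approx e_{i+1}(x_1,\dots,x_{i-1},x_i,x_{i+1},z,z,x_{i+2},\dots,x_n)$; and $e_n(x_1,\dots,x_{n-1},y,y,x_n)\approx e_{n+1}(x_1,\dots,x_n)$. Operations satisfying $\mathrm{Ele}(n)$ form an elevator chain of length $n$. An operation $f$ of arity $\ell k$, with arguments split into $\ell$ consecutive blocks of length $k$, is $k$-absorptive if, writing $S_1,\dots,S_\ell$ for the sets of entries of the blocks: (a) the value of $f$ depends only on $\{S_1,\dots,S_\ell\}$ (so one may write $f(S_1,\dots,S_\ell)$), and (b) $f(S_1,S_2,S_3,\dots,S_\ell)=f(S_2,S_2,S_3,\dots,S_\ell)$ whenever $S_2\subseteq S_1$. **Caterpillars.** A structure is injective if every tuple in every relation has pairwise distinct entries. The canonical database of a pp-formula (in prenex form, quantified variables renamed apart) is the structure whose elements are its variables and whose tuples are its atomic conjuncts. An injective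 $\tau$-structure $\mathbb C$ is a caterpillar if there are distinct elements $a_0,\dots,a_m$ and a pp-formula $\phi\wedge\psi$ in free variables $a_0,\dots,a_m$ whose canonical database is isomorphic to $\mathbb C$, where $\phi=\phi_0(a_0,a_1)\wedge\dots\wedge\phi_{m-1}(a_{m-1},a_m)$, each $\phi_i$ being obtained from an atomic formula in which $a_i$ and $a_{i+1}$ occur by existentially quantifying all other variables; $\psi=\psi_0(a_0)\wedge\dots\wedge\psi_m(a_m)$, each $\psi_i$ being a possibly empty conjunction of formulas obtained from an atomic formula in which $a_i$ occurs by existentially quantifying all other variables; and, unless $\mathbb C$ is an isolated point, $\psi_0,\psi_m$ are nonempty. $(a_0,\dots,a_m)$ is the spine, the $a_i$ are joints, the pairs $(a_k,a_{k+1})$ are vertebrae. For $i<j$, the $(a_i,a_j)$-unfolding of $\mathbb C$ is the canonical database of the conjunction, using new variables $a'_{i+1},\dots,a'_j,a''_i,\dots,a''_{j-1}$, of: $\phi_k(a_k,a_{k+1})$ for $k<i$ and $k\ge j$; $\psi_k(a_k)$ for $k\le i$ and $k\ge j$; the formulas $\phi_i,\dots,\phi_{j-1}$ along each of the sequences $(a_i,a'_{i+1},\dots,a'_{j-1},a'_j)$, $(a''_i,a_{i+1},\dots,a_{j-1},a'_j)$, $(a''_i,a''_{i+1},\dots,a''_{j-1},a_j)$; and $\psi_k(a'_k),\psi_k(a_k),\psi_k(a''_k)$ for $i<k<j$. It is a caterpillar with spine $(a_0,\dots,a_i,a'_{i+1},\dots,a'_j,a_{j-1},\dots,a_{i+1},a''_i,a''_{i+1},\dots,a''_{j-1},a_j,\dots,a_m)$.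 It fixes the vertebrae $(a_k,a_{k+1})$ with $k<i$ or $k\ge j$ (which remain vertebrae). An unfolding of $\mathbb C$ fixing a set of vertebrae is a structure obtained from $\mathbb C$ by repeatedly (zero or more times) applying $(a,b)$-unfoldings that fix all these vertebrae. A class $\mathcal F$ is closed under $n$-fixed unfoldings of caterpillars if for every caterpillar $\mathbb C\in\mathcal F$ there is a set of at most $n$ vertebrae of $\mathbb C$ such that every unfolding of $\mathbb C$ fixing them is in $\mathcal F$. If $\mathbb C$ is a caterpillar with spine $(a_0,\dots,a_m)$, $0\le i_1<j_1\le\dots\le i_n<j_n\le m$, and $\mathbb C_k$ is the $(a_{i_k},a_{j_k})$-unfolding of $\mathbb C$ for $k\in[n]$, then $\mathbb C$ is an $n$-folding of $(\mathbb C_1,\dots,\mathbb C_n)$. A class is closed under $n$-foldings of caterpillars if it contains all $n$-foldings of all $n$-tuples of caterpillars from it. **Dualities.** $(\mathcal F,\mathbb B)$ is a duality pair if for every finite structure $\mathbb A$: $\mathbb A\not\to\mathbb B$ iff some $\mathbb F\in\mathcal F$ has $\mathbb F\to\mathbb A$. $\mathbb B$ has caterpillar duality if there is a duality pair $(\mathcal F,\mathbb B)$ with $\mathcal F$ a set of caterpillars; it has $n$-fixed unfolded caterpillar duality if moreover $\mathcal F$ can be chosen closed under $n$-fixed unfoldings of caterpillars. **Datalog.** Let $\tau\subseteq\rho$ be finite relational signatures; symbols of $\tau$ are EDBs, those of $\rho\setminus\tau$ are IDBs, one of which is the 0-ary goal predicate $G$. A Datalog program is a finite set of rules $\phi_0\;{:}{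 - }\;\phi_1\wedge\dots\wedge\phi_r$ with atomic $\rho$-formulas $\phi_i$, the head $\phi_0$ having an IDB symbol. A derivation on a finite $\tau$-structure starts with all IDBs empty and repeatedly adds the head tuple of a rule under an assignment satisfying its body; it derives the goal if $G$ becomes nonempty. A program solves $\mathrm{CSP}(\mathbb B)$ if for every finite $\tau$-structure $\mathbb A$ it can derive the goal on $\mathbb A$ iff $\mathbb A\not\to\mathbb B$. It is linear if every rule body has at most one IDB atom (listed first), arc if each rule has at most one EDB atom, monadic if all IDBs have arity at most 1. The reversed rule of $\phi_0\;{:}{ - }\;\phi_1\wedge\phi_2\wedge\dots\wedge\phi_r$ ($\phi_1$ an IDB atom) is $\phi_1\;{:}{ - }\;\phi_0\wedge\phi_2\wedge\dots\wedge\phi_r$. A linear program is symmetric if it contains the reversed rule of each of its rules that has an IDB in the body and whose head is not $G$. It is $n$-almost symmetric if it is linear and there is a quasi-order $\le$ on the IDBs such that every strict chain $P_1<\dots<P_m$ has $m\le n+1$, and for every rule with head IDB $P_0$ and body IDB $P_1$ we have $P_0\le P_1$, and if also $P_1\le P_0$ then the reversed rule is in the program. "s$_n$lam" means $n$-almost symmetric, linear, arc, monadic; "lam" means linear, arc, monadic; "slam" means symmetric and lam. Canonical programs for $\mathbb B$: let $k$ be the maximal arity of symbols of $\tau$. Introduce an IDB for every unary relation on $B$, and the goal predicate, interpreted as the empty 0-ary relation. The canonical lam program consists of all linear arc rules over these symbols with at most $k$ variables such that $\forall\bar x(\phi_1\wedge\dots\wedge\phi_r\Rightarrow\phi_0)$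 holds in the expansion of $\mathbb B$ by the IDBs. The canonical slam program consists of those of its rules that have no IDB in the body, or head $G$, or whose reversed rule is also in it. The canonical s$_n$lam program consists of $n+1$ copies $\Pi_0,\dots,\Pi_n$ of the canonical slam program together with, for each rule $\phi_0\;{:}{ - }\;\phi_1\wedge\phi_2\wedge\dots\wedge\phi_r$ of the canonical lam program with $\phi_0,\phi_1$ IDB atoms and each $i\in\{0,\dots,n-1\}$, the rule $\phi_0^i\;{:}{ - }\;\phi_1^{i+1}\wedge\phi_2\wedge\dots\wedge\phi_r$, where the superscript $j$ indicates the copy of the IDB in $\Pi_j$; the program derives the goal if some copy of the goal predicate is derived. -}

module Defs where

open import Level using (0ℓ)
open import Algebra.Core using (Op₂)
open import Algebra.Lattice.Structures using (IsLattice; IsDistributiveLattice)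
open import Data.Empty using (⊥)
open import Data.Fin.Base as Fin using (Fin; zero; suc; toℕ; inject₁; fromℕ)
import Data.Fin.Properties as Fin
open import Data.Fin.Subset using (Subset; ∣_∣) renaming (_∈_ to _∈ₛ_)
open import Data.List.Base as List using (List; []; _∷_; _++_; length; allFin)
open import Data.List.Extrema.Nat using (max)
open import Data.List.Membership.Propositional using (_∈_)
open import Data.List.Relation.Unary.All using (All)
open import Data.List.Relation.Unary.Linked using (Linked)
open import Data.Maybe.Base using (Maybe; just; nothing)
open import Data.Nat.Base using (ℕ; zero; suc; _+_; _*_; _≤_; NonZero)
import Data.Nat.Properties as ℕ
open import Data.Product.Base using (Σ; Σ-syntax; ∃; ∃-syntax; _×_; _,_; proj₁; proj₂)
open import Data.Sum.Base using (_⊎_; inj₁; inj₂)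
open import Data.Unit.Base using (⊤)
open import Data.Vec.Base as Vec
  using (Vec; []; _∷_; lookup; tabulate; insertAt; replicate; _[_]≔_)
import Data.Vec.Membership.Propositional as Vec
open import Function.Bundles using (_↔_; _⇔_; module Inverse)
open import Relation.Binary.Core using (Rel)
open import Relation.Binary.Structures using (IsPreorder)
open import Relation.Binary.PropositionalEquality
  using (_≡_; _≢_; _≗_)
open import Relation.Nullary using (¬_; yes; no)
open import Relation.Nullary.Decidable using (_×-dec_)
open import Relation.Unary using (Pred)

Finite : Set → Set
Finite A = ∃[ k ] (A ↔ Fin k)

TFAE : List Set₁ → Set₁
TFAE Ps = ∀ i j → List.lookup Ps i → List.lookup Ps j

------------------------------------------------------------------------
-- Relational structures

record Signature : Set where
  field
    #symbols       : ℕ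
    arity          : Fin #symbols → ℕ
    arity-positive : ∀ s → NonZero (arity s)

  Symbol : Set
  Symbol = Fin #symbols

open Signature public

-- Finiteness of the domain is not built in; it is required explicitly
-- wherever the domain is not finite by construction.
record Structure (τ : Signature) : Set₁ where
  field
    Carrier : Set
    rel     : (s : Symbol τ) → Vec Carrier (arity τ s) → Set

open Structure public

module _ {τ : Signature} where

  IsHom : (𝔸 𝔹 : Structure τ) → (Carrier 𝔸 → Carrier 𝔹) → Set
  IsHom 𝔸 𝔹 f = ∀ s t → rel 𝔸 s t → rel 𝔹 s (Vec.map f t)

  infix 4 _⟶_ _⟷_ _≅_

  _⟶_ : Structure τ → Structure τ → Set
  𝔸 ⟶ 𝔹 = ∃ (IsHom 𝔸 𝔹)

  _⟷_ : Structure τ → Structure τ → Set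
  𝔸 ⟷ 𝔹 = (𝔸 ⟶ 𝔹) × (𝔹 ⟶ 𝔸)

  record _≅_ (𝔸 𝔹 : Structure τ) : Set where
    field
      bijection : Carrier 𝔸 ↔ Carrier 𝔹
    open Inverse bijection public using (to; from)
    field
      to-hom   : IsHom 𝔸 𝔹 to
      from-hom : IsHom 𝔹 𝔸 from

  power : Structure τ → ℕ → Structure τ
  power 𝔹 m = record
    { Carrier = Vec (Carrier 𝔹) m
    ; rel     = λ s t → ∀ (i : Fin m) → rel 𝔹 s (Vec.map (λ v → lookup v i) t)
    }

digraph : Signature
digraph = record { #symbols = 1 ; arity = λ _ → 2 ; arity-positive = λ _ → _ }

𝕋 : ℕ → Structure digraph
𝕋 m = record { Carrier = Fin m ; rel = λ { _ (x ∷ y ∷ []) → x Fin.< y } }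

------------------------------------------------------------------------
-- Primitive positive constructions

data PP (τ : Signature) (n : ℕ) : Set where
  atom : (s : Symbol τ) → Vec (Fin n) (arity τ s) → PP τ n
  _≐_  : Fin n → Fin n → PP τ n
  _∧_  : PP τ n → PP τ n → PP τ n
  ∃∃_  : PP τ (suc n) → PP τ n

_⊨_[_] : ∀ {τ n} (𝔸 : Structure τ) → PP τ n → Vec (Carrier 𝔸) n → Set
𝔸 ⊨ atom s xs [ ρ ] = rel 𝔸 s (Vec.map (lookup ρ) xs)
𝔸 ⊨ x ≐ y     [ ρ ] = lookup ρ x ≡ lookup ρ y
𝔸 ⊨ φ ∧ ψ     [ ρ ] = 𝔸 ⊨ φ [ ρ ] × 𝔸 ⊨ ψ [ ρ ]
𝔸 ⊨ ∃∃ φ      [ ρ ] = ∃[ a ] 𝔸 ⊨ φ [ a ∷ ρ ]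

ppPower : ∀ {σ τ} (𝔸 : Structure σ) (d : ℕ) →
          (∀ s → PP σ (arity τ s * d)) → Structure τ
ppPower 𝔸 d φ = record
  { Carrier = Vec (Carrier 𝔸) d
  ; rel     = λ s t → 𝔸 ⊨ φ s [ Vec.concat t ]
  }

_PPConstructs_ : ∀ {σ τ} → Structure σ → Structure τ → Set
_PPConstructs_ {σ} {τ} 𝔸 𝔹 =
  ∃[ d ] NonZero d ×
  Σ[ φ ∈ (∀ s → PP σ (arity τ s * d)) ] (𝔹 ⟷ ppPower 𝔸 d φ)

------------------------------------------------------------------------
-- Operations, clones, minor conditions

Op : Set → ℕ → Set
Op A m = Vec A m → A

-- Only the members of positive arity are ever considered.
OpSet : Set → Set₁
OpSet A = ∀ m → Op A m → Set

Pol : ∀ {τ} (𝔹 : Structure τ) → OpSet (Carrier 𝔹)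
Pol 𝔹 m = IsHom (power 𝔹 m) 𝔹

minor : ∀ {A n m} → (Fin n → Fin m) → Op A n → Op A m
minor σ f a = f (tabulate (λ i → lookup a (σ i)))

-- The map is defined on operations as Agda functions, so it must not
-- distinguish pointwise equal ones; `preserves` contains this as the
-- case where σ is the identity.
record MinionHom {A B : Set} (M : OpSet A) (N : OpSet B) : Set where
  field
    map       : ∀ {m} .{{_ : NonZero m}} → Σ (Op A m) (M m) → Σ (Op B m) (N m)
    preserves : ∀ {n m} .{{_ : NonZero n}} .{{_ : NonZero m}}
                (f : Σ (Op A n) (M n)) (g : Σ (Op A m) (M m)) (σ : Fin n → Fin m) →
                proj₁ g ≗ minor σ (proj₁ f) →
                proj₁ (map g) ≗ minor σ (proj₁ (map f))

record Clone (A : Set) : Set₁ where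
  field
    member      : OpSet A
    projection  : ∀ {m} (i : Fin m) → member m (λ a → lookup a i)
    composition : ∀ {m l} .{{_ : NonZero m}} .{{_ : NonZero l}}
                  {f : Op A m} {g : Fin m → Op A l} →
                  member m f → (∀ i → member l (g i)) →
                  member l (λ a → f (tabulate (λ i → g i a)))
    respects-≗  : ∀ {m} {f g : Op A m} → f ≗ g → member m f → member m g

-- f(x₁,…,xₙ) ≈ g(y₁,…,yₘ), the variables being named by natural numbers
record Identity {k : ℕ} (ar : Fin k → ℕ) : Set where
  constructor _⟨_⟩≈_⟨_⟩
  field
    lhs     : Fin k
    lhsArgs : Vec ℕ (ar lhs)
    rhs     : Fin k
    rhsArgs : Vec ℕ (ar rhs)

record MinorCondition : Set where
  field
    #functions     : ℕ
    ar             : Fin #functions → ℕ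
    ar-positive    : ∀ f → NonZero (ar f)
    identities     : List (Identity ar)

_Satisfies_ : ∀ {A} → OpSet A → MinorCondition → Set
_Satisfies_ {A} M Γ =
  Σ[ ⟦_⟧ ∈ (∀ f → Op A (ar f)) ]
    (∀ f → M (ar f) ⟦ f ⟧) ×
    All (λ { (f ⟨ xs ⟩≈ g ⟨ ys ⟩) →
             ∀ (ρ : ℕ → A) → ⟦ f ⟧ (Vec.map ρ xs) ≡ ⟦ g ⟧ (Vec.map ρ ys) })
        identities
  where open MinorCondition Γ

_ImpliesForFiniteClones_ : MinorCondition → MinorCondition → Set₁
Γ ImpliesForFiniteClones Δ =
  ∀ {A : Set} → Finite A → (C : Clone A) →
  Clone.member C Satisfies Γ → Clone.member C Satisfies Δ

-- The symbols p₀, pₙ₊₁, p₁, …, pₙ in this order.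
HM : ℕ → MinorCondition
HM n = record
  { #functions = 2 + n ; ar = ar ; ar-positive = pos ; identities = ids n }
  where
  ar : ∀ {n} → Fin (2 + n) → ℕ
  ar zero          = 1
  ar (suc zero)    = 1
  ar (suc (suc _)) = 3

  pos : ∀ {n} (f : Fin (2 + n)) → NonZero (ar f)
  pos zero          = _
  pos (suc zero)    = _
  pos (suc (suc _)) = _

  pattern first = zero
  pattern last  = suc zero
  pattern p i   = suc (suc i)
  pattern x     = 0
  pattern y     = 1

  ids : ∀ n → List (Identity (ar {n}))
  ids zero    = (first ⟨ x ∷ [] ⟩≈ last ⟨ y ∷ [] ⟩) ∷ []
  ids (suc m) =
    (first ⟨ x ∷ [] ⟩≈ p zero ⟨ x ∷ y ∷ y ∷ [] ⟩) ∷
    (p (fromℕ m) ⟨ x ∷ x ∷ y ∷ [] ⟩≈ last ⟨ y ∷ [] ⟩) ∷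
    List.map (λ i → p (inject₁ i) ⟨ x ∷ x ∷ y ∷ [] ⟩≈ p (suc i) ⟨ x ∷ y ∷ y ∷ [] ⟩)
             (allFin m)

-- x₁,…,xₚ,z,z,xₚ₊₁,…,xₙ
insertTwice : ∀ {A : Set} {n} → Vec A n → Fin (suc n) → A → Vec A (2 + n)
insertTwice xs p z = insertAt (insertAt xs p z) (inject₁ p) z

-- A chain of length n = 1 + m; `e i` is the operation eᵢ₊₁ for i = 0,…,m.
record ElevatorChain[1+_] (m : ℕ) {A : Set} (M : OpSet A) : Set where
  private n = suc m
  field
    e-first e-last : Op A n
    e              : Fin n → Op A (2 + n)
    e-first∈M      : M n e-first
    e-last∈M       : M n e-last
    e∈M            : ∀ i → M (2 + n) (e i)
    start : ∀ xs z → e-first xs ≡ e zero (insertTwice xs (suc zero) z)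
    climb : ∀ (i : Fin m) xs y z →
            e (inject₁ i) (insertTwice xs (inject₁ (inject₁ i)) y)
            ≡ e (suc i) (insertTwice xs (suc (suc i)) z)
    end   : ∀ xs y → e (fromℕ m) (insertTwice xs (inject₁ (fromℕ m)) y) ≡ e-last xs

module _ {A : Set} where

  _⊆ᵉ_ _≈ᵉ_ : ∀ {k} → Vec A k → Vec A k → Set
  S ⊆ᵉ T = ∀ {a} → a Vec.∈ S → a Vec.∈ T
  S ≈ᵉ T = S ⊆ᵉ T × T ⊆ᵉ S

  _⊑_ : ∀ {ℓ k} → Vec (Vec A k) ℓ → Vec (Vec A k) ℓ → Set
  Ss ⊑ Ts = ∀ i → ∃[ j ] lookup Ss i ≈ᵉ lookup Ts j

  DependsOnlyOnSets : ∀ ℓ k → Op A (ℓ * k) → Set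
  DependsOnlyOnSets ℓ k f = ∀ (Ss Ts : Vec (Vec A k) ℓ) →
    Ss ⊑ Ts → Ts ⊑ Ss → f (Vec.concat Ss) ≡ f (Vec.concat Ts)

  -- For ℓ ≤ 1 there is no second block and hence nothing to require.
  AbsorbsSupersets : ∀ ℓ k → Op A (ℓ * k) → Set
  AbsorbsSupersets 0             k f = ⊤
  AbsorbsSupersets 1             k f = ⊤
  AbsorbsSupersets (suc (suc ℓ)) k f =
    ∀ (S₁ S₂ : Vec A k) (Ss : Vec (Vec A k) ℓ) → S₂ ⊆ᵉ S₁ →
    f (Vec.concat (S₁ ∷ S₂ ∷ Ss)) ≡ f (Vec.concat (S₂ ∷ S₂ ∷ Ss))

  Absorptive : ∀ ℓ k → Op A (ℓ * k) → Set
  Absorptive ℓ k f = DependsOnlyOnSets ℓ k f × AbsorbsSupersets ℓ k f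

HasAbsorptive : ∀ {A} → OpSet A → Set
HasAbsorptive {A} M = ∀ ℓ k .{{_ : NonZero ℓ}} .{{_ : NonZero k}} →
  ∃[ f ] M (ℓ * k) f × Absorptive ℓ k f

IsPolymorphism₂ : ∀ {τ} (𝔹 : Structure τ) → Op₂ (Carrier 𝔹) → Set
IsPolymorphism₂ 𝔹 _·_ = Pol 𝔹 2 (λ { (x ∷ y ∷ []) → x · y })

HasLatticePol : ∀ {τ} → Structure τ → Set
HasLatticePol 𝔹 =
  Σ[ _⊔_ ∈ Op₂ (Carrier 𝔹) ] Σ[ _⊓_ ∈ Op₂ (Carrier 𝔹) ]
  (IsPolymorphism₂ 𝔹 _⊔_ × IsPolymorphism₂ 𝔹 _⊓_ × IsLattice _≡_ _⊔_ _⊓_)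

HasDistributiveLatticePol : ∀ {τ} → Structure τ → Set
HasDistributiveLatticePol 𝔹 =
  Σ[ _⊔_ ∈ Op₂ (Carrier 𝔹) ] Σ[ _⊓_ ∈ Op₂ (Carrier 𝔹) ]
  (IsPolymorphism₂ 𝔹 _⊔_ × IsPolymorphism₂ 𝔹 _⊓_ × IsDistributiveLattice _≡_ _⊔_ _⊓_)

------------------------------------------------------------------------
-- Caterpillars

module _ (τ : Signature) where

  -- An atomic formula with all variables outside J existentially quantified:
  -- `just x` is an occurrence of the free variable x, and each `nothing` is a
  -- quantified variable of its own.  (Repeated quantified variables never
  -- occur in injective structures.)
  record Conjunct (J : Set) : Set where
    constructor _⦅_⦆
    field
      symbol : Symbol τ
      args   : Vec (Maybe J) (arity τ symbol)

  -- The formula φᵢ(aᵢ,aᵢ₊₁): a symbol and the positions of aᵢ and aᵢ₊₁.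
  record Link : Set where
    field
      symbol        : Symbol τ
      source target : Fin (arity τ symbol)
      distinct      : source ≢ target

  -- A conjunct of ψᵢ(aᵢ): a symbol and the position of aᵢ.
  record Leg : Set where
    field
      symbol   : Symbol τ
      position : Fin (arity τ symbol)

  -- The formula φ ∧ ψ in the free variables a₀,…,aₘ, where m = len.
  record Caterpillar : Set where
    field
      len  : ℕ
      link : Fin len → Link
      legs : Fin (suc len) → List Leg
      ends : (len ≡ 0 × legs zero ≡ []) ⊎ (legs zero ≢ [] × legs (fromℕ len) ≢ [])

module _ {τ : Signature} where

  linkAt : ∀ {J} → Link τ → J → J → Conjunct τ J
  linkAt φ x y = symbol ⦅ replicate _ nothing [ source ]≔ just x [ target ]≔ just y ⦆
    where open Link φ

  legAt : ∀ {J} → Leg τ → J → Conjunct τ J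
  legAt ψ x = symbol ⦅ replicate _ nothing [ position ]≔ just x ⦆
    where open Leg ψ

  module CanonicalDatabase {J I : Set} (conj : I → Conjunct τ J) where
    open Conjunct

    record Quantified : Set where
      constructor quantified
      field
        conjunct : I
        position : Fin (arity τ (symbol (conj conjunct)))
        .isBound : lookup (args (conj conjunct)) position ≡ nothing

    Variable : Set
    Variable = J ⊎ Quantified

    variableAt : ∀ c (p : Fin (arity τ (symbol (conj c)))) → Variable
    variableAt c p with lookup (args (conj c)) p in eq
    ... | just x  = inj₁ x
    ... | nothing = inj₂ (quantified c p eq)

    data Tuple : (s : Symbol τ) → Vec Variable (arity τ s) → Set where
      tuple : ∀ c → Tuple (symbol (conj c)) (tabulate (variableAt c))

  canonicalDatabase : {J I : Set} → (I → Conjunct τ J) → Structure τ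
  canonicalDatabase conj = record { Carrier = Variable ; rel = Tuple }
    where open CanonicalDatabase conj

  module _ (C : Caterpillar τ) where
    open Caterpillar C

    Joint : Set
    Joint = Fin (suc len)

    conjuncts : Fin len ⊎ (Σ[ k ∈ Joint ] Fin (length (legs k))) → Conjunct τ Joint
    conjuncts (inj₁ k)       = linkAt (link k) (inject₁ k) (suc k)
    conjuncts (inj₂ (k , l)) = legAt (List.lookup (legs k) l) k

    ⟦_⟧ : Structure τ
    ⟦_⟧ = canonicalDatabase conjuncts

  IsCaterpillar : Structure τ → Set
  IsCaterpillar ℂ = ∃[ C ] ℂ ≅ ⟦ C ⟧

  -- The (aᵢ,aⱼ)-unfolding.
  module Unfold (C : Caterpillar τ) (i j : Joint C) (i<j : i Fin.< j) where
    open Caterpillar C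

    data Var : Set where
      a  : Joint C → Var
      a′ : (k : Joint C) → .(i Fin.< k) → .(k Fin.≤ j) → Var
      a″ : (k : Joint C) → .(i Fin.≤ k) → .(k Fin.< j) → Var

    -- The k-th entries of the sequences (aᵢ,a′ᵢ₊₁,…,a′ⱼ),
    -- (a″ᵢ,aᵢ₊₁,…,aⱼ₋₁,a′ⱼ) and (a″ᵢ,…,a″ⱼ₋₁,aⱼ).
    seq₁ seq₂ seq₃ : (k : Joint C) → .(i Fin.≤ k) → .(k Fin.≤ j) → Var
    seq₁ k _ k≤j with i Fin.<? k
    ... | yes i<k = a′ k i<k k≤j
    ... | no  _   = a i
    seq₂ k _ _ with i Fin.<? k | k Fin.<? j
    ... | no  _ | _     = a″ i ℕ.≤-refl i<j
    ... | yes _ | yes _ = a k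
    ... | yes _ | no  _ = a′ j i<j ℕ.≤-refl
    seq₃ k i≤k _ with k Fin.<? j
    ... | yes k<j = a″ k i≤k k<j
    ... | no  _   = a j

    data Index : Set where
      link-fixed : (k : Fin len) → .(inject₁ k Fin.< i ⊎ j Fin.≤ inject₁ k) → Index
      link₁ link₂ link₃ :
        (k : Fin len) → .(i Fin.≤ inject₁ k) → .(suc k Fin.≤ j) → Index
      leg-fixed : (k : Joint C) → .(k Fin.≤ i ⊎ j Fin.≤ k) → Fin (length (legs k)) → Index
      leg leg′ leg″ :
        (k : Joint C) → .(i Fin.< k) → .(k Fin.< j) → Fin (length (legs k)) → Index

    along : ((k : Joint C) → .(i Fin.≤ k) → .(k Fin.≤ j) → Var) →
            (k : Fin len) → .(i Fin.≤ inject₁ k) → .(suc k Fin.≤ j) → Conjunct τ Var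
    along seq k i≤k k<j = linkAt (link k)
      (seq (inject₁ k) i≤k (ℕ.≤-trans (ℕ.<⇒≤ (Fin.≤̄⇒inject₁< {i = k} ℕ.≤-refl)) k<j))
      (seq (suc k) (ℕ.≤-trans i≤k (ℕ.<⇒≤ (Fin.≤̄⇒inject₁< {i = k} ℕ.≤-refl))) k<j)

    conj : Index → Conjunct τ Var
    conj (link-fixed k _)     = linkAt (link k) (a (inject₁ k)) (a (suc k))
    conj (link₁ k i≤k k<j)    = along seq₁ k i≤k k<j
    conj (link₂ k i≤k k<j)    = along seq₂ k i≤k k<j
    conj (link₃ k i≤k k<j)    = along seq₃ k i≤k k<j
    conj (leg-fixed k _ l)    = legAt (List.lookup (legs k) l) (a k)
    conj (leg  k _ _ l)       = legAt (List.lookup (legs k) l) (a k)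
    conj (leg′ k i<k k<j l)   = legAt (List.lookup (legs k) l) (a′ k i<k (ℕ.<⇒≤ k<j))
    conj (leg″ k i<k k<j l)   = legAt (List.lookup (legs k) l) (a″ k (ℕ.<⇒≤ i<k) k<j)

    unfolded : Structure τ
    unfolded = canonicalDatabase conj

    -- (a₀,…,aᵢ,a′ᵢ₊₁,…,a′ⱼ,aⱼ₋₁,…,aᵢ₊₁,a″ᵢ,…,a″ⱼ₋₁,aⱼ,…,aₘ)
    spine : List Var
    spine = List.map a (List.filter (Fin._≤? i) joints)
         ++ List.mapMaybe prime joints
         ++ List.reverse (List.map a (List.filter (λ k → (i Fin.<? k) ×-dec (k Fin.<? j)) joints))
         ++ List.mapMaybe doublePrime joints
         ++ List.map a (List.filter (j Fin.≤?_) joints)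
      where
      joints = allFin (suc len)

      prime doublePrime : Joint C → Maybe Var
      prime k with i Fin.<? k | k Fin.≤? j
      ... | yes i<k | yes k≤j = just (a′ k i<k k≤j)
      ... | _       | _       = nothing
      doublePrime k with i Fin.≤? k | k Fin.<? j
      ... | yes i≤k | yes k<j = just (a″ k i≤k k<j)
      ... | _       | _       = nothing

    -- D presents the unfolding as a caterpillar with the spine above.
    record UnfoldsTo (D : Caterpillar τ) : Set where
      field
        iso       : ⟦ D ⟧ ≅ unfolded
        iso-spine : List.map (λ k → _≅_.to iso (inj₁ k)) (allFin (suc (Caterpillar.len D)))
                    ≡ List.map inj₁ spine

      -- The k′-th vertebra of D is the k-th vertebra of C.
      SameVertebra : Fin (Caterpillar.len D) → Fin len → Set
      SameVertebra k′ k =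
        _≅_.to iso (inj₁ (inject₁ k′)) ≡ inj₁ (a (inject₁ k)) ×
        _≅_.to iso (inj₁ (suc k′))     ≡ inj₁ (a (suc k))

    Fixes : Subset len → Set
    Fixes S = ∀ k → k ∈ₛ S → inject₁ k Fin.< i ⊎ j Fin.≤ inject₁ k

  -- Unfolding C S D: D arises from C by repeated unfoldings which fix the
  -- vertebrae in S; in a step, S′ is the set S seen in the new spine.
  data Unfolding (C : Caterpillar τ) (S : Subset (Caterpillar.len C)) :
                 Caterpillar τ → Set where
    done : Unfolding C S C
    step : ∀ {D E} i j (i<j : i Fin.< j) → Unfold.Fixes C i j i<j S →
           (u : Unfold.UnfoldsTo C i j i<j D) (S′ : Subset (Caterpillar.len D)) →
           (∀ k′ → k′ ∈ₛ S′ ⇔ (∃[ k ] k ∈ₛ S × Unfold.UnfoldsTo.SameVertebra u k′ k)) →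
           Unfolding D S′ E → Unfolding C S E

------------------------------------------------------------------------
-- Classes of structures and dualities

Class : Signature → Set₁
Class τ = Pred (Structure τ) 0ℓ

module _ {τ : Signature} where

  CSP coCSP : Structure τ → Class τ
  CSP   𝔹 𝔸 = Finite (Carrier 𝔸) × 𝔸 ⟶ 𝔹
  coCSP 𝔹 𝔸 = Finite (Carrier 𝔸) × ¬ (𝔸 ⟶ 𝔹)

  ClosedUnderFoldings : ℕ → Class τ → Set₁
  ClosedUnderFoldings n K =
    ∀ (C : Caterpillar τ) (i j : Fin n → Joint C) (i<j : ∀ k → i k Fin.< j k) →
    (∀ {k l} → k Fin.< l → j k Fin.≤ i l) →
    (ℂ : Structure τ) (ℂs : Fin n → Structure τ) →
    ℂ ≅ ⟦ C ⟧ → (∀ k → ℂs k ≅ Unfold.unfolded C (i k) (j k) (i<j k)) →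
    (∀ k → K (ℂs k)) → K ℂ

  ClosedUnderFixedUnfoldings : ℕ → Class τ → Set₁
  ClosedUnderFixedUnfoldings n K =
    ∀ (C : Caterpillar τ) (ℂ : Structure τ) → ℂ ≅ ⟦ C ⟧ → K ℂ →
    ∃[ S ] ∣ S ∣ ≤ n ×
      (∀ {D : Caterpillar τ} → Unfolding C S D →
       ∀ (𝔻 : Structure τ) → 𝔻 ≅ ⟦ D ⟧ → K 𝔻)

  IsDualityPair : Class τ → Structure τ → Set₁
  IsDualityPair F 𝔹 = ∀ (𝔸 : Structure τ) → Finite (Carrier 𝔸) →
    (¬ (𝔸 ⟶ 𝔹)) ⇔ (∃[ 𝔽 ] F 𝔽 × 𝔽 ⟶ 𝔸)

  IsCaterpillarDuality : Class τ → Structure τ → Set₁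
  IsCaterpillarDuality F 𝔹 = (∀ 𝔽 → F 𝔽 → IsCaterpillar 𝔽) × IsDualityPair F 𝔹

  HasCaterpillarDuality : Structure τ → Set₁
  HasCaterpillarDuality 𝔹 = ∃[ F ] IsCaterpillarDuality F 𝔹

  HasFixedUnfoldedCaterpillarDuality : ℕ → Structure τ → Set₁
  HasFixedUnfoldedCaterpillarDuality n 𝔹 =
    ∃[ F ] IsCaterpillarDuality F 𝔹 × ClosedUnderFixedUnfoldings n F

------------------------------------------------------------------------
-- Datalog

record Atom {S : Set} (ar : S → ℕ) (V : Set) : Set where
  constructor _⟪_⟫
  field
    symbol : S
    args   : Vec V (ar symbol)

_⊩_[_] : {S : Set} {ar : S → ℕ} {V A : Set} →
          (∀ s → Vec A (ar s) → Set) → Atom ar V → (V → A) → Set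
I ⊩ s ⟪ xs ⟫ [ ρ ] = I s (Vec.map ρ xs)

module Datalog (τ : Signature) {IDB : Set} (ar : IDB → ℕ) where

  -- head :- (conjunction of idbs) ∧ (conjunction of edbs)
  record Rule : Set where
    field
      #vars : ℕ
      head  : Atom ar (Fin #vars)
      idbs  : List (Atom ar (Fin #vars))
      edbs  : List (Atom (arity τ) (Fin #vars))

  open Rule public

  Program : Set₁
  Program = Pred Rule 0ℓ

  FiniteProgram : Program → Set
  FiniteProgram P = ∃[ rs ] (∀ r → P r ⇔ r ∈ rs)

  data Derives (P : Program) (𝔸 : Structure τ) : ∀ Q → Vec (Carrier 𝔸) (ar Q) → Set where
    fire : ∀ r → P r → (ρ : Fin (#vars r) → Carrier 𝔸) →
           All (λ φ → Derives P 𝔸 (Atom.symbol φ) (Vec.map ρ (Atom.args φ))) (idbs r) →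
           All (λ φ → rel 𝔸 ⊩ φ [ ρ ]) (edbs r) →
           Derives P 𝔸 (Atom.symbol (head r)) (Vec.map ρ (Atom.args (head r)))

  -- `goals` are the copies of the goal predicate; usually there is just one.
  Solves : Program → (goals : Pred IDB 0ℓ) → Structure τ → Set₁
  Solves P goals 𝔹 = ∀ (𝔸 : Structure τ) → Finite (Carrier 𝔸) →
    (∃[ G ] goals G × ∃[ t ] Derives P 𝔸 G t) ⇔ (¬ (𝔸 ⟶ 𝔹))

  LinearRule ArcRule : Pred Rule 0ℓ
  LinearRule r = length (idbs r) ≤ 1
  ArcRule    r = length (edbs r) ≤ 1

  -- The relation `Reversed r r′` says that r has an IDB in its body and that
  -- r′ is the reversed rule.
  data Reversed : Rule → Rule → Set where
    reversed : ∀ {n φ₀ φ₁ φs} →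
      Reversed (record { #vars = n ; head = φ₀ ; idbs = φ₁ ∷ [] ; edbs = φs })
               (record { #vars = n ; head = φ₁ ; idbs = φ₀ ∷ [] ; edbs = φs })

  Monadic : Set
  Monadic = ∀ Q → ar Q ≤ 1

  Linear Arc : Program → Set
  Linear P = ∀ r → P r → LinearRule r
  Arc    P = ∀ r → P r → ArcRule r

  headIDB : Rule → IDB
  headIDB r = Atom.symbol (head r)

  AlmostSymmetric : ℕ → Program → Set₁
  AlmostSymmetric n P = Linear P × Σ[ _≼_ ∈ Rel IDB 0ℓ ]
    (IsPreorder _≡_ _≼_ ×
    (∀ Qs → Linked (λ Q Q′ → Q ≼ Q′ × ¬ (Q′ ≼ Q)) Qs → length Qs ≤ suc n) ×
    (∀ r r′ → P r → Reversed r r′ →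
       headIDB r ≼ headIDB r′ × (headIDB r′ ≼ headIDB r → P r′)))

-- Some n-almost symmetric linear arc monadic program solves CSP(𝔹).
SolvedBySnlam : ∀ {τ} → ℕ → Structure τ → Set₁
SolvedBySnlam {τ} n 𝔹 =
  Σ[ IDB ∈ Set ] Finite IDB × Σ[ ar ∈ (IDB → ℕ) ] let open Datalog τ ar in
  Σ[ G ∈ IDB ] ar G ≡ 0 × Monadic ×
  Σ[ P ∈ Program ] FiniteProgram P × Arc P × AlmostSymmetric n P × Solves P (_≡ G) 𝔹

maxArity : Signature → ℕ
maxArity τ = max 0 (List.map (arity τ) (allFin (#symbols τ)))

-- Subsets of the finite domain B, enumerated as Fin N, are represented by
-- Subset N, so that there are only finitely many IDBs.
module Canonical {τ : Signature} (𝔹 : Structure τ) (finite : Finite (Carrier 𝔹)) where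

  open Inverse (proj₂ finite) using (to)

  data IDB : Set where
    goal  : IDB
    unary : Subset (proj₁ finite) → IDB

  ar : IDB → ℕ
  ar goal      = 0
  ar (unary _) = 1

  interpretation : ∀ Q → Vec (Carrier 𝔹) (ar Q) → Set
  interpretation goal      []       = ⊥
  interpretation (unary U) (b ∷ []) = to b ∈ₛ U

  open Datalog τ ar

  Valid : Rule → Set
  Valid r = ∀ ρ →
    All (λ φ → interpretation ⊩ φ [ ρ ]) (idbs r) →
    All (λ φ → rel 𝔹 ⊩ φ [ ρ ]) (edbs r) →
    interpretation ⊩ head r [ ρ ]

  lam : Program
  lam r = #vars r ≤ maxArity τ × LinearRule r × ArcRule r × Valid r

  slam : Program
  slam r = lam r × (idbs r ≡ [] ⊎ headIDB r ≡ goal ⊎ (∃[ r′ ] Reversed r r′ × lam r′))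

  module Copies (n : ℕ) where

    arᶜ : Fin (suc n) × IDB → ℕ
    arᶜ (_ , Q) = ar Q

    copyAtom : ∀ {V} → Fin (suc n) → Atom ar V → Atom arᶜ V
    copyAtom i (Q ⟪ xs ⟫) = (i , Q) ⟪ xs ⟫

    copyRule : (headCopy bodyCopy : Fin (suc n)) → Rule → Datalog.Rule τ arᶜ
    copyRule i j r = record
      { #vars = #vars r
      ; head  = copyAtom i (head r)
      ; idbs  = List.map (copyAtom j) (idbs r)
      ; edbs  = edbs r
      }

    data snlam : Datalog.Program τ arᶜ where
      within  : ∀ r → slam r → (i : Fin (suc n)) → snlam (copyRule i i r)
      between : ∀ r → lam r → idbs r ≢ [] → (i : Fin n) →
                snlam (copyRule (inject₁ i) (suc i) r)

SolvedByCanonicalSnlam : ∀ {τ} → ℕ → (𝔹 : Structure τ) → Finite (Carrier 𝔹) → Set₁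
SolvedByCanonicalSnlam {τ} n 𝔹 finite =
  Datalog.Solves τ arᶜ snlam (λ Q → proj₂ Q ≡ goal) 𝔹
  where
  open Canonical 𝔹 finite
  open Copies n

{-# OPTIONS --safe #-}
-- All conditions are equivalent to the following: whenever 𝔸 does not map to
-- 𝔹, some path in 𝔸 spells a word of legs and links along which all values of
-- 𝔹 are excluded one set after the other, at most n letters being irreversible.
--
-- A caterpillar is a word, and unfolding it replaces a factor u by u u⁻¹ u.
-- Sets that are carried along u exactly can be folded, by taking the symmetric
-- difference of the sets on the three copies of u, and every set of values that
-- cannot be excluded along the unfoldings of a word is bounded by such exact
-- sets.  Choosing maximal exact segments greedily, closure under (n+1)-foldings
-- or n-fixed unfoldings leaves at most n letters between the segments.
--
-- The sets along the path are a derivation of the canonical program.  A program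
-- with n + 1 levels cannot derive the goal on the power of 𝕋ₙ₊₂ whose
-- coordinates are the maps from 𝔹 to 𝕋ₙ₊₂: a fact U(v) of level n - j forces the
-- coordinate of v at the map with values j + 1 on U and j elsewhere to exceed j.
-- Conversely, 𝕋ₙ₊₂ is a lattice and has an elevator chain, whose operations
-- count the arguments above each threshold, three of them through their parity.
-- If a minor condition fails in 𝕋ₙ₊₂, then every clone satisfying it has, in the
-- digraph of its members of arity n + 2, a walk of length n + 2, hence HM(n).
module Submission where

open import Defs
open import Level using (0ℓ; Lift; lift; lower) renaming (suc to lsuc)
open import Algebra.Core using (Op₂)
open import Axiom.ExcludedMiddle using (ExcludedMiddle)
open import Data.Bool.Base using (Bool; true; false; not; T; _xor_; if_then_else_)
import Data.Bool.Properties as Bool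
open import Data.Empty using (⊥; ⊥-elim)
open import Data.Fin.Base as Fin using (Fin; zero; suc; toℕ; inject₁; fromℕ; fromℕ<)
import Data.Fin.Properties as Fin
open import Data.Fin.Properties using (toℕ-inject₁; toℕ<n; toℕ-fromℕ<; toℕ-fromℕ; toℕ-injective)
open import Data.List.Base as List using (List; []; _∷_; _++_; length; allFin)
import Data.List.Properties as List
open import Data.List.Properties using (++-assoc; ++-identityʳ)
open import Data.List.Membership.Propositional using (_∈_)
import Data.List.Membership.Propositional.Properties as Mem
open import Data.List.Relation.Unary.All as All using (All; []; _∷_)
import Data.List.Relation.Unary.All.Properties as All
open import Data.List.Relation.Unary.Any as Any using (Any; here; there)
open import Data.List.Relation.Unary.Linked using (Linked; []; [-]; _∷_)
open import Data.Maybe.Base as Maybe using (Maybe; just; nothing)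
open import Data.Maybe.Properties using (just-injective)
open import Data.Nat.Base
import Data.Nat.Properties as ℕ
open import Data.Nat.Properties using (_≤?_; _<?_; ≤-trans; <⇒≤; ≤-reflexive; ≮⇒≥; <⇒≱; ≤-refl; m≤m+n; <-≤-trans; +-suc; +-identityʳ; <-irrefl; ≤-pred; ≰⇒>; m≤n⇒m≤1+n; +-comm; ≤-<-trans; m∸n+n≡m; ≤⇒≯; ≤-antisym; n≤1+n; m+[n∸m]≡n; <-trans; +-monoˡ-≤; m≤n+m; m<m+n; 1+n≰n; +-mono-≤; m+n∸n≡m; m+n∸m≡n; +-cancelʳ-≤; +-cancelʳ-≡; ≤∧≢⇒<; +-monoʳ-≤; +-assoc)
open import Data.Product.Base using (Σ; Σ-syntax; ∃; ∃-syntax; ∃₂; _×_; _,_; proj₁; proj₂)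
open import Data.Sum.Base using (_⊎_; inj₁; inj₂)
open import Data.Sum.Properties using (inj₁-injective)
open import Data.Unit.Base using (⊤; tt)
open import Data.Vec.Base as Vec using (Vec; []; _∷_; lookup; tabulate; insertAt; replicate; _[_]≔_)
import Data.Vec.Properties as Vec
open import Data.Vec.Properties using (lookup∘tabulate; lookup-map; tabulate-cong; lookup-concat; map-∘; map-cong)
open import Function.Base using (_∘_; id; case_of_)
open import Function.Bundles using (_↔_; _⇔_; mk⇔; mk↔ₛ′; module Inverse; module Equivalence)
open import Relation.Binary.Construct.Closure.ReflexiveTransitive using (Star; ε; _◅_; _◅◅_; gmap)
open import Relation.Binary.PropositionalEquality
open import Relation.Nullary using (¬_; Dec; yes; no; contradiction; recompute)
open import Relation.Nullary.Decidable using (⌊_⌋; _×-dec_; _⊎-dec_; decidable-stable)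
open import Data.Fin.Subset using (Subset; ∣_∣) renaming (_∈_ to _∈ₛ_)
open import Data.List.Relation.Unary.AllPairs.Core using (AllPairs; []; _∷_)
import Data.List.Relation.Unary.Any.Properties as Any
import Data.List.Relation.Unary.Unique.DecPropositional.Properties as Unique
open import Data.Nat.Tactic.RingSolver using (solve-∀)
import Data.List.Extrema.Nat as Extrema
open import Relation.Binary.Structures using (IsPreorder)
import Data.Fin.Induction as Fin using (<-weakInduction)
import Data.Vec.Membership.Propositional as VecMem
import Data.Vec.Relation.Unary.Any as VecAny
import Data.Vec.Relation.Unary.Any.Properties as VecAny
import Data.Vec.Membership.Propositional.Properties as VecMem
import Algebra.Construct.NaturalChoice.Max as Max
import Algebra.Construct.NaturalChoice.Min as Min
import Algebra.Lattice.Construct.NaturalChoice.MinMaxOp as MinMax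
import Algebra.Lattice.Properties.Lattice as LatticeProperties
open import Algebra.Lattice.Bundles using (Lattice)
open import Algebra.Lattice.Structures using (IsLattice; IsDistributiveLattice)
open import Relation.Binary.Lattice.Bundles using () renaming (Lattice to OrderLattice)
import Data.Fin.Relation.Unary.Top as Top
open import Relation.Binary.Definitions using (tri<; tri≈; tri>)

-- Words over signed letters

-- The difficulty lies in the greedy choice. A segment is closed because some expansion of it,
-- together with expansions of the earlier segments, admits a path; these expansions differ from
-- segment to segment, while a folding speaks of a single caterpillar. The witnesses are reconciled
-- by confluence: the values reached along the expansions of a word remain the same when the word
-- itself is expanded first. This in turn rests on a duality. The values reached at the positions of
-- a word form an exact sequence of sets, and exact sequences pass to expansions and back. Exactness
-- in both directions is indispensable: the middle copy of u is read backwards, so its sets enter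
-- the symmetric difference in reverse.
--
-- The constants fit as follows. Closing n + 1 segments would allow n + 1 simultaneous foldings, so
-- at most n letters are irreversible, and n + 1 levels of a program suffice. A fact with j strict
-- levels above its predicate pushes a coordinate above j, where j runs from 0 to n; the maps with
-- the two values j and j + 1 thus use exactly the n + 2 elements of the tournament.

module Words (X : Set) where

  Letter : Set
  Letter = Bool × X

  Word : Set
  Word = List Letter

  neg : Letter → Letter
  neg (σ , x) = not σ , x

  neg-neg : ∀ l → neg (neg l) ≡ l
  neg-neg (true  , x) = refl
  neg-neg (false , x) = refl

  inv : Word → Word
  inv []      = []
  inv (l ∷ w) = inv w ++ neg l ∷ []

  inv-++ : ∀ u v → inv (u ++ v) ≡ inv v ++ inv u
  inv-++ []      v = sym (++-identityʳ (inv v))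
  inv-++ (l ∷ u) v = trans (cong (_++ neg l ∷ []) (inv-++ u v)) (++-assoc (inv v) (inv u) _)

  inv-inv : ∀ w → inv (inv w) ≡ w
  inv-inv []      = refl
  inv-inv (l ∷ w) = trans (inv-++ (inv w) (neg l ∷ [])) (cong₂ _∷_ (neg-neg l) (inv-inv w))

  infix 4 _⇝₁_ _⇝_

  data _⇝₁_ : Word → Word → Set where
    expand : ∀ a u b → a ++ u ++ b ⇝₁ a ++ u ++ inv u ++ u ++ b

  _⇝_ : Word → Word → Set
  _⇝_ = Star _⇝₁_

  ⇝₁-++ˡ : ∀ p {w w′} → w ⇝₁ w′ → p ++ w ⇝₁ p ++ w′
  ⇝₁-++ˡ p (expand a u b) =
    subst₂ _⇝₁_ (++-assoc p a _) (++-assoc p a _) (expand (p ++ a) u b)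

  ⇝₁-++ʳ : ∀ q {w w′} → w ⇝₁ w′ → w ++ q ⇝₁ w′ ++ q
  ⇝₁-++ʳ q (expand a u b) = subst₂ _⇝₁_
    (sym (trans (++-assoc a _ q) (cong (a ++_) (++-assoc u b q))))
    (sym (trans (++-assoc a _ q) (cong (a ++_)
      (trans (++-assoc u _ q) (cong (u ++_)
        (trans (++-assoc (inv u) _ q) (cong (inv u ++_) (++-assoc u b q))))))))
    (expand a u (b ++ q))

  ⇝-++ˡ : ∀ p {w w′} → w ⇝ w′ → p ++ w ⇝ p ++ w′
  ⇝-++ˡ p = gmap (p ++_) (⇝₁-++ˡ p)

  ⇝-++ʳ : ∀ q {w w′} → w ⇝ w′ → w ++ q ⇝ w′ ++ q
  ⇝-++ʳ q = gmap (_++ q) (⇝₁-++ʳ q)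

  ⇝₁-[] : ∀ {w w′} → w ⇝₁ w′ → w ≡ [] → w′ ≡ []
  ⇝₁-[] (expand [] [] b) eq = eq

  ⇝-[] : ∀ {w} → [] ⇝ w → w ≡ []
  ⇝-[] = go refl
    where
    go : ∀ {w w′} → w ≡ [] → w ⇝ w′ → w′ ≡ []
    go eq ε        = eq
    go eq (s ◅ ss) = go (⇝₁-[] s eq) ss

  -- A walk on a word with steps in both directions, as a zipper.  The first
  -- index tells whether the walk faces forward, the next two are the letters
  -- read when walking back and when walking ahead, the last one is the word
  -- read so far.
  data Walk (x : Word) : Bool → Word → Word → Word → Set where
    start : Walk x true [] x []
    step  : ∀ {d bh l ah w} → Walk x d bh (l ∷ ah) w → Walk x d (neg l ∷ bh) ah (w ++ l ∷ [])
    turn  : ∀ {d bh ah w} → Walk x d bh ah w → Walk x (not d) ah bh w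

  -- Walks none of whose runs can be folded: the lengths of the runs decrease
  -- strictly, except that the second may be as long as the first.  The
  -- indices are the number of turns, the data of the walk and its final run,
  -- read backwards.
  data Reduced (x : Word) : ℕ → Bool → Word → Word → Word → Word → Set where
    straight : ∀ bh {ah} → inv bh ++ ah ≡ x → Reduced x 0 true bh ah (inv bh) bh
    turned   : ∀ {k d ah w} l u m bh →
               Reduced x k d ((l ∷ u) ++ m ++ bh) ah w ((l ∷ u) ++ m) →
               m ≢ [] ⊎ k ≡ 0 →
               Reduced x (suc k) (not d) (inv (l ∷ u) ++ ah) (m ++ bh) (w ++ l ∷ u) (inv (l ∷ u))

  module _ {x : Word} where

    reduced-word : ∀ {k d bh ah w run} → Reduced x k d bh ah w run → ∃[ t ] w ≡ t ++ inv run
    reduced-word (straight _ _)                   = [] , refl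
    reduced-word (turned {w = w} l u _ _ _ _) = w , cong (w ++_) (sym (inv-inv (l ∷ u)))

    straight-run : ∀ {d bh ah w run} → Reduced x 0 d bh ah w run → d ≡ true × run ≡ bh
    straight-run (straight _ _) = refl , refl

    inv-nonempty : ∀ l u {v} → inv (l ∷ u) ++ v ≢ []
    inv-nonempty l u eq = contradiction (List.++-conicalʳ (inv u) _ (List.++-conicalˡ _ _ eq)) λ ()

    cast-reduced : ∀ {k d d′ bh bh′ ah ah′ w w′ run run′} →
      d ≡ d′ → bh ≡ bh′ → ah ≡ ah′ → w ≡ w′ → run ≡ run′ →
      Reduced x k d bh ah w run → Reduced x k d′ bh′ ah′ w′ run′
    cast-reduced refl refl refl refl refl R = R

    -- The word read so far ends with `inv u`; walking back along `u` and then again along `inv u`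
    -- expands this final factor.
    fold-back : ∀ {k d bh ah w} u m → Reduced x k d bh ah w (u ++ m) → w ⇝₁ w ++ u ++ inv u
    fold-back {w = w} u m R with t , refl ← reduced-word R = subst₂ _⇝₁_ eq₁ eq₂ (expand (t ++ inv m) (inv u) [])
      where
      eq₀ : t ++ inv (u ++ m) ≡ (t ++ inv m) ++ inv u
      eq₀ = trans (cong (t ++_) (inv-++ u m)) (sym (++-assoc t _ _))
      eq₁ : (t ++ inv m) ++ inv u ++ [] ≡ t ++ inv (u ++ m)
      eq₁ = trans (cong ((t ++ inv m) ++_) (++-identityʳ (inv u))) (sym eq₀)
      eq₂ : (t ++ inv m) ++ inv u ++ inv (inv u) ++ inv u ++ [] ≡ (t ++ inv (u ++ m)) ++ u ++ inv u
      eq₂ = begin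
        (t ++ inv m) ++ inv u ++ inv (inv u) ++ inv u ++ []
          ≡⟨ cong₂ (λ p q → (t ++ inv m) ++ inv u ++ p ++ q) (inv-inv u) (++-identityʳ (inv u)) ⟩
        (t ++ inv m) ++ inv u ++ u ++ inv u ≡⟨ ++-assoc (t ++ inv m) (inv u) _ ⟨
        ((t ++ inv m) ++ inv u) ++ u ++ inv u ≡⟨ cong (_++ u ++ inv u) eq₀ ⟨
        (t ++ inv (u ++ m)) ++ u ++ inv u ∎
        where open ≡-Reasoning

    ReducesTo : Bool → Word → Word → Word → Set
    ReducesTo d bh ah w = ∃[ k ] ∃[ w′ ] ∃[ run ] Reduced x k d bh ah w′ run × w′ ⇝ w

    -- Walking over the whole final run in the opposite direction brings the walk back to where it
    -- had turned. Both passes are removed by `fold-back`, which leaves one turn less.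
    unturn : ∀ {k d bh ah w run r} → Reduced x (suc k) d bh ah w run → bh ≡ run ++ r →
             ReducesTo (not d) (inv run ++ ah) r (w ++ run)
    unturn {r = r} (turned {k} {d} {ah} {w} l u m bh R _) eq =
      k , w , (l ∷ u) ++ m ,
      cast-reduced (sym (Bool.not-involutive d))
        (trans (sym (++-assoc (l ∷ u) m bh))
          (trans (++-assoc (l ∷ u) m bh) (cong (_++ m ++ bh) (sym (inv-inv (l ∷ u))))))
        (List.++-cancelˡ (inv (l ∷ u)) _ _ eq) refl refl R ,
      subst (w ⇝₁_) (sym (++-assoc w (l ∷ u) _)) (fold-back (l ∷ u) m R) ◅ ε

    reduced-step : ∀ {k d bh ah A w run l} → Reduced x k d bh A w run → A ≡ l ∷ ah →
                   ReducesTo d (neg l ∷ bh) ah (w ++ l ∷ [])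
    reduced-step {l = l} (straight bh eq) refl =
      0 , _ , _ ,
      cast-reduced refl refl refl (cong (λ z → inv bh ++ z ∷ []) (neg-neg l)) refl
        (straight (neg l ∷ bh) (trans (++-assoc (inv bh) _ _)
          (trans (cong (λ z → inv bh ++ z ∷ _) (neg-neg l)) eq))) , ε
    reduced-step (turned l u [] bh R (inj₁ ne)) eq = contradiction refl ne
    reduced-step (turned l u [] bh R (inj₂ refl)) eq
      with () ← trans (sym eq) (sym (List.++-cancelˡ (l ∷ u) [] bh (proj₂ (straight-run R))))
    reduced-step {l = a} (turned {k} {d} {ah} {w} l u (.a ∷ m) bh R c) refl = go k m R
      where
      eq-w : w ++ l ∷ u ++ a ∷ [] ≡ (w ++ l ∷ u) ++ a ∷ []
      eq-w = sym (++-assoc w (l ∷ u) _)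
      eq-inv : inv (l ∷ u ++ a ∷ []) ≡ neg a ∷ inv (l ∷ u)
      eq-inv = inv-++ (l ∷ u) (a ∷ [])
      longer : ∀ {k} m → Reduced x k d ((l ∷ u) ++ a ∷ m ++ bh) ah w ((l ∷ u) ++ a ∷ m) →
               m ≢ [] ⊎ k ≡ 0 →
               ReducesTo (not d) (neg a ∷ inv (l ∷ u) ++ ah) (m ++ bh) ((w ++ l ∷ u) ++ a ∷ [])
      longer m R c = _ , _ , _ ,
        cast-reduced refl (cong (_++ ah) eq-inv) refl eq-w refl
          (turned l (u ++ a ∷ []) m bh
            (cast-reduced refl (cong (l ∷_) (sym (++-assoc u (a ∷ []) (m ++ bh)))) refl refl
              (cong (l ∷_) (sym (++-assoc u (a ∷ []) m))) R) c) , ε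
      go : ∀ k m → Reduced x k d ((l ∷ u) ++ a ∷ m ++ bh) ah w ((l ∷ u) ++ a ∷ m) →
           ReducesTo (not d) (neg a ∷ inv (l ∷ u) ++ ah) (m ++ bh) ((w ++ l ∷ u) ++ a ∷ [])
      -- Nothing precedes the first run, so a second run of the same length cannot be folded away.
      go zero    m       R = longer m R (inj₂ refl)
      go (suc k) (b ∷ m) R = longer (b ∷ m) R (inj₁ λ ())
      -- The new run has become as long as the preceding one, which is not the first; these two runs
      -- cancel.
      go (suc k) []      R = subst₂ (λ p → ReducesTo (not d) (p ++ ah) bh)
        eq-inv eq-w (unturn R (cong (l ∷_) (sym (++-assoc u (a ∷ []) bh))))

    -- A reduced walk has no run of length zero after a turn, so a turn is recorded only together
    -- with the letter that follows it.
    reduced-turn : ∀ {k d BH bh ah w run l} → Reduced x k d BH ah w run → BH ≡ l ∷ bh →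
                   ReducesTo (not d) (neg l ∷ ah) bh (w ++ l ∷ [])
    reduced-turn {zero} {bh = bh} {l = l} R eq with straight-run R
    ... | refl , refl = _ , _ , _ ,
      cast-reduced refl refl (++-identityʳ bh) refl refl
        (turned l [] bh [] (cast-reduced refl (trans eq (cong (l ∷_) (sym (++-identityʳ bh)))) refl refl eq R)
          (inj₂ refl)) , ε
    reduced-turn {suc k} R@(turned l₀ u₀ _ _ _ _) eq = go (inv (l₀ ∷ u₀)) (λ e → inv-nonempty l₀ u₀ (trans (++-identityʳ _) e)) R eq
      where
      go : ∀ {d ah₀ ah w bh l} run → run ≢ [] → Reduced x (suc k) d (run ++ ah₀) ah w run →
           run ++ ah₀ ≡ l ∷ bh → ReducesTo (not d) (neg l ∷ ah) bh (w ++ l ∷ [])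
      go [] ne R eq = contradiction refl ne
      go (l ∷ []) ne R refl = unturn R refl
      go (l ∷ b ∷ run) ne R refl = _ , _ , _ , turned l [] (b ∷ run) _ R (inj₁ λ ()) , ε

    -- The second alternative accounts for a pending turn, one that no letter has followed yet.
    reduce : ∀ {d bh ah w} → Walk x d bh ah w → ReducesTo d bh ah w ⊎ ReducesTo (not d) ah bh w
    reduce start = inj₁ (0 , _ , _ , straight [] refl , ε)
    reduce (step W) with reduce W
    ... | inj₁ (_ , _ , _ , R , s) =
      let k , w , run , R′ , s′ = reduced-step R refl in
      inj₁ (k , w , run , R′ , s′ ◅◅ ⇝-++ʳ _ s)
    ... | inj₂ (_ , _ , _ , R , s) =
      let k , w , run , R′ , s′ = reduced-turn R refl in
      inj₁ (k , w , run , cast-reduced (Bool.not-involutive _) refl refl refl refl R′ , s′ ◅◅ ⇝-++ʳ _ s)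
    reduce (turn W) with reduce W
    ... | inj₁ (k , w , run , R , s) =
      inj₂ (k , w , run , cast-reduced (sym (Bool.not-involutive _)) refl refl refl refl R , s)
    ... | inj₂ r = inj₁ r

    private
      -- Nothing is ahead, so the last run cannot have left a nonempty part `m` of its predecessor;
      -- and after a single turn the walk would face backward. Hence there was no turn.
      end-forward : ∀ {k bh ah w run} → Reduced x k true bh ah w run → ah ≡ [] → w ≡ x
      end-forward {zero} (straight bh eq) refl = trans (sym (++-identityʳ _)) eq
      end-forward {suc k} R = go R refl
        where
        go : ∀ {d bh ah w run} → Reduced x (suc k) d bh ah w run → d ≡ true → ah ≡ [] → w ≡ x
        go (turned l u m bh R (inj₁ ne)) _ e = contradiction (List.++-conicalˡ m bh e) ne
        go (turned l u m bh R (inj₂ refl)) e _ with straight-run R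
        go (turned l u m bh R (inj₂ refl)) () _ | refl , _

      end-backward : ∀ {k d bh ah w run} → Reduced x k d bh ah w run → d ≡ false → bh ≢ []
      end-backward (turned l u _ _ _ _) _ = inv-nonempty l u

    walk-expands : ∀ {w bh} → Walk x true bh [] w → x ⇝ w
    walk-expands W with reduce W
    ... | inj₁ (_ , _ , _ , R , s) = subst (_⇝ _) (end-forward R refl) s
    ... | inj₂ (_ , _ , _ , R , s) = contradiction refl (end-backward R refl)

-- Classical reasoning

EM : Set₂
EM = ExcludedMiddle (lsuc 0ℓ)

module Classical (em : EM) where

  decide : (P : Set) → Dec P
  decide P with em {Lift (lsuc 0ℓ) P}
  ... | yes (lift p) = yes p
  ... | no ¬p        = no (¬p ∘ lift)

  stable : ∀ {P : Set} → ¬ ¬ P → P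
  stable {P} = decidable-stable (decide P)

  ¬∀⇒∃ : ∀ {A : Set} {P : A → Set} → ¬ (∀ a → P a) → ∃[ a ] ¬ P a
  ¬∀⇒∃ {P = P} ¬∀ = stable λ ¬∃ → ¬∀ λ a → stable λ ¬p → ¬∃ (a , ¬p)

  truth : Set → Bool
  truth P = ⌊ decide P ⌋

  truth⁺ : ∀ {P} → P → truth P ≡ true
  truth⁺ {P} p with decide P
  ... | yes _ = refl
  ... | no ¬p = contradiction p ¬p

  truth⁻ : ∀ {P} → truth P ≡ true → P
  truth⁻ {P} eq with decide P
  ... | yes p = p

  truth-⇔ : ∀ {P Q} → (P → Q) → (Q → P) → truth P ≡ truth Q
  truth-⇔ {P} {Q} f g with decide P | decide Q
  ... | yes _ | yes _ = refl
  ... | no _  | no _  = refl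
  ... | yes p | no ¬q = contradiction (f p) ¬q
  ... | no ¬p | yes q = contradiction (g q) ¬p

-- Composition of relations along words

module Semantics (em : EM) {X B : Set} (sem : X → B → B → Set) where

  open Classical em
  open Words X

  Step : Letter → B → B → Set
  Step (true  , x) b c = sem x b c
  Step (false , x) b c = sem x c b

  Step-neg : ∀ l {b c} → Step l b c → Step (neg l) c b
  Step-neg (true  , x) s = s
  Step-neg (false , x) s = s

  Path : Word → B → B → Set
  Path []      b c = b ≡ c
  Path (l ∷ w) b c = ∃[ d ] Step l b d × Path w d c

  Path-++⁺ : ∀ u {v b c d} → Path u b c → Path v c d → Path (u ++ v) b d
  Path-++⁺ []      refl         q = q
  Path-++⁺ (l ∷ u) (e , s , p) q = e , s , Path-++⁺ u p q

  Path-++⁻ : ∀ u {v b d} → Path (u ++ v) b d → ∃[ c ] Path u b c × Path v c d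
  Path-++⁻ []      q           = _ , refl , q
  Path-++⁻ (l ∷ u) (e , s , p) = let c , p₁ , p₂ = Path-++⁻ u p in c , (e , s , p₁) , p₂

  Path-inv : ∀ u {b c} → Path u b c → Path (inv u) c b
  Path-inv []      refl        = refl
  Path-inv (l ∷ u) (e , s , p) = Path-++⁺ (inv u) (Path-inv u p) (_ , Step-neg l s , refl)

  Path-⇝₁ : ∀ {w w′ b c} → w ⇝₁ w′ → Path w b c → Path w′ b c
  Path-⇝₁ (expand a u v) p =
    let d , pa , q  = Path-++⁻ a p
        e , pu , pv = Path-++⁻ u q
    in Path-++⁺ a pa (Path-++⁺ u pu (Path-++⁺ (inv u) (Path-inv u pu) (Path-++⁺ u pu pv)))

  Path-⇝ : ∀ {w w′ b c} → w ⇝ w′ → Path w b c → Path w′ b c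
  Path-⇝ ε        p = p
  Path-⇝ (s ◅ ss) p = Path-⇝ ss (Path-⇝₁ s p)

  -- This is exactness: membership is preserved in both directions, while a value without a partner
  -- along the letter is unconstrained.
  BalancedStep : Letter → (B → Bool) → (B → Bool) → Set
  BalancedStep l U V = ∀ {b c} → Step l b c → U b ≡ V c

  data Balanced : Word → (B → Bool) → (B → Bool) → Set where
    []  : ∀ {U V} → U ≗ V → Balanced [] U V
    _∷_ : ∀ {l w U V W} → BalancedStep l U V → Balanced w V W → Balanced (l ∷ w) U W

  Balanced-respˡ : ∀ {w U U′ V} → U′ ≗ U → Balanced w U V → Balanced w U′ V
  Balanced-respˡ eq ([] e)   = [] λ b → trans (eq b) (e b)
  Balanced-respˡ eq (s ∷ bs) = (λ p → trans (eq _) (s p)) ∷ bs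

  Balanced-respʳ : ∀ {w U V V′} → V ≗ V′ → Balanced w U V → Balanced w U V′
  Balanced-respʳ eq ([] e)   = [] λ b → trans (e b) (eq b)
  Balanced-respʳ eq (s ∷ bs) = s ∷ Balanced-respʳ eq bs

  Balanced-++⁺ : ∀ {u v U V W} → Balanced u U V → Balanced v V W → Balanced (u ++ v) U W
  Balanced-++⁺ ([] e)   q = Balanced-respˡ e q
  Balanced-++⁺ (s ∷ bs) q = s ∷ Balanced-++⁺ bs q

  Balanced-++⁻ : ∀ u {v U W} → Balanced (u ++ v) U W → ∃[ V ] Balanced u U V × Balanced v V W
  Balanced-++⁻ []      q        = _ , [] (λ _ → refl) , q
  Balanced-++⁻ (l ∷ u) (s ∷ bs) = let V , p , q = Balanced-++⁻ u bs in V , s ∷ p , q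

  Balanced-inv : ∀ {u U V} → Balanced u U V → Balanced (inv u) V U
  Balanced-inv ([] e)                      = [] (sym ∘ e)
  Balanced-inv {l ∷ u} (_∷_ {U = U} s bs) = Balanced-++⁺ (Balanced-inv bs) (back ∷ [] λ _ → refl)
    where
    back : BalancedStep (neg l) _ U
    back p = sym (s (subst (λ l → Step l _ _) (neg-neg l) (Step-neg (neg l) p)))

  _⊕_⊕_ : (U V W : B → Bool) → B → Bool
  (U ⊕ V ⊕ W) b = U b xor (V b xor W b)

  -- Exactness is an equation between truth values and therefore passes to every Boolean
  -- combination.
  Balanced-⊕ : ∀ {u U U′ V V′ W W′} → Balanced u U U′ → Balanced u V V′ → Balanced u W W′ →
               Balanced u (U ⊕ V ⊕ W) (U′ ⊕ V′ ⊕ W′)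
  Balanced-⊕ ([] e)   ([] f)   ([] g)   = [] λ b → cong₂ _xor_ (e b) (cong₂ _xor_ (f b) (g b))
  Balanced-⊕ (s ∷ bs) (t ∷ cs) (r ∷ ds) =
    (λ p → cong₂ _xor_ (s p) (cong₂ _xor_ (t p) (r p))) ∷ Balanced-⊕ bs cs ds

  xor-cancelʳ : ∀ a b → a ≡ a xor (b xor b)
  xor-cancelʳ false false = refl
  xor-cancelʳ false true  = refl
  xor-cancelʳ true  false = refl
  xor-cancelʳ true  true  = refl

  xor-cancelˡ : ∀ a b → a xor (a xor b) ≡ b
  xor-cancelˡ false b     = refl
  xor-cancelˡ true  false = refl
  xor-cancelˡ true  true  = refl

  -- Read along `u`, the three copies carry `A` to `C`, `D` to `C` and `D` to `E`. Now `A ⊕ D ⊕ D`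
  -- is `A`, and `C ⊕ C ⊕ E` is `E`.
  Balanced-fold₁ : ∀ {w w′ U V} → w ⇝₁ w′ → Balanced w′ U V → Balanced w U V
  Balanced-fold₁ (expand a u v) p =
    let A , pa , q  = Balanced-++⁻ a p
        C , pu , r  = Balanced-++⁻ u q
        D , pi , s  = Balanced-++⁻ (inv u) r
        E , pu′ , pv = Balanced-++⁻ u s
        pi′ = subst (λ w → Balanced w D C) (inv-inv u) (Balanced-inv pi)
    in Balanced-++⁺ pa (Balanced-++⁺
         (Balanced-respˡ (λ b → xor-cancelʳ (A b) (D b))
           (Balanced-respʳ (λ b → xor-cancelˡ (C b) (E b)) (Balanced-⊕ pu pi′ pu′))) pv)

  Balanced-unfold₁ : ∀ {w w′ U V} → w ⇝₁ w′ → Balanced w U V → Balanced w′ U V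
  Balanced-unfold₁ (expand a u v) p =
    let A , pa , q  = Balanced-++⁻ a p
        C , pu , pv = Balanced-++⁻ u q
    in Balanced-++⁺ pa (Balanced-++⁺ pu (Balanced-++⁺ (Balanced-inv pu) (Balanced-++⁺ pu pv)))

  Balanced-fold : ∀ {w w′ U V} → w ⇝ w′ → Balanced w′ U V → Balanced w U V
  Balanced-fold ε        p = p
  Balanced-fold (s ◅ ss) p = Balanced-fold₁ s (Balanced-fold ss p)

  Balanced-unfold : ∀ {w w′ U V} → w ⇝ w′ → Balanced w U V → Balanced w′ U V
  Balanced-unfold ε        p = p
  Balanced-unfold (s ◅ ss) p = Balanced-unfold ss (Balanced-unfold₁ s p)

  Balanced-Path : ∀ {w U V b c} → Balanced w U V → Path w b c → U b ≡ V c
  Balanced-Path ([] e)   refl        = e _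
  Balanced-Path (s ∷ bs) (_ , t , p) = trans (s t) (Balanced-Path bs p)

  -- The values reached from P along some word that x expands to.
  ZigzagImage : (B → Set) → Word → B → Set
  ZigzagImage P x c = ∃[ w ] x ⇝ w × ∃[ b ] P b × Path w b c

  module _ (P : B → Set) (x : Word) where

    private
      Reached : Word → Word → B → Set
      Reached bh ah c = ∃[ w ] Walk x true bh ah w × ∃[ b ] P b × Path w b c

      reached : Word → Word → B → Bool
      reached bh ah c = truth (Reached bh ah c)

      ahead : ∀ {bh l ah b c} → Step l b c → Reached bh (l ∷ ah) b → Reached (neg l ∷ bh) ah c
      ahead s (w , W , b , Pb , p) = _ , step W , b , Pb , Path-++⁺ w p (_ , s , refl)

      back : ∀ {bh l ah b c} → Step l b c → Reached (neg l ∷ bh) ah c → Reached bh (l ∷ ah) b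
      back {bh} {l} {ah} s (w , W , b , Pb , p) =
        -- The walk turns, reads one letter back, and turns again.
        w ++ neg l ∷ [] , subst (λ l′ → Walk x true bh (l′ ∷ ah) (w ++ neg l ∷ [])) (neg-neg l) (turn (step (turn W))) ,
        b , Pb , Path-++⁺ w p (_ , Step-neg l s , refl)

      balance : ∀ bh ah → ∃[ end ] Balanced ah (reached bh ah) (reached end [])
      balance bh []       = bh , [] λ _ → refl
      balance bh (l ∷ ah) =
        let end , bs = balance (neg l ∷ bh) ah
        in end , (λ s → truth-⇔ (ahead s) (back s)) ∷ bs

    -- At each position of `x`, take the values to which walks on `x` lead from `P`. Since walks may
    -- also go back, these sets are exact; and a walk that has arrived at the right end reads an
    -- expansion of `x`.
    zigzag-duality : ∃₂ λ U V → Balanced x U V × (∀ {b} → P b → U b ≡ true) ×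
                     (∀ {c} → V c ≡ true → ZigzagImage P x c)
    zigzag-duality =
      let end , bs = balance [] x in _ , _ , bs ,
      (λ Pb → truth⁺ (_ , start , _ , Pb , refl)) ,
      (λ eq → let w , W , r = truth⁻ eq in w , walk-expands W , r)

  -- The exact sets of `x′` fold to `x` and unfold to the given expansion of `x`, along which the
  -- path from `P` must end in the last of them. That set contains only values reached along
  -- expansions of `x′`.
  zigzag-confluence : ∀ {P x x′ c} → x ⇝ x′ → ZigzagImage P x c → ZigzagImage P x′ c
  zigzag-confluence {P} {x} {x′} s (w , t , b , Pb , p) =
    let U , V , bs , P⊆U , V⊆ = zigzag-duality P x′
    in V⊆ (trans (sym (Balanced-Path (Balanced-unfold t (Balanced-fold s bs)) p)) (P⊆U Pb))

  -- Chains of sets with irreversible letters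

  MarkedWord : Set
  MarkedWord = List (Bool × Letter)

  #marks : MarkedWord → ℕ
  #marks []              = 0
  #marks ((true  , _) ∷ w) = suc (#marks w)
  #marks ((false , _) ∷ w) = #marks w

  unmarked : Word → MarkedWord
  unmarked = List.map (false ,_)

  ForwardStep : Letter → (B → Bool) → (B → Bool) → Set
  ForwardStep l U V = ∀ {b c} → Step l b c → U b ≡ true → V c ≡ true

  -- A marked letter need only be passable in one direction; each mark will later cost one level of
  -- the program.
  data Chain : MarkedWord → (B → Bool) → (B → Bool) → Set where
    []      : ∀ {U V} → U ≗ V → Chain [] U V
    free    : ∀ {l w U V W} → BalancedStep l U V → Chain w V W → Chain ((false , l) ∷ w) U W
    fixed   : ∀ {l w U V W} → ForwardStep l U V → Chain w V W → Chain ((true , l) ∷ w) U W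

  Chain-respˡ : ∀ {w U U′ V} → U′ ≗ U → Chain w U V → Chain w U′ V
  Chain-respˡ eq ([] e)      = [] λ b → trans (eq b) (e b)
  Chain-respˡ eq (free s c)  = free (λ p → trans (eq _) (s p)) c
  Chain-respˡ eq (fixed s c) = fixed (λ p e → s p (trans (sym (eq _)) e)) c

  Chain-++ : ∀ {u v U V W} → Chain u U V → Chain v V W → Chain (u ++ v) U W
  Chain-++ ([] e)      q = Chain-respˡ e q
  Chain-++ (free s c)  q = free s (Chain-++ c q)
  Chain-++ (fixed s c) q = fixed s (Chain-++ c q)

  Chain-unmarked : ∀ {w U V} → Balanced w U V → Chain (unmarked w) U V
  Chain-unmarked ([] e)   = [] e
  Chain-unmarked (s ∷ bs) = free s (Chain-unmarked bs)

-- From closure under foldings to chains with few marks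

module Foldings (em : EM) {X B : Set} (sem : X → B → B → Set) (P Q : B → Set) where

  open Classical em
  open Words X
  open Semantics em sem

  Good : Word → Set
  Good w = ∃₂ λ b c → P b × Q c × Path w b c

  Good-⇝ : ∀ {w w′} → w ⇝ w′ → Good w → Good w′
  Good-⇝ s (b , c , Pb , Qc , p) = b , c , Pb , Qc , Path-⇝ s p

  Good-confluence : ∀ u v {x x′ x″} → x ⇝ x′ → x ⇝ x″ → Good (u ++ x″ ++ v) →
                    ∃[ w ] x′ ⇝ w × Good (u ++ w ++ v)
  Good-confluence u v s s″ (b , c , Pb , Qc , p) =
    let d , pu , q = Path-++⁻ u p
        e , px , pv = Path-++⁻ _ q
        w , t , d′ , (b′ , Pb′ , pu′) , pw = zigzag-confluence {P = λ d → ∃[ b ] P b × Path u b d} s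
                                              (_ , s″ , d , (b , Pb , pu) , px)
    in w , t , b′ , c , Pb′ , Qc , Path-++⁺ u pu′ (Path-++⁺ w pw pv)

  flatten : ∀ {m} → Vec Word m → Word → Word
  flatten []       y = y
  flatten (v ∷ vs) y = v ++ flatten vs y

  flatten-⇝ : ∀ {m} (vs : Vec Word m) i {v} y → lookup vs i ⇝ v → flatten vs y ⇝ flatten (vs [ i ]≔ v) y
  flatten-⇝ (u ∷ vs) zero    y s = ⇝-++ʳ (flatten vs y) s
  flatten-⇝ (u ∷ vs) (suc i) y s = ⇝-++ˡ u (flatten-⇝ vs i y s)

  -- The counterpart for words of closure under `N`-foldings of caterpillars: each of `N`
  -- consecutive factors is expanded alone.
  FoldingClosed : ℕ → Set
  FoldingClosed N = ∀ (vs : Vec Word N) y →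
    (∀ i → ∃[ v ] lookup vs i ⇝₁ v × Good (flatten (vs [ i ]≔ v) y)) → Good (flatten vs y)

  private
    steps : ∀ {w w′} → w ⇝ w′ → ℕ
    steps ε        = 0
    steps (_ ◅ ss) = suc (steps ss)

    sum-mono : ∀ {m} (f g : Fin m → ℕ) → (∀ i → f i ≤ g i) → Vec.sum (tabulate f) ≤ Vec.sum (tabulate g)
    sum-mono {zero}  f g f≤g = z≤n
    sum-mono {suc m} f g f≤g = +-mono-≤ (f≤g zero) (sum-mono (f ∘ suc) (g ∘ suc) (f≤g ∘ suc))

    sum-< : ∀ {m} (f g : Fin m → ℕ) → (∀ i → f i ≤ g i) → ∀ i → f i < g i →
            Vec.sum (tabulate f) < Vec.sum (tabulate g)
    sum-< f g f≤g zero    lt = ℕ.+-mono-<-≤ lt (sum-mono (f ∘ suc) (g ∘ suc) (f≤g ∘ suc))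
    sum-< f g f≤g (suc i) lt = ℕ.+-mono-≤-< (f≤g zero) (sum-< (f ∘ suc) (g ∘ suc) (f≤g ∘ suc) i lt)

    any-or-all : ∀ {m} {A C : Fin m → Set} → (∀ i → A i ⊎ C i) → ∃ A ⊎ (∀ i → C i)
    any-or-all {zero}  f = inj₂ λ ()
    any-or-all {suc m} f with f zero | any-or-all (f ∘ suc)
    ... | inj₁ a | _            = inj₁ (zero , a)
    ... | inj₂ c | inj₁ (i , a) = inj₁ (suc i , a)
    ... | inj₂ c | inj₂ cs      = inj₂ λ { zero → c ; (suc i) → cs i }

  ExpandableAt : ∀ {N} → Vec Word N → Word → Fin N → Set
  ExpandableAt vs y i = ∃[ v ] lookup vs i ⇝ v × Good (flatten (vs [ i ]≔ v) y)

  module _ {N} (closed : FoldingClosed (suc N)) (y : Word) where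

    private
      Family : Vec Word (suc N) → Set
      Family vs = ∀ i → ExpandableAt vs y i

      size : ∀ vs → Family vs → ℕ
      size vs F = Vec.sum (tabulate λ i → steps (proj₁ (proj₂ (F i))))

      -- The first step of the i-th expansion is carried out; the expansions of
      -- the other factors remain good since goodness is preserved by expansions.
      module Advance (vs : Vec Word (suc N)) (F : Family vs) (i : Fin (suc N)) {v₁}
                     (s : lookup vs i ⇝₁ v₁) (ss : v₁ ⇝ proj₁ (F i)) where

        vs′ : Vec Word (suc N)
        vs′ = vs [ i ]≔ v₁

        family′ : Family vs′
        family′ j with j Fin.≟ i
        ... | yes refl = _ , subst (_⇝ _) (sym (Vec.lookup∘updateAt j vs)) ss ,
                         subst (λ us → Good (flatten us y)) (sym (Vec.[]≔-idempotent vs j)) (proj₂ (proj₂ (F j)))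
        ... | no j≢i = _ , subst (_⇝ _) (sym (Vec.lookup∘updateAt′ j i j≢i vs)) (proj₁ (proj₂ (F j))) ,
                       subst (λ us → Good (flatten us y)) (Vec.[]≔-commutes vs j i j≢i)
                         (Good-⇝ (flatten-⇝ (vs [ j ]≔ _) i y
                           (subst (_⇝ v₁) (sym (Vec.lookup∘updateAt′ i j (j≢i ∘ sym) vs)) (s ◅ ε)))
                           (proj₂ (proj₂ (F j))))

        private
          steps-subst : ∀ {u u′ w} (e : u ≡ u′) (t : u ⇝ w) → steps (subst (_⇝ w) e t) ≡ steps t
          steps-subst refl t = refl

        smaller : (eq : proj₁ (proj₂ (F i)) ≡ s ◅ ss) → size vs′ family′ < size vs F
        smaller eq = sum-< _ _ le i lt
          where
          le : ∀ j → steps (proj₁ (proj₂ (family′ j))) ≤ steps (proj₁ (proj₂ (F j)))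
          le j with j Fin.≟ i
          ... | yes refl = ≤-trans (≤-reflexive (steps-subst _ ss))
                             (subst (λ t → steps ss ≤ steps t) (sym eq) (n≤1+n _))
          ... | no j≢i   = ≤-reflexive (steps-subst _ (proj₁ (proj₂ (F j))))
          lt : steps (proj₁ (proj₂ (family′ i))) < steps (proj₁ (proj₂ (F i)))
          lt with i Fin.≟ i
          ... | yes refl = ≤-trans (s≤s (≤-reflexive (steps-subst _ ss)))
                             (subst (λ t → suc (steps ss) ≤ steps t) (sym eq) ≤-refl)
          ... | no i≢i   = contradiction refl i≢i

      record FirstStep (vs : Vec Word (suc N)) (F : Family vs) (i : Fin (suc N)) : Set where
        field
          {v₁} : Word
          s    : lookup vs i ⇝₁ v₁
          ss   : v₁ ⇝ proj₁ (F i)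
          eq   : proj₁ (proj₂ (F i)) ≡ s ◅ ss

      view : ∀ {u v} (t : u ⇝ v) → u ≡ v ⊎ ∃[ v₁ ] Σ[ s ∈ u ⇝₁ v₁ ] Σ[ ss ∈ v₁ ⇝ v ] t ≡ s ◅ ss
      view ε        = inj₁ refl
      view (s ◅ ss) = inj₂ (_ , s , ss , refl)

      first-step : ∀ vs F i → Good (flatten vs y) ⊎ FirstStep vs F i
      first-step vs F i with view (proj₁ (proj₂ (F i)))
      ... | inj₁ eq = inj₁ (subst (λ us → Good (flatten us y))
        (trans (cong (vs [ i ]≔_) (sym eq)) (Vec.[]≔-lookup vs i)) (proj₂ (proj₂ (F i))))
      ... | inj₂ (_ , s , ss , eq) = inj₂ record { s = s ; ss = ss ; eq = eq }

      -- Induction on the total number of expansion steps. Each first step is carried out on its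
      -- own, the induction hypothesis makes the resulting word good, and the closure property
      -- combines these words.
      loop : ∀ k vs (F : Family vs) → size vs F ≤ k → Good (flatten vs y)
      loop k vs F size≤k with any-or-all (first-step vs F)
      ... | inj₁ (_ , g) = g
      loop zero vs F size≤k | inj₂ fs = contradiction
        (<-≤-trans (Advance.smaller vs F zero _ _ (FirstStep.eq (fs zero))) size≤k) λ ()
      loop (suc k) vs F size≤k | inj₂ fs = closed vs y λ i →
        _ , FirstStep.s (fs i) , loop k (vs [ i ]≔ FirstStep.v₁ (fs i)) (Advance.family′ vs F i (FirstStep.s (fs i)) (FirstStep.ss (fs i)))
          (≤-pred (<-≤-trans (Advance.smaller vs F i _ _ (FirstStep.eq (fs i))) size≤k))

    folding-closed* : ∀ vs → (∀ i → ExpandableAt vs y i) → Good (flatten vs y)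
    folding-closed* vs F = loop _ vs F ≤-refl

  -- Greedy decomposition into segments

  infixl 5 _▸_∙_

  data Segments : ℕ → Set where
    ε     : Segments 0
    _▸_∙_ : ∀ {k} → Segments k → Word → Letter → Segments (suc k)

  flat : ∀ {k} → Segments k → Word → Word
  flat ε           y = y
  flat (s ▸ x ∙ c) y = flat s (x ++ c ∷ y)

  flat-++ : ∀ {k} (s : Segments k) y → flat s y ≡ flat s [] ++ y
  flat-++ ε           y = refl
  flat-++ (s ▸ x ∙ c) y = trans (flat-++ s (x ++ c ∷ y)) (trans (cong (flat s [] ++_) (sym (++-assoc x (c ∷ []) y)))
    (trans (sym (++-assoc (flat s []) _ y)) (cong (_++ y) (sym (flat-++ s _)))))

  infix 4 _⇝ₛ_

  data _⇝ₛ_ : ∀ {k} → Segments k → Segments k → Set where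
    ε     : ε ⇝ₛ ε
    _▸_∙_ : ∀ {k} {s s′ : Segments k} {x x′} → s ⇝ₛ s′ → x ⇝ x′ → ∀ c → s ▸ x ∙ c ⇝ₛ s′ ▸ x′ ∙ c

  flat-⇝ : ∀ {k} (s : Segments k) {y y′} → y ⇝ y′ → flat s y ⇝ flat s y′
  flat-⇝ s {y} {y′} t = subst₂ _⇝_ (sym (flat-++ s y)) (sym (flat-++ s y′)) (⇝-++ˡ (flat s []) t)

  Good-confluence-flat : ∀ {k} (s : Segments k) v {x x′ x″} → x ⇝ x′ → x ⇝ x″ → Good (flat s (x″ ++ v)) →
                         ∃[ w ] x′ ⇝ w × Good (flat s (w ++ v))
  Good-confluence-flat s v t t″ g =
    let w , r , g′ = Good-confluence (flat s []) v t t″ (subst Good (flat-++ s _) g)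
    in w , r , subst Good (sym (flat-++ s _)) g′

  -- Expansions that leave the letters between the segments intact are what unfoldings with fixed
  -- vertebrae become on words.
  Free : ∀ {k} → Segments k → Word → Word → Set
  Free s x y = ∀ {s′ x′} → s ⇝ₛ s′ → x ⇝ x′ → ¬ Good (flat s′ (x′ ++ y))

  -- Segments that were chosen greedily: none can be prolonged by the letter
  -- that follows it.
  data Greedy : ∀ {k} → Segments k → Word → Set where
    nil  : ∀ {y} → Greedy ε y
    snoc : ∀ {k} {s : Segments k} {x c y} → Greedy s (x ++ c ∷ y) →
           (∃₂ λ s′ x′ → s ⇝ₛ s′ × x ++ c ∷ [] ⇝ x′ × Good (flat s′ (x′ ++ y))) →
           Greedy (s ▸ x ∙ c) y

  -- The hypothesis of a folding whose factors are the segments, each together with the letter that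
  -- closes it.
  ExpandableSegments : ∀ {k} → Segments k → Word → Set
  ExpandableSegments ε           y = ⊤
  ExpandableSegments (s ▸ x ∙ c) y =
    (∃[ v ] x ++ c ∷ [] ⇝ v × Good (flat s (v ++ y))) × ExpandableSegments s (x ++ c ∷ y)

  ExpandableSegments-⇝ : ∀ {k} (s : Segments k) {y y′} → y ⇝ y′ →
                         ExpandableSegments s y → ExpandableSegments s y′
  ExpandableSegments-⇝ ε           t e = tt
  ExpandableSegments-⇝ (s ▸ x ∙ c) t ((v , r , g) , e) =
    (v , r , Good-⇝ (flat-⇝ s (⇝-++ˡ v t)) g) , ExpandableSegments-⇝ s (⇝-++ˡ x (⇝-++ˡ (c ∷ []) t)) e

  private
    Zigzag : ∀ {k} → Segments k → Set
    Zigzag s = ∃₂ λ s′ r → s ⇝ₛ s′ × Good (flat s′ r)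

    rest : ∀ {k} {s : Segments k} → Zigzag s → Word
    rest = proj₁ ∘ proj₂

    absorb : ∀ {k} {s : Segments k} {x c} → Zigzag (s ▸ x ∙ c) → Zigzag s
    absorb (_ , r , _▸_∙_ {x′ = x′} t _ c , g) = _ , x′ ++ c ∷ r , t , g

    -- The expansions of `x` are merged one after the other: confluence turns each into a further
    -- expansion of the common one found so far, and the words treated before stay good under
    -- further expansion.
    gather : ∀ {k} {s ŝ : Segments k} {x c} (zs : List (Zigzag (s ▸ x ∙ c))) →
             All (λ z → Good (flat ŝ (rest (absorb z)))) zs →
             ∃[ x̂ ] x ⇝ x̂ × All (λ z → Good (flat ŝ (x̂ ++ c ∷ rest z))) zs
    gather [] [] = _ , ε , []
    gather {ŝ = ŝ} {c = c} ((_ , r , t ▸ u ∙ _ , _) ∷ zs) (g ∷ gs) =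
      let x̂ , v , hs = gather {ŝ = ŝ} zs gs
          w , v′ , h = Good-confluence-flat ŝ (c ∷ r) v u g
      in w , v ◅◅ v′ , h ∷ All.map (λ {z} → Good-⇝ (flat-⇝ ŝ (⇝-++ʳ (c ∷ rest z) v′))) hs

  -- All the good zigzags zs of initial parts are simultaneously replaced by
  -- ones which agree on the segments.
  common-expansion : ∀ {k} {s : Segments k} {y} → Greedy s y → (zs : List (Zigzag s)) →
    ∃[ ŝ ] s ⇝ₛ ŝ × All (λ z → Good (flat ŝ (rest z))) zs × ExpandableSegments ŝ y
  common-expansion nil zs = ε , ε , All.universal (λ { (_ , _ , ε , g) → g }) zs , tt
  common-expansion {y = y} (snoc {x = x} {c} greedy (s′ , q , t , u , g)) zs
    -- The witness against prolonging `x` expands the earlier segments as well, so it joins the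
    -- zigzags before these segments are treated.
    with common-expansion greedy ((s′ , q ++ y , t , g) ∷ List.map absorb zs)
  ... | ŝ , t̂ , h ∷ hs , e =
    let x̂ , v , gs = gather {ŝ = ŝ} zs (All.map⁻ hs)
        -- The witness is transferred to the expansion `x̂` on which the other zigzags have settled.
        q̂ , v′ , h′ = Good-confluence-flat ŝ y (⇝-++ʳ (c ∷ []) v) u h
    in ŝ ▸ x̂ ∙ c , t̂ ▸ v ∙ c , gs , (q̂ , v′ , h′) , ExpandableSegments-⇝ ŝ (⇝-++ʳ (c ∷ y) v) e

  module _ {n} (closed : FoldingClosed (suc n)) where

    private
      -- The segments move into the vector one by one until it holds all `suc n` factors of the
      -- folding.
      fold-segments : ∀ {k m} (s : Segments k) (vs : Vec Word m) y → k + m ≡ suc n →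
        (∀ i → ∃[ v ] lookup vs i ⇝ v × Good (flat s (flatten (vs [ i ]≔ v) y))) →
        ExpandableSegments s (flatten vs y) → Good (flat s (flatten vs y))
      fold-segments ε vs y refl F e = folding-closed* closed y vs F
      fold-segments {suc k} {m} (s ▸ x ∙ c) vs y eq F ((v , r , g) , e) =
        subst Good (assoc vs) (fold-segments s ((x ++ c ∷ []) ∷ vs) y (trans (+-suc k m) eq)
          (λ { zero    → v , r , g
             ; (suc i) → let v , r , g = F i in v , r , subst Good (sym (assoc (vs [ i ]≔ v))) g })
          (subst (ExpandableSegments s) (sym (++-assoc x (c ∷ []) _)) e))
        where
        assoc : ∀ (us : Vec Word m) → flat s ((x ++ c ∷ []) ++ flatten us y) ≡ flat s (x ++ c ∷ flatten us y)
        assoc us = cong (flat s) (++-assoc x (c ∷ []) _)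

    -- After a common expansion, each of the `suc n` segments can be expanded separately with a good
    -- result. A folding would then make the word good, against freeness.
    greedy-bound : ∀ {s : Segments (suc n)} {y} → Greedy s y → Free s [] y → ⊥
    greedy-bound {y = y} greedy fr with common-expansion greedy []
    ... | ŝ , t , _ , e = fr t ε (fold-segments ŝ [] y (+-identityʳ _) (λ ()) e)

    -- The word is scanned from the left, and `x` grows as long as freeness persists. A letter that
    -- destroys it closes the segment and becomes irreversible.
    greedy-segments : ∀ y {k} (s : Segments k) x → k ≤ n → Greedy s (x ++ y) → Free s x y →
      ∃[ k ] k ≤ n × Σ[ s′ ∈ Segments k ] ∃[ x′ ] flat s′ x′ ≡ flat s (x ++ y) × Free s′ x′ []
    greedy-segments [] s x k≤n greedy fr =
      _ , k≤n , s , x , cong (flat s) (sym (++-identityʳ x)) , fr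
    greedy-segments (c ∷ y) {k} s x k≤n greedy fr with decide (Free s (x ++ c ∷ []) y)
    ... | yes fr′ =
      let k , k≤n , s′ , x′ , eq , f = greedy-segments y s (x ++ c ∷ []) k≤n
                                         (subst (Greedy s) (sym (++-assoc x _ y)) greedy) fr′
      in k , k≤n , s′ , x′ , trans eq (cong (flat s) (++-assoc x _ y)) , f
    ... | no ¬fr′ = continue (ℕ.m≤n⇒m<n∨m≡n k≤n)
      where
      witness : ∃₂ λ s′ x′ → s ⇝ₛ s′ × x ++ c ∷ [] ⇝ x′ × Good (flat s′ (x′ ++ y))
      witness = stable λ none → ¬fr′ λ t u g → none (_ , _ , t , u , g)
      greedy′ : Greedy (s ▸ x ∙ c) y
      greedy′ = snoc greedy witness
      fr″ : Free (s ▸ x ∙ c) [] y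
      fr″ (t ▸ u ∙ c) r g with refl ← ⇝-[] r = fr t u g
      continue : k < n ⊎ k ≡ n → _
      continue (inj₁ k<n)  = greedy-segments y (s ▸ x ∙ c) [] k<n greedy′ fr″
      continue (inj₂ refl) = ⊥-elim (greedy-bound greedy′ fr″)

  marks : ∀ {k} → Segments k → MarkedWord
  marks ε           = []
  marks (s ▸ x ∙ c) = marks s ++ unmarked x ++ (true , c) ∷ []

  Separates : MarkedWord → Set
  Separates w = ∃₂ λ U V → Chain w U V × (∀ {b} → P b → U b ≡ true) × (∀ {b} → Q b → V b ≡ true → ⊥)

  private
    -- `R` consists of the values reached from `P` along expansions of the segments. The chain must
    -- be available for every set containing `R`, because the next segment begins with an exact set
    -- that may be larger.
    segments-chain : ∀ {k} (s : Segments k) → ∃[ R ]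
      (∀ {V} → (∀ {b} → R b → V b ≡ true) → ∃[ U ] Chain (marks s) U V × (∀ {b} → P b → U b ≡ true)) ×
      (∀ {c} → R c → ∃[ s′ ] s ⇝ₛ s′ × ∃[ b ] P b × Path (flat s′ []) b c)
    segments-chain ε = P , (λ P⊆V → _ , [] (λ _ → refl) , P⊆V) , λ Pc → ε , ε , _ , Pc , refl
    segments-chain (s ▸ x ∙ c) =
      let R , chain , R⊆ = segments-chain s
          U , V , bs , R⊆U , V⊆ = zigzag-duality R x
      in (λ d → ∃[ b ] V b ≡ true × Step c b d) ,
         (λ {W} ⊆W → let U₀ , ch , P⊆U₀ = chain R⊆U in
            U₀ , Chain-++ ch (Chain-++ (Chain-unmarked bs)
              (fixed {V = W} (λ q Vb → ⊆W (_ , Vb , q)) ([] λ _ → refl))) , P⊆U₀) ,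
         λ (b , Vb , q) →
           let x′ , u , b′ , Rb′ , p = V⊆ Vb
               s′ , t , a , Pa , p₀  = R⊆ Rb′
           in s′ ▸ x′ ∙ c , t ▸ u ∙ c , a , Pa ,
              subst (λ w → Path w a _) (sym (flat-++ s′ (x′ ++ c ∷ [])))
                (Path-++⁺ (flat s′ []) p₀ (Path-++⁺ x′ p (_ , q , refl)))

  -- A value of `Q` in the last set would be reached from `P` along an expansion of all segments,
  -- against freeness.
  free-separates : ∀ {k} (s : Segments k) x → Free s x [] → Separates (marks s ++ unmarked x)
  free-separates s x fr =
    let R , chain , R⊆ = segments-chain s
        U , V , bs , R⊆U , V⊆ = zigzag-duality R x
        U₀ , ch , P⊆U₀ = chain R⊆U
    in U₀ , V , Chain-++ ch (Chain-unmarked bs) , P⊆U₀ , λ {c} Qc Vc →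
       let x′ , u , b′ , Rb′ , p = V⊆ Vc
           s′ , t , a , Pa , p₀ = R⊆ Rb′
       in fr t u (a , c , Pa , Qc , subst (λ w → Path w a c)
            (sym (trans (flat-++ s′ (x′ ++ [])) (cong (flat s′ [] ++_) (++-identityʳ x′))))
            (Path-++⁺ (flat s′ []) p₀ p))

  forget : MarkedWord → Word
  forget = List.map proj₂

  forget-unmarked : ∀ w → forget (unmarked w) ≡ w
  forget-unmarked []      = refl
  forget-unmarked (l ∷ w) = cong (l ∷_) (forget-unmarked w)

  #marks-++ : ∀ u v → #marks (u ++ v) ≡ #marks u + #marks v
  #marks-++ []                v = refl
  #marks-++ ((true  , _) ∷ u) v = cong suc (#marks-++ u v)
  #marks-++ ((false , _) ∷ u) v = #marks-++ u v

  #marks-unmarked : ∀ w → #marks (unmarked w) ≡ 0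
  #marks-unmarked []      = refl
  #marks-unmarked (_ ∷ w) = #marks-unmarked w

  #marks-marks : ∀ {k} (s : Segments k) → #marks (marks s) ≡ k
  #marks-marks ε           = refl
  #marks-marks (s ▸ x ∙ c) = trans (#marks-++ (marks s) _) (trans (cong₂ _+_ (#marks-marks s)
    (trans (#marks-++ (unmarked x) _) (cong (_+ 1) (#marks-unmarked x)))) (+-comm _ 1))

  forget-marks : ∀ {k} (s : Segments k) x → forget (marks s ++ unmarked x) ≡ flat s x
  forget-marks ε           y = forget-unmarked y
  forget-marks (s ▸ x ∙ c) y = begin
    forget ((marks s ++ unmarked x ++ (true , c) ∷ []) ++ unmarked y)
      ≡⟨ List.map-++ proj₂ (marks s ++ unmarked x ++ (true , c) ∷ []) _ ⟩
    forget (marks s ++ unmarked x ++ (true , c) ∷ []) ++ forget (unmarked y)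
      ≡⟨ cong₂ _++_ (trans (List.map-++ proj₂ (marks s) _) (cong (forget (marks s) ++_)
           (trans (List.map-++ proj₂ (unmarked x) _) (cong (_++ c ∷ []) (forget-unmarked x))))) (forget-unmarked y) ⟩
    (forget (marks s) ++ x ++ c ∷ []) ++ y
      ≡⟨ trans (++-assoc (forget (marks s)) _ y) (cong (forget (marks s) ++_) (++-assoc x _ y)) ⟩
    forget (marks s) ++ x ++ c ∷ y
      ≡⟨ cong (forget (marks s) ++_) (sym (forget-unmarked (x ++ c ∷ y))) ⟩
    forget (marks s) ++ forget (unmarked (x ++ c ∷ y))
      ≡⟨ sym (List.map-++ proj₂ (marks s) _) ⟩
    forget (marks s ++ unmarked (x ++ c ∷ y)) ≡⟨ forget-marks s (x ++ c ∷ y) ⟩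
    flat s (x ++ c ∷ y) ∎
    where open ≡-Reasoning

  SeparableWith : ℕ → Word → Set
  SeparableWith n w = ∃[ m ] forget m ≡ w × #marks m ≤ n × Separates m

  segments-separable : ∀ {n k} (s : Segments k) x → k ≤ n → Free s x [] → SeparableWith n (flat s x)
  segments-separable s x k≤n fr =
    marks s ++ unmarked x , forget-marks s x ,
    subst (_≤ _) (sym (trans (#marks-++ (marks s) _) (trans (cong₂ _+_ (#marks-marks s) (#marks-unmarked x)) (+-identityʳ _)))) k≤n ,
    free-separates s x fr

  folding-closed⇒separable : ∀ {n} → FoldingClosed (suc n) → ∀ w → ¬ Good w → SeparableWith n w
  folding-closed⇒separable {n} closed w ¬good =
    let _ , k≤n , s , x , eq , fr = greedy-segments closed w ε [] z≤n nil
                                        (λ { ε t g → case ⇝-[] t of λ { refl → ¬good g } })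
    in subst (SeparableWith n) eq (segments-separable s x k≤n fr)

-- Finite types

-- Lists with repetitions are easier to build than bijections; `listable⇒finite` removes the
-- repetitions by deciding equality classically.
Listable : Set → Set
Listable A = Σ[ xs ∈ List A ] ∀ a → a ∈ xs

listable-Fin : ∀ m → Listable (Fin m)
listable-Fin m = allFin m , Mem.∈-allFin

listable-Σ : ∀ {A : Set} {F : A → Set} → Listable A → (∀ a → Listable (F a)) → Listable (Σ A F)
listable-Σ {A} {F} (as , ∈as) bs = pairs as , λ (a , b) → pairs-complete (∈as a) b
  where
  pairs : List A → List (Σ A F)
  pairs []       = []
  pairs (a ∷ as) = List.map (a ,_) (proj₁ (bs a)) ++ pairs as
  pairs-complete : ∀ {as a} → a ∈ as → ∀ b → (a , b) ∈ pairs as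
  pairs-complete (here refl) b = Mem.∈-++⁺ˡ (Mem.∈-map⁺ (_ ,_) (proj₂ (bs _) b))
  pairs-complete {a′ ∷ _} (there i) b = Mem.∈-++⁺ʳ (List.map (a′ ,_) _) (pairs-complete i b)

listable-partial : ∀ {A C : Set} (f : A → Maybe C) → (∀ c → ∃[ a ] f a ≡ just c) → Listable A → Listable C
listable-partial {A} {C} f onto (as , ∈as) = List.mapMaybe f as , λ c → let a , eq = onto c in hit (∈as a) eq
  where
  hit : ∀ {as a c} → a ∈ as → f a ≡ just c → c ∈ List.mapMaybe f as
  hit {a ∷ as} (here refl) eq with f a
  hit (here refl) refl | just c = here refl
  hit {a ∷ as} (there i) eq with f a
  ... | just _  = there (hit i eq)
  ... | nothing = hit i eq

listable-image : ∀ {A C : Set} (f : A → C) → (∀ c → ∃[ a ] f a ≡ c) → Listable A → Listable C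
listable-image f onto = listable-partial (just ∘ f) (λ c → let a , eq = onto c in a , cong just eq)

listable-⊎ : ∀ {A C : Set} → Listable A → Listable C → Listable (A ⊎ C)
listable-⊎ (as , ∈as) (cs , ∈cs) = List.map inj₁ as ++ List.map inj₂ cs ,
  λ { (inj₁ a) → Mem.∈-++⁺ˡ (Mem.∈-map⁺ inj₁ (∈as a))
    ; (inj₂ c) → Mem.∈-++⁺ʳ (List.map inj₁ as) (Mem.∈-map⁺ inj₂ (∈cs c)) }

listable-Vec : ∀ {A : Set} m → Listable A → Listable (Vec A m)
listable-Vec zero    l = [] ∷ [] , λ { [] → here refl }
listable-Vec (suc m) l = listable-image (λ (a , as) → a ∷ as) (λ { (a ∷ as) → (a , as) , refl })
                           (listable-Σ l λ _ → listable-Vec m l)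

finite⇒listable : ∀ {A} → Finite A → Listable A
finite⇒listable (k , bij) =
  listable-image (Inverse.from bij) (λ a → Inverse.to bij a , Inverse.strictlyInverseʳ bij a) (listable-Fin k)

module _ (em : EM) where

  open Classical em

  listable⇒finite : ∀ {A} → Listable A → Finite A
  listable⇒finite {A} (xs , ∈xs) = length ys , mk↔ₛ′ (Any.index ∘ ∈ys) (List.lookup ys)
    (λ i → lookup-injective (Unique.deduplicate-! _≟_ xs) _ _ (sym (Any.lookup-index (∈ys (List.lookup ys i)))))
    (λ a → sym (Any.lookup-index (∈ys a)))
    where
    _≟_ : (a b : A) → Dec (a ≡ b)
    a ≟ b = decide (a ≡ b)
    ys = List.deduplicate _≟_ xs
    ∈ys : ∀ a → a ∈ ys
    ∈ys a = Mem.∈-deduplicate⁺ _≟_ (∈xs a)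
    lookup-injective : ∀ {zs : List A} → AllPairs _≢_ zs → ∀ i j → List.lookup zs i ≡ List.lookup zs j → i ≡ j
    lookup-injective (_ ∷ _)   zero    zero    _  = refl
    lookup-injective (p ∷ _)   zero    (suc j) eq = contradiction eq (All.lookup p (Mem.∈-lookup j))
    lookup-injective (p ∷ _)   (suc i) zero    eq = contradiction (sym eq) (All.lookup p (Mem.∈-lookup i))
    lookup-injective (_ ∷ ps)  (suc i) (suc j) eq = cong suc (lookup-injective ps i j eq)

finite-↔ : ∀ {A C} → A ↔ C → Finite C → Finite A
finite-↔ bij (k , bij′) = k , mk↔ₛ′ (Inverse.to bij′ ∘ Inverse.to bij) (Inverse.from bij ∘ Inverse.from bij′)
  (λ i → trans (cong (Inverse.to bij′) (Inverse.strictlyInverseˡ bij _)) (Inverse.strictlyInverseˡ bij′ i))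
  (λ a → trans (cong (Inverse.from bij) (Inverse.strictlyInverseʳ bij′ _)) (Inverse.strictlyInverseʳ bij a))

lookup-ext : ∀ {A : Set} {m} {u v : Vec A m} → (∀ i → lookup u i ≡ lookup v i) → u ≡ v
lookup-ext {u = u} {v} eq = trans (sym (Vec.tabulate∘lookup u)) (trans (tabulate-cong eq) (Vec.tabulate∘lookup v))

lookup-map-tabulate : ∀ {A C : Set} {m} (g : A → C) (f : Fin m → A) p → lookup (Vec.map g (tabulate f)) p ≡ g (f p)
lookup-map-tabulate g f p = trans (lookup-map p g (tabulate f)) (cong g (lookup∘tabulate f p))

recover : ∀ {A : Set} {m : Maybe A} → .(m ≡ nothing) → m ≡ nothing
recover {m = nothing} _ = refl

just-or-nothing : ∀ {A : Set} (m : Maybe A) → (∃[ a ] m ≡ just a) ⊎ m ≡ nothing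
just-or-nothing (just a) = inj₁ (a , refl)
just-or-nothing nothing  = inj₂ refl

-- Structures and their homomorphisms

module _ {τ : Signature} where

  id-hom : (𝔸 : Structure τ) → 𝔸 ⟶ 𝔸
  id-hom 𝔸 = id , λ s t r → subst (rel 𝔸 s) (sym (Vec.map-id t)) r

  _∘ₕ_ : {𝔸 𝔹 ℂ : Structure τ} → 𝔹 ⟶ ℂ → 𝔸 ⟶ 𝔹 → 𝔸 ⟶ ℂ
  _∘ₕ_ {ℂ = ℂ} (g , g-hom) (f , f-hom) =
    g ∘ f , λ s t r → subst (rel ℂ s) (sym (map-∘ g f t)) (g-hom s _ (f-hom s t r))

  ≅-to : {𝔸 𝔹 : Structure τ} → 𝔸 ≅ 𝔹 → 𝔸 ⟶ 𝔹
  ≅-to i = _≅_.to i , _≅_.to-hom i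

  ≅-from : {𝔸 𝔹 : Structure τ} → 𝔸 ≅ 𝔹 → 𝔹 ⟶ 𝔸
  ≅-from i = _≅_.from i , _≅_.from-hom i

  ≅-refl : {𝔸 : Structure τ} → 𝔸 ≅ 𝔸
  ≅-refl {𝔸} = record
    { bijection = mk↔ₛ′ id id (λ _ → refl) (λ _ → refl)
    ; to-hom    = proj₂ (id-hom 𝔸)
    ; from-hom  = proj₂ (id-hom 𝔸)
    }

  LegRel : (𝔸 : Structure τ) → Leg τ → Carrier 𝔸 → Set
  LegRel 𝔸 ψ x = ∃[ r ] rel 𝔸 (Leg.symbol ψ) r × lookup r (Leg.position ψ) ≡ x

  LinkRel : (𝔸 : Structure τ) → Link τ → Carrier 𝔸 → Carrier 𝔸 → Set
  LinkRel 𝔸 φ x y = ∃[ r ] rel 𝔸 (Link.symbol φ) r × lookup r (Link.source φ) ≡ x × lookup r (Link.target φ) ≡ y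


  lookup-linkAt : ∀ {J : Set} (φ : Link τ) {x y z : J} p → lookup (Conjunct.args (linkAt φ x y)) p ≡ just z →
                  (p ≡ Link.source φ × z ≡ x) ⊎ (p ≡ Link.target φ × z ≡ y)
  lookup-linkAt φ {x} {y} p eq with p Fin.≟ Link.target φ
  ... | yes refl with refl ← trans (sym eq) (Vec.lookup∘updateAt p (replicate _ nothing [ Link.source φ ]≔ just x)) =
    inj₂ (refl , refl)
  ... | no p≢t with p Fin.≟ Link.source φ
  ...   | yes refl with refl ← trans (sym eq) (trans (Vec.lookup∘updateAt′ p (Link.target φ) p≢t (replicate _ nothing [ p ]≔ just x))
                                  (Vec.lookup∘updateAt p (replicate _ nothing))) =
    inj₁ (refl , refl)
  ...   | no p≢s with () ← trans (sym eq) (trans (Vec.lookup∘updateAt′ p (Link.target φ) p≢t (replicate _ nothing [ Link.source φ ]≔ just x))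
                            (trans (Vec.lookup∘updateAt′ p (Link.source φ) p≢s (replicate _ nothing)) (Vec.lookup-replicate p nothing)))

  lookup-linkAt-source : ∀ {J : Set} (φ : Link τ) {x y : J} →
                         lookup (Conjunct.args (linkAt φ x y)) (Link.source φ) ≡ just x
  lookup-linkAt-source φ {x} = trans
    (Vec.lookup∘updateAt′ (Link.source φ) (Link.target φ) (Link.distinct φ) (replicate _ nothing [ Link.source φ ]≔ just x))
                             (Vec.lookup∘updateAt (Link.source φ) (replicate _ nothing))

  lookup-linkAt-target : ∀ {J : Set} (φ : Link τ) {x y : J} →
                         lookup (Conjunct.args (linkAt φ x y)) (Link.target φ) ≡ just y
  lookup-linkAt-target φ {x} = Vec.lookup∘updateAt (Link.target φ) (replicate _ nothing [ Link.source φ ]≔ just x)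

  lookup-legAt : ∀ {J : Set} (ψ : Leg τ) {x z : J} p → lookup (Conjunct.args (legAt ψ x)) p ≡ just z →
                 p ≡ Leg.position ψ × z ≡ x
  lookup-legAt ψ p eq with p Fin.≟ Leg.position ψ
  ... | yes refl with refl ← trans (sym eq) (Vec.lookup∘updateAt p (replicate _ nothing)) = refl , refl
  ... | no p≢ with () ← trans (sym eq) (trans (Vec.lookup∘updateAt′ p (Leg.position ψ) p≢ (replicate _ nothing)) (Vec.lookup-replicate p nothing))

  lookup-legAt-position : ∀ {J : Set} (ψ : Leg τ) {x : J} →
                          lookup (Conjunct.args (legAt ψ x)) (Leg.position ψ) ≡ just x
  lookup-legAt-position ψ = Vec.lookup∘updateAt (Leg.position ψ) (replicate _ nothing)

  Satisfied : (𝔸 : Structure τ) {J : Set} → Conjunct τ J → (J → Carrier 𝔸) → Set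
  Satisfied 𝔸 κ h = ∃[ r ] rel 𝔸 (Conjunct.symbol κ) r ×
                    (∀ p {x} → lookup (Conjunct.args κ) p ≡ just x → lookup r p ≡ h x)

  satisfied-link : ∀ 𝔸 {J : Set} φ {x y} (h : J → Carrier 𝔸) →
                   LinkRel 𝔸 φ (h x) (h y) → Satisfied 𝔸 (linkAt φ x y) h
  satisfied-link 𝔸 φ h (r , R , eqx , eqy) = r , R , λ p eq → case lookup-linkAt φ p eq of λ
    { (inj₁ (refl , refl)) → eqx ; (inj₂ (refl , refl)) → eqy }

  link-satisfied : ∀ 𝔸 {J : Set} φ {x y} (h : J → Carrier 𝔸) →
                   Satisfied 𝔸 (linkAt φ x y) h → LinkRel 𝔸 φ (h x) (h y)
  link-satisfied 𝔸 φ h (r , R , eq) = r , R , eq _ (lookup-linkAt-source φ) , eq _ (lookup-linkAt-target φ)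

  satisfied-leg : ∀ 𝔸 {J : Set} ψ {x} (h : J → Carrier 𝔸) →
                  LegRel 𝔸 ψ (h x) → Satisfied 𝔸 (legAt ψ x) h
  satisfied-leg 𝔸 ψ h (r , R , eqx) = r , R , λ p eq → case lookup-legAt ψ p eq of λ { (refl , refl) → eqx }

  leg-satisfied : ∀ 𝔸 {J : Set} ψ {x} (h : J → Carrier 𝔸) →
                  Satisfied 𝔸 (legAt ψ x) h → LegRel 𝔸 ψ (h x)
  leg-satisfied 𝔸 ψ h (r , R , eq) = r , R , eq _ (lookup-legAt-position ψ)

  -- `variableAt c p` is defined by a with-abstraction together with its
  -- equation, so abstracting over `lookup (args (conj c)) p` in a goal
  -- mentioning it is ill-typed unless the left-hand side of that equation is
  -- spared.  It is, since `conj u` and `conj tt` are definitionally but not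
  -- syntactically equal.
  module Unblocked {J I : Set} (conj : ⊤ → I → Conjunct τ J) (u : ⊤) where

    open CanonicalDatabase (conj tt)
    open Conjunct

    same : ∀ c p → lookup (args (conj u c)) p ≡ lookup (args (conj tt c)) p
    same c p = refl

    at-just : ∀ c p {x} → lookup (args (conj u c)) p ≡ just x → variableAt c p ≡ inj₁ x
    at-just c p e with lookup (args (conj tt c)) p | same c p
    ... | just y  | e′ = cong inj₁ (just-injective (trans (sym e′) e))
    ... | nothing | e′ with () ← trans (sym e′) e

    at-nothing : ∀ c p (eq : lookup (args (conj u c)) p ≡ nothing) → variableAt c p ≡ inj₂ (quantified c p eq)
    at-nothing c p e with lookup (args (conj tt c)) p | same c p
    ... | nothing | _  = refl
    ... | just y  | e′ with () ← trans (sym e′) e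

  module Database {J I : Set} (conj : I → Conjunct τ J) where

    open CanonicalDatabase conj public
    open Conjunct

    variableAt-just : ∀ c p {x} → lookup (args (conj c)) p ≡ just x → variableAt c p ≡ inj₁ x
    variableAt-just = Unblocked.at-just (λ _ → conj) tt

    variableAt-nothing : ∀ c p (eq : lookup (args (conj c)) p ≡ nothing) → variableAt c p ≡ inj₂ (quantified c p eq)
    variableAt-nothing = Unblocked.at-nothing (λ _ → conj) tt

    variableAt-inj₁ : ∀ c p {x} → variableAt c p ≡ inj₁ x → lookup (args (conj c)) p ≡ just x
    variableAt-inj₁ c p e with just-or-nothing (lookup (args (conj c)) p)
    ... | inj₁ (y , eq) = trans eq (cong just (inj₁-injective (trans (sym (variableAt-just c p eq)) e)))
    ... | inj₂ eq with () ← trans (sym e) (variableAt-nothing c p eq)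

    lookup-tuple : ∀ c p {x} → lookup (args (conj c)) p ≡ just x → lookup (tabulate (variableAt c)) p ≡ inj₁ x
    lookup-tuple c p eq = trans (lookup∘tabulate (variableAt c) p) (variableAt-just c p eq)

    lookup-tuple⁻ : ∀ c p {x} → lookup (tabulate (variableAt c)) p ≡ inj₁ x → lookup (args (conj c)) p ≡ just x
    lookup-tuple⁻ c p eq = variableAt-inj₁ c p (trans (sym (lookup∘tabulate (variableAt c) p)) eq)

    tuple-cast : ∀ c {κ} (e : conj c ≡ κ) (t : Vec Variable (arity τ (symbol κ))) →
      (∀ p → lookup t p ≡ variableAt c (subst (λ κ → Fin (arity τ (symbol κ))) (sym e) p)) → Tuple (symbol κ) t
    tuple-cast c refl t eq = subst (Tuple _) (lookup-ext λ p → trans (lookup∘tabulate _ p) (sym (eq p))) (tuple c)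

    -- Free variables follow the assignment, and quantified ones take their values from the tuples
    -- that witness the conjuncts.
    hom-from : ∀ 𝔸 (h : J → Carrier 𝔸) → (∀ c → Satisfied 𝔸 (conj c) h) →
               Σ[ g ∈ canonicalDatabase conj ⟶ 𝔸 ] ∀ x → proj₁ g (inj₁ x) ≡ h x
    hom-from 𝔸 h sat = (g , hom) , λ _ → refl
      where
      g : Variable → Carrier 𝔸
      g (inj₁ x)                    = h x
      g (inj₂ (quantified c p _)) = lookup (proj₁ (sat c)) p
      g-variableAt : ∀ c p → g (variableAt c p) ≡ lookup (proj₁ (sat c)) p
      g-variableAt c p with just-or-nothing (lookup (args (conj c)) p)
      ... | inj₁ (x , eq) = trans (cong g (variableAt-just c p eq)) (sym (proj₂ (proj₂ (sat c)) p eq))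
      ... | inj₂ eq       = cong g (variableAt-nothing c p eq)
      hom : IsHom (canonicalDatabase conj) 𝔸 g
      hom s _ (tuple c) = subst (rel 𝔸 s) (lookup-ext λ p → sym (trans (lookup-map-tabulate g (variableAt c) p) (g-variableAt c p))) (proj₁ (proj₂ (sat c)))

    hom-satisfies : ∀ 𝔸 (g : canonicalDatabase conj ⟶ 𝔸) c → Satisfied 𝔸 (conj c) (proj₁ g ∘ inj₁)
    hom-satisfies 𝔸 (g , hom) c = _ , hom _ _ (tuple c) , λ p eq →
      trans (lookup-map-tabulate g (variableAt c) p) (cong g (variableAt-just c p eq))

    listable-database : Listable J → Listable I → Listable Variable
    listable-database lJ lI = listable-⊎ lJ (listable-partial bound onto (listable-Σ lI λ _ → listable-Fin _))
      where
      bound′ : ∀ c p → (∃[ x ] lookup (args (conj c)) p ≡ just x) ⊎ lookup (args (conj c)) p ≡ nothing → Maybe Quantified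
      bound′ c p (inj₁ _)  = nothing
      bound′ c p (inj₂ eq) = just (quantified c p eq)
      bound : Σ[ c ∈ I ] Fin (arity τ (symbol (conj c))) → Maybe Quantified
      bound (c , p) = bound′ c p (just-or-nothing (lookup (args (conj c)) p))
      bound-nothing : ∀ c p (eq : lookup (args (conj c)) p ≡ nothing) → bound (c , p) ≡ just (quantified c p eq)
      bound-nothing c p eq with just-or-nothing (lookup (args (conj c)) p)
      ... | inj₂ _        = refl
      ... | inj₁ (_ , e′) with () ← trans (sym eq) e′
      onto : ∀ q → ∃[ a ] bound a ≡ just q
      onto (quantified c p b) = (c , p) , bound-nothing c p (recover b)

  mapConjunct : ∀ {J J′ : Set} → (J′ → J) → Conjunct τ J′ → Conjunct τ J
  mapConjunct β (s ⦅ xs ⦆) = s ⦅ Vec.map (Maybe.map β) xs ⦆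

  module _ {J J′ I I′ : Set} (conj : I → Conjunct τ J) (conj′ : I′ → Conjunct τ J′)
           (joints : J′ ↔ J) (ι : I′ → I) (ι-injective : ∀ {c d} → ι c ≡ ι d → c ≡ d)
           (ι-surjective : ∀ c → ∃[ c′ ] ι c′ ≡ c)
           (agree : ∀ c → conj (ι c) ≡ mapConjunct (Inverse.to joints) (conj′ c)) where

    private
      module D  = Database conj
      module D′ = Database conj′
      β = Inverse.to joints
      Pos : ∀ {J : Set} → Conjunct τ J → Set
      Pos κ = Fin (arity τ (Conjunct.symbol κ))

      pos⁺ : ∀ {κ κ′} → κ ≡ mapConjunct β κ′ → Pos κ′ → Pos κ
      pos⁺ e = subst Pos (sym e)

      pos⁻ : ∀ {κ κ′} → κ ≡ mapConjunct β κ′ → Pos κ → Pos κ′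
      pos⁻ e = subst Pos e

      pos⁻∘pos⁺ : ∀ {κ κ′} (e : κ ≡ mapConjunct β κ′) p → pos⁻ e (pos⁺ e p) ≡ p
      pos⁻∘pos⁺ refl p = refl

      pos⁺∘pos⁻ : ∀ {κ κ′} (e : κ ≡ mapConjunct β κ′) p → pos⁺ e (pos⁻ e p) ≡ p
      pos⁺∘pos⁻ refl p = refl

      lookup-pos⁺ : ∀ {κ κ′} (e : κ ≡ mapConjunct β κ′) p →
                    lookup (Conjunct.args κ) (pos⁺ e p) ≡ Maybe.map β (lookup (Conjunct.args κ′) p)
      lookup-pos⁺ {κ′ = κ′} refl p = lookup-map p _ (Conjunct.args κ′)

      bound⁺ : ∀ {κ κ′} (e : κ ≡ mapConjunct β κ′) p → lookup (Conjunct.args κ′) p ≡ nothing →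
               lookup (Conjunct.args κ) (pos⁺ e p) ≡ nothing
      bound⁺ e p b = trans (lookup-pos⁺ e p) (cong (Maybe.map β) b)

      map-nothing : ∀ {m : Maybe J′} → Maybe.map β m ≡ nothing → m ≡ nothing
      map-nothing {nothing} _ = refl

      bound⁻ : ∀ {κ κ′} (e : κ ≡ mapConjunct β κ′) p → lookup (Conjunct.args κ) p ≡ nothing →
               lookup (Conjunct.args κ′) (pos⁻ e p) ≡ nothing
      bound⁻ {κ′ = κ′} refl p b = map-nothing (trans (sym (lookup-map p _ (Conjunct.args κ′))) b)

      agree′ : ∀ {c c′} → ι c′ ≡ c → conj c ≡ mapConjunct β (conj′ c′)
      agree′ refl = agree _

      fwd : D′.Variable → D.Variable
      fwd (inj₁ x)                      = inj₁ (β x)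
      fwd (inj₂ (D′.quantified c p b)) = inj₂ (D.quantified (ι c) (pos⁺ (agree c) p) (bound⁺ (agree c) p b))

      pull : ∀ {c c′} → ι c′ ≡ c → (p : Pos (conj c)) → .(lookup (Conjunct.args (conj c)) p ≡ nothing) → D′.Variable
      pull {c′ = c′} e p b = inj₂ (D′.quantified c′ (pos⁻ (agree′ e) p) (bound⁻ (agree′ e) p b))

      bwd : D.Variable → D′.Variable
      bwd (inj₁ x)                     = inj₁ (Inverse.from joints x)
      bwd (inj₂ (D.quantified c p b)) = pull (proj₂ (ι-surjective c)) p b

      quantified-≡ : ∀ {c p q} .{b : lookup (Conjunct.args (conj c)) p ≡ nothing}
                     .{b′ : lookup (Conjunct.args (conj c)) q ≡ nothing} → p ≡ q →
                     inj₂ {A = J} (D.quantified c p b) ≡ inj₂ (D.quantified c q b′)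
      quantified-≡ refl = refl

      quantified′-≡ : ∀ {c p q} .{b : lookup (Conjunct.args (conj′ c)) p ≡ nothing}
                      .{b′ : lookup (Conjunct.args (conj′ c)) q ≡ nothing} → p ≡ q →
                      inj₂ {A = J′} (D′.quantified c p b) ≡ inj₂ (D′.quantified c q b′)
      quantified′-≡ refl = refl

      fwd∘pull : ∀ {c c′} (e : ι c′ ≡ c) p .(b : lookup (Conjunct.args (conj c)) p ≡ nothing) →
                 fwd (pull e p b) ≡ inj₂ (D.quantified c p b)
      fwd∘pull refl p b = quantified-≡ (pos⁺∘pos⁻ (agree _) p)

      pull∘fwd : ∀ {c c′} (e : ι c′ ≡ ι c) → c′ ≡ c → ∀ p .(b : lookup (Conjunct.args (conj′ c)) p ≡ nothing)
                 .(b′ : lookup (Conjunct.args (conj (ι c))) (pos⁺ (agree c) p) ≡ nothing) →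
                 pull e (pos⁺ (agree c) p) b′ ≡ inj₂ (D′.quantified c p b)
      pull∘fwd refl refl p b b′ = quantified′-≡ (pos⁻∘pos⁺ (agree _) p)

      bijection : D′.Variable ↔ D.Variable
      bijection = mk↔ₛ′ fwd bwd
        (λ { (inj₁ x) → cong inj₁ (Inverse.strictlyInverseˡ joints x)
           ; (inj₂ (D.quantified c p b)) → fwd∘pull (proj₂ (ι-surjective c)) p b })
        (λ { (inj₁ x) → cong inj₁ (Inverse.strictlyInverseʳ joints x)
           ; (inj₂ (D′.quantified c p b)) →
             let e = proj₂ (ι-surjective (ι c)) in pull∘fwd e (ι-injective e) p b (bound⁺ (agree c) p (recover b)) })

      fwd-variableAt : ∀ c p → fwd (D′.variableAt c p) ≡ D.variableAt (ι c) (pos⁺ (agree c) p)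
      fwd-variableAt c p with just-or-nothing (lookup (Conjunct.args (conj′ c)) p)
      ... | inj₁ (x , eq) = trans (cong fwd (D′.variableAt-just c p eq))
        (sym (D.variableAt-just (ι c) _ (trans (lookup-pos⁺ (agree c) p) (cong (Maybe.map β) eq))))
      ... | inj₂ eq = trans (cong fwd (D′.variableAt-nothing c p eq))
        (sym (D.variableAt-nothing (ι c) _ (bound⁺ (agree c) p eq)))

      tuple-pull : ∀ c {κ} (e : κ ≡ mapConjunct β (conj′ c)) (t : Vec D′.Variable (arity τ (Conjunct.symbol κ))) →
                   (∀ p → lookup t (pos⁺ e p) ≡ D′.variableAt c p) → D′.Tuple (Conjunct.symbol κ) t
      tuple-pull c refl t eq =
        subst (D′.Tuple _) (lookup-ext λ p → trans (lookup∘tabulate _ p) (sym (eq p))) (D′.tuple c)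

      bwd-tuple : ∀ {c c′} → ι c′ ≡ c → D′.Tuple (Conjunct.symbol (conj c)) (Vec.map bwd (tabulate (D.variableAt c)))
      bwd-tuple {c′ = c′} refl = tuple-pull c′ (agree c′) _ λ p →
        trans (lookup-map-tabulate bwd (D.variableAt (ι c′)) (pos⁺ (agree c′) p))
          (trans (cong bwd (sym (fwd-variableAt c′ p))) (Inverse.strictlyInverseʳ bijection _))

    -- Renaming joints and conjuncts does not affect the canonical database. The types of positions
    -- depend on the conjunct, so positions are transported along `agree` by `pos⁺` and `pos⁻`.
    database-≅ : Σ[ i ∈ canonicalDatabase conj′ ≅ canonicalDatabase conj ] ∀ x → _≅_.to i (inj₁ x) ≡ inj₁ (β x)
    database-≅ = record
      { bijection = bijection
      ; to-hom    = λ { s _ (D′.tuple c) → D.tuple-cast (ι c) (agree c) _ λ p →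
          trans (lookup-map-tabulate fwd (D′.variableAt c) p) (fwd-variableAt c p) }
      ; from-hom  = λ { s _ (D.tuple c) → bwd-tuple (proj₂ (ι-surjective c)) }
      } , λ _ → refl

-- Caterpillars as words

data Item (τ : Signature) : Set where
  unary  : Leg τ → Item τ
  binary : Link τ → Item τ

module _ {τ : Signature} where

  open Words (Item τ)

  flip : Link τ → Link τ
  flip φ = record
    { symbol   = Link.symbol φ
    ; source   = Link.target φ
    ; target   = Link.source φ
    ; distinct = Link.distinct φ ∘ sym
    }

  orient : Bool → Link τ → Link τ
  orient true  φ = φ
  orient false φ = flip φ

  orient-not : ∀ σ φ → orient (not σ) φ ≡ flip (orient σ φ)
  orient-not true  φ = refl
  orient-not false φ = refl

  linkAt-flip : ∀ {J : Set} φ (x y : J) → linkAt (flip φ) x y ≡ linkAt φ y x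
  linkAt-flip φ x y = cong (Link.symbol φ ⦅_⦆)
    (Vec.[]≔-commutes (replicate _ nothing) (Link.target φ) (Link.source φ) (Link.distinct φ ∘ sym))

  -- A leg is a partial identity. Thus legs and links are letters alike, and a leg is its own
  -- inverse.
  sem : (𝔸 : Structure τ) → Item τ → Carrier 𝔸 → Carrier 𝔸 → Set
  sem 𝔸 (unary ψ)  x y = x ≡ y × LegRel 𝔸 ψ x
  sem 𝔸 (binary φ) x y = LinkRel 𝔸 φ x y

  LinkRel-flip : ∀ 𝔸 φ {x y} → LinkRel 𝔸 (flip φ) x y → LinkRel 𝔸 φ y x
  LinkRel-flip 𝔸 φ (r , R , eqx , eqy) = r , R , eqy , eqx

  #links : Word → ℕ
  #links []                  = 0
  #links ((_ , unary _) ∷ w)  = #links w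
  #links ((_ , binary _) ∷ w) = suc (#links w)

  nthLink : Word → ℕ → Maybe (Bool × Link τ)
  nthLink []                  t       = nothing
  nthLink ((_ , unary _) ∷ w)  t       = nthLink w t
  nthLink ((σ , binary φ) ∷ w) zero    = just (σ , φ)
  nthLink ((σ , binary φ) ∷ w) (suc t) = nthLink w t

  legsOf : Word → ℕ → List (Leg τ)
  legsOf []                  t       = []
  legsOf ((_ , unary ψ) ∷ w)  zero    = ψ ∷ legsOf w zero
  legsOf ((_ , unary ψ) ∷ w)  (suc t) = legsOf w (suc t)
  legsOf ((_ , binary φ) ∷ w) zero    = []
  legsOf ((_ , binary φ) ∷ w) (suc t) = legsOf w t

  #links-++ : ∀ u v → #links (u ++ v) ≡ #links u + #links v
  #links-++ []                  v = refl
  #links-++ ((_ , unary _) ∷ u)  v = #links-++ u v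
  #links-++ ((_ , binary _) ∷ u) v = cong suc (#links-++ u v)

  #links-inv : ∀ u → #links (inv u) ≡ #links u
  #links-inv []                  = refl
  #links-inv ((_ , unary _) ∷ u)  = trans (#links-++ (inv u) _) (trans (+-identityʳ _) (#links-inv u))
  #links-inv ((_ , binary _) ∷ u) = trans (#links-++ (inv u) _) (trans (+-comm _ 1) (cong suc (#links-inv u)))

  nthLink-++ˡ : ∀ u v {t} → t < #links u → nthLink (u ++ v) t ≡ nthLink u t
  nthLink-++ˡ ((_ , unary _) ∷ u)  v         t<      = nthLink-++ˡ u v t<
  nthLink-++ˡ ((_ , binary _) ∷ u) v {zero}  t<      = refl
  nthLink-++ˡ ((_ , binary _) ∷ u) v {suc t} (s≤s t<) = nthLink-++ˡ u v t<

  nthLink-++ʳ : ∀ u v t → nthLink (u ++ v) (#links u + t) ≡ nthLink v t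
  nthLink-++ʳ []                  v t = refl
  nthLink-++ʳ ((_ , unary _) ∷ u)  v t = nthLink-++ʳ u v t
  nthLink-++ʳ ((_ , binary _) ∷ u) v t = nthLink-++ʳ u v t

  nthLink-inv : ∀ u {s t σ φ} → suc (s + t) ≡ #links u → nthLink u t ≡ just (σ , φ) → nthLink (inv u) s ≡ just (not σ , φ)
  nthLink-inv ((_ , unary _) ∷ u) {s} {t} eq nth =
    trans (nthLink-++ˡ (inv u) _ (subst (s <_) (trans eq (sym (#links-inv u))) (s≤s (m≤m+n s t)))) (nthLink-inv u eq nth)
  nthLink-inv ((σ , binary φ) ∷ u) {s} {zero} eq refl =
    trans (cong (nthLink (inv u ++ _)) (trans (sym (+-identityʳ s))
      (trans (ℕ.suc-injective eq) (trans (sym (#links-inv u)) (sym (+-identityʳ _))))))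
      (nthLink-++ʳ (inv u) _ 0)
  nthLink-inv ((_ , binary _) ∷ u) {s} {suc t} eq nth =
    let eq′ = trans (sym (+-suc s t)) (ℕ.suc-injective eq) in
    trans (nthLink-++ˡ (inv u) _ (subst (s <_) (trans eq′ (sym (#links-inv u))) (s≤s (m≤m+n s t)))) (nthLink-inv u eq′ nth)

  ∈legsOf-++ˡ : ∀ u v t {ψ} → ψ ∈ legsOf u t → ψ ∈ legsOf (u ++ v) t
  ∈legsOf-++ˡ ((_ , unary _) ∷ u)  v zero    (here eq)  = here eq
  ∈legsOf-++ˡ ((_ , unary _) ∷ u)  v zero    (there i)  = there (∈legsOf-++ˡ u v zero i)
  ∈legsOf-++ˡ ((_ , unary _) ∷ u)  v (suc t) i          = ∈legsOf-++ˡ u v (suc t) i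
  ∈legsOf-++ˡ ((_ , binary _) ∷ u) v (suc t) i          = ∈legsOf-++ˡ u v t i

  ∈legsOf-++ʳ : ∀ u v t {ψ} → ψ ∈ legsOf v t → ψ ∈ legsOf (u ++ v) (#links u + t)
  ∈legsOf-++ʳ []                  v t i = i
  ∈legsOf-++ʳ ((_ , unary _) ∷ u)  v t i = ∈legsOf-leg (u ++ v) (#links u + t) (∈legsOf-++ʳ u v t i)
    where
    ∈legsOf-leg : ∀ w t {σ ψ ψ′} → ψ ∈ legsOf w t → ψ ∈ legsOf ((σ , unary ψ′) ∷ w) t
    ∈legsOf-leg w zero    i = there i
    ∈legsOf-leg w (suc t) i = i
  ∈legsOf-++ʳ ((_ , binary _) ∷ u) v t i = ∈legsOf-++ʳ u v t i

  ∈legsOf-++⁻ : ∀ u v t {ψ} → ψ ∈ legsOf (u ++ v) t →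
                (ψ ∈ legsOf u t × t ≤ #links u) ⊎ ∃[ s ] t ≡ #links u + s × ψ ∈ legsOf v s
  ∈legsOf-++⁻ []                  v t       i         = inj₂ (t , refl , i)
  ∈legsOf-++⁻ ((_ , unary _) ∷ u)  v zero    (here eq) = inj₁ (here eq , z≤n)
  ∈legsOf-++⁻ ((_ , unary _) ∷ u)  v zero    (there i) with ∈legsOf-++⁻ u v zero i
  ... | inj₁ (i′ , le) = inj₁ (there i′ , le)
  ... | inj₂ r         = inj₂ r
  ∈legsOf-++⁻ ((_ , unary _) ∷ u)  v (suc t) i         = ∈legsOf-++⁻ u v (suc t) i
  ∈legsOf-++⁻ ((_ , binary _) ∷ u) v (suc t) i         with ∈legsOf-++⁻ u v t i
  ... | inj₁ (i′ , le)     = inj₁ (i′ , s≤s le)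
  ... | inj₂ (s , eq , i′) = inj₂ (s , cong suc eq , i′)

  ∈legsOf-inv : ∀ u {s t ψ} → s + t ≡ #links u → ψ ∈ legsOf u t → ψ ∈ legsOf (inv u) s
  ∈legsOf-inv ((_ , unary ψ) ∷ u) {s} {zero} eq (here refl) =
    subst (λ s → ψ ∈ legsOf (inv u ++ _) s) (trans (+-identityʳ _) (trans (#links-inv u) (trans (sym eq) (+-identityʳ s))))
      (∈legsOf-++ʳ (inv u) _ 0 (here refl))
  ∈legsOf-inv ((_ , unary _) ∷ u) {s} {zero}  eq (there i) = ∈legsOf-++ˡ (inv u) _ s (∈legsOf-inv u eq i)
  ∈legsOf-inv ((_ , unary _) ∷ u) {s} {suc t} eq i         = ∈legsOf-++ˡ (inv u) _ s (∈legsOf-inv u eq i)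
  ∈legsOf-inv ((_ , binary _) ∷ u) {s} {suc t} eq i =
    ∈legsOf-++ˡ (inv u) _ s (∈legsOf-inv u (ℕ.suc-injective (trans (sym (+-suc s t)) eq)) i)

  module Traces (em : EM) (𝔸 : Structure τ) where

    open Semantics em (sem 𝔸) public

    Step-orient : ∀ σ φ {x y} → Step (σ , binary φ) x y → LinkRel 𝔸 (orient σ φ) x y
    Step-orient true  φ s = s
    Step-orient false φ s = LinkRel-flip 𝔸 (flip φ) s

    -- A path given by its values at the joints, letters being addressed by the number of links
    -- before them. Values beyond the end of the word are arbitrary.
    Trace : Word → (ℕ → Carrier 𝔸) → Set
    Trace w f = (∀ t {σ φ} → nthLink w t ≡ just (σ , φ) → LinkRel 𝔸 (orient σ φ) (f t) (f (suc t))) ×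
                (∀ t {ψ} → ψ ∈ legsOf w t → LegRel 𝔸 ψ (f t))

    private
      cons : Carrier 𝔸 → (ℕ → Carrier 𝔸) → ℕ → Carrier 𝔸
      cons b f zero    = b
      cons b f (suc t) = f t

      leg-eq : ∀ σ {ψ x y} → Step (σ , unary ψ) x y → x ≡ y × LegRel 𝔸 ψ x
      leg-eq true  s          = s
      leg-eq false (refl , r) = refl , r

    Path⇒Trace : ∀ w {b c} → Path w b c → ∃[ f ] Trace w f × f 0 ≡ b × f (#links w) ≡ c
    Path⇒Trace [] {b} refl = (λ _ → b) , ((λ _ ()) , (λ _ ())) , refl , refl
    Path⇒Trace ((σ , unary ψ) ∷ w) (d , s , p) with leg-eq σ s | Path⇒Trace w p
    ... | refl , r | f , (links , legs) , refl , eq =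
      f , (links , λ { zero (here refl) → r ; zero (there i) → legs zero i ; (suc t) i → legs (suc t) i }) , refl , eq
    Path⇒Trace ((σ , binary φ) ∷ w) {b} (d , s , p) with Path⇒Trace w p
    ... | f , (links , legs) , refl , eq =
      cons b f , ((λ { zero refl → Step-orient σ φ s ; (suc t) e → links t e }) ,
                  λ { (suc t) i → legs t i }) , refl , eq

  -- For legs only an inclusion is required: an unfolding has no legs where its spine turns, whereas
  -- the expanded word may have letters there. The inclusion is what turns traces of the word into
  -- homomorphisms.
  record Spells (C : Caterpillar τ) (w : Word) : Set where
    open Caterpillar C
    field
      length≡ : #links w ≡ len
      links≡  : ∀ k → ∃₂ λ σ φ → nthLink w (toℕ k) ≡ just (σ , φ) × link k ≡ orient σ φ
      legs⊆   : ∀ t {ψ} → ψ ∈ legs t → ψ ∈ legsOf w (toℕ t)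

  module _ (C : Caterpillar τ) where

    open Caterpillar C

    hom-caterpillar : ∀ 𝔸 (f : Joint C → Carrier 𝔸) →
      (∀ k → LinkRel 𝔸 (link k) (f (inject₁ k)) (f (suc k))) →
      (∀ t {ψ} → ψ ∈ legs t → LegRel 𝔸 ψ (f t)) → ⟦ C ⟧ ⟶ 𝔸
    hom-caterpillar 𝔸 f links legs⊨ = proj₁ (Database.hom-from (conjuncts C) 𝔸 f λ
      { (inj₁ k)       → satisfied-link 𝔸 (link k) f (links k)
      ; (inj₂ (t , l)) → satisfied-leg 𝔸 (List.lookup (legs t) l) f (legs⊨ t (Mem.∈-lookup l)) })

    hom-link : ∀ 𝔸 (g : ⟦ C ⟧ ⟶ 𝔸) k → LinkRel 𝔸 (link k) (proj₁ g (inj₁ (inject₁ k))) (proj₁ g (inj₁ (suc k)))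
    hom-link 𝔸 g k = link-satisfied 𝔸 (link k) _ (Database.hom-satisfies (conjuncts C) 𝔸 g (inj₁ k))

    hom-leg : ∀ 𝔸 (g : ⟦ C ⟧ ⟶ 𝔸) t {ψ} → ψ ∈ legs t → LegRel 𝔸 ψ (proj₁ g (inj₁ t))
    hom-leg 𝔸 g t i with Any.index i | Any.lookup-index i
    ... | l | refl = leg-satisfied 𝔸 (List.lookup (legs t) l) _ (Database.hom-satisfies (conjuncts C) 𝔸 g (inj₂ (t , l)))

  module _ (em : EM) (𝔸 : Structure τ) where

    open Traces em 𝔸

    spelled-hom : ∀ {C w} → Spells C w → ∀ {f} → Trace w f → ⟦ C ⟧ ⟶ 𝔸
    spelled-hom {C} sp {f} (links , legs) = hom-caterpillar C 𝔸 (f ∘ toℕ)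
      (λ k → let σ , φ , nth , eq = Spells.links≡ sp k in
        subst₂ (λ λᵏ t → LinkRel 𝔸 λᵏ (f t) (f (suc (toℕ k)))) (sym eq) (sym (toℕ-inject₁ k)) (links (toℕ k) nth))
      (λ t i → legs (toℕ t) (Spells.legs⊆ sp t i))

  legWord : List (Leg τ) → Word
  legWord = List.map (λ ψ → true , unary ψ)

  wordOf : ∀ m → (Fin m → Link τ) → (Fin (suc m) → List (Leg τ)) → Word
  wordOf zero    links legs = legWord (legs zero)
  wordOf (suc m) links legs = legWord (legs zero) ++ (true , binary (links zero)) ∷ wordOf m (links ∘ suc) (legs ∘ suc)

  word : Caterpillar τ → Word
  word C = wordOf len link legs
    where open Caterpillar C

  #links-legs : ∀ ψs w → #links (legWord ψs ++ w) ≡ #links w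
  #links-legs []       w = refl
  #links-legs (ψ ∷ ψs) w = #links-legs ψs w

  nthLink-legs : ∀ ψs w t → nthLink (legWord ψs ++ w) t ≡ nthLink w t
  nthLink-legs []       w t = refl
  nthLink-legs (ψ ∷ ψs) w t = nthLink-legs ψs w t

  legsOf-legs-zero : ∀ ψs w → legsOf (legWord ψs ++ w) 0 ≡ ψs ++ legsOf w 0
  legsOf-legs-zero []       w = refl
  legsOf-legs-zero (ψ ∷ ψs) w = cong (ψ ∷_) (legsOf-legs-zero ψs w)

  legsOf-legs-suc : ∀ ψs w t → legsOf (legWord ψs ++ w) (suc t) ≡ legsOf w (suc t)
  legsOf-legs-suc []       w t = refl
  legsOf-legs-suc (ψ ∷ ψs) w t = legsOf-legs-suc ψs w t

  private
    legWord-[] : ∀ ψs → legWord ψs ≡ legWord ψs ++ []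
    legWord-[] ψs = sym (++-identityʳ _)

  #links-wordOf : ∀ m links legs → #links (wordOf m links legs) ≡ m
  #links-wordOf zero    links legs = trans (cong #links (legWord-[] (legs zero))) (#links-legs (legs zero) [])
  #links-wordOf (suc m) links legs = trans (#links-legs (legs zero) _) (cong suc (#links-wordOf m _ _))

  nthLink-wordOf : ∀ m links legs k → nthLink (wordOf m links legs) (toℕ k) ≡ just (true , links k)
  nthLink-wordOf (suc m) links legs zero    = nthLink-legs (legs zero) _ 0
  nthLink-wordOf (suc m) links legs (suc k) = trans (nthLink-legs (legs zero) _ _) (nthLink-wordOf m _ _ k)

  legsOf-wordOf : ∀ m links legs t → legsOf (wordOf m links legs) (toℕ t) ≡ legs t
  legsOf-wordOf zero    links legs zero = trans (cong (λ w → legsOf w 0) (legWord-[] (legs zero)))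
    (trans (legsOf-legs-zero (legs zero) []) (++-identityʳ _))
  legsOf-wordOf (suc m) links legs zero    = trans (legsOf-legs-zero (legs zero) _) (++-identityʳ _)
  legsOf-wordOf (suc m) links legs (suc t) = trans (legsOf-legs-suc (legs zero) _ _) (legsOf-wordOf m _ _ t)

  spells-word : ∀ C → Spells C (word C)
  spells-word C = record
    { length≡ = #links-wordOf len link legs
    ; links≡  = λ k → true , link k , nthLink-wordOf len link legs k , refl
    ; legs⊆   = λ t i → subst (_ ∈_) (sym (legsOf-wordOf len link legs t)) i
    }
    where open Caterpillar C

  module _ (em : EM) (𝔸 : Structure τ) where

    open Traces em 𝔸

    Path-legs : ∀ ψs {w b c} → (∀ {ψ} → ψ ∈ ψs → LegRel 𝔸 ψ b) → Path w b c → Path (legWord ψs ++ w) b c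
    Path-legs []       legs p = p
    Path-legs (ψ ∷ ψs) legs p = _ , (refl , legs (here refl)) , Path-legs ψs (legs ∘ there) p

    wordOf-Path : ∀ m links legs (f : Fin (suc m) → Carrier 𝔸) →
      (∀ k → LinkRel 𝔸 (links k) (f (inject₁ k)) (f (suc k))) → (∀ t {ψ} → ψ ∈ legs t → LegRel 𝔸 ψ (f t)) →
      Path (wordOf m links legs) (f zero) (f (fromℕ m))
    wordOf-Path zero    links legs f L ψs =
      subst (λ w → Path w _ _) (sym (legWord-[] (legs zero))) (Path-legs (legs zero) (ψs zero) refl)
    wordOf-Path (suc m) links legs f L ψs = Path-legs (legs zero) (ψs zero)
      (_ , L zero , wordOf-Path m (links ∘ suc) (legs ∘ suc) (f ∘ suc) (L ∘ suc) (λ t → ψs (suc t)))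

    hom-Path : ∀ C (g : ⟦ C ⟧ ⟶ 𝔸) →
               Path (word C) (proj₁ g (inj₁ zero)) (proj₁ g (inj₁ (fromℕ (Caterpillar.len C))))
    hom-Path C g = wordOf-Path _ _ _ (proj₁ g ∘ inj₁) (hom-link C 𝔸 g) (λ t → hom-leg C 𝔸 g t)

  linkOf : ∀ w → Fin (#links w) → Link τ
  linkOf ((_ , unary _) ∷ w)  k       = linkOf w k
  linkOf ((σ , binary φ) ∷ w) zero    = orient σ φ
  linkOf ((_ , binary _) ∷ w) (suc k) = linkOf w k

  linkOf-nthLink : ∀ w k → ∃₂ λ σ φ → nthLink w (toℕ k) ≡ just (σ , φ) × linkOf w k ≡ orient σ φ
  linkOf-nthLink ((_ , unary _) ∷ w)  k       = linkOf-nthLink w k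
  linkOf-nthLink ((σ , binary φ) ∷ w) zero    = σ , φ , refl , refl
  linkOf-nthLink ((_ , binary _) ∷ w) (suc k) = linkOf-nthLink w k

  padded : Leg τ → Leg τ → Word → Word
  padded ψ ψ′ w = (true , unary ψ) ∷ w ++ (true , unary ψ′) ∷ []

  -- A caterpillar with a spine needs legs at both ends. The added legs also record in which sets a
  -- path starts and ends.
  caterpillar : Leg τ → Leg τ → Word → Caterpillar τ
  caterpillar ψ ψ′ w = record
    { len  = #links w′
    ; link = linkOf w′
    ; legs = legsOf w′ ∘ toℕ
    ; ends = inj₂ ((λ ()) , λ eq → case subst (ψ′ ∈_) eq last of λ ())
    }
    where
    w′ = padded ψ ψ′ w
    last : ψ′ ∈ legsOf w′ (toℕ (fromℕ (#links w′)))
    last = subst (λ t → ψ′ ∈ legsOf w′ t)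
      (trans (+-identityʳ _) (trans (sym (trans (#links-++ w _) (+-identityʳ _))) (sym (toℕ-fromℕ (#links w′)))))
      (∈legsOf-++ʳ ((true , unary ψ) ∷ w) _ 0 (here refl))

  spells-caterpillar : ∀ ψ ψ′ w → Spells (caterpillar ψ ψ′ w) (padded ψ ψ′ w)
  spells-caterpillar ψ ψ′ w = record
    { length≡ = refl
    ; links≡  = linkOf-nthLink (padded ψ ψ′ w)
    ; legs⊆   = λ t i → i
    }

  module _ (em : EM) where

    caterpillar-finite : ∀ C → Finite (Carrier (⟦_⟧ {τ} C))
    caterpillar-finite C = listable⇒finite em (Database.listable-database (conjuncts C) (listable-Fin _)
      (listable-⊎ (listable-Fin _) (listable-Σ (listable-Fin _) λ _ → listable-Fin _)))

-- The unfolding as a caterpillar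

module Unfolded {τ : Signature} (C : Caterpillar τ) (i j : Joint C) (i<j : i Fin.< j) where

  open Caterpillar C
  open Unfold C i j i<j public

  α β : ℕ
  α = toℕ i
  β = toℕ j

  -- The stretch from `i` to `j` occupies the positions `α` to `β`, its backward copy those from `β`
  -- to `β + δ`, and in the last copy and everything after it the positions have moved by `shift`.
  δ : ℕ
  δ = β ∸ α

  shift : ℕ
  shift = δ + δ

  i+δ≡j : α + δ ≡ β
  i+δ≡j = m+[n∸m]≡n (<⇒≤ i<j)

  i+shift≡j+δ : α + shift ≡ β + δ
  i+shift≡j+δ = trans (sym (+-assoc α δ δ)) (cong (_+ δ) i+δ≡j)

  j+j≡i+[j+δ] : β + β ≡ α + (β + δ)
  j+j≡i+[j+δ] = trans (cong (_+ β) (sym i+δ≡j)) (trans (+-assoc α δ β) (cong (α +_) (+-comm δ β)))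

  i≤len : α ≤ len
  i≤len = Fin.toℕ≤pred[n] i

  j≤len : β ≤ len
  j≤len = Fin.toℕ≤pred[n] j

  -- The position on the spine.
  posA′ : ∀ x → Dec (x ≤ α) → Dec (x < β) → ℕ
  posA′ x (yes _) _       = x
  posA′ x (no _)  (yes _) = β + β ∸ x
  posA′ x (no _)  (no _)  = x + shift

  posA : ℕ → ℕ
  posA x = posA′ x (x ≤? α) (x <? β)

  pos : Var → ℕ
  pos (a k)      = posA (toℕ k)
  pos (a′ k _ _) = toℕ k
  pos (a″ k _ _) = toℕ k + shift

  posA-≤ : ∀ {x} → x ≤ α → posA x ≡ x
  posA-≤ {x} le with x ≤? α
  ... | yes _ = refl
  ... | no ¬p = contradiction le ¬p

  posA-mid : ∀ {x} → α < x → x < β → posA x ≡ β + β ∸ x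
  posA-mid {x} gt lt with x ≤? α | x <? β
  ... | yes p | _     = contradiction p (<⇒≱ gt)
  ... | no _  | yes _ = refl
  ... | no _  | no ¬p = contradiction lt ¬p

  posA-≥ : ∀ {x} → β ≤ x → posA x ≡ x + shift
  posA-≥ {x} ge with x ≤? α | x <? β
  ... | yes p | _     = contradiction (<-≤-trans i<j (≤-trans ge p)) (<-irrefl refl)
  ... | no _  | yes p = contradiction ge (<⇒≱ p)
  ... | no _  | no _  = refl

  private
    recompute-≤ : ∀ {m n} → .(m ≤ n) → m ≤ n
    recompute-≤ {m} {n} p = recompute (m ≤? n) p

  pos-seq₁ : ∀ k .p .q → pos (seq₁ k p q) ≡ toℕ k
  pos-seq₁ k p q with i Fin.<? k
  ... | yes _ = refl
  ... | no ¬p = trans (posA-≤ ≤-refl) (≤-antisym (recompute-≤ p) (≮⇒≥ ¬p))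

  -- The backward copy is the reflection of the first one at position `β`; stated as a sum, this
  -- avoids truncated subtraction.
  pos-seq₂ : ∀ k .p .q → pos (seq₂ k p q) + toℕ k ≡ β + β
  pos-seq₂ k p q with i Fin.<? k | k Fin.<? j
  ... | no ¬p  | _      = trans (cong (_+ toℕ k) (trans i+shift≡j+δ refl))
    (trans (+-comm (β + δ) (toℕ k)) (trans (cong (_+ (β + δ)) (≤-antisym (≮⇒≥ ¬p) (recompute-≤ p))) (sym j+j≡i+[j+δ])))
  ... | yes p′ | yes q′ = trans (cong (_+ toℕ k) (posA-mid p′ q′)) (m∸n+n≡m (≤-trans (<⇒≤ q′) (m≤m+n _ _)))
  ... | yes p′ | no ¬q  = cong (β +_) (≤-antisym (recompute-≤ q) (≮⇒≥ ¬q))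

  pos-seq₃ : ∀ k .p .q → pos (seq₃ k p q) ≡ toℕ k + shift
  pos-seq₃ k p q with k Fin.<? j
  ... | yes _ = refl
  ... | no ¬q = trans (posA-≥ ≤-refl) (cong (_+ shift) (≤-antisym (≮⇒≥ ¬q) (recompute-≤ q)))

  private
    at : ∀ x → .(x < suc len) → Joint C
    at x p = fromℕ< p

    at-≡ : ∀ {x} .(p : x < suc len) {k} → toℕ k ≡ x → at x p ≡ k
    at-≡ p refl = Fin.fromℕ<-toℕ _ p

    toℕ-at : ∀ {x} .(p : x < suc len) → toℕ (at x p) ≡ x
    toℕ-at p = toℕ-fromℕ< p

    ≥at : ∀ {x y} .(p : x < suc len) → y ≤ x → y ≤ toℕ (at x p)
    ≥at p le = subst (_ ≤_) (sym (toℕ-at p)) le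

    ≤at : ∀ {x y} .(p : x < suc len) → x ≤ y → toℕ (at x p) ≤ y
    ≤at p le = subst (_≤ _) (sym (toℕ-at p)) le

    <at : ∀ {x y} .(p : x < suc len) → x < y → toℕ (at x p) < y
    <at p lt = subst (_< _) (sym (toℕ-at p)) lt

  middle-< : ∀ {t k m n} → t + k ≡ m + n → t ≤ m → n ≤ k
  middle-< {t} {k} {m} {n} eq le = ℕ.+-cancelˡ-≤ t n k (≤-trans (+-monoˡ-≤ n le) (≤-reflexive (sym eq)))

  mirror : ∀ {t} → t ≤ β + δ → t + (β + β ∸ t) ≡ β + β
  mirror le = m+[n∸m]≡n (≤-trans le (subst (β + δ ≤_) (sym j+j≡i+[j+δ]) (m≤n+m (β + δ) α)))

  sum-<ʳ : ∀ {t k m n} → t + k ≡ m + n → m < t → k < n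
  sum-<ʳ {t} {k} {m} {n} eq lt = ≰⇒> λ le → <-irrefl (sym eq) (ℕ.+-mono-<-≤ lt le)

  sum-≤ʳ : ∀ {t k m n} → t + k ≡ m + n → m ≤ t → k ≤ n
  sum-≤ʳ {t} {k} {m} {n} eq le = ≮⇒≥ λ lt → <-irrefl (sym eq) (ℕ.+-mono-≤-< le lt)

  j+j≡[j+δ]+i : β + β ≡ (β + δ) + α
  j+j≡[j+δ]+i = trans j+j≡i+[j+δ] (+-comm α _)

  mirror-< : ∀ {t} → β < t → t ≤ β + δ → β + β ∸ t < β
  mirror-< gt le = sum-<ʳ (mirror le) gt

  mirror-> : ∀ {t} → t < β + δ → α < β + β ∸ t
  mirror-> lt = sum-<ʳ {m = _} (sym (trans (mirror (<⇒≤ lt)) j+j≡[j+δ]+i)) lt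

  mirror-≥ : ∀ {t} → t ≤ β + δ → α ≤ β + β ∸ t
  mirror-≥ le = sum-≤ʳ (sym (trans (mirror le) j+j≡[j+δ]+i)) le

  shift≤ : ∀ {t} → β + δ ≤ t → shift ≤ t
  shift≤ le = ≤-trans (m≤n+m shift α) (≤-trans (≤-reflexive i+shift≡j+δ) le)

  unshift : ∀ {t} → β + δ ≤ t → (t ∸ shift) + shift ≡ t
  unshift le = m∸n+n≡m (shift≤ le)

  i≤unshift : ∀ {t} → β + δ ≤ t → α ≤ t ∸ shift
  i≤unshift le = +-cancelʳ-≤ shift _ _ (≤-trans (≤-reflexive i+shift≡j+δ) (≤-trans le (≤-reflexive (sym (unshift le)))))

  unshift-< : ∀ {t n} → β + δ ≤ t → t < n + shift → t ∸ shift < n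
  unshift-< le lt = ℕ.+-cancelʳ-< shift _ _ (subst (_< _) (sym (unshift le)) lt)

  unshift-≥ : ∀ {t n} → β + δ ≤ t → n + shift ≤ t → n ≤ t ∸ shift
  unshift-≥ le ge = +-cancelʳ-≤ shift _ _ (≤-trans ge (≤-reflexive (sym (unshift le))))

  j+δ≤j+shift : β + δ ≤ β + shift
  j+δ≤j+shift = +-monoʳ-≤ β (m≤m+n δ δ)

  -- The five cases are the five lists of which the spine is composed.
  var′ : ∀ t → t < suc len + shift →
         Dec (t ≤ α) → Dec (t ≤ β) → Dec (t < β + δ) → Dec (t < β + shift) → Var
  var′ t t< (yes p) _ _ _ = a (at t (s≤s (≤-trans p i≤len)))
  var′ t t< (no p) (yes q) _ _ =
    let b = s≤s (≤-trans q j≤len) in a′ (at t b) (≥at b (≰⇒> p)) (≤at b q)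
  var′ t t< (no p) (no q) (yes r) _ =
    a (at (β + β ∸ t) (s≤s (≤-trans (<⇒≤ (mirror-< (≰⇒> q) (<⇒≤ r))) j≤len)))
  var′ t t< (no p) (no q) (no r) (yes s) =
    let b = unshift-< (≮⇒≥ r) t< in a″ (at (t ∸ shift) b) (≥at b (i≤unshift (≮⇒≥ r))) (<at b (unshift-< (≮⇒≥ r) s))
  var′ t t< (no p) (no q) (no r) (no s) = a (at (t ∸ shift) (unshift-< (≮⇒≥ r) t<))

  var : ∀ t → t < suc len + shift → Var
  var t t< = var′ t t< (t ≤? α) (t ≤? β) (t <? β + δ) (t <? β + shift)

  pos-var : ∀ t t< → pos (var t t<) ≡ t
  pos-var t t< with t ≤? α | t ≤? β | t <? β + δ | t <? β + shift
  ... | yes p | _     | _     | _     = trans (cong posA (toℕ-at (s≤s (≤-trans p i≤len)))) (posA-≤ p)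
  ... | no p  | yes q | _     | _     = toℕ-at (s≤s (≤-trans q j≤len))
  ... | no p  | no q  | yes r | _     =
    trans (cong posA (toℕ-at (s≤s (≤-trans (<⇒≤ (mirror-< (≰⇒> q) (<⇒≤ r))) j≤len))))
      (trans (posA-mid (mirror-> r) (mirror-< (≰⇒> q) (<⇒≤ r)))
        (ℕ.m∸[m∸n]≡n (≤-trans (<⇒≤ r) (subst (β + δ ≤_) (sym j+j≡i+[j+δ]) (m≤n+m (β + δ) α)))))
  ... | no p  | no q  | no r  | yes s = trans (cong (_+ shift) (toℕ-at (unshift-< (≮⇒≥ r) t<))) (unshift (≮⇒≥ r))
  ... | no p  | no q  | no r  | no s  =
    trans (cong posA (toℕ-at (unshift-< (≮⇒≥ r) t<)))
      (trans (posA-≥ (unshift-≥ (≮⇒≥ r) (≮⇒≥ s))) (unshift (≮⇒≥ r)))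

  private
    a-≡ : ∀ {k k′} → k ≡ k′ → a k ≡ a k′
    a-≡ refl = refl

    a′-≡ : ∀ {k k′} .{p q p′ q′} → k ≡ k′ → a′ k p q ≡ a′ k′ p′ q′
    a′-≡ refl = refl

    a″-≡ : ∀ {k k′} .{p q p′ q′} → k ≡ k′ → a″ k p q ≡ a″ k′ p′ q′
    a″-≡ refl = refl

    var-≤ : ∀ k {t} t< → toℕ k ≡ t → toℕ k ≤ α → var t t< ≡ a k
    var-≤ k {t} t< eq le with t ≤? α
    ... | yes p = a-≡ (at-≡ (s≤s (≤-trans p i≤len)) eq)
    ... | no p  = contradiction (subst (_≤ α) eq le) p

    var-′ : ∀ k .p .q {t} t< → toℕ k ≡ t → α < toℕ k → toℕ k ≤ β → var t t< ≡ a′ k p q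
    var-′ k p q {t} t< refl gt le with t ≤? α | t ≤? β
    ... | yes p′ | _      = contradiction p′ (<⇒≱ gt)
    ... | no _   | yes q′ = a′-≡ (at-≡ (s≤s (≤-trans q′ j≤len)) refl)
    ... | no _   | no q′  = contradiction le q′

    var-mid : ∀ k {t} t< → t + toℕ k ≡ β + β → α < toℕ k → toℕ k < β → var t t< ≡ a k
    var-mid k {t} t< eq gt lt = helper (t ≤? α) (t ≤? β) (t <? β + δ) (t <? β + shift)
      where
      j<t : β < t
      j<t = ≰⇒> λ le → <⇒≱ lt (middle-< {t} {toℕ k} eq le)
      t<j+δ : t < β + δ
      t<j+δ = ≰⇒> λ ge → <⇒≱ gt (sum-≤ʳ (trans eq j+j≡[j+δ]+i) ge)
      helper : ∀ d₁ d₂ d₃ d₄ → var′ t t< d₁ d₂ d₃ d₄ ≡ a k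
      helper (yes p) _ _ _ = contradiction (<-trans i<j (<-≤-trans j<t p)) (<-irrefl refl)
      helper (no _) (yes q) _ _ = contradiction q (<⇒≱ j<t)
      helper (no _) (no _) (no r) _ = contradiction t<j+δ r
      helper (no p) (no q) (yes r) d₄ = a-≡ (at-≡ (s≤s (≤-trans (<⇒≤ (mirror-< (≰⇒> q) (<⇒≤ r))) j≤len))
        (ℕ.+-cancelˡ-≡ t _ _ (trans eq (sym (mirror (<⇒≤ r))))))

    module _ (k : Joint C) {t} (t< : t < suc len + shift) (eq : toℕ k + shift ≡ t) (i≤k : α ≤ toℕ k) where

      j+δ≤t : β + δ ≤ t
      j+δ≤t = subst₂ _≤_ i+shift≡j+δ eq (+-monoˡ-≤ shift i≤k)

      j<t : β < t
      j<t = <-≤-trans (m<m+n β (ℕ.m<n⇒0<n∸m i<j)) j+δ≤t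

      var-late : ∀ {v} → (∀ .b → β ≤ toℕ k → a (at (t ∸ shift) b) ≡ v) →
                 (∀ .b .p .q → toℕ k < β → a″ (at (t ∸ shift) b) p q ≡ v) → var t t< ≡ v
      var-late {v} f g = helper (t ≤? α) (t ≤? β) (t <? β + δ) (t <? β + shift)
        where
        helper : ∀ d₁ d₂ d₃ d₄ → var′ t t< d₁ d₂ d₃ d₄ ≡ v
        helper (yes p) _ _ _ = contradiction (<-trans i<j (<-≤-trans j<t p)) (<-irrefl refl)
        helper (no _) (yes q) _ _ = contradiction q (<⇒≱ j<t)
        helper (no _) (no _) (yes r) _ = contradiction j+δ≤t (<⇒≱ r)
        helper (no p) (no q) (no r) (yes s) = g _ _ _ (ℕ.+-cancelʳ-< shift _ _ (subst (_< _) (sym eq) s))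
        helper (no p) (no q) (no r) (no s) = f _ (+-cancelʳ-≤ shift _ _ (subst (_ ≤_) (sym eq) (≮⇒≥ s)))

      at-late : ∀ .b → at (t ∸ shift) b ≡ k
      at-late b = at-≡ b (+-cancelʳ-≡ shift _ _ (trans eq (sym (unshift j+δ≤t))))

      var-″ : ∀ .p .q → toℕ k < β → var t t< ≡ a″ k p q
      var-″ p q lt = var-late (λ _ ge → contradiction ge (<⇒≱ lt)) (λ b _ _ _ → a″-≡ (at-late b))

      var-≥ : β ≤ toℕ k → var t t< ≡ a k
      var-≥ ge = var-late (λ b _ → a-≡ (at-late b)) (λ _ _ _ lt → contradiction ge (<⇒≱ lt))

  data Place (k : Joint C) : Set where
    early : toℕ k ≤ α → Place k
    mid   : α < toℕ k → toℕ k < β → Place k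
    late  : β ≤ toℕ k → Place k

  place : ∀ k → Place k
  place k with toℕ k ≤? α | toℕ k <? β
  ... | yes p | _     = early p
  ... | no p  | yes q = mid (≰⇒> p) q
  ... | no p  | no q  = late (≮⇒≥ q)

  var-pos : ∀ v t< → var (pos v) t< ≡ v
  var-pos (a k) t< with place k
  ... | early p = var-≤ k t< (sym (posA-≤ p)) p
  ... | mid p q = var-mid k t< (trans (cong (_+ toℕ k) (posA-mid p q)) (m∸n+n≡m (≤-trans (<⇒≤ q) (m≤m+n _ _)))) p q
  ... | late p  = var-≥ k t< (sym (posA-≥ p)) (≤-trans (<⇒≤ i<j) p) p
  var-pos (a′ k p q) t< = var-′ k p q t< refl (recompute-≤ p) (recompute-≤ q)
  var-pos (a″ k p q) t< = var-″ k t< refl (recompute-≤ p) p q (recompute-≤ q)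

  pos-< : ∀ v → pos v < suc len + shift
  pos-< (a k) with place k
  ... | early p = subst (_< _) (sym (posA-≤ p)) (<-≤-trans (toℕ<n k) (m≤m+n _ shift))
  ... | mid p q = subst (_< _) (sym (posA-mid p q)) (≤-<-trans
    (sum-≤ʳ {toℕ k} {_} {α} (trans (trans (+-comm (toℕ k) _) (m∸n+n≡m (≤-trans (<⇒≤ q) (m≤m+n _ _)))) j+j≡i+[j+δ]) (<⇒≤ p))
    (s≤s (+-mono-≤ j≤len (m≤m+n δ δ))))
  ... | late p  = subst (_< _) (sym (posA-≥ p)) (ℕ.+-monoˡ-< shift (toℕ<n k))
  pos-< (a′ k _ _) = <-≤-trans (toℕ<n k) (m≤m+n _ shift)
  pos-< (a″ k _ _) = ℕ.+-monoˡ-< shift (toℕ<n k)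

  pos-injective : ∀ {v w} → pos v ≡ pos w → v ≡ w
  pos-injective {v} {w} eq = trans (sym (var-pos v (pos-< v))) (trans (same eq) (var-pos w (pos-< w)))
    where
    same : ∀ {s t} → s ≡ t → ∀ {s<} {t<} → var s s< ≡ var t t<
    same refl {s<} {t<} rewrite ℕ.≤-irrelevant s< t< = refl

  -- How the e-th vertebra of the unfolding arises from the k-th one, in its
  -- original direction or not.
  data Range (k : ℕ) : ℕ → Bool → Set where
    before : ∀ {e} → k < β → e ≡ k → Range k e true
    within : ∀ {e} → α ≤ k → k < β → suc (e + k) ≡ β + β → Range k e false
    after  : ∀ {e} → α ≤ k → e ≡ k + shift → Range k e true

  edgeOf′ : ∀ x → Dec (x < α) → ℕ
  edgeOf′ x (yes _) = x
  edgeOf′ x (no _)  = x + shift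

  -- The position of a link on the spine; junk for legs.
  edgeOf : Index → ℕ
  edgeOf (link-fixed k _)   = edgeOf′ (toℕ k) (toℕ k <? α)
  edgeOf (link₁ k _ _)      = toℕ k
  edgeOf (link₂ k _ _)      = β + β ∸ suc (toℕ k)
  edgeOf (link₃ k _ _)      = toℕ k + shift
  edgeOf (leg-fixed _ _ _)  = 0
  edgeOf (leg _ _ _ _)      = 0
  edgeOf (leg′ _ _ _ _)     = 0
  edgeOf (leg″ _ _ _ _)     = 0

  edgeOf′-< : ∀ {x} (d : Dec (x < α)) → x < α → edgeOf′ x d ≡ x
  edgeOf′-< (yes _) lt = refl
  edgeOf′-< (no ¬p) lt = contradiction lt ¬p

  edgeOf′-≥ : ∀ {x} (d : Dec (x < α)) → α ≤ x → edgeOf′ x d ≡ x + shift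
  edgeOf′-≥ (yes p) ge = contradiction ge (<⇒≱ p)
  edgeOf′-≥ (no _)  ge = refl

  -- A link of the unfolding found at position `e` of the spine, with the link `k` of `C` it copies.
  -- Its variables `x` and `y` are in the order of the original, which the spine may pass in
  -- reverse.
  record Edge (e : ℕ) : Set where
    field
      index   : Index
      edge≡   : edgeOf index ≡ e
      k       : Fin len
      forward : Bool
      x y     : Var
      conj≡   : conj index ≡ linkAt (link k) x y
      ends    : (forward ≡ true × pos x ≡ e × pos y ≡ suc e) ⊎ (forward ≡ false × pos y ≡ e × pos x ≡ suc e)
      range   : Range (toℕ k) e forward

  fixed-early : ∀ k {e} → toℕ k ≡ e → suc (toℕ k) ≤ α → Edge e
  fixed-early k eq le = record
    { index = link-fixed k (inj₁ (subst (_< α) (sym (toℕ-inject₁ k)) le))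
    ; edge≡ = trans (edgeOf′-< (toℕ k <? α) le) eq
    ; conj≡ = refl
    ; ends  = inj₁ (refl , trans (cong posA (toℕ-inject₁ k)) (trans (posA-≤ (<⇒≤ le)) eq) , trans (posA-≤ le) (cong suc eq))
    ; range = before (<-trans le i<j) (sym eq)
    }

  edge₁ : ∀ k {e} → toℕ k ≡ e → α ≤ toℕ k → toℕ k < β → Edge e
  edge₁ k eq ge lt = record
    { index = link₁ k (subst (α ≤_) (sym (toℕ-inject₁ k)) ge) lt
    ; edge≡ = eq
    ; conj≡ = refl
    ; ends  = inj₁ (refl , trans (pos-seq₁ (inject₁ k) _ _) (trans (toℕ-inject₁ k) eq) , trans (pos-seq₁ (suc k) _ _) (cong suc eq))
    ; range = before lt (sym eq)
    }

  edge₂ : ∀ k {e} → α ≤ toℕ k → toℕ k < β → suc (e + toℕ k) ≡ β + β → Edge e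
  edge₂ k {e} ge lt eq = record
    { index = link₂ k i≤k lt
    ; edge≡ = trans (cong (_∸ suc (toℕ k)) (trans (sym eq) (sym (+-suc e (toℕ k))))) (m+n∸n≡m e (suc (toℕ k)))
    ; conj≡ = refl
    ; ends  = inj₂ (refl ,
        +-cancelʳ-≡ (suc (toℕ k)) _ _ (trans (pos-seq₂ (suc k) _ _) (trans (sym eq) (sym (+-suc e (toℕ k))))) ,
        +-cancelʳ-≡ (toℕ k) _ _ (trans (cong (pos (seq₂ (inject₁ k) i≤k k≤j) +_) (sym (toℕ-inject₁ k))) (trans (pos-seq₂ (inject₁ k) i≤k k≤j) (sym eq))))
    ; range = within ge lt eq
    }
    where
    i≤k : i Fin.≤ inject₁ k
    i≤k = subst (α ≤_) (sym (toℕ-inject₁ k)) ge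
    k≤j : inject₁ k Fin.≤ j
    k≤j = subst (_≤ β) (sym (toℕ-inject₁ k)) (<⇒≤ lt)

  edge₃ : ∀ k {e} → toℕ k + shift ≡ e → α ≤ toℕ k → toℕ k < β → Edge e
  edge₃ k eq ge lt = record
    { index = link₃ k (subst (α ≤_) (sym (toℕ-inject₁ k)) ge) lt
    ; edge≡ = eq
    ; conj≡ = refl
    ; ends  = inj₁ (refl , trans (pos-seq₃ (inject₁ k) _ _) (trans (cong (_+ shift) (toℕ-inject₁ k)) eq) ,
                           trans (pos-seq₃ (suc k) _ _) (cong suc eq))
    ; range = after ge (sym eq)
    }

  fixed-late : ∀ k {e} → toℕ k + shift ≡ e → β ≤ toℕ k → Edge e
  fixed-late k eq ge = record
    { index = link-fixed k (inj₂ (subst (β ≤_) (sym (toℕ-inject₁ k)) ge))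
    ; edge≡ = trans (edgeOf′-≥ (toℕ k <? α) (≤-trans (<⇒≤ i<j) ge)) eq
    ; conj≡ = refl
    ; ends  = inj₁ (refl , trans (cong posA (toℕ-inject₁ k)) (trans (posA-≥ ge) eq) ,
                           trans (posA-≥ (m≤n⇒m≤1+n ge)) (cong suc eq))
    ; range = after (≤-trans (<⇒≤ i<j) ge) (sym eq)
    }

  private
    atᵉ : ∀ {e} → e < len → Fin len
    atᵉ p = fromℕ< p

    toℕ-atᵉ : ∀ {e} (p : e < len) → toℕ (atᵉ p) ≡ e
    toℕ-atᵉ p = toℕ-fromℕ< p

  edge′ : ∀ e → e < len + shift → Dec (e < α) → Dec (e < β) → Dec (e < β + δ) → Dec (e < β + shift) → Edge e
  edge′ e e< (yes p) _ _ _ =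
    let b = <-≤-trans p i≤len in fixed-early (atᵉ b) (toℕ-atᵉ b) (subst (_< α) (sym (toℕ-atᵉ b)) p)
  edge′ e e< (no p) (yes q) _ _ =
    let b = <-≤-trans q j≤len in
    edge₁ (atᵉ b) (toℕ-atᵉ b) (subst (α ≤_) (sym (toℕ-atᵉ b)) (≮⇒≥ p)) (subst (_< β) (sym (toℕ-atᵉ b)) q)
  edge′ e e< (no p) (no q) (yes r) _ =
    let lt = mirror-< (s≤s (≮⇒≥ q)) r
        b  = <-≤-trans lt j≤len
    in edge₂ (atᵉ b) (subst (α ≤_) (sym (toℕ-atᵉ b)) (mirror-≥ r)) (subst (_< β) (sym (toℕ-atᵉ b)) lt)
         (trans (cong (λ k → suc (e + k)) (toℕ-atᵉ b)) (mirror r))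
  edge′ e e< (no p) (no q) (no r) (yes s) =
    let b = unshift-< (≮⇒≥ r) e< in
    edge₃ (atᵉ b) (trans (cong (_+ shift) (toℕ-atᵉ b)) (unshift (≮⇒≥ r)))
      (subst (α ≤_) (sym (toℕ-atᵉ b)) (i≤unshift (≮⇒≥ r))) (subst (_< β) (sym (toℕ-atᵉ b)) (unshift-< (≮⇒≥ r) s))
  edge′ e e< (no p) (no q) (no r) (no s) =
    let b = unshift-< (≮⇒≥ r) e< in
    fixed-late (atᵉ b) (trans (cong (_+ shift) (toℕ-atᵉ b)) (unshift (≮⇒≥ r)))
      (subst (β ≤_) (sym (toℕ-atᵉ b)) (unshift-≥ (≮⇒≥ r) (≮⇒≥ s)))

  edge : ∀ e → e < len + shift → Edge e
  edge e e< = edge′ e e< (e <? α) (e <? β) (e <? β + δ) (e <? β + shift)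

  private
    link-fixed-≡ : ∀ {k k′} .{p p′} → k ≡ k′ → link-fixed k p ≡ link-fixed k′ p′
    link-fixed-≡ refl = refl

    link₁-≡ : ∀ {k k′} .{p q p′ q′} → k ≡ k′ → link₁ k p q ≡ link₁ k′ p′ q′
    link₁-≡ refl = refl

    link₂-≡ : ∀ {k k′} .{p q p′ q′} → k ≡ k′ → link₂ k p q ≡ link₂ k′ p′ q′
    link₂-≡ refl = refl

    link₃-≡ : ∀ {k k′} .{p q p′ q′} → k ≡ k′ → link₃ k p q ≡ link₃ k′ p′ q′
    link₃-≡ refl = refl

    atᵉ-≡ : ∀ {e k} (b : e < len) → toℕ k ≡ e → atᵉ b ≡ k
    atᵉ-≡ b eq = toℕ-injective (trans (toℕ-atᵉ b) (sym eq))

    j<j+δ : β < β + δ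
    j<j+δ = m<m+n β (ℕ.m<n⇒0<n∸m i<j)


  -- This and its companions below locate every link conjunct on the spine, as needed for the
  -- surjectivity of the enumeration of conjuncts.
  edge-fixed-early : ∀ k .p → toℕ k < α → ∀ e< → Edge.index (edge (toℕ k) e<) ≡ link-fixed k p
  edge-fixed-early k p lt e< with toℕ k <? α
  ... | yes q = link-fixed-≡ (atᵉ-≡ (<-≤-trans q i≤len) refl)
  ... | no ¬q = contradiction lt ¬q

  edge-link₁ : ∀ k .p .q → α ≤ toℕ k → toℕ k < β → ∀ e< → Edge.index (edge (toℕ k) e<) ≡ link₁ k p q
  edge-link₁ k p q ge lt e< with toℕ k <? α | toℕ k <? β
  ... | yes r | _     = contradiction ge (<⇒≱ r)
  ... | no _  | yes r = link₁-≡ (atᵉ-≡ (<-≤-trans r j≤len) refl)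
  ... | no _  | no r  = contradiction lt r

  edge-link₂ : ∀ k .p .q {e} → α ≤ toℕ k → toℕ k < β → suc e + toℕ k ≡ β + β →
               ∀ e< → Edge.index (edge e e<) ≡ link₂ k p q
  edge-link₂ k p q {e} ge lt eq e< = helper (e <? α) (e <? β) (e <? β + δ) (e <? β + shift)
    where
    j≤e : β ≤ e
    j≤e = ≮⇒≥ λ e<j → <⇒≱ lt (middle-< {suc e} eq e<j)
    e<j+δ : suc e ≤ β + δ
    e<j+δ = ≮⇒≥ λ lt′ → <⇒≱ (sum-<ʳ (trans eq j+j≡[j+δ]+i) lt′) ge
    helper : ∀ d₁ d₂ d₃ d₄ → Edge.index (edge′ e e< d₁ d₂ d₃ d₄) ≡ link₂ k p q
    helper (yes p) _ _ _ = contradiction (<-≤-trans (<-trans p i<j) j≤e) (<-irrefl refl)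
    helper (no _) (yes q) _ _ = contradiction j≤e (<⇒≱ q)
    helper (no _) (no _) (no r) _ = contradiction e<j+δ r
    helper (no _) (no q) (yes r) _ = link₂-≡ (atᵉ-≡ (<-≤-trans (mirror-< (s≤s (≮⇒≥ q)) r) j≤len) (ℕ.+-cancelˡ-≡ (suc e) _ _ (trans eq (sym (mirror r)))))

  module _ (k : Fin len) (ge : α ≤ toℕ k) (e< : toℕ k + shift < len + shift) where

    private
      j+δ≤e : β + δ ≤ toℕ k + shift
      j+δ≤e = ≤-trans (≤-reflexive (sym i+shift≡j+δ)) (+-monoˡ-≤ shift ge)

      at-k : ∀ b → atᵉ {toℕ k + shift ∸ shift} b ≡ k
      at-k b = atᵉ-≡ b (sym (m+n∸n≡m (toℕ k) shift))

      split : ∀ {c} → (∀ b .(p : i Fin.≤ inject₁ (atᵉ {toℕ k + shift ∸ shift} b)) .(q : suc (atᵉ b) Fin.≤ j) → toℕ k < β → link₃ (atᵉ b) p q ≡ c) →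
              (∀ b .(p : inject₁ (atᵉ {toℕ k + shift ∸ shift} b) Fin.< i ⊎ j Fin.≤ inject₁ (atᵉ b)) → β ≤ toℕ k → link-fixed (atᵉ b) p ≡ c) →
              Edge.index (edge (toℕ k + shift) e<) ≡ c
      split {c} f g = helper (toℕ k + shift <? α) (toℕ k + shift <? β) (toℕ k + shift <? β + δ) (toℕ k + shift <? β + shift)
        where
        helper : ∀ d₁ d₂ d₃ d₄ → Edge.index (edge′ (toℕ k + shift) e< d₁ d₂ d₃ d₄) ≡ c
        helper (yes p) _ _ _ = contradiction (<-≤-trans (<-trans p (<-trans i<j j<j+δ)) j+δ≤e) (<-irrefl refl)
        helper (no _) (yes q) _ _ = contradiction (<-≤-trans (<-trans q j<j+δ) j+δ≤e) (<-irrefl refl)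
        helper (no _) (no _) (yes r) _ = contradiction j+δ≤e (<⇒≱ r)
        helper (no _) (no _) (no r) (yes s) = f (unshift-< (≮⇒≥ r) e<) _ _ (ℕ.+-cancelʳ-< shift _ _ s)
        helper (no _) (no _) (no r) (no s) = g (unshift-< (≮⇒≥ r) e<) _ (+-cancelʳ-≤ shift _ _ (≮⇒≥ s))

    edge-link₃ : ∀ .p .q → toℕ k < β → Edge.index (edge (toℕ k + shift) e<) ≡ link₃ k p q
    edge-link₃ p q lt = split (λ b _ _ _ → link₃-≡ (at-k b)) (λ _ _ ge → contradiction lt (≤⇒≯ ge))

    edge-fixed-late : ∀ .p → β ≤ toℕ k → Edge.index (edge (toℕ k + shift) e<) ≡ link-fixed k p
    edge-fixed-late p ge = split (λ _ _ _ lt → contradiction lt (≤⇒≯ ge)) (λ b _ _ → link-fixed-≡ (at-k b))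

  legsIf : Bool → List (Leg τ) → List (Leg τ)
  legsIf true  ψs = ψs
  legsIf false ψs = []

  -- The legs at a variable of the spine; there are none where it turns.
  legsAt : Var → List (Leg τ)
  legsAt (a k)      = legs k
  legsAt (a′ k _ _) = legsIf ⌊ k Fin.<? j ⌋ (legs k)
  legsAt (a″ k _ _) = legsIf ⌊ i Fin.<? k ⌋ (legs k)

module _ {τ : Signature} {J J′ : Set} (β : J′ → J) where

  mapConjunct-link : ∀ (φ : Link τ) x y → mapConjunct β (linkAt φ x y) ≡ linkAt φ (β x) (β y)
  mapConjunct-link φ x y = cong (Link.symbol φ ⦅_⦆)
    (trans (Vec.map-[]≔ (Maybe.map β) (replicate _ nothing [ Link.source φ ]≔ just x) (Link.target φ))
      (cong (_[ Link.target φ ]≔ just (β y)) (trans (Vec.map-[]≔ (Maybe.map β) (replicate _ nothing) (Link.source φ))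
        (cong (_[ Link.source φ ]≔ just (β x)) (Vec.map-replicate (Maybe.map β) nothing _)))))

  mapConjunct-leg : ∀ (ψ : Leg τ) x → mapConjunct β (legAt ψ x) ≡ legAt ψ (β x)
  mapConjunct-leg ψ x = cong (Leg.symbol ψ ⦅_⦆)
    (trans (Vec.map-[]≔ (Maybe.map β) (replicate _ nothing) (Leg.position ψ))
      (cong (_[ Leg.position ψ ]≔ just (β x)) (Vec.map-replicate (Maybe.map β) nothing _)))

module UnfoldedCaterpillar {τ : Signature} (C : Caterpillar τ) (i j : Joint C) (i<j : i Fin.< j) where

  open Caterpillar C
  open Unfolded C i j i<j

  private
    onlyIf : ∀ {P : Set} (d : Dec P) {ψs : List (Leg τ)} → .P → Fin (length ψs) → Fin (length (legsIf ⌊ d ⌋ ψs))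
    onlyIf (yes _) p l = l
    onlyIf (no ¬p) p l = ⊥-elim (¬p (recompute (no ¬p) p))

    legIndexA : ∀ k → Place k → Fin (length (legs k)) → Index
    legIndexA k (early p) l = leg-fixed k (inj₁ p) l
    legIndexA k (mid p q) l = leg k p q l
    legIndexA k (late p)  l = leg-fixed k (inj₂ p) l

    legIndex′ : ∀ k .(p : i Fin.< k) (d : Dec (k Fin.< j)) → Fin (length (legsIf ⌊ d ⌋ (legs k))) → Index
    legIndex′ k p (yes q) l = leg′ k p q l

    legIndex″ : ∀ k .(q : k Fin.< j) (d : Dec (i Fin.< k)) → Fin (length (legsIf ⌊ d ⌋ (legs k))) → Index
    legIndex″ k q (yes p) l = leg″ k p q l

  legIndex : ∀ v → Fin (length (legsAt v)) → Index
  legIndex (a k)      l = legIndexA k (place k) l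
  legIndex (a′ k p _) l = legIndex′ k p (k Fin.<? j) l
  legIndex (a″ k _ q) l = legIndex″ k q (i Fin.<? k) l

  private
    LegOf : Set
    LegOf = Σ[ v ∈ Var ] Fin (length (legsAt v))

  -- A left inverse of `legIndex`, undefined on links: it yields injectivity on the legs and keeps
  -- them apart from the links.
  unleg : Index → Maybe LegOf
  unleg (leg-fixed k _ l) = just (a k , l)
  unleg (leg k _ _ l)     = just (a k , l)
  unleg (leg′ k p q l)    = just (a′ k p (<⇒≤ q) , onlyIf (k Fin.<? j) q l)
  unleg (leg″ k p q l)    = just (a″ k (<⇒≤ p) q , onlyIf (i Fin.<? k) p l)
  unleg (link-fixed _ _)  = nothing
  unleg (link₁ _ _ _)     = nothing
  unleg (link₂ _ _ _)     = nothing
  unleg (link₃ _ _ _)     = nothing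

  private
    legIndex′-onlyIf : ∀ k .p .q d l → legIndex′ k p d (onlyIf d q l) ≡ leg′ k p q l
    legIndex′-onlyIf k p q (yes _) l = refl
    legIndex′-onlyIf k p q (no ¬q) l = ⊥-elim (¬q (recompute (no ¬q) q))

    legIndex″-onlyIf : ∀ k .p .q d l → legIndex″ k q d (onlyIf d p l) ≡ leg″ k p q l
    legIndex″-onlyIf k p q (yes _) l = refl
    legIndex″-onlyIf k p q (no ¬p) l = ⊥-elim (¬p (recompute (no ¬p) p))

    conj-legIndex′ : ∀ k .p .q d l → conj (legIndex′ k p d l) ≡ legAt (List.lookup (legsIf ⌊ d ⌋ (legs k)) l) (a′ k p q)
    conj-legIndex′ k p q (yes _) l = refl

    conj-legIndex″ : ∀ k .p .q d l → conj (legIndex″ k q d l) ≡ legAt (List.lookup (legsIf ⌊ d ⌋ (legs k)) l) (a″ k p q)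
    conj-legIndex″ k p q (yes _) l = refl

    unleg-legIndex′ : ∀ k .p .q d l (eq : (k Fin.<? j) ≡ d) →
                      unleg (legIndex′ k p d l) ≡ just (a′ k p q , subst (λ d → Fin (length (legsIf ⌊ d ⌋ (legs k)))) (sym eq) l)
    unleg-legIndex′ k p q (yes r) l eq = cong (λ l → just (a′ k p q , l)) (sub (k Fin.<? j) eq)
      where
      sub : ∀ d (eq : d ≡ yes r) → onlyIf d r l ≡ subst (λ d → Fin (length (legsIf ⌊ d ⌋ (legs k)))) (sym eq) l
      sub _ refl = refl

    unleg-legIndex″ : ∀ k .p .q d l (eq : (i Fin.<? k) ≡ d) →
                      unleg (legIndex″ k q d l) ≡ just (a″ k p q , subst (λ d → Fin (length (legsIf ⌊ d ⌋ (legs k)))) (sym eq) l)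
    unleg-legIndex″ k p q (yes r) l eq = cong (λ l → just (a″ k p q , l)) (sub (i Fin.<? k) eq)
      where
      sub : ∀ d (eq : d ≡ yes r) → onlyIf d r l ≡ subst (λ d → Fin (length (legsIf ⌊ d ⌋ (legs k)))) (sym eq) l
      sub _ refl = refl

  unleg-legIndex : ∀ v l → unleg (legIndex v l) ≡ just (v , l)
  unleg-legIndex (a k) l with place k
  ... | early _ = refl
  ... | mid _ _ = refl
  ... | late _  = refl
  unleg-legIndex (a′ k p q) l = unleg-legIndex′ k p q (k Fin.<? j) l refl
  unleg-legIndex (a″ k p q) l = unleg-legIndex″ k p q (i Fin.<? k) l refl

  conj-legIndex : ∀ v l → conj (legIndex v l) ≡ legAt (List.lookup (legsAt v) l) v
  conj-legIndex (a k) l with place k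
  ... | early _ = refl
  ... | mid _ _ = refl
  ... | late _  = refl
  conj-legIndex (a′ k p q) l = conj-legIndex′ k p q (k Fin.<? j) l
  conj-legIndex (a″ k p q) l = conj-legIndex″ k p q (i Fin.<? k) l

  unfoldedLink : ∀ {e} → Edge e → Link τ
  unfoldedLink E = orient (Edge.forward E) (link (Edge.k E))

  private
    nonempty-ends : legs zero ≢ [] × legs (fromℕ len) ≢ []
    nonempty-ends with ends
    ... | inj₂ ne       = ne
    -- A single point does not have two joints `i < j`.
    ... | inj₁ (eq , _) = contradiction (<-≤-trans i<j (≤-trans j≤len (≤-reflexive eq))) λ ()

    var-zero : var 0 (s≤s z≤n) ≡ a zero
    var-zero = trans (same (sym (posA-≤ z≤n)) {s≤s z≤n} {pos-< (a zero)}) (var-pos (a zero) (pos-< (a zero)))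
      where
      same : ∀ {s t} → s ≡ t → ∀ {s<} {t<} → var s s< ≡ var t t<
      same refl {s<} {t<} rewrite ℕ.≤-irrelevant s< t< = refl

    var-last : ∀ {t} t< → t ≡ len + shift → var t t< ≡ a (fromℕ len)
    var-last t< eq = pos-injective (trans (pos-var _ t<) (trans eq (sym (trans
      (posA-≥ (≤-trans j≤len (≤-reflexive (sym (toℕ-fromℕ len))))) (cong (_+ shift) (toℕ-fromℕ len))))))

  unfoldedCaterpillar : Caterpillar τ
  unfoldedCaterpillar = record
    { len  = len + shift
    ; link = λ e → unfoldedLink (edge (toℕ e) (toℕ<n e))
    ; legs = λ t → legsAt (var (toℕ t) (toℕ<n t))
    ; ends = inj₂ ( (λ eq → proj₁ nonempty-ends (trans (cong legsAt (sym var-zero)) eq))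
                  , (λ eq → proj₂ nonempty-ends (trans (cong legsAt (sym (var-last _ (toℕ-fromℕ _)))) eq)) )
    }

  private
    D = unfoldedCaterpillar

    same : ∀ {s t} → s ≡ t → ∀ {s<} {t<} → var s s< ≡ var t t<
    same refl {s<} {t<} rewrite ℕ.≤-irrelevant s< t< = refl

    sameEdge : ∀ {s t} → s ≡ t → ∀ {s<} {t<} → Edge.index (edge s s<) ≡ Edge.index (edge t t<)
    sameEdge refl {s<} {t<} rewrite ℕ.≤-irrelevant s< t< = refl

  varAt : Joint D → Var
  varAt t = var (toℕ t) (toℕ<n t)

  joints↔ : Joint D ↔ Var
  joints↔ = mk↔ₛ′ varAt (λ v → fromℕ< (pos-< v))
    (λ v → trans (same (toℕ-fromℕ< (pos-< v)) {toℕ<n (fromℕ< (pos-< v))} {pos-< v}) (var-pos v (pos-< v)))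
    (λ t → toℕ-injective (trans (toℕ-fromℕ< (pos-< (varAt t))) (pos-var (toℕ t) (toℕ<n t))))

  private
    ι : Fin (len + shift) ⊎ (Σ[ t ∈ Joint D ] Fin (length (Caterpillar.legs D t))) → Index
    ι (inj₁ e)       = Edge.index (edge (toℕ e) (toℕ<n e))
    ι (inj₂ (t , l)) = legIndex (varAt t) l

    -- A leg mentions only one joint, but the two variables of an edge have different positions.
    unleg-edge : ∀ {e} (E : Edge e) → unleg (Edge.index E) ≡ nothing
    unleg-edge {e} E = go (Edge.index E) {link (Edge.k E)} {Edge.x E} {Edge.y E} (Edge.conj≡ E) (x≢y {Edge.x E} {Edge.y E} {Edge.forward E} (Edge.ends E))
      where
      x≢y : ∀ {x y b} → (b ≡ true × pos x ≡ e × pos y ≡ suc e) ⊎ (b ≡ false × pos y ≡ e × pos x ≡ suc e) → x ≢ y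
      x≢y (inj₁ (_ , p , q)) refl = ℕ.1+n≢n (sym (trans (sym p) q))
      x≢y (inj₂ (_ , p , q)) refl = ℕ.1+n≢n (sym (trans (sym p) q))
      leg≢link : ∀ {ψ φ} {x y v : Var} → legAt ψ v ≡ linkAt φ x y → x ≢ y → ⊥
      leg≢link {ψ} {φ} {x} {y} {v} eq ne = both (legAt ψ v) refl eq
        where
        both : ∀ κ → legAt ψ v ≡ κ → κ ≡ linkAt φ x y → ⊥
        both _ eq refl = contradict _ eq (lookup-linkAt-source φ) (lookup-linkAt-target φ)
          where
          contradict : ∀ κ → legAt ψ v ≡ κ → ∀ {s t} → lookup (Conjunct.args κ) s ≡ just x → lookup (Conjunct.args κ) t ≡ just y → ⊥
          contradict _ refl {s} {t} es et = ne (trans (proj₂ (lookup-legAt ψ s es)) (sym (proj₂ (lookup-legAt ψ t et))))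
      go : ∀ c {φ x y} → conj c ≡ linkAt φ x y → x ≢ y → unleg c ≡ nothing
      go (link-fixed _ _)  _  _  = refl
      go (link₁ _ _ _)     _  _  = refl
      go (link₂ _ _ _)     _  _  = refl
      go (link₃ _ _ _)     _  _  = refl
      go (leg-fixed k _ l) {φ} eq ne = ⊥-elim (leg≢link {List.lookup (legs k) l} {φ} {v = a k} eq ne)
      go (leg k _ _ l) {φ} eq ne = ⊥-elim (leg≢link {List.lookup (legs k) l} {φ} {v = a k} eq ne)
      go (leg′ k p q l) {φ} eq ne = ⊥-elim (leg≢link {List.lookup (legs k) l} {φ} {v = a′ k p (<⇒≤ q)} eq ne)
      go (leg″ k p q l) {φ} eq ne = ⊥-elim (leg≢link {List.lookup (legs k) l} {φ} {v = a″ k (<⇒≤ p) q} eq ne)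

    just≢nothing : ∀ {A : Set} {x : A} → just x ≢ nothing
    just≢nothing ()

    leg-unique : ∀ {t t′ l l′} → (varAt t , l) ≡ (varAt t′ , l′) →
                 inj₂ {A = Fin (len + shift)} {B = Σ[ t ∈ Joint D ] Fin (length (Caterpillar.legs D t))} (t , l) ≡ inj₂ (t′ , l′)
    leg-unique {t} {t′} eq with joint-eq eq
      where
      joint-eq : ∀ {t t′ l l′} → _≡_ {A = LegOf} (varAt t , l) (varAt t′ , l′) → t ≡ t′
      joint-eq {t} {t′} eq = trans (sym (Inverse.strictlyInverseʳ joints↔ t))
        (trans (cong (Inverse.from joints↔ ∘ proj₁) eq) (Inverse.strictlyInverseʳ joints↔ t′))
    leg-unique refl | refl = refl

    ι-injective : ∀ {c d} → ι c ≡ ι d → c ≡ d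
    ι-injective {inj₁ e} {inj₁ e′} eq = cong inj₁ (toℕ-injective
      (trans (sym (Edge.edge≡ (edge (toℕ e) _))) (trans (cong edgeOf eq) (Edge.edge≡ (edge (toℕ e′) _)))))
    ι-injective {inj₁ e} {inj₂ (t , l)} eq =
      contradiction (trans (sym (unleg-legIndex (varAt t) l)) (trans (cong unleg (sym eq)) (unleg-edge (edge (toℕ e) _)))) just≢nothing
    ι-injective {inj₂ (t , l)} {inj₁ e} eq =
      contradiction (trans (sym (unleg-legIndex (varAt t) l)) (trans (cong unleg eq) (unleg-edge (edge (toℕ e) _)))) just≢nothing
    ι-injective {inj₂ (t , l)} {inj₂ (t′ , l′)} eq = leg-unique (just-injective
      (trans (sym (unleg-legIndex (varAt t) l)) (trans (cong unleg eq) (unleg-legIndex (varAt t′) l′))))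

    edge-preimage : ∀ {c e} → e < len + shift → (∀ e< → Edge.index (edge e e<) ≡ c) → ∃[ d ] ι d ≡ c
    edge-preimage e< eq = inj₁ (fromℕ< e<) , trans (sameEdge (toℕ-fromℕ< e<) {t< = e<}) (eq e<)

    leg-preimage : ∀ {c} v l → legIndex v l ≡ c → ∃[ d ] ι d ≡ c
    leg-preimage v l eq = inj₂ (Inverse.from joints↔ v , subst (Fin ∘ length ∘ legsAt) (sym inverse) l) ,
      trans (legIndex-subst (sym inverse)) eq
      where
      inverse = Inverse.strictlyInverseˡ joints↔ v
      legIndex-subst : ∀ {w} (eq : v ≡ w) → legIndex w (subst (Fin ∘ length ∘ legsAt) eq l) ≡ legIndex v l
      legIndex-subst refl = refl

    recompute-≤ : ∀ {m n} → .(m ≤ n) → m ≤ n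
    recompute-≤ {m} {n} p = recompute (m ≤? n) p

    inject-≥ : ∀ {k : Fin len} {m} → .(m ≤ toℕ (inject₁ k)) → m ≤ toℕ k
    inject-≥ {k} p = subst (_ ≤_) (toℕ-inject₁ k) (recompute-≤ p)

    decide-fixed : ∀ (k : Fin len) → .(inject₁ k Fin.< i ⊎ j Fin.≤ inject₁ k) → toℕ k < toℕ i ⊎ toℕ j ≤ toℕ k
    decide-fixed k p with recompute ((inject₁ k Fin.<? i) ⊎-dec (j Fin.≤? inject₁ k)) p
    ... | inj₁ q = inj₁ (subst (_< toℕ i) (toℕ-inject₁ k) q)
    ... | inj₂ q = inj₂ (subst (toℕ j ≤_) (toℕ-inject₁ k) q)

    leg-fixed-index : ∀ k .p l → legIndex (a k) l ≡ leg-fixed k p l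
    leg-fixed-index k p l with place k
    ... | early _ = refl
    ... | late _  = refl
    ... | mid q r with recompute ((k Fin.≤? i) ⊎-dec (j Fin.≤? k)) p
    ...   | inj₁ q′ = contradiction q′ (<⇒≱ q)
    ...   | inj₂ r′ = contradiction r′ (<⇒≱ r)

    leg-mid-index : ∀ k .p .q l → legIndex (a k) l ≡ leg k p q l
    leg-mid-index k p q l with place k
    ... | early r = ⊥-elim (<⇒≱ (recompute-≤ p) r)
    ... | mid _ _ = refl
    ... | late r  = ⊥-elim (<⇒≱ (recompute-≤ q) r)

    ι-surjective : ∀ c → ∃[ d ] ι d ≡ c
    ι-surjective (link-fixed k p) with decide-fixed k p
    ... | inj₁ q = edge-preimage (<-≤-trans (toℕ<n k) (m≤m+n len shift)) (edge-fixed-early k p q)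
    ... | inj₂ q = edge-preimage (ℕ.+-monoˡ-< shift (toℕ<n k)) (λ e< → edge-fixed-late k (≤-trans (<⇒≤ i<j) q) e< p q)
    ι-surjective (link₁ k p q) =
      edge-preimage (<-≤-trans (toℕ<n k) (m≤m+n len shift)) (edge-link₁ k p q (inject-≥ {k} p) (recompute-≤ q))
    ι-surjective (link₂ k p q) = edge-preimage bound (edge-link₂ k p q (inject-≥ {k} p) k<j eq)
      where
      k<j : toℕ k < toℕ j
      k<j = recompute-≤ q
      e = toℕ j + toℕ j ∸ suc (toℕ k)
      eq : suc e + toℕ k ≡ toℕ j + toℕ j
      eq = trans (sym (+-suc e (toℕ k))) (m∸n+n≡m (≤-trans k<j (m≤m+n _ _)))
      bound : e < len + shift
      bound = ≤-trans (+-cancelʳ-≤ (toℕ i) _ _ (≤-trans (+-monoʳ-≤ (suc e) (inject-≥ {k} p))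
        (≤-reflexive (trans eq (trans j+j≡i+[j+δ] (+-comm (toℕ i) _))))))
        (+-mono-≤ j≤len (m≤m+n _ _))
    ι-surjective (link₃ k p q) =
      edge-preimage (ℕ.+-monoˡ-< shift (toℕ<n k)) (λ e< → edge-link₃ k (inject-≥ {k} p) e< p q (recompute-≤ q))
    ι-surjective (leg-fixed k p l) = leg-preimage (a k) l (leg-fixed-index k p l)
    ι-surjective (leg k p q l)     = leg-preimage (a k) l (leg-mid-index k p q l)
    ι-surjective (leg′ k p q l)    = leg-preimage (a′ k p (<⇒≤ q)) (onlyIf (k Fin.<? j) q l) (legIndex′-onlyIf k p q (k Fin.<? j) l)
    ι-surjective (leg″ k p q l)    = leg-preimage (a″ k (<⇒≤ p) q) (onlyIf (i Fin.<? k) p l) (legIndex″-onlyIf k p q (i Fin.<? k) l)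

    var-≡ : ∀ {t} v t< → pos v ≡ t → v ≡ var t t<
    var-≡ v t< refl = sym (var-pos v t<)

    edge-linkAt : ∀ {e} (E : Edge e) t< t+1< → conj (Edge.index E) ≡ linkAt (unfoldedLink E) (var e t<) (var (suc e) t+1<)
    edge-linkAt E t< t+1< = trans (Edge.conj≡ E) (go (Edge.forward E) (Edge.ends E))
      where
      open Edge E using (k; x; y)
      go : ∀ b → (b ≡ true × pos x ≡ _ × pos y ≡ _) ⊎ (b ≡ false × pos y ≡ _ × pos x ≡ _) →
           linkAt (link k) x y ≡ linkAt (orient b (link k)) (var _ t<) (var _ t+1<)
      go true  (inj₁ (_ , ex , ey)) = cong₂ (linkAt (link k)) (var-≡ x t< ex) (var-≡ y t+1< ey)
      go false (inj₂ (_ , ey , ex)) = trans (sym (linkAt-flip (link k) y x))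
        (cong₂ (linkAt (flip (link k))) (var-≡ y t< ey) (var-≡ x t+1< ex))

    agree : ∀ c → conj (ι c) ≡ mapConjunct varAt (conjuncts D c)
    agree (inj₁ e) = trans (edge-linkAt (edge (toℕ e) (toℕ<n e)) (ℕ.m<n⇒m<1+n (toℕ<n e)) (s≤s (toℕ<n e)))
      (trans (cong₂ (linkAt (unfoldedLink (edge (toℕ e) (toℕ<n e)))) (same (sym (toℕ-inject₁ e)) {ℕ.m<n⇒m<1+n (toℕ<n e)} {toℕ<n (inject₁ e)}) (same {suc (toℕ e)} refl {s≤s (toℕ<n e)} {toℕ<n {suc (len + shift)} (suc e)})) (sym (mapConjunct-link varAt (unfoldedLink (edge (toℕ e) (toℕ<n e))) (inject₁ e) (suc e))))
    agree (inj₂ (t , l)) = trans (conj-legIndex (varAt t) l) (sym (mapConjunct-leg varAt (List.lookup (legsAt (varAt t)) l) t))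

  unfolded-≅ : Σ[ iso ∈ ⟦ D ⟧ ≅ unfolded ] ∀ t → _≅_.to iso (inj₁ t) ≡ inj₁ (varAt t)
  unfolded-≅ = database-≅ conj (conjuncts D) joints↔ ι (λ {c} → ι-injective {c}) ι-surjective agree

-- The spine of an unfolding

-- The functions used in the definition of `spine` are not in scope outside of
-- it; they are recovered by unification, which needs the lists involved to be
-- stuck, hence the case distinction on i.
module SpineShape {τ : Signature} (C : Caterpillar τ) where

  open Caterpillar C

  isMid : (i j k : Joint C) → Dec (i Fin.< k × k Fin.< j)
  isMid i j k = (i Fin.<? k) ×-dec (k Fin.<? j)

  shaped : (i j : Joint C) (i<j : i Fin.< j) → let open Unfold C i j i<j in List Var → List Var → List Var
  shaped i j i<j us vs =
    List.map a (List.filter (Fin._≤? i) (allFin _)) ++ us ++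
    List.reverse (List.map a (List.filter (isMid i j) (allFin _))) ++ vs ++
    List.map a (List.filter (j Fin.≤?_) (allFin _))
    where open Unfold C i j i<j

  Shape : (i j : Joint C) (i<j : i Fin.< j) → Set
  Shape i j i<j = ∃₂ λ f g →
    spine ≡ shaped i j i<j (List.mapMaybe f (allFin _)) (List.mapMaybe g (allFin _)) ×
    (∀ k → ¬ (i Fin.< k × k Fin.≤ j) → f k ≡ nothing) × (∀ k p q → f k ≡ just (a′ k p q)) ×
    (∀ k → ¬ (i Fin.≤ k × k Fin.< j) → g k ≡ nothing) × (∀ k p q → g k ≡ just (a″ k p q))
    where open Unfold C i j i<j

  private
    positive : List (Joint C)
    positive = List.tabulate {n = len} suc

  module _ (j : Fin len) (i<j : zero {len} Fin.< suc j) where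

    open Unfold C zero (suc j) i<j

    private
      functions : ∃₂ λ f g → spine ≡ shaped zero (suc j) i<j (List.mapMaybe f positive) (a″ zero z≤n i<j ∷ List.mapMaybe g positive)
      functions = _ , _ , refl

      f g : Joint C → Maybe Var
      f = proj₁ functions
      g = proj₁ (proj₂ functions)

      f-out : ∀ k → ¬ (zero {len} Fin.< k × k Fin.≤ suc j) → f k ≡ nothing
      f-out k out with zero {len} Fin.<? k | k Fin.≤? suc j
      ... | yes p | yes q = contradiction (p , q) out
      ... | yes _ | no _  = refl
      ... | no _  | _     = refl

      f-in : ∀ k p q → f k ≡ just (a′ k p q)
      f-in k p q with zero {len} Fin.<? k | k Fin.≤? suc j
      ... | yes _ | yes _ = refl
      ... | yes _ | no ¬q = contradiction q ¬q
      ... | no ¬p | _     = contradiction p ¬p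

      g-out : ∀ k → ¬ (zero {len} Fin.≤ k × k Fin.< suc j) → g k ≡ nothing
      g-out k out with zero {len} Fin.≤? k | k Fin.<? suc j
      ... | yes p | yes q = contradiction (p , q) out
      ... | yes _ | no _  = refl
      ... | no _  | _     = refl

      g-in : ∀ k p q → g k ≡ just (a″ k p q)
      g-in k p q with zero {len} Fin.≤? k | k Fin.<? suc j
      ... | yes _ | yes _ = refl
      ... | yes _ | no ¬q = contradiction q ¬q
      ... | no ¬p | _     = contradiction p ¬p

    shape-zero : Shape zero (suc j) i<j
    shape-zero = f , g , refl {x = spine} , f-out , f-in , g-out , g-in

  module _ (i j : Fin len) (i<j : suc i Fin.< suc j) where

    open Unfold C (suc i) (suc j) i<j

    private
      functions : ∃₂ λ f g → spine ≡ shaped (suc i) (suc j) i<j (List.mapMaybe f positive) (List.mapMaybe g positive)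
      functions = _ , _ , refl

      f g : Joint C → Maybe Var
      f = proj₁ functions
      g = proj₁ (proj₂ functions)

      f-out : ∀ k → ¬ (suc i Fin.< k × k Fin.≤ suc j) → f k ≡ nothing
      f-out k out with suc i Fin.<? k | k Fin.≤? suc j
      ... | yes p | yes q = contradiction (p , q) out
      ... | yes _ | no _  = refl
      ... | no _  | _     = refl

      f-in : ∀ k p q → f k ≡ just (a′ k p q)
      f-in k p q with suc i Fin.<? k | k Fin.≤? suc j
      ... | yes _ | yes _ = refl
      ... | yes _ | no ¬q = contradiction q ¬q
      ... | no ¬p | _     = contradiction p ¬p

      g-out : ∀ k → ¬ (suc i Fin.≤ k × k Fin.< suc j) → g k ≡ nothing
      g-out k out with suc i Fin.≤? k | k Fin.<? suc j
      ... | yes p | yes q = contradiction (p , q) out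
      ... | yes _ | no _  = refl
      ... | no _  | _     = refl

      g-in : ∀ k p q → g k ≡ just (a″ k p q)
      g-in k p q with suc i Fin.≤? k | k Fin.<? suc j
      ... | yes _ | yes _ = refl
      ... | yes _ | no ¬q = contradiction q ¬q
      ... | no ¬p | _     = contradiction p ¬p

    shape-suc : Shape (suc i) (suc j) i<j
    shape-suc = f , g , refl , f-out , f-in , g-out , g-in

  shape : ∀ i j i<j → Shape i j i<j
  shape zero    (suc j) i<j = shape-zero j i<j
  shape (suc i) (suc j) i<j = shape-suc i j i<j

module UnfoldedSpine {τ : Signature} (C : Caterpillar τ) (i j : Joint C) (i<j : i Fin.< j) where

  open Caterpillar C
  open Unfolded C i j i<j
  open UnfoldedCaterpillar C i j i<j

  private
    joints : List (Joint C)
    joints = allFin (suc len)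

    open SpineShape C using (isMid; shape)

    prime doublePrime : Joint C → Maybe Var
    prime       = proj₁ (shape i j i<j)
    doublePrime = proj₁ (proj₂ (shape i j i<j))

    shape-props = proj₂ (proj₂ (shape i j i<j))

  data Run : List (Joint C) → ℕ → ℕ → Set where
    []  : ∀ {n} → Run [] n n
    _∷_ : ∀ {k ks n m} → toℕ k ≡ n → Run ks (suc n) m → Run (k ∷ ks) n m

  -- Since `pos` is injective, a list is determined by the interval of positions that it runs
  -- through; this replaces any direct comparison with the filtered lists of the spine.
  data Enumerates : List Var → ℕ → ℕ → Set where
    []  : ∀ {n} → Enumerates [] n n
    _∷_ : ∀ {v vs n m} → pos v ≡ n → Enumerates vs (suc n) m → Enumerates (v ∷ vs) n m

  private
    run-joints : Run joints 0 (suc len)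
    run-joints = go (suc len) id (λ _ → refl)
      where
      go : ∀ m {n} (f : Fin m → Joint C) → (∀ x → toℕ (f x) ≡ n + toℕ x) → Run (List.tabulate f) n (n + m)
      go zero    {n} f eq = subst (Run [] n) (sym (+-identityʳ n)) []
      go (suc m) {n} f eq = trans (eq zero) (+-identityʳ n) ∷
        subst (Run _ (suc n)) (sym (+-suc n m)) (go m (f ∘ suc) λ x → trans (eq (suc x)) (+-suc n (toℕ x)))

    run-≤ : ∀ {ks n m} → Run ks n m → n ≤ m
    run-≤ []      = ≤-refl
    run-≤ (_ ∷ r) = <⇒≤ (run-≤ r)

    split : ∀ {ks n m} → Run ks n m → ∀ b → n ≤ b → b ≤ m →
            ∃₂ λ ks₁ ks₂ → ks ≡ ks₁ ++ ks₂ × Run ks₁ n b × Run ks₂ b m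
    split {ks} {n} r b n≤b b≤m with n ℕ.≟ b
    split r b n≤b b≤m | yes refl = [] , _ , refl , [] , r
    split [] b n≤b b≤m | no n≢b = contradiction (≤-antisym n≤b b≤m) n≢b
    split (eq ∷ r) b n≤b b≤m | no n≢b with split r b (≤∧≢⇒< n≤b n≢b) b≤m
    ... | ks₁ , ks₂ , refl , r₁ , r₂ = _ , ks₂ , refl , eq ∷ r₁ , r₂

    run-All : ∀ {ks n m} {P : Joint C → Set} → Run ks n m → (∀ k → n ≤ toℕ k → toℕ k < m → P k) → All P ks
    run-All []        f = []
    run-All (refl ∷ r) f = f _ ≤-refl (run-≤ r) ∷ run-All r (λ k le lt → f k (<⇒≤ le) lt)

    Enumerates-++ : ∀ {us vs n m l} → Enumerates us n m → Enumerates vs m l → Enumerates (us ++ vs) n l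
    Enumerates-++ []       e′ = e′
    Enumerates-++ (eq ∷ e) e′ = eq ∷ Enumerates-++ e e′

    run-map : ∀ {ks n m} → Run ks n m → ∀ o (g : Joint C → Var) →
              (∀ k → n ≤ toℕ k → toℕ k < m → pos (g k) ≡ toℕ k + o) → Enumerates (List.map g ks) (n + o) (m + o)
    run-map []         o g f = []
    run-map (refl ∷ r) o g f = f _ ≤-refl (run-≤ r) ∷ run-map r o g (λ k le lt → f k (<⇒≤ le) lt)

    run-mapMaybe : ∀ {ks n m} → Run ks n m → ∀ o (g : Joint C → Maybe Var) →
                   (∀ k → n ≤ toℕ k → toℕ k < m → ∃[ v ] g k ≡ just v × pos v ≡ toℕ k + o) →
                   Enumerates (List.mapMaybe g ks) (n + o) (m + o)
    run-mapMaybe []         o g f = []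
    run-mapMaybe (_∷_ {k} refl r) o g f with g k | f k ≤-refl (run-≤ r)
    ... | just v | _ , refl , eq = eq ∷ run-mapMaybe r o g (λ k le lt → f k (<⇒≤ le) lt)

    mapMaybe-none : ∀ {ks} (g : Joint C → Maybe Var) → All (λ k → g k ≡ nothing) ks → List.mapMaybe g ks ≡ []
    mapMaybe-none g []                 = refl
    mapMaybe-none {k ∷ _} g (eq ∷ eqs) with g k
    ... | nothing = mapMaybe-none g eqs

    run-reverse : ∀ {ks n m} → Run ks n m → ∀ s {p q} (g : Joint C → Var) →
                  (∀ k → n ≤ toℕ k → toℕ k < m → pos (g k) + toℕ k ≡ s) → p + m ≡ suc s → q + n ≡ suc s →
                  Enumerates (List.reverse (List.map g ks)) p q
    run-reverse {n = n} [] s {p} g f pm qn =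
      subst (Enumerates [] p) (+-cancelʳ-≡ n _ _ (trans pm (sym qn))) []
    run-reverse {n = n} (_∷_ {k} refl r) s {p} {zero} g f pm qn =
      contradiction (≤-trans (<-≤-trans (run-≤ r) (≤-trans (m≤n+m _ p) (≤-reflexive (trans pm (sym qn))))) ≤-refl) (<-irrefl refl)
    run-reverse {n = n} (_∷_ {k} {ks} refl r) s {p} {suc q} g f pm qn =
      subst (λ l → Enumerates l p (suc q)) (sym (List.unfold-reverse (g k) (List.map g ks)))
        (Enumerates-++ (run-reverse r s g (λ k le lt → f k (<⇒≤ le) lt) pm (trans (+-suc q n) qn))
          (+-cancelʳ-≡ (toℕ k) _ _ (trans (f k ≤-refl (run-≤ r)) (sym (ℕ.suc-injective qn))) ∷ []))

    select : ∀ lo hi → lo ≤ hi → hi ≤ suc len → {P : Joint C → Set} (P? : ∀ k → Dec (P k)) →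
             (∀ k → P k → lo ≤ toℕ k × toℕ k < hi) → (∀ k → lo ≤ toℕ k → toℕ k < hi → P k) →
             Run (List.filter P? joints) lo hi
    select lo hi lo≤hi hi≤ P? out ins with split run-joints lo z≤n (≤-trans lo≤hi hi≤)
    ... | ks₁ , ks₂ , eq , r₁ , r₂ with split r₂ hi lo≤hi hi≤
    ... | ks₃ , ks₄ , eq′ , r₃ , r₄ = subst (λ ks → Run ks lo hi) (sym filtered) r₃
      where
      filtered : List.filter P? joints ≡ ks₃
      filtered = begin
        List.filter P? joints                ≡⟨ cong (List.filter P?) (trans eq (cong (ks₁ ++_) eq′)) ⟩
        List.filter P? (ks₁ ++ ks₃ ++ ks₄)   ≡⟨ List.filter-++ P? ks₁ _ ⟩
        List.filter P? ks₁ ++ List.filter P? (ks₃ ++ ks₄)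
          ≡⟨ cong₂ _++_ (List.filter-none P? (run-All r₁ λ k _ lt p → <⇒≱ lt (proj₁ (out k p)))) (List.filter-++ P? ks₃ ks₄) ⟩
        List.filter P? ks₃ ++ List.filter P? ks₄
          ≡⟨ cong₂ _++_ (List.filter-all P? (run-All r₃ ins)) (List.filter-none P? (run-All r₄ λ k ge _ p → <⇒≱ (proj₂ (out k p)) ge)) ⟩
        ks₃ ++ [] ≡⟨ ++-identityʳ ks₃ ⟩
        ks₃ ∎
        where open ≡-Reasoning

    selectMaybe : ∀ lo hi o → lo ≤ hi → hi ≤ suc len → (g : Joint C → Maybe Var) →
                  (∀ k → ¬ (lo ≤ toℕ k × toℕ k < hi) → g k ≡ nothing) →
                  (∀ k → lo ≤ toℕ k → toℕ k < hi → ∃[ v ] g k ≡ just v × pos v ≡ toℕ k + o) →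
                  Enumerates (List.mapMaybe g joints) (lo + o) (hi + o)
    selectMaybe lo hi o lo≤hi hi≤ g out ins with split run-joints lo z≤n (≤-trans lo≤hi hi≤)
    ... | ks₁ , ks₂ , eq , r₁ , r₂ with split r₂ hi lo≤hi hi≤
    ... | ks₃ , ks₄ , eq′ , r₃ , r₄ = subst (λ vs → Enumerates vs (lo + o) (hi + o)) (sym mapped) (run-mapMaybe r₃ o g ins)
      where
      mapped : List.mapMaybe g joints ≡ List.mapMaybe g ks₃
      mapped = begin
        List.mapMaybe g joints              ≡⟨ cong (List.mapMaybe g) (trans eq (cong (ks₁ ++_) eq′)) ⟩
        List.mapMaybe g (ks₁ ++ ks₃ ++ ks₄) ≡⟨ List.mapMaybe-++ g ks₁ _ ⟩
        List.mapMaybe g ks₁ ++ List.mapMaybe g (ks₃ ++ ks₄)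
          ≡⟨ cong₂ _++_ (mapMaybe-none g (run-All r₁ λ k _ lt → out k λ (ge , _) → <⇒≱ lt ge)) (List.mapMaybe-++ g ks₃ ks₄) ⟩
        List.mapMaybe g ks₃ ++ List.mapMaybe g ks₄
          ≡⟨ cong (List.mapMaybe g ks₃ ++_) (mapMaybe-none g (run-All r₄ λ k ge _ → out k λ (_ , lt) → <⇒≱ lt ge)) ⟩
        List.mapMaybe g ks₃ ++ [] ≡⟨ ++-identityʳ _ ⟩
        List.mapMaybe g ks₃ ∎
        where open ≡-Reasoning

    prime-out : ∀ k → ¬ (suc α ≤ toℕ k × toℕ k < suc β) → prime k ≡ nothing
    prime-out k out = proj₁ (proj₂ shape-props) k λ (p , q) → out (p , s≤s q)

    prime-in : ∀ k → suc α ≤ toℕ k → toℕ k < suc β → ∃[ v ] prime k ≡ just v × pos v ≡ toℕ k + 0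
    prime-in k p (s≤s q) = _ , proj₁ (proj₂ (proj₂ shape-props)) k p q , sym (+-identityʳ _)

    doublePrime-out : ∀ k → ¬ (α ≤ toℕ k × toℕ k < β) → doublePrime k ≡ nothing
    doublePrime-out = proj₁ (proj₂ (proj₂ (proj₂ shape-props)))

    doublePrime-in : ∀ k → α ≤ toℕ k → toℕ k < β → ∃[ v ] doublePrime k ≡ just v × pos v ≡ toℕ k + shift
    doublePrime-in k p q = _ , proj₂ (proj₂ (proj₂ (proj₂ shape-props))) k p q , refl

    cast-enumerates : ∀ {vs n n′ m m′} → n ≡ n′ → m ≡ m′ → Enumerates vs n m → Enumerates vs n′ m′
    cast-enumerates refl refl e = e

  spine-enumerates : Enumerates spine 0 (suc len + shift)
  spine-enumerates = subst (λ vs → Enumerates vs 0 (suc len + shift)) (sym (proj₁ shape-props))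
    (Enumerates-++ part₁ (Enumerates-++ part₂ (Enumerates-++ part₃ (Enumerates-++ part₄ part₅))))
    where
    i<j<len : suc α ≤ suc len
    i<j<len = s≤s i≤len
    part₁ : Enumerates (List.map a (List.filter (Fin._≤? i) joints)) 0 (suc α)
    part₁ = cast-enumerates refl (+-identityʳ _) (run-map
      (select 0 (suc α) z≤n i<j<len (Fin._≤? i) (λ k p → z≤n , s≤s p) (λ { k _ (s≤s p) → p })) 0 a
      (λ { k _ (s≤s p) → trans (posA-≤ p) (sym (+-identityʳ _)) }))
    part₂ : Enumerates (List.mapMaybe prime joints) (suc α) (suc β)
    part₂ = cast-enumerates (+-identityʳ _) (+-identityʳ _)
      (selectMaybe (suc α) (suc β) 0 (ℕ.m<n⇒m<1+n i<j) (s≤s j≤len) prime prime-out prime-in)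
    part₃ : Enumerates (List.reverse (List.map a (List.filter (isMid i j) joints))) (suc β) (β + δ)
    part₃ = run-reverse (select (suc α) β i<j (m≤n⇒m≤1+n j≤len) (isMid i j) (λ k p → p) (λ k p q → p , q))
      (β + β) a
      (λ k p q → trans (cong (_+ toℕ k) (posA-mid p q)) (m∸n+n≡m (≤-trans (<⇒≤ q) (m≤m+n _ _))))
      refl
      (trans (+-suc (β + δ) α) (cong suc (trans (+-comm (β + δ) α) (sym j+j≡i+[j+δ]))))
    part₄ : Enumerates (List.mapMaybe doublePrime joints) (β + δ) (β + shift)
    part₄ = cast-enumerates i+shift≡j+δ refl
      (selectMaybe α β shift (<⇒≤ i<j) (m≤n⇒m≤1+n j≤len) doublePrime doublePrime-out doublePrime-in)
    part₅ : Enumerates (List.map a (List.filter (j Fin.≤?_) joints)) (β + shift) (suc len + shift)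
    part₅ = run-map (select β (suc len) (m≤n⇒m≤1+n j≤len) ≤-refl (j Fin.≤?_)
      (λ k p → p , toℕ<n k) (λ k p _ → p)) shift a (λ k p _ → posA-≥ p)

  private
    enumerates-≤ : ∀ {vs n m} → Enumerates vs n m → n ≤ m
    enumerates-≤ []      = ≤-refl
    enumerates-≤ (_ ∷ e) = <⇒≤ (enumerates-≤ e)

    enumerates-unique : ∀ {us vs n m} → Enumerates us n m → Enumerates vs n m → us ≡ vs
    enumerates-unique []       []         = refl
    enumerates-unique []       (_ ∷ e)    = contradiction (enumerates-≤ e) (<-irrefl refl)
    enumerates-unique (_ ∷ e)  []         = contradiction (enumerates-≤ e) (<-irrefl refl)
    enumerates-unique (p ∷ e)  (q ∷ e′)   = cong₂ _∷_ (pos-injective (trans p (sym q))) (enumerates-unique e e′)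

    enumerates-tabulate : ∀ m {n} (f : Fin m → Var) → (∀ x → pos (f x) ≡ n + toℕ x) → Enumerates (List.tabulate f) n (n + m)
    enumerates-tabulate zero    {n} f eq = cast-enumerates refl (sym (+-identityʳ n)) []
    enumerates-tabulate (suc m) {n} f eq = trans (eq zero) (+-identityʳ n) ∷
      cast-enumerates refl (sym (+-suc n m)) (enumerates-tabulate m (f ∘ suc) λ x → trans (eq (suc x)) (+-suc n (toℕ x)))

  unfoldsTo : UnfoldsTo unfoldedCaterpillar
  unfoldsTo = record
    { iso       = proj₁ unfolded-≅
    ; iso-spine = trans (List.map-cong (proj₂ unfolded-≅) (allFin (suc len + shift)))
        (trans (List.map-∘ (allFin (suc len + shift))) (cong (List.map inj₁) (trans (List.map-tabulate id varAt)
          (enumerates-unique (enumerates-tabulate (suc len + shift) varAt (λ t → pos-var (toℕ t) (toℕ<n t))) spine-enumerates))))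
    }

  module _ {D : Caterpillar τ} (u : UnfoldsTo D) where

    open UnfoldsTo u

    private
      positions : ∀ m {X : Set} (h : Fin m → Var ⊎ X) vs {n n′} → List.tabulate h ≡ List.map inj₁ vs → Enumerates vs n n′ →
                  n + m ≡ n′ × (∀ t → ∃[ v ] h t ≡ inj₁ v × pos v ≡ n + toℕ t)
      positions zero    h [] {n} eq [] = +-identityʳ n , λ ()
      positions (suc m) h (v ∷ vs) {n} eq (p ∷ e) =
        let len≡ , f = positions m (h ∘ suc) vs (List.∷-injectiveʳ eq) e in
        trans (+-suc n m) len≡ ,
        λ { zero    → v , List.∷-injectiveˡ eq , trans p (sym (+-identityʳ n))
          ; (suc t) → let v , eq , q = f t in v , eq , trans q (sym (+-suc n (toℕ t))) }

      all-positions = positions (suc (Caterpillar.len D)) (λ k → _≅_.to iso (inj₁ k)) spine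
        (trans (sym (List.map-tabulate id _)) iso-spine) spine-enumerates

    unfoldsTo-len : Caterpillar.len D ≡ len + shift
    unfoldsTo-len = ℕ.suc-injective (proj₁ all-positions)

    -- The prescribed spine determines the position of every joint in any presentation of the
    -- unfolding, not only in `unfoldedCaterpillar`.
    unfoldsTo-joint : ∀ t → ∃[ v ] _≅_.to iso (inj₁ t) ≡ inj₁ v × pos v ≡ toℕ t
    unfoldsTo-joint = proj₂ all-positions

-- Words of unfoldings

module _ {τ : Signature} (C : Caterpillar τ) (i j : Joint C) (i<j : i Fin.< j) where

  open Words (Item τ)
  open Caterpillar C
  open Unfolded C i j i<j
  open UnfoldedCaterpillar C i j i<j

  module _ (A u B : Word) (sp : Spells C (A ++ u ++ B)) (#A : #links A ≡ α) (#u : #links A + #links u ≡ β) where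

    private
      i₀ = i
      w  = A ++ u ++ B
      w′ = A ++ u ++ inv u ++ u ++ B

      #u≡δ : #links u ≡ δ
      #u≡δ = sym (trans (cong₂ _∸_ (sym #u) (sym #A)) (m+n∸m≡n (#links A) (#links u)))

      w≡ : (A ++ u) ++ B ≡ w
      w≡ = ++-assoc A u B

      w′≡ : (A ++ u) ++ inv u ++ u ++ B ≡ w′
      w′≡ = ++-assoc A u _

      w′≡′ : ((A ++ u) ++ inv u) ++ u ++ B ≡ w′
      w′≡′ = trans (++-assoc (A ++ u) (inv u) _) w′≡

      #Au : #links (A ++ u) ≡ β
      #Au = trans (#links-++ A u) #u

      #Auu : #links ((A ++ u) ++ inv u) ≡ β + δ
      #Auu = trans (#links-++ (A ++ u) (inv u)) (cong₂ _+_ #Au (trans (#links-inv u) #u≡δ))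

      offset : ∀ {k} → α ≤ k → #links A + (k ∸ α) ≡ k
      offset ge = trans (cong (_+ (_ ∸ α)) #A) (m+[n∸m]≡n ge)

      shifted : ∀ {k} → α ≤ k → #links ((A ++ u) ++ inv u) + (k ∸ α) ≡ k + shift
      shifted {k} ge = begin
        #links ((A ++ u) ++ inv u) + (k ∸ α) ≡⟨ cong (_+ (k ∸ α)) (trans #Auu (sym i+shift≡j+δ)) ⟩
        α + shift + (k ∸ α)              ≡⟨ cong (_+ (k ∸ α)) (+-comm α shift) ⟩
        shift + α + (k ∸ α)              ≡⟨ +-assoc shift α _ ⟩
        shift + (α + (k ∸ α))            ≡⟨ cong (shift +_) (m+[n∸m]≡n ge) ⟩
        shift + k                                ≡⟨ +-comm shift k ⟩
        k + shift ∎
        where open ≡-Reasoning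

      -- r is the distance from the second copy's start, s that from the first's.
      mirrored : ∀ {e k} → α ≤ k → k ≤ β → ∀ c → c + (e + k) ≡ β + β → β ≤ e →
                 c + (e ∸ β + (k ∸ α)) ≡ #links u
      mirrored {e} {k} i≤k k≤j c eq j≤e = ℕ.+-cancelˡ-≡ (α + β) _ _ (begin
        α + β + (c + (r + s))   ≡⟨ +-solve α β c r s ⟩
        c + ((β + r) + (α + s)) ≡⟨ cong₂ (λ p q → c + (p + q)) (m+[n∸m]≡n j≤e) (m+[n∸m]≡n i≤k) ⟩
        c + (e + k)                     ≡⟨ eq ⟩
        β + β                   ≡⟨ trans j+j≡i+[j+δ] (sym (+-assoc α β δ)) ⟩
        α + β + δ               ≡⟨ cong (α + β +_) #u≡δ ⟨
        α + β + #links u ∎)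
        where
        open ≡-Reasoning
        r = e ∸ β
        s = k ∸ α
        +-solve : ∀ a b c r s → a + b + (c + (r + s)) ≡ c + ((b + r) + (a + s))
        +-solve = solve-∀

      second : ∀ {e} → β ≤ e → #links (A ++ u) + (e ∸ β) ≡ e
      second ge = trans (cong (_+ (_ ∸ β)) #Au) (m+[n∸m]≡n ge)

      nth-within : ∀ {k} → α ≤ k → nthLink w k ≡ nthLink (u ++ B) (k ∸ α)
      nth-within ge = trans (cong (nthLink w) (sym (offset ge))) (nthLink-++ʳ A (u ++ B) _)

      ∸-< : ∀ {k} → α ≤ k → k < β → k ∸ α < #links u
      ∸-< ge lt = subst (_ <_) (sym #u≡δ) (ℕ.∸-monoˡ-< lt ge)

      j≤e : ∀ {e k} → k < β → suc (e + k) ≡ β + β → β ≤ e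
      j≤e {e} {k} lt eq = ≮⇒≥ λ e<j → <-irrefl (trans (+-suc e k) eq) (ℕ.+-mono-<-≤ e<j lt)

      -- The ranges correspond to the parts `A ++ u`, `inv u` and `u ++ B` of the expanded word;
      -- only in the second does the sign of the letter change.
      nth-range : ∀ {k e b σ φ} → Range k e b → nthLink w k ≡ just (σ , φ) →
                  ∃[ σ′ ] nthLink w′ e ≡ just (σ′ , φ) × orient b (orient σ φ) ≡ orient σ′ φ
      nth-range {k} (before lt refl) nth = _ , trans (cong (λ w → nthLink w k) (sym w′≡))
        (trans (nthLink-++ˡ (A ++ u) _ (subst (k <_) (sym #Au) lt))
          (trans (sym (nthLink-++ˡ (A ++ u) B (subst (k <_) (sym #Au) lt))) (trans (cong (λ w → nthLink w k) w≡) nth))) , refl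
      nth-range {k} {e} {σ = σ} {φ} (within ge lt eq) nth = not σ , (begin
        nthLink w′ e ≡⟨ cong₂ nthLink (sym w′≡) (sym (second (j≤e lt eq))) ⟩
        nthLink ((A ++ u) ++ inv u ++ u ++ B) (#links (A ++ u) + (e ∸ β)) ≡⟨ nthLink-++ʳ (A ++ u) _ _ ⟩
        nthLink (inv u ++ u ++ B) (e ∸ β) ≡⟨ nthLink-++ˡ (inv u) _ r< ⟩
        nthLink (inv u) (e ∸ β)
          ≡⟨ nthLink-inv u m (trans (sym (nthLink-++ˡ u B (∸-< ge lt))) (trans (sym (nth-within ge)) nth)) ⟩
        just (not σ , φ) ∎) , sym (orient-not σ φ)
        where
        open ≡-Reasoning
        m = mirrored {e} {k} ge (<⇒≤ lt) 1 eq (j≤e lt eq)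
        r< : e ∸ β < #links (inv u)
        r< = subst (_ <_) (trans m (sym (#links-inv u))) (s≤s (m≤m+n _ _))
      nth-range {k} (after ge refl) nth = _ , trans (cong₂ nthLink (sym w′≡′) (sym (shifted ge)))
        (trans (nthLink-++ʳ ((A ++ u) ++ inv u) (u ++ B) _) (trans (sym (nth-within ge)) nth)) , refl

      legs-early : ∀ {k ψ} → k < β → ψ ∈ legsOf w k → ψ ∈ legsOf w′ k
      legs-early {k} {ψ} lt i with ∈legsOf-++⁻ (A ++ u) B k (subst (λ w → ψ ∈ legsOf w k) (sym w≡) i)
      ... | inj₁ (i′ , _) = subst (λ w → ψ ∈ legsOf w k) w′≡ (∈legsOf-++ˡ (A ++ u) _ k i′)
      ... | inj₂ (s , refl , _) = contradiction lt (≤⇒≯ (subst (_≤ _) #Au (m≤m+n _ s)))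

      legs-tail : ∀ {k ψ} → α < k → ψ ∈ legsOf w k → ψ ∈ legsOf (u ++ B) (k ∸ α)
      legs-tail {k} {ψ} gt i with ∈legsOf-++⁻ A (u ++ B) k i
      ... | inj₁ (_ , le) = contradiction (subst (k ≤_) #A le) (<⇒≱ gt)
      ... | inj₂ (s , refl , i′) = subst (λ t → ψ ∈ legsOf (u ++ B) t)
        (trans (sym (m+n∸m≡n (#links A) s)) (cong (#links A + s ∸_) #A)) i′

      legs-late : ∀ {k ψ} → α < k → ψ ∈ legsOf w k → ψ ∈ legsOf w′ (k + shift)
      legs-late {k} {ψ} gt i = subst₂ (λ w t → ψ ∈ legsOf w t) w′≡′ (shifted (<⇒≤ gt))
        (∈legsOf-++ʳ ((A ++ u) ++ inv u) (u ++ B) _ (legs-tail gt i))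

      legs-mid : ∀ {k ψ} → α < k → k < β → ψ ∈ legsOf w k → ψ ∈ legsOf w′ (β + β ∸ k)
      legs-mid {k} {ψ} gt lt i with ∈legsOf-++⁻ u B (k ∸ toℕ i₀) (legs-tail gt i)
      ... | inj₂ (s , eq , _) = contradiction (∸-< (<⇒≤ gt) lt) (≤⇒≯ (subst (#links u ≤_) (sym eq) (m≤m+n _ s)))
      ... | inj₁ (i′ , _) = subst₂ (λ w t → ψ ∈ legsOf w t) w′≡ (second j≤)
        (∈legsOf-++ʳ (A ++ u) (inv u ++ u ++ B) _ (∈legsOf-++ˡ (inv u) _ _
          (∈legsOf-inv u (mirrored (<⇒≤ gt) (<⇒≤ lt) 0 (m∸n+n≡m (≤-trans (<⇒≤ lt) (m≤m+n _ _))) j≤) i′)))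
        where
        j≤ : β ≤ β + β ∸ k
        j≤ = subst (_≤ β + β ∸ k) (m+n∸n≡m β β) (ℕ.∸-monoʳ-≤ (β + β) (<⇒≤ lt))

      legsIf-∈ : ∀ {P : Set} (d : Dec P) {ψs : List (Leg τ)} {ψ} → ψ ∈ legsIf ⌊ d ⌋ ψs → P × ψ ∈ ψs
      legsIf-∈ (yes p) i = p , i

      legs-var : ∀ v {ψ} → ψ ∈ legsAt v → ψ ∈ legsOf w′ (pos v)
      legs-var (a k) {ψ} i with place k
      ... | early p = subst (λ t → ψ ∈ legsOf w′ t) (sym (posA-≤ p)) (legs-early (≤-<-trans p i<j) (Spells.legs⊆ sp k i))
      ... | mid p q = subst (λ t → ψ ∈ legsOf w′ t) (sym (posA-mid p q)) (legs-mid p q (Spells.legs⊆ sp k i))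
      ... | late p  = subst (λ t → ψ ∈ legsOf w′ t) (sym (posA-≥ p)) (legs-late (<-≤-trans i<j p) (Spells.legs⊆ sp k i))
      legs-var (a′ k _ _) i = let lt , i′ = legsIf-∈ (k Fin.<? j) i in legs-early lt (Spells.legs⊆ sp k i′)
      legs-var (a″ k _ _) i′ = let gt , i″ = legsIf-∈ (i Fin.<? k) i′ in legs-late gt (Spells.legs⊆ sp k i″)

    -- This is the link between expansions of words and unfoldings of caterpillars.
    spells-unfolded : Spells unfoldedCaterpillar w′
    spells-unfolded = record
      { length≡ = begin
          #links w′ ≡⟨ cong #links w′≡′ ⟨
          #links (((A ++ u) ++ inv u) ++ u ++ B) ≡⟨ #links-++ ((A ++ u) ++ inv u) _ ⟩
          #links ((A ++ u) ++ inv u) + #links (u ++ B) ≡⟨ cong (_+ #links (u ++ B)) (trans #Auu (sym i+shift≡j+δ)) ⟩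
          α + shift + #links (u ++ B) ≡⟨ cong (λ z → z + shift + #links (u ++ B)) #A ⟨
          #links A + shift + #links (u ++ B) ≡⟨ +-swap (#links A) shift _ ⟩
          #links A + #links (u ++ B) + shift ≡⟨ cong (_+ shift) (trans (sym (#links-++ A (u ++ B))) (Spells.length≡ sp)) ⟩
          len + shift ∎
      ; links≡ = λ e →
          let E = edge (toℕ e) (toℕ<n e)
              σ , φ , nth , eq = Spells.links≡ sp (Edge.k E)
              σ′ , nth′ , eq′ = nth-range (Edge.range E) nth
          in σ′ , φ , nth′ , trans (cong (orient (Edge.forward E)) eq) eq′
      ; legs⊆ = λ t {ψ} i → subst (λ s → ψ ∈ legsOf w′ s) (pos-var (toℕ t) (toℕ<n t)) (legs-var (varAt t) i)
      }
      where
      open ≡-Reasoning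
      +-swap : ∀ a b c → a + b + c ≡ a + c + b
      +-swap = solve-∀

    module _ (em : EM) (𝔸 : Structure τ) where

      unfolded-hom : ∀ {f} → Traces.Trace em 𝔸 w′ f → unfolded ⟶ 𝔸
      unfolded-hom tr = _∘ₕ_ {ℂ = 𝔸} (spelled-hom em 𝔸 spells-unfolded tr) (≅-from (proj₁ unfolded-≅))

-- Foldings and separating chains

module _ {τ : Signature} where

  open Words (Item τ)

  legsOf-bound : ∀ (w : Word) t {ψ} → ψ ∈ legsOf w t → t ≤ #links w
  legsOf-bound ((_ , unary _) ∷ w)  zero    i = z≤n
  legsOf-bound ((_ , unary _) ∷ w)  (suc t) i = legsOf-bound w (suc t) i
  legsOf-bound ((_ , binary _) ∷ w) (suc t) i = s≤s (legsOf-bound w t i)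

  nthLink-bound : ∀ (w : Word) t {l} → nthLink w t ≡ just l → t < #links w
  nthLink-bound ((_ , unary _) ∷ w)  t       eq = nthLink-bound w t eq
  nthLink-bound ((_ , binary _) ∷ w) zero    eq = s≤s z≤n
  nthLink-bound ((_ , binary _) ∷ w) (suc t) eq = s≤s (nthLink-bound w t eq)

  module _ (em : EM) (𝔸 : Structure τ) where

    open Traces em 𝔸

    private
      orient-step : ∀ σ φ {x y} → LinkRel 𝔸 (orient σ φ) x y → Step (σ , binary φ) x y
      orient-step true  φ r                   = r
      orient-step false φ (r , R , eqx , eqy) = r , R , eqy , eqx

      leg-step : ∀ σ {ψ x} → LegRel 𝔸 ψ x → Step (σ , unary ψ) x x
      leg-step true  r = refl , r
      leg-step false r = refl , r

    Trace⇒Path : ∀ w {f} → Trace w f → Path w (f 0) (f (#links w))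
    Trace⇒Path [] tr = refl
    Trace⇒Path ((σ , unary ψ) ∷ w) {f} (links , legs) =
      _ , leg-step σ (legs 0 (here refl)) , Trace⇒Path w (links , λ { zero i → legs 0 (there i) ; (suc t) i → legs (suc t) i })
    Trace⇒Path ((σ , binary φ) ∷ w) {f} (links , legs) =
      _ , orient-step σ φ (links 0 refl) , Trace⇒Path w {f ∘ suc} ((λ t → links (suc t)) , (λ t → legs (suc t)))

    caterpillar-Path : ∀ ψ ψ′ w → ⟦ caterpillar ψ ψ′ w ⟧ ⟶ 𝔸 → ∃₂ λ b c → Path (padded ψ ψ′ w) b c
    caterpillar-Path ψ ψ′ w g = _ , _ , Trace⇒Path w′ {f} (links , legs)
      where
      w′ = padded ψ ψ′ w
      C  = caterpillar ψ ψ′ w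
      f′ : ∀ t → Dec (t < suc (#links w′)) → Carrier 𝔸
      f′ t (yes p) = proj₁ g (inj₁ (fromℕ< p))
      -- Positions beyond the spine are irrelevant and get a default value.
      f′ t (no _)  = proj₁ g (inj₁ zero)
      f : ℕ → Carrier 𝔸
      f t = f′ t (t <? suc (#links w′))
      f-joint : ∀ t (k : Joint C) → toℕ k ≡ t → f t ≡ proj₁ g (inj₁ k)
      f-joint t k refl with toℕ k <? suc (#links w′)
      ... | yes p = cong (proj₁ g ∘ inj₁) (Fin.fromℕ<-toℕ k p)
      ... | no ¬p = contradiction (toℕ<n k) ¬p
      links : ∀ t {σ φ} → nthLink w′ t ≡ just (σ , φ) → LinkRel 𝔸 (orient σ φ) (f t) (f (suc t))
      links t {σ} {φ} nth with k ← fromℕ< (nthLink-bound w′ t nth) in eqk =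
        let toℕk = trans (cong toℕ (sym eqk)) (toℕ-fromℕ< _)
            σ′ , φ′ , nth′ , eq = linkOf-nthLink w′ k
            same = just-injective (trans (sym nth′) (trans (cong (nthLink w′) toℕk) nth))
        in subst₂ (LinkRel 𝔸 (orient σ φ)) (sym (f-joint t (inject₁ k) (trans (toℕ-inject₁ k) toℕk)))
             (sym (f-joint (suc t) (suc k) (cong suc toℕk)))
             (subst (λ φ → LinkRel 𝔸 φ (proj₁ g (inj₁ (inject₁ k))) (proj₁ g (inj₁ (suc k))))
               (trans eq (cong (λ l → orient (proj₁ l) (proj₂ l)) same)) (hom-link C 𝔸 g k))
      legs : ∀ t {ψ} → ψ ∈ legsOf w′ t → LegRel 𝔸 ψ (f t)
      legs t {ψ″} i with k ← fromℕ< (s≤s (legsOf-bound w′ t i)) in eqk =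
        let toℕk = trans (cong toℕ (sym eqk)) (toℕ-fromℕ< _) in
        subst (LegRel 𝔸 ψ″) (sym (f-joint t k toℕk)) (hom-leg C 𝔸 g k (subst (λ t → ψ″ ∈ legsOf w′ t) (sym toℕk) i))

    Path-padded⁺ : ∀ ψ ψ′ w {b c} → LegRel 𝔸 ψ b → LegRel 𝔸 ψ′ c → Path w b c → Path (padded ψ ψ′ w) b c
    Path-padded⁺ ψ ψ′ w r r′ p = _ , (refl , r) , Path-++⁺ w p (_ , (refl , r′) , refl)

    Path-padded⁻ : ∀ ψ ψ′ w {b c} → Path (padded ψ ψ′ w) b c → LegRel 𝔸 ψ b × LegRel 𝔸 ψ′ c × Path w b c
    Path-padded⁻ ψ ψ′ w (_ , (refl , r) , p) with Path-++⁻ w p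
    ... | _ , q , _ , (refl , r′) , refl = r , r′ , q

    legs-only : ∀ u {b c} → #links u ≡ 0 → Path u b c → b ≡ c
    legs-only []                     eq p                = p
    legs-only ((true , unary _) ∷ u)  eq (_ , (refl , _) , p) = legs-only u eq p
    legs-only ((false , unary _) ∷ u) eq (_ , (refl , _) , p) = legs-only u eq p

    -- Without links, `u` is a product of partial identities, so a path passes its three copies
    -- without moving and can pass one of them instead.
    Path-without : ∀ A u B {b c} → #links u ≡ 0 → Path (A ++ u ++ inv u ++ u ++ B) b c → Path (A ++ u ++ B) b c
    Path-without A u B eq p with Path-++⁻ A p
    ... | _ , pA , q with Path-++⁻ u q
    ... | _ , pu , q with Path-++⁻ (inv u) q
    ... | _ , pi , q with Path-++⁻ u q
    ... | _ , pu′ , pB with legs-only u eq pu | legs-only (inv u) (trans (#links-inv u) eq) pi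
    ... | refl | refl = Path-++⁺ A pA (Path-++⁺ u pu′ pB)

module _ (em : EM) {τ : Signature} (𝔹 : Structure τ) (ψ ψ′ : Leg τ) where

  open Words (Item τ)
  open Traces em 𝔹
  open Foldings em (sem 𝔹) (LegRel 𝔹 ψ) (LegRel 𝔹 ψ′)

  private
    record Factor (w w′ : Word) : Set where
      field
        {A u B} : Word
        w≡  : w ≡ A ++ u ++ B
        w′≡ : w′ ≡ A ++ u ++ inv u ++ u ++ B

    factor : ∀ {m} pre (vs : Vec Word m) y i {v} → lookup vs i ⇝₁ v →
             Factor (pre ++ flatten vs y) (pre ++ flatten (vs [ i ]≔ v) y)
    factor pre (_ ∷ vs) y zero (expand a u b) = record
      { A = pre ++ a ; u = u ; B = b ++ flatten vs y
      ; w≡  = trans (cong (pre ++_) (trans (++-assoc a _ _) (cong (a ++_) (++-assoc u b _)))) (sym (++-assoc pre a _))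
      ; w′≡ = trans (cong (pre ++_) (trans (++-assoc a _ _) (cong (a ++_) (trans (++-assoc u _ _)
          (cong (u ++_) (trans (++-assoc (inv u) _ _) (cong (inv u ++_) (++-assoc u b _)))))))) (sym (++-assoc pre a _))
      }
    factor pre (v₀ ∷ vs) y (suc i) s with factor (pre ++ v₀) vs y i s
    ... | F = record
      { A = Factor.A F ; u = Factor.u F ; B = Factor.B F
      ; w≡  = trans (sym (++-assoc pre v₀ _)) (Factor.w≡ F)
      ; w′≡ = trans (sym (++-assoc pre v₀ _)) (Factor.w′≡ F)
      }

    #links-≤ : ∀ (u v : Word) → #links u ≤ #links (u ++ v)
    #links-≤ u v = subst (#links u ≤_) (sym (#links-++ u v)) (m≤m+n _ _)

    factor-low : ∀ {m} pre (vs : Vec Word m) y i {v} (s : lookup vs i ⇝₁ v) →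
                 #links pre ≤ #links (Factor.A (factor pre vs y i s))
    factor-low pre (_ ∷ vs)  y zero (expand a u b) = #links-≤ pre a
    factor-low pre (v₀ ∷ vs) y (suc i) s = ≤-trans (#links-≤ pre v₀) (factor-low (pre ++ v₀) vs y i s)

    -- The factors follow one another, which becomes the condition on the intervals of a folding.
    factor-order : ∀ {m} pre (vs : Vec Word m) y {i l v v′} (s : lookup vs i ⇝₁ v) (s′ : lookup vs l ⇝₁ v′) → i Fin.< l →
                   #links (Factor.A (factor pre vs y i s)) + #links (Factor.u (factor pre vs y i s)) ≤
                   #links (Factor.A (factor pre vs y l s′))
    factor-order pre (_ ∷ vs) y {zero} {suc l} (expand a u b) s′ lt =
      ≤-trans (≤-trans (≤-reflexive (sym (#links-++ (pre ++ a) u)))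
        (subst (#links ((pre ++ a) ++ u) ≤_) (cong #links assoc) (#links-≤ ((pre ++ a) ++ u) b)))
        (factor-low (pre ++ a ++ u ++ b) vs y l s′)
      where
      assoc : ((pre ++ a) ++ u) ++ b ≡ pre ++ a ++ u ++ b
      assoc = trans (++-assoc (pre ++ a) u b) (++-assoc pre a _)
    factor-order pre (v₀ ∷ vs) y {suc i} {suc l} s s′ (s≤s lt) = factor-order (pre ++ v₀) vs y s s′ lt

  good-hom : ∀ {C w} → Spells C w → Good w → ⟦ C ⟧ ⟶ 𝔹
  good-hom {w = w} sp (_ , _ , _ , _ , p) = spelled-hom em 𝔹 sp (proj₁ (proj₂ (Path⇒Trace w p)))

  -- The expanded factors become intervals of joints in the caterpillar of the whole word, and the
  -- legs `ψ` and `ψ′` at its ends express the conditions on the end points of paths.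
  closed⇒folding-closed : ∀ {N} → ClosedUnderFoldings N (CSP 𝔹) → FoldingClosed N
  closed⇒folding-closed {N} closed vs y steps
    with Fin.any? (λ i → #links (Factor.u (factor [] vs y i (proj₁ (proj₂ (steps i))))) ℕ.≟ 0)
  -- An expansion of legs alone is not an unfolding, which needs `i < j`; but it can be undone in
  -- the path directly.
  ... | yes (i , eq) =
    let F = factor [] vs y i (proj₁ (proj₂ (steps i)))
        b , c , Pb , Qc , p = proj₂ (proj₂ (steps i))
    in b , c , Pb , Qc , subst (λ w → Path w b c) (sym (Factor.w≡ F))
         (Path-without em 𝔹 (Factor.A F) (Factor.u F) (Factor.B F) eq (subst (λ w → Path w b c) (Factor.w′≡ F) p))
  ... | no ¬legs =
    let b , c , p = caterpillar-Path em 𝔹 ψ ψ′ w (proj₂ closed-C)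
        Pb , Qc , q = Path-padded⁻ em 𝔹 ψ ψ′ w p
    in b , c , Pb , Qc , q
    where
    w = flatten vs y
    C = caterpillar ψ ψ′ w
    F : ∀ k → Factor w (flatten (vs [ k ]≔ proj₁ (steps k)) y)
    F k = factor [] vs y k (proj₁ (proj₂ (steps k)))
    A u B : Fin N → Word
    A k = (true , unary ψ) ∷ Factor.A (F k)
    u k = Factor.u (F k)
    B k = Factor.B (F k) ++ (true , unary ψ′) ∷ []
    w≡ : ∀ k → padded ψ ψ′ w ≡ A k ++ u k ++ B k
    w≡ k = cong (_ ∷_) (trans (cong (_++ _) (Factor.w≡ (F k)))
      (trans (++-assoc (Factor.A (F k)) _ _) (cong (Factor.A (F k) ++_) (++-assoc (u k) _ _))))
    w′≡ : ∀ k → padded ψ ψ′ (flatten (vs [ k ]≔ proj₁ (steps k)) y) ≡ A k ++ u k ++ inv (u k) ++ u k ++ B k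
    w′≡ k = cong (_ ∷_) (trans (cong (_++ _) (Factor.w′≡ (F k))) (trans (++-assoc (Factor.A (F k)) _ _)
      (cong (Factor.A (F k) ++_) (trans (++-assoc (u k) _ _) (cong (u k ++_)
        (trans (++-assoc (inv (u k)) _ _) (cong (inv (u k) ++_) (++-assoc (u k) _ _))))))))
    bound : ∀ k → #links (A k) + #links (u k) ≤ #links (padded ψ ψ′ w)
    bound k = subst₂ _≤_ (#links-++ (A k) (u k)) (cong #links (trans (++-assoc (A k) (u k) (B k)) (sym (w≡ k))))
      (#links-≤ (A k ++ u k) (B k))
    i< : ∀ k → #links (A k) < suc (#links (padded ψ ψ′ w))
    i< k = s≤s (≤-trans (m≤m+n _ _) (bound k))
    i j : Fin N → Joint C
    i k = fromℕ< (i< k)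
    j k = fromℕ< (s≤s (bound k))
    #A : ∀ k → #links (A k) ≡ toℕ (i k)
    #A k = sym (toℕ-fromℕ< (i< k))
    #u : ∀ k → #links (A k) + #links (u k) ≡ toℕ (j k)
    #u k = sym (toℕ-fromℕ< (s≤s (bound k)))
    i<j : ∀ k → i k Fin.< j k
    i<j k = subst₂ _<_ (#A k) (#u k) (m<m+n _ (ℕ.n≢0⇒n>0 λ eq → ¬legs (k , eq)))
    ordered : ∀ {k l} → k Fin.< l → j k Fin.≤ i l
    ordered {k} {l} lt = subst₂ _≤_ (#u k) (#A l) (factor-order [] vs y (proj₁ (proj₂ (steps k))) (proj₁ (proj₂ (steps l))) lt)
    unfolded-in : ∀ k → CSP 𝔹 (Unfold.unfolded C (i k) (j k) (i<j k))
    unfolded-in k =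
      finite-↔ (bijection-sym (_≅_.bijection (proj₁ (UnfoldedCaterpillar.unfolded-≅ C (i k) (j k) (i<j k))))) (caterpillar-finite em _) ,
      unfolded-hom C (i k) (j k) (i<j k) (A k) (u k) (B k)
        (subst (Spells C) (w≡ k) (spells-caterpillar ψ ψ′ w)) (#A k) (#u k) em 𝔹 (proj₁ (proj₂ (Path⇒Trace (A k ++ u k ++ inv (u k) ++ u k ++ B k) path)))
      where
      bijection-sym : ∀ {X Y : Set} → X ↔ Y → Y ↔ X
      bijection-sym b = mk↔ₛ′ (Inverse.from b) (Inverse.to b) (Inverse.strictlyInverseʳ b) (Inverse.strictlyInverseˡ b)
      b c : Carrier 𝔹
      b = proj₁ (proj₂ (proj₂ (steps k)))
      c = proj₁ (proj₂ (proj₂ (proj₂ (steps k))))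
      path : Path (A k ++ u k ++ inv (u k) ++ u k ++ B k) b c
      path = let _ , _ , Pb , Qc , p = proj₂ (proj₂ (steps k)) in
        subst (λ w → Path w b c) (w′≡ k) (Path-padded⁺ em 𝔹 ψ ψ′ (flatten (vs [ k ]≔ proj₁ (steps k)) y) Pb Qc p)
    closed-C : CSP 𝔹 ⟦ C ⟧
    closed-C = closed C i j i<j ordered ⟦ C ⟧ (λ k → Unfold.unfolded C (i k) (j k) (i<j k)) ≅-refl (λ _ → ≅-refl) unfolded-in

module _ (em : EM) {τ : Signature} (𝔹 : Structure τ) (b₀ : Carrier 𝔹) {n : ℕ}
         (closed : ClosedUnderFoldings (suc n) (CSP 𝔹)) where

  SeparableBetween : Leg τ → Leg τ → Caterpillar τ → Set
  SeparableBetween ψ ψ′ C = Foldings.SeparableWith em (sem 𝔹) (LegRel 𝔹 ψ) (LegRel 𝔹 ψ′) n (word C)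

  -- Any legs at the two ends may serve as the start and the target. An isolated point has none, but
  -- it maps to `b₀`.
  caterpillar-separable : ∀ C → ¬ (⟦ C ⟧ ⟶ 𝔹) → ∃₂ λ ψ ψ′ →
    ψ ∈ Caterpillar.legs C zero × ψ′ ∈ Caterpillar.legs C (fromℕ (Caterpillar.len C)) × SeparableBetween ψ ψ′ C
  caterpillar-separable C ¬hom = go (Caterpillar.ends C)
    where
    open Caterpillar C
    nonempty : ∀ ψs → ψs ≢ [] → ∃[ ψ ] ψ ∈ ψs
    nonempty []      ne = contradiction refl ne
    nonempty (ψ ∷ _) ne = ψ , here refl
    no-leg : ∀ {ψs} {ψ : Leg τ} → ψs ≡ [] → ψ ∈ ψs → ⊥
    no-leg refl ()
    isolated : ∀ m (links : Fin m → Link τ) (legs : Fin (suc m) → List (Leg τ)) → m ≡ 0 → legs zero ≡ [] →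
               (∀ k → LinkRel 𝔹 (links k) b₀ b₀) × (∀ t {ψ} → ψ ∈ legs t → LegRel 𝔹 ψ b₀)
    isolated _ links legs refl eq = (λ ()) , λ { zero i → ⊥-elim (no-leg eq i) }
    go : _ → _
    go (inj₁ (len≡ , legs≡)) =
      let L , ψs = isolated len link legs len≡ legs≡ in contradiction (hom-caterpillar C 𝔹 (λ _ → b₀) L ψs) ¬hom
    go (inj₂ (ne , ne′)) =
      let ψ , ψ∈ = nonempty (legs zero) ne
          ψ′ , ψ′∈ = nonempty (legs (fromℕ len)) ne′
      in ψ , ψ′ , ψ∈ , ψ′∈ , Foldings.folding-closed⇒separable em (sem 𝔹) (LegRel 𝔹 ψ) (LegRel 𝔹 ψ′)
           (closed⇒folding-closed em 𝔹 ψ ψ′ closed) (word C) (¬hom ∘ good-hom em 𝔹 ψ ψ′ (spells-word C))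

-- Chains along caterpillars

module CaterpillarChains (em : EM) {τ : Signature} (𝔹 : Structure τ) where

  open Classical em
  open Words (Item τ)
  open Traces em 𝔹

  forgetMarks : MarkedWord → Word
  forgetMarks = List.map proj₂

  OnLinks : MarkedWord → Set
  OnLinks = All λ (b , _ , x) → b ≡ true → ∃[ φ ] x ≡ binary φ

  leg-step⁻ : ∀ σ {ψ x y} → Step (σ , unary ψ) x y → x ≡ y × LegRel 𝔹 ψ x
  leg-step⁻ true  s          = s
  leg-step⁻ false (refl , r) = refl , r

  leg-step⁺ : ∀ σ {ψ x} → LegRel 𝔹 ψ x → Step (σ , unary ψ) x x
  leg-step⁺ true  r = refl , r
  leg-step⁺ false r = refl , r

  -- A mark on a leg can be moved to the preceding link, or dropped if there is
  -- none: the sets between that link and the leg are enlarged so as to become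
  -- balanced along the legs.  In the second case the mark is still to be
  -- placed.
  Relocated : MarkedWord → (B₁ B₂ : Carrier 𝔹 → Bool) → Set
  Relocated m U V = ∃[ m′ ] forgetMarks m′ ≡ forgetMarks m × OnLinks m′ ×
    ( (#marks m′ ≤ #marks m × Chain m′ U V)
    ⊎ (suc (#marks m′) ≤ #marks m × ∃[ U′ ] (∀ {b} → U b ≡ true → U′ b ≡ true) × Chain m′ U′ V) )

  private
    onLeg : Leg τ → (U V : Carrier 𝔹 → Bool) → Carrier 𝔹 → Bool
    onLeg ψ U V b = if truth (LegRel 𝔹 ψ b) then V b else U b

    onLeg-balanced : ∀ σ ψ U V → BalancedStep (σ , unary ψ) (onLeg ψ U V) V
    onLeg-balanced σ ψ U V {b} s with leg-step⁻ σ {ψ} s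
    ... | refl , r rewrite truth⁺ r = refl

    -- On values that have the leg, `U` is contained in `V` by the forward step; elsewhere `U` is
    -- kept.
    onLeg-⊇ : ∀ σ ψ U V → ForwardStep (σ , unary ψ) U V → ∀ {b} → U b ≡ true → onLeg ψ U V b ≡ true
    onLeg-⊇ σ ψ U V f {b} Ub with decide (LegRel 𝔹 ψ b)
    ... | yes r = f (leg-step⁺ σ {ψ} r) Ub
    ... | no _  = Ub

    balanced⇒forward : ∀ {l U V V′} → BalancedStep l U V → (∀ {b} → V b ≡ true → V′ b ≡ true) → ForwardStep l U V′
    balanced⇒forward s V⊆V′ q Ub = V⊆V′ (trans (sym (s q)) Ub)

  relocate : ∀ {m U V} → Chain m U V → Relocated m U V
  relocate ([] e) = [] , refl , [] , inj₁ (z≤n , [] e)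
  relocate {(false , σ , unary ψ) ∷ m} (free {U = U} {V} s c) with relocate c
  ... | m′ , eq , on , inj₁ (le , c′) = (false , σ , unary ψ) ∷ m′ , cong (_ ∷_) eq , (λ ()) ∷ on , inj₁ (le , free s c′)
  ... | m′ , eq , on , inj₂ (le , V′ , V⊆V′ , c′) = (false , σ , unary ψ) ∷ m′ , cong (_ ∷_) eq , (λ ()) ∷ on ,
    inj₂ (le , onLeg ψ U V′ , onLeg-⊇ σ ψ U V′ (balanced⇒forward {l = σ , unary ψ} {U} {V} s V⊆V′) , free (onLeg-balanced σ ψ U V′) c′)
  relocate {(true , σ , unary ψ) ∷ m} (fixed {U = U} {V} s c) with relocate c
  ... | m′ , eq , on , inj₁ (le , c′) = (false , σ , unary ψ) ∷ m′ , cong (_ ∷_) eq , (λ ()) ∷ on ,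
    inj₂ (s≤s le , onLeg ψ U V , onLeg-⊇ σ ψ U V s , free (onLeg-balanced σ ψ U V) c′)
  ... | m′ , eq , on , inj₂ (le , V′ , V⊆V′ , c′) = (false , σ , unary ψ) ∷ m′ , cong (_ ∷_) eq , (λ ()) ∷ on ,
    inj₂ (m≤n⇒m≤1+n le , onLeg ψ U V′ , onLeg-⊇ σ ψ U V′ (λ q Ub → V⊆V′ (s q Ub)) , free (onLeg-balanced σ ψ U V′) c′)
  relocate {(false , σ , binary φ) ∷ m} (free {U = U} {V} s c) with relocate c
  ... | m′ , eq , on , inj₁ (le , c′) = (false , σ , binary φ) ∷ m′ , cong (_ ∷_) eq , (λ ()) ∷ on , inj₁ (le , free s c′)
  ... | m′ , eq , on , inj₂ (le , V′ , V⊆V′ , c′) = (true , σ , binary φ) ∷ m′ , cong (_ ∷_) eq , (λ _ → φ , refl) ∷ on ,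
    inj₁ (le , fixed (balanced⇒forward {l = σ , binary φ} {U} {V} s V⊆V′) c′)
  relocate {(true , σ , binary φ) ∷ m} (fixed s c) with relocate c
  ... | m′ , eq , on , inj₁ (le , c′) = (true , σ , binary φ) ∷ m′ , cong (_ ∷_) eq , (λ _ → φ , refl) ∷ on , inj₁ (s≤s le , fixed s c′)
  ... | m′ , eq , on , inj₂ (le , V′ , V⊆V′ , c′) = (true , σ , binary φ) ∷ m′ , cong (_ ∷_) eq , (λ _ → φ , refl) ∷ on ,
    inj₁ (m≤n⇒m≤1+n le , fixed (λ q Ub → V⊆V′ (s q Ub)) c′)

  -- The sets on both sides of the legs at each joint.
  record Sets {len} (links : Fin len → Link τ) (legs : Fin (suc len) → List (Leg τ)) (S : Fin len → Bool)
              (U V : Carrier 𝔹 → Bool) : Set where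
    field
      In Out   : Fin (suc len) → Carrier 𝔹 → Bool
      initial    : ∀ x → In zero x ≡ U x
      pass     : ∀ t x → (∀ {ψ} → ψ ∈ legs t → LegRel 𝔹 ψ x) → In t x ≡ Out t x
      forward  : ∀ k {x y} → LinkRel 𝔹 (links k) x y → Out (inject₁ k) x ≡ true → In (suc k) y ≡ true
      balanced : ∀ k → S k ≡ false → ∀ {x y} → LinkRel 𝔹 (links k) x y → Out (inject₁ k) x ≡ In (suc k) y
      final      : ∀ x → Out (fromℕ len) x ≡ V x

  private
    strip-legs : ∀ ψs {m w U V} → forgetMarks m ≡ legWord ψs ++ w → OnLinks m → Chain m U V →
      ∃₂ λ m′ W → forgetMarks m′ ≡ w × OnLinks m′ × #marks m′ ≡ #marks m × Chain m′ W V ×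
      (∀ x → (∀ {ψ} → ψ ∈ ψs → LegRel 𝔹 ψ x) → U x ≡ W x)
    strip-legs [] eq on c = _ , _ , eq , on , refl , c , λ _ _ → refl
    strip-legs (ψ ∷ ψs) {(true , _) ∷ m} eq (o ∷ on) c with List.∷-injectiveˡ eq
    ... | refl with () ← proj₂ (o refl)
    strip-legs (ψ ∷ ψs) {(false , _) ∷ m} eq (_ ∷ on) (free s c) with List.∷-injectiveˡ eq
    ... | refl = 
      let m′ , W , eq′ , on′ , marks , c′ , f = strip-legs ψs (List.∷-injectiveʳ eq) on c
      in m′ , W , eq′ , on′ , marks , c′ , λ x legs → trans (s (refl , legs (here refl))) (f x (legs ∘ there))

  chain-sets : ∀ len (links : Fin len → Link τ) legs {m U V} → forgetMarks m ≡ wordOf len links legs → OnLinks m → Chain m U V →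
               Σ[ S ∈ Subset len ] ∣ S ∣ ≡ #marks m × Sets links legs (lookup S) U V
  chain-sets zero links legs {m} {U} eq on c
    with strip-legs (legs zero) (trans eq (sym (++-identityʳ _))) on c
  ... | [] , W , _ , _ , marks , [] W≗V , f = [] , marks , record
    { In = λ _ → U ; Out = λ _ → W ; initial = λ _ → refl
    ; pass = λ { zero → f } ; forward = λ () ; balanced = λ () ; final = W≗V }
  chain-sets (suc len) links legs {m} {U} eq on c with strip-legs (legs zero) eq on c
  ... | (b , l) ∷ m′ , W , eq′ , _ ∷ on′ , marks , c′ , f with List.∷-injectiveˡ eq′
  ...   | refl with c′
  ...     | free s c″ =
    let S , count≡ , R = chain-sets len (links ∘ suc) (legs ∘ suc) (List.∷-injectiveʳ eq′) on′ c″
        open Sets R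
    in false ∷ S , trans count≡ marks , record
      { In = λ { zero → U ; (suc t) → In t } ; Out = λ { zero → W ; (suc t) → Out t } ; initial = λ _ → refl
      ; pass = λ { zero → f ; (suc t) → pass t }
      ; forward = λ { zero {x} {y} r e → trans (initial y) (trans (sym (s r)) e) ; (suc k) → forward k }
      ; balanced = λ { zero _ {x} {y} r → trans (s r) (sym (initial y)) ; (suc k) → balanced k }
      ; final = final }
  ...     | fixed s c″ =
    let S , count≡ , R = chain-sets len (links ∘ suc) (legs ∘ suc) (List.∷-injectiveʳ eq′) on′ c″
        open Sets R
    in true ∷ S , trans (cong suc count≡) marks , record
      { In = λ { zero → U ; (suc t) → In t } ; Out = λ { zero → W ; (suc t) → Out t } ; initial = λ _ → refl
      ; pass = λ { zero → f ; (suc t) → pass t }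
      ; forward = λ { zero {x} {y} r e → trans (initial y) (s r e) ; (suc k) → forward k }
      ; balanced = λ { zero () ; (suc k) → balanced k }
      ; final = final }

  -- The pairs compatible with all tuples containing d and d′.
  Compatible : (𝔻 : Structure τ) → (d d′ : Carrier 𝔻) → (x y : Carrier 𝔹) → Set
  Compatible 𝔻 d d′ x y = ∀ s t → rel 𝔻 s t → ∀ p q → lookup t p ≡ d → lookup t q ≡ d′ →
                          ∃[ r ] rel 𝔹 s r × lookup r p ≡ x × lookup r q ≡ y

  hom-compatible : ∀ {𝔻 : Structure τ} (g : 𝔻 ⟶ 𝔹) d d′ → Compatible 𝔻 d d′ (proj₁ g d) (proj₁ g d′)
  hom-compatible (g , hom) d d′ s t R p q eqp eqq =
    _ , hom s t R , trans (lookup-map p g t) (cong g eqp) , trans (lookup-map q g t) (cong g eqq)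

  compatible-from : ∀ {𝔻 𝔼 : Structure τ} (g : 𝔻 ⟶ 𝔼) {d d′ e e′ x y} → proj₁ g d ≡ e → proj₁ g d′ ≡ e′ →
                    Compatible 𝔼 e e′ x y → Compatible 𝔻 d d′ x y
  compatible-from (g , hom) refl refl com s t R p q eqp eqq =
    com s (Vec.map g t) (hom s t R) p q (trans (lookup-map p g t) (cong g eqp)) (trans (lookup-map q g t) (cong g eqq))

  -- A certificate that no homomorphism exists: the image of every point lies in its sets, yet
  -- nothing is left at the last one. It refers to the structure only through `Compatible` and
  -- therefore passes through isomorphisms.
  record Derivation (𝔻 : Structure τ) {T} (d : Fin (suc T) → Carrier 𝔻) (S : Fin T → Set) : Set where
    field
      In Out   : Fin (suc T) → Carrier 𝔹 → Bool
      initial    : ∀ x → Compatible 𝔻 (d zero) (d zero) x x → In zero x ≡ true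
      pass     : ∀ t x → Compatible 𝔻 (d t) (d t) x x → In t x ≡ Out t x
      forward  : ∀ k {x y} → Compatible 𝔻 (d (inject₁ k)) (d (suc k)) x y → Out (inject₁ k) x ≡ true → In (suc k) y ≡ true
      balanced : ∀ k → ¬ S k → ∀ {x y} → Compatible 𝔻 (d (inject₁ k)) (d (suc k)) x y → Out (inject₁ k) x ≡ In (suc k) y
      final      : ∀ x → Compatible 𝔻 (d (fromℕ T)) (d (fromℕ T)) x x → Out (fromℕ T) x ≢ true

  derivation⇒¬hom : ∀ {𝔻 T} {d : Fin (suc T) → Carrier 𝔻} {S} → Derivation 𝔻 d S → ¬ (𝔻 ⟶ 𝔹)
  derivation⇒¬hom {𝔻} {T} {d} D g = final _ (com _ _) (trans (sym (pass _ _ (com _ _))) (all (fromℕ T)))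
    where
    open Derivation D
    com = hom-compatible {𝔻} g
    all : ∀ t → In t (proj₁ g (d t)) ≡ true
    all = go T (λ t → In t (proj₁ g (d t)) ≡ true) (initial _ (com _ _))
            (λ k e → forward k (com _ _) (trans (sym (pass _ _ (com _ _))) e))
      where
      go : ∀ m (P : Fin (suc m) → Set) → P zero → (∀ k → P (inject₁ k) → P (suc k)) → ∀ t → P t
      go m P z s zero          = z
      go (suc m) P z s (suc t) = go m (P ∘ suc) (s zero z) (s ∘ suc) t

  module _ (C : Caterpillar τ) where

    open Caterpillar C
    open Database (conjuncts C)

    compatible-link : ∀ k {x y} → Compatible ⟦ C ⟧ (inj₁ (inject₁ k)) (inj₁ (suc k)) x y → LinkRel 𝔹 (link k) x y
    compatible-link k com = com _ _ (tuple (inj₁ k)) _ _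
      (lookup-tuple (inj₁ k) (Link.source (link k)) (lookup-linkAt-source (link k)))
      (lookup-tuple (inj₁ k) (Link.target (link k)) (lookup-linkAt-target (link k)))

    compatible-leg : ∀ t {x ψ} → ψ ∈ legs t → Compatible ⟦ C ⟧ (inj₁ t) (inj₁ t) x x → LegRel 𝔹 ψ x
    compatible-leg t i com with Any.index i | Any.lookup-index i
    ... | l | refl =
      let ψ  = List.lookup (legs t) l
          at = lookup-tuple (inj₂ (t , l)) (Leg.position ψ) (lookup-legAt-position ψ)
          r , R , eq , _ = com _ _ (tuple (inj₂ (t , l))) _ _ at at
      in r , R , eq

    inject₁≢suc : ∀ {m} (k : Fin m) → inject₁ k ≢ suc k
    inject₁≢suc k eq = ℕ.1+n≢n (sym (trans (sym (toℕ-inject₁ k)) (cong toℕ eq)))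

    link-compatible : ∀ k {x y} → LinkRel 𝔹 (link k) x y → Compatible ⟦ C ⟧ (inj₁ (inject₁ k)) (inj₁ (suc k)) x y
    link-compatible k r s _ (tuple c) p q eqp eqq = go c p q
      (lookup-tuple⁻ c p eqp) (lookup-tuple⁻ c q eqq)
      where
      go : ∀ c p q → lookup (Conjunct.args (conjuncts C c)) p ≡ just (inject₁ k) →
           lookup (Conjunct.args (conjuncts C c)) q ≡ just (suc k) →
           ∃[ r ] rel 𝔹 (Conjunct.symbol (conjuncts C c)) r × lookup r p ≡ _ × lookup r q ≡ _
      go (inj₁ k′) p q ep eq with lookup-linkAt (link k′) p ep | lookup-linkAt (link k′) q eq
      ... | inj₁ (_ , e)    | inj₁ (_ , e′)      = contradiction (trans e (sym e′)) (inject₁≢suc k)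
      ... | inj₂ (_ , e)    | inj₂ (_ , e′)      = contradiction (trans e (sym e′)) (inject₁≢suc k)
      ... | inj₁ (refl , _) | inj₂ (refl , refl) = r
      ... | inj₂ (_ , e)    | inj₁ (_ , e′)      = contradiction (trans (sym (toℕ-inject₁ k)) (cong toℕ e))
        λ e″ → <-irrefl refl (≤-trans (≤-reflexive (trans (cong toℕ e′) (toℕ-inject₁ k′))) (≤-trans (n≤1+n _) (≤-reflexive (sym e″))))
      go (inj₂ (t , l)) p q ep eq = contradiction
        (trans (proj₂ (lookup-legAt (List.lookup (legs t) l) p ep)) (sym (proj₂ (lookup-legAt (List.lookup (legs t) l) q eq)))) (inject₁≢suc k)

    -- The only tuples containing a joint are its legs and the adjacent links.
    joint-compatible : ∀ t {x} → (∀ {ψ} → ψ ∈ legs t → LegRel 𝔹 ψ x) →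
      (∀ k → inject₁ k ≡ t → ∃[ y ] LinkRel 𝔹 (link k) x y) → (∀ k → suc k ≡ t → ∃[ y ] LinkRel 𝔹 (link k) y x) →
      Compatible ⟦ C ⟧ (inj₁ t) (inj₁ t) x x
    joint-compatible t {x} ψs out inn s _ (tuple c) p q eqp eqq = go c p q
      (lookup-tuple⁻ c p eqp) (lookup-tuple⁻ c q eqq)
      where
      go : ∀ c p q → lookup (Conjunct.args (conjuncts C c)) p ≡ just t →
           lookup (Conjunct.args (conjuncts C c)) q ≡ just t →
           ∃[ r ] rel 𝔹 (Conjunct.symbol (conjuncts C c)) r × lookup r p ≡ x × lookup r q ≡ x
      go (inj₁ k) p q ep eq with lookup-linkAt (link k) p ep | lookup-linkAt (link k) q eq
      ... | inj₁ (refl , e) | inj₁ (refl , _) = let _ , r , R , es , _ = out k (sym e) in r , R , es , es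
      ... | inj₂ (refl , e) | inj₂ (refl , _) = let _ , r , R , _ , et = inn k (sym e) in r , R , et , et
      ... | inj₁ (_ , e)    | inj₂ (_ , e′)   = contradiction (trans (sym e) e′) (inject₁≢suc k)
      ... | inj₂ (_ , e)    | inj₁ (_ , e′)   = contradiction (trans (sym e′) e) (inject₁≢suc k)
      go (inj₂ (t , l)) p q ep eq with lookup-legAt (List.lookup (legs t) l) p ep | lookup-legAt (List.lookup (legs t) l) q eq
      ... | refl , refl | refl , _ = let r , R , e = ψs (Mem.∈-lookup l) in r , R , e , e

-- Derivations survive unfoldings

module UnfoldedDerivation (em : EM) {τ : Signature} (𝔹 : Structure τ)
                          (C : Caterpillar τ) (i j : Joint C) (i<j : i Fin.< j) where

  open Classical em
  open CaterpillarChains em 𝔹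
  open Caterpillar C
  open Unfolded C i j i<j
  open UnfoldedCaterpillar C i j i<j
  open UnfoldedSpine C i j i<j

  private
    δ>0 : 0 < δ
    δ>0 = ℕ.m<n⇒0<n∸m i<j

    j<j+δ′ : β < β + δ
    j<j+δ′ = m<m+n β δ>0

    conj-compatible : ∀ c {κ x y p q b b′} → conj c ≡ κ →
      lookup (Conjunct.args κ) p ≡ just x → lookup (Conjunct.args κ) q ≡ just y →
      Compatible unfolded (inj₁ x) (inj₁ y) b b′ →
      ∃[ r ] rel 𝔹 (Conjunct.symbol κ) r × lookup r p ≡ b × lookup r q ≡ b′
    conj-compatible c {p = p} {q} refl ep eq com =
      com _ _ (Database.tuple c) p q (Database.lookup-tuple conj c p ep) (Database.lookup-tuple conj c q eq)

    swap : ∀ {𝔻 : Structure τ} {d d′ x y} → Compatible 𝔻 d d′ x y → Compatible 𝔻 d′ d y x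
    swap com s t R p q eqp eqq = let r , S , e , e′ = com s t R q p eqq eqp in r , S , e′ , e

    source≡ : ∀ {e} (E : Edge e) → pos (Edge.x E) ≡ (if Edge.forward E then e else suc e)
    source≡ E = go (Edge.ends E)
      where
      go : ∀ {b e m m′} → (b ≡ true × m ≡ e × m′ ≡ suc e) ⊎ (b ≡ false × m′ ≡ e × m ≡ suc e) → m ≡ (if b then e else suc e)
      go (inj₁ (refl , eq , _)) = eq
      go (inj₂ (refl , _ , eq)) = eq

    target≡ : ∀ {e} (E : Edge e) → pos (Edge.y E) ≡ (if Edge.forward E then suc e else e)
    target≡ E = go (Edge.ends E)
      where
      go : ∀ {b e m m′} → (b ≡ true × m ≡ e × m′ ≡ suc e) ⊎ (b ≡ false × m′ ≡ e × m ≡ suc e) → m′ ≡ (if b then suc e else e)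
      go (inj₁ (refl , _ , eq)) = eq
      go (inj₂ (refl , eq , _)) = eq

    edge-compatible : ∀ {e} (E : Edge e) {v v′ b b′} → pos v ≡ pos (Edge.x E) → pos v′ ≡ pos (Edge.y E) →
                      Compatible unfolded (inj₁ v) (inj₁ v′) b b′ → LinkRel 𝔹 (link (Edge.k E)) b b′
    edge-compatible E {v} {v′} ev ev′ com with pos-injective {v} {Edge.x E} ev | pos-injective {v′} {Edge.y E} ev′
    ... | refl | refl = conj-compatible (Edge.index E) (Edge.conj≡ E)
      (lookup-linkAt-source (link (Edge.k E))) (lookup-linkAt-target (link (Edge.k E))) com

    -- The copy v of the joint k has all the legs and links of k.
    record Over (k : Joint C) (v : Var) : Set where
      field
        legs⊆ : ∀ {ψ} → ψ ∈ legs k → ψ ∈ legsAt v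
        out   : ∀ k₀ → inject₁ k₀ ≡ k → ∃[ e ] Σ[ E ∈ Edge e ] Edge.k E ≡ k₀ × pos v ≡ pos (Edge.x E)
        inn   : ∀ k₀ → suc k₀ ≡ k → ∃[ e ] Σ[ E ∈ Edge e ] Edge.k E ≡ k₀ × pos v ≡ pos (Edge.y E)

    over-compatible : ∀ {k v b} → Over k v → Compatible unfolded (inj₁ v) (inj₁ v) b b → Compatible ⟦ C ⟧ (inj₁ k) (inj₁ k) b b
    over-compatible {k} {v} {b} o com = joint-compatible C k leg⊨ out⊨ inn⊨
      where
      open Over o
      leg⊨ : ∀ {ψ} → ψ ∈ legs k → LegRel 𝔹 ψ b
      leg⊨ i with Any.index (legs⊆ i) | Any.lookup-index (legs⊆ i)
      ... | l | refl =
        let ψ = List.lookup (legsAt v) l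
            r , R , eq , _ = conj-compatible (legIndex v l) (conj-legIndex v l) (lookup-legAt-position ψ) (lookup-legAt-position ψ) com
        in r , R , eq
      out⊨ : ∀ k₀ → inject₁ k₀ ≡ k → ∃[ y ] LinkRel 𝔹 (link k₀) b y
      out⊨ k₀ eq with out k₀ eq
      ... | _ , E , refl , ev with pos-injective {v} {Edge.x E} ev
      ...   | refl =
        let at = lookup-linkAt-source (link (Edge.k E)) {Edge.x E} {Edge.y E}
            r , R , e , _ = conj-compatible (Edge.index E) (Edge.conj≡ E) at at com
        in _ , r , R , e , refl
      inn⊨ : ∀ k₀ → suc k₀ ≡ k → ∃[ y ] LinkRel 𝔹 (link k₀) y b
      inn⊨ k₀ eq with inn k₀ eq
      ... | _ , E , refl , ev with pos-injective {v} {Edge.y E} ev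
      ...   | refl =
        let at = lookup-linkAt-target (link (Edge.k E)) {Edge.x E} {Edge.y E}
            r , R , e , _ = conj-compatible (Edge.index E) (Edge.conj≡ E) at at com
        in _ , r , R , refl , e

    legsIf-yes : ∀ {P : Set} (d : Dec P) {ψs : List (Leg τ)} {ψ} → P → ψ ∈ ψs → ψ ∈ legsIf ⌊ d ⌋ ψs
    legsIf-yes (yes _) p i = i
    legsIf-yes (no ¬p) p i = contradiction p ¬p

    τinj : ∀ {k₀ : Fin len} {k} → inject₁ k₀ ≡ k → toℕ k₀ ≡ toℕ k
    τinj {k₀} refl = sym (toℕ-inject₁ k₀)

    mirror-sum : ∀ {k} → k < β → suc (β + β ∸ suc k + k) ≡ β + β
    mirror-sum {k} lt = trans (sym (+-suc _ k)) (m∸n+n≡m (≤-trans lt (m≤m+n _ _)))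

    suc-mirror : ∀ {k} → k < β → suc (β + β ∸ suc k) ≡ β + β ∸ k
    suc-mirror {k} lt = sym (ℕ.+-∸-assoc 1 (≤-trans lt (m≤m+n β β)))

    over-a : ∀ k → Over k (a k)
    over-a k = record { legs⊆ = id ; out = λ k₀ eq → out k₀ (τinj eq) (place k) ; inn = λ { k₀ refl → inn k₀ (place k) } }
      where
      out : ∀ k₀ → toℕ k₀ ≡ toℕ k → Place k → ∃[ e ] Σ[ E ∈ Edge e ] Edge.k E ≡ k₀ × posA (toℕ k) ≡ pos (Edge.x E)
      out k₀ eq (early p) with toℕ k₀ <? α
      ... | yes q = let E = fixed-early k₀ eq q in _ , E , refl , trans (posA-≤ p) (sym (source≡ E))
      ... | no ¬q = let E = edge₁ k₀ eq (≮⇒≥ ¬q) (≤-<-trans (≤-reflexive eq) (≤-<-trans p i<j)) in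
        _ , E , refl , trans (posA-≤ p) (sym (source≡ E))
      out k₀ eq (mid p q) =
        let q′ = subst (_< β) (sym eq) q
            E  = edge₂ k₀ (subst (α ≤_) (sym eq) (<⇒≤ p)) q′ (mirror-sum q′)
        in _ , E , refl , trans (posA-mid p q) (trans (cong (β + β ∸_) (sym eq)) (trans (sym (suc-mirror q′)) (sym (source≡ E))))
      out k₀ eq (late p) =
        let E = fixed-late k₀ (cong (_+ shift) eq) (subst (β ≤_) (sym eq) p) in _ , E , refl , trans (posA-≥ p) (sym (source≡ E))
      inn : ∀ k₀ → Place (suc k₀) → ∃[ e ] Σ[ E ∈ Edge e ] Edge.k E ≡ k₀ × posA (suc (toℕ k₀)) ≡ pos (Edge.y E)
      inn k₀ (early p) = let E = fixed-early k₀ refl p in _ , E , refl , trans (posA-≤ p) (sym (target≡ E))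
      inn k₀ (mid (s≤s p) q) =
        let E = edge₂ k₀ p (<⇒≤ q) (mirror-sum (<⇒≤ q)) in _ , E , refl , trans (posA-mid (s≤s p) q) (sym (target≡ E))
      inn k₀ (late p) with β ≤? toℕ k₀
      ... | yes q = let E = fixed-late k₀ refl q in _ , E , refl , trans (posA-≥ p) (sym (target≡ E))
      ... | no ¬q = let E = edge₃ k₀ refl (≤-pred (<-≤-trans i<j p)) (≰⇒> ¬q) in _ , E , refl , trans (posA-≥ p) (sym (target≡ E))

    over-a′ : ∀ k .p .q → α < toℕ k → toℕ k < β → Over k (a′ k p q)
    over-a′ k p q gt lt = record
      { legs⊆ = legsIf-yes (k Fin.<? j) lt
      ; out = λ k₀ eq → let E = edge₁ k₀ (τinj eq) (subst (α ≤_) (sym (τinj eq)) (<⇒≤ gt)) (subst (_< β) (sym (τinj eq)) lt) in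
          _ , E , refl , sym (source≡ E)
      ; inn = λ { k₀ refl → let E = edge₁ k₀ refl (≤-pred gt) (<⇒≤ lt) in _ , E , refl , sym (target≡ E) }
      }

    over-a″ : ∀ k .p .q → α < toℕ k → toℕ k < β → Over k (a″ k p q)
    over-a″ k p q gt lt = record
      { legs⊆ = legsIf-yes (i Fin.<? k) gt
      ; out = λ k₀ eq → let E = edge₃ k₀ (cong (_+ shift) (τinj eq)) (subst (α ≤_) (sym (τinj eq)) (<⇒≤ gt)) (subst (_< β) (sym (τinj eq)) lt) in
          _ , E , refl , sym (source≡ E)
      ; inn = λ { k₀ refl → let E = edge₃ k₀ refl (≤-pred gt) (<⇒≤ lt) in _ , E , refl , sym (target≡ E) }
      }

  module _ {S : Subset len} (fixes : Fixes S) (D₀ : Derivation ⟦ C ⟧ inj₁ (_∈ₛ S)) where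

    open Derivation D₀

    private
      onℕ : (Joint C → Carrier 𝔹 → Bool) → ℕ → Carrier 𝔹 → Bool
      onℕ F t with t <? suc len
      ... | yes p = F (fromℕ< p)
      ... | no _  = F zero

      onℕ-toℕ : ∀ F {k t} → toℕ k ≡ t → onℕ F t ≡ F k
      onℕ-toℕ F {k} {t} refl with toℕ k <? suc len
      ... | yes p = cong F (Fin.fromℕ<-toℕ k p)
      ... | no ¬p = contradiction (toℕ<n k) ¬p

      inAt′ outAt′ : ∀ e {P Q : Set} → Dec P → Dec Q → Carrier 𝔹 → Bool
      inAt′ e (yes _) _       = onℕ In e
      inAt′ e (no _)  (yes _) = onℕ Out (β + β ∸ e)
      inAt′ e (no _)  (no _)  = onℕ In (e ∸ shift)
      outAt′ e (yes _) _       = onℕ Out e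
      outAt′ e (no _)  (yes _) = onℕ In (β + β ∸ e)
      outAt′ e (no _)  (no _)  = onℕ Out (e ∸ shift)

      -- Going backwards, In and Out change roles; turning, they agree.
      inAt outAt : ℕ → Carrier 𝔹 → Bool
      inAt  e = inAt′ e (e ≤? β) (e ≤? β + δ)
      outAt e = outAt′ e (e <? β) (e <? β + δ)

      inAt-early : ∀ {e k} → e ≤ β → toℕ k ≡ e → inAt e ≡ In k
      inAt-early {e} le eq with e ≤? β
      ... | yes _ = onℕ-toℕ In eq
      ... | no ¬p = contradiction le ¬p

      inAt-mid : ∀ {e k} → β < e → e ≤ β + δ → e + toℕ k ≡ β + β → inAt e ≡ Out k
      inAt-mid {e} gt le eq with e ≤? β | e ≤? β + δ
      ... | yes p | _     = contradiction p (<⇒≱ gt)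
      ... | no _  | yes _ = onℕ-toℕ Out (sym (trans (cong (_∸ e) (sym eq)) (m+n∸m≡n e _)))
      ... | no _  | no ¬q = contradiction le ¬q

      inAt-late : ∀ {e k} → β + δ < e → toℕ k + shift ≡ e → inAt e ≡ In k
      inAt-late {e} gt eq with e ≤? β | e ≤? β + δ
      ... | yes p | _     = contradiction (≤-trans p (m≤m+n _ δ)) (<⇒≱ gt)
      ... | no _  | yes p = contradiction p (<⇒≱ gt)
      ... | no _  | no _  = onℕ-toℕ In (sym (trans (cong (_∸ shift) (sym eq)) (m+n∸n≡m _ shift)))

      outAt-early : ∀ {e k} → e < β → toℕ k ≡ e → outAt e ≡ Out k
      outAt-early {e} lt eq with e <? β
      ... | yes _ = onℕ-toℕ Out eq
      ... | no ¬p = contradiction lt ¬p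

      outAt-mid : ∀ {e k} → β ≤ e → e < β + δ → e + toℕ k ≡ β + β → outAt e ≡ In k
      outAt-mid {e} ge lt eq with e <? β | e <? β + δ
      ... | yes p | _     = contradiction ge (<⇒≱ p)
      ... | no _  | yes _ = onℕ-toℕ In (sym (trans (cong (_∸ e) (sym eq)) (m+n∸m≡n e _)))
      ... | no _  | no ¬q = contradiction lt ¬q

      outAt-late : ∀ {e k} → β + δ ≤ e → toℕ k + shift ≡ e → outAt e ≡ Out k
      outAt-late {e} ge eq with e <? β | e <? β + δ
      ... | yes p | _     = contradiction (≤-trans (m≤m+n _ δ) ge) (<⇒≱ p)
      ... | no _  | yes p = contradiction ge (<⇒≱ p)
      ... | no _  | no _  = onℕ-toℕ Out (sym (trans (cong (_∸ shift) (sym eq)) (m+n∸n≡m _ shift)))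

      -- Where the spine turns there may be no legs to rely on, but there the incoming and the
      -- outgoing set are the same by definition. Every other copy of a joint has all of its legs
      -- and links.
      pass-at : ∀ v {e} x → pos v ≡ e → Compatible unfolded (inj₁ v) (inj₁ v) x x → inAt e x ≡ outAt e x
      pass-at (a k) x refl com with over-compatible (over-a k) com | place k
      ... | com′ | early p = trans (cong (λ F → F x) (inAt-early {k = k} (≤-trans (≤-reflexive eq) (<⇒≤ k<j)) (sym eq)))
        (trans (pass k x com′) (cong (λ F → F x) (sym (outAt-early {k = k} (≤-<-trans (≤-reflexive eq) k<j) (sym eq)))))
        where
        eq  = posA-≤ p
        k<j = ≤-<-trans p i<j
      ... | com′ | mid p q = trans (cong (λ F → F x) (inAt-mid {k = k} gt (<⇒≤ lt) eq))
        (trans (sym (pass k x com′)) (cong (λ F → F x) (sym (outAt-mid {k = k} (<⇒≤ gt) lt eq))))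
        where
        eq : posA (toℕ k) + toℕ k ≡ β + β
        eq = trans (cong (_+ toℕ k) (posA-mid p q)) (m∸n+n≡m (≤-trans (<⇒≤ q) (m≤m+n _ _)))
        gt : β < posA (toℕ k)
        gt = ≰⇒> λ le → <⇒≱ q (middle-< {posA (toℕ k)} eq le)
        lt : posA (toℕ k) < β + δ
        lt = ≰⇒> λ ge → <⇒≱ p (sum-≤ʳ (trans eq j+j≡[j+δ]+i) ge)
      ... | com′ | late p = trans (cong (λ F → F x) (inAt-late {k = k} gt (sym (posA-≥ p))))
        (trans (pass k x com′) (cong (λ F → F x) (sym (outAt-late {k = k} (<⇒≤ gt) (sym (posA-≥ p))))))
        where
        gt : β + δ < posA (toℕ k)
        gt = subst (β + δ <_) (sym (posA-≥ p)) (≤-<-trans (+-monoˡ-≤ δ p) (ℕ.+-monoʳ-< (toℕ k) (m<m+n δ δ>0)))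
      pass-at (a′ k p q) x refl com = helper (toℕ k <? β)
        where
        helper : Dec (toℕ k < β) → inAt (toℕ k) x ≡ outAt (toℕ k) x
        helper (yes lt) = trans (cong (λ F → F x) (inAt-early {k = k} (<⇒≤ lt) refl))
          (trans (pass k x (over-compatible (over-a′ k p q (recompute (_ <? _) p) lt) com)) (cong (λ F → F x) (sym (outAt-early {k = k} lt refl))))
        helper (no ¬lt) = cong (λ F → F x) (trans (inAt-early {k = k} (≤-reflexive eq) refl)
          (sym (outAt-mid {k = k} (≮⇒≥ ¬lt) (subst (_< β + δ) (sym eq) j<j+δ′) (cong₂ _+_ eq eq))))
          where
          eq : toℕ k ≡ β
          eq = ≤-antisym (recompute (_ ≤? _) q) (≮⇒≥ ¬lt)
      pass-at (a″ k p q) x refl com with α <? toℕ k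
      ... | yes gt = trans (cong (λ F → F x) (inAt-late {k = k} past refl))
        (trans (pass k x (over-compatible (over-a″ k p q gt (recompute (_ <? _) q)) com)) (cong (λ F → F x) (sym (outAt-late {k = k} (<⇒≤ past) refl))))
        where
        past : β + δ < toℕ k + shift
        past = subst (_< toℕ k + shift) i+shift≡j+δ (ℕ.+-monoˡ-< shift gt)
      ... | no ¬gt = cong (λ F → F x) (trans
        (inAt-mid {k = k} (subst (β <_) (sym eq′) j<j+δ′) (≤-reflexive eq′) (trans (cong₂ _+_ eq′ eq) (sym j+j≡[j+δ]+i)))
        (sym (outAt-late {k = k} (≤-reflexive (sym eq′)) refl)))
        where
        eq : toℕ k ≡ α
        eq = ≤-antisym (≮⇒≥ ¬gt) (recompute (_ ≤? _) p)
        eq′ : toℕ k + shift ≡ β + δ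
        eq′ = trans (cong (_+ shift) eq) i+shift≡j+δ

      record StepAt (e : ℕ) (x y : Carrier 𝔹) : Set where
        field
          edge-at  : Edge e
          forward  : outAt e x ≡ true → inAt (suc e) y ≡ true
          balanced : ¬ (Edge.k edge-at ∈ₛ S) → outAt e x ≡ inAt (suc e) y

      step-at : ∀ {e} → e < len + shift → ∀ {v v′ x y} → pos v ≡ e → pos v′ ≡ suc e →
                Compatible unfolded (inj₁ v) (inj₁ v′) x y → StepAt e x y
      step-at {e} e< {v₀} {v₀′} ev₀ ev₀′ com₀ = step-along (edge e e<) {v₀} {v₀′} ev₀ ev₀′ com₀
        where
        step-along : (E : Edge e) → ∀ {v v′ x y} → pos v ≡ e → pos v′ ≡ suc e →
                     Compatible unfolded (inj₁ v) (inj₁ v′) x y → StepAt e x y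
        step-along E {v} {v′} {x} {y} ev ev′ com = shape (Edge.range E) (orientation (Edge.ends E)) refl
         where
         shape : ∀ {k b} → Range k e b → (b ≡ true × LinkRel 𝔹 (link (Edge.k E)) x y) ⊎ (b ≡ false × LinkRel 𝔹 (link (Edge.k E)) y x) →
                 k ≡ toℕ (Edge.k E) → StepAt e x y
         shape (before lt eq) (inj₁ (_ , r)) refl =
           let k   = Edge.k E
               eqo = outAt-early {k = inject₁ k} (subst (_< β) (sym eq) lt) (trans (toℕ-inject₁ k) (sym eq))
               eqi = inAt-early {k = suc k} (subst (_< β) (sym eq) lt) (cong suc (sym eq))
               com′ = link-compatible C k r
           in record { edge-at = E
                     ; forward = λ o → trans (cong (λ F → F y) eqi) (forward k com′ (trans (cong (λ F → F x) (sym eqo)) o))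
                     ; balanced = λ ∉S → trans (cong (λ F → F x) eqo) (trans (balanced k ∉S com′) (cong (λ F → F y) (sym eqi))) }
         shape (after ge eq) (inj₁ (_ , r)) refl =
           let k   = Edge.k E
               ge′ = ≤-trans (≤-reflexive (sym i+shift≡j+δ)) (≤-trans (+-monoˡ-≤ shift ge) (≤-reflexive (sym eq)))
               eqo = outAt-late {k = inject₁ k} ge′ (trans (cong (_+ shift) (toℕ-inject₁ k)) (sym eq))
               eqi = inAt-late {k = suc k} (s≤s ge′) (cong suc (sym eq))
               com′ = link-compatible C k r
           in record { edge-at = E
                     ; forward = λ o → trans (cong (λ F → F y) eqi) (forward k com′ (trans (cong (λ F → F x) (sym eqo)) o))
                     ; balanced = λ ∉S → trans (cong (λ F → F x) eqo) (trans (balanced k ∉S com′) (cong (λ F → F y) (sym eqi))) }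
         shape (within ge lt eq) (inj₂ (_ , r)) refl =
           let k   = Edge.k E
               j≤e = ≮⇒≥ λ e<j → <-irrefl (trans (+-suc e (toℕ k)) eq) (ℕ.+-mono-<-≤ e<j lt)
               e<j+δ = ≮⇒≥ λ lt′ → <⇒≱ (sum-<ʳ {suc e} {toℕ k} (trans eq j+j≡[j+δ]+i) lt′) ge
               eqo = outAt-mid {k = suc k} j≤e e<j+δ (trans (+-suc e (toℕ k)) eq)
               eqi = inAt-mid {k = inject₁ k} (s≤s j≤e) e<j+δ (trans (cong (suc e +_) (toℕ-inject₁ k)) eq)
               com′ = link-compatible C k r
               -- A vertebra in the unfolded stretch is not fixed, so its sets are exact and can be
               -- read backwards.
               ∉S : ¬ (k ∈ₛ S)
               ∉S k∈S = case fixes k k∈S of λ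
                 { (inj₁ p) → <⇒≱ (subst (_< α) (toℕ-inject₁ k) p) ge
                 ; (inj₂ p) → <⇒≱ lt (subst (β ≤_) (toℕ-inject₁ k) p) }
               eq′ = trans (cong (λ F → F x) eqo) (trans (sym (balanced k ∉S com′)) (cong (λ F → F y) (sym eqi)))
           in record { edge-at = E ; forward = λ o → trans (sym eq′) o ; balanced = λ _ → eq′ }
         orientation : (Edge.forward E ≡ true × pos (Edge.x E) ≡ e × pos (Edge.y E) ≡ suc e) ⊎
                       (Edge.forward E ≡ false × pos (Edge.y E) ≡ e × pos (Edge.x E) ≡ suc e) → _
         orientation (inj₁ (b , ex , ey)) = inj₁ (b , edge-compatible E {v} {v′} (trans ev (sym ex)) (trans ev′ (sym ey)) com)
         orientation (inj₂ (b , ey , ex)) = inj₂ (b , edge-compatible E {v′} {v} (trans ev′ (sym ex)) (trans ev (sym ey)) (swap {unfolded} com))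

    module _ {D : Caterpillar τ} (u : UnfoldsTo D) (S′ : Subset (Caterpillar.len D))
             (S′-spec : ∀ k′ → k′ ∈ₛ S′ ⇔ (∃[ k ] k ∈ₛ S × UnfoldsTo.SameVertebra u k′ k)) where

      open UnfoldsTo u

      private
        v : Joint D → Var
        v t = proj₁ (unfoldsTo-joint u t)

        to-v : ∀ t → _≅_.to iso (inj₁ t) ≡ inj₁ (v t)
        to-v t = proj₁ (proj₂ (unfoldsTo-joint u t))

        pos-v : ∀ t → pos (v t) ≡ toℕ t
        pos-v t = proj₂ (proj₂ (unfoldsTo-joint u t))

        to-unfolded : ∀ {t t′ x y} → Compatible ⟦ D ⟧ (inj₁ t) (inj₁ t′) x y → Compatible unfolded (inj₁ (v t)) (inj₁ (v t′)) x y
        to-unfolded {t} {t′} = compatible-from {unfolded} {⟦ D ⟧} (≅-from iso) (back t) (back t′)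
          where
          back : ∀ t → _≅_.from iso (inj₁ (v t)) ≡ inj₁ t
          back t = trans (cong (_≅_.from iso) (sym (to-v t))) (Inverse.strictlyInverseʳ (_≅_.bijection iso) (inj₁ t))

        e< : ∀ k → toℕ k < len + shift
        e< k = subst (toℕ k <_) (unfoldsTo-len u) (toℕ<n k)

        step-D : ∀ k {x y} → Compatible ⟦ D ⟧ (inj₁ (inject₁ k)) (inj₁ (suc k)) x y → StepAt (toℕ k) x y
        step-D k com = step-at (e< k) (trans (pos-v (inject₁ k)) (toℕ-inject₁ k)) (pos-v (suc k)) (to-unfolded com)

        -- An edge over a fixed link is that vertebra itself: it stays in place if it comes before
        -- `i` and moves by `shift` if it comes after `j`.
        fixed-vertebra : ∀ k (E : Edge (toℕ k)) → Edge.k E ∈ₛ S → k ∈ₛ S′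
        fixed-vertebra k′ E k∈S = Equivalence.from (S′-spec k′) (k , k∈S , same (inject₁ k′) (inject₁ k) (proj₁ positions) , same (suc k′) (suc k) (proj₂ positions))
          where
          k = Edge.k E
          same : ∀ t l → toℕ t ≡ posA (toℕ l) → _≅_.to iso (inj₁ t) ≡ inj₁ (a l)
          same t l eq = trans (to-v t) (cong inj₁ (pos-injective {v t} {a l} (trans (pos-v t) eq)))
          positions : toℕ (inject₁ k′) ≡ posA (toℕ (inject₁ k)) × toℕ (suc k′) ≡ posA (toℕ (suc k))
          positions = go (Edge.range E) (fixes k k∈S)
            where
            go : ∀ {b} → Range (toℕ k) (toℕ k′) b → inject₁ k Fin.< i ⊎ j Fin.≤ inject₁ k →
                 toℕ (inject₁ k′) ≡ posA (toℕ (inject₁ k)) × suc (toℕ k′) ≡ posA (suc (toℕ k))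
            go r (inj₁ p) with r | subst (_< α) (toℕ-inject₁ k) p
            ... | before _ eq   | q = trans (toℕ-inject₁ k′) (trans eq (sym (trans (cong posA (toℕ-inject₁ k)) (posA-≤ (<⇒≤ q))))) ,
                                      trans (cong suc eq) (sym (posA-≤ q))
            ... | within ge _ _ | q = contradiction ge (<⇒≱ q)
            ... | after ge _    | q = contradiction ge (<⇒≱ q)
            go r (inj₂ p) with r | subst (β ≤_) (toℕ-inject₁ k) p
            ... | before lt _   | q = contradiction q (<⇒≱ lt)
            ... | within _ lt _ | q = contradiction q (<⇒≱ lt)
            ... | after _ eq    | q = trans (toℕ-inject₁ k′) (trans eq (sym (trans (cong posA (toℕ-inject₁ k)) (posA-≥ q)))) ,
                                      trans (cong suc eq) (sym (posA-≥ (m≤n⇒m≤1+n q)))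

      unfolded-derivation : Derivation ⟦ D ⟧ inj₁ (_∈ₛ S′)
      unfolded-derivation = record
        { In = inAt ∘ toℕ
        ; Out = outAt ∘ toℕ
        ; initial = λ x com → trans (cong (λ F → F x) (inAt-early {k = zero} z≤n refl))
            (initial x (over-compatible (over-a zero) (subst (λ w → Compatible unfolded (inj₁ w) (inj₁ w) x x)
              (pos-injective {v zero} {a zero} (trans (pos-v zero) (sym (posA-≤ z≤n)))) (to-unfolded com))))
        ; pass = λ t x com → pass-at (v t) x (pos-v t) (to-unfolded com)
        ; forward = λ k {x} {y} com → subst (λ e → outAt e x ≡ true → inAt (suc (toℕ k)) y ≡ true) (sym (toℕ-inject₁ k)) (StepAt.forward (step-D k com))
        ; balanced = λ k ∉S′ {x} {y} com → subst (λ e → outAt e x ≡ inAt (suc (toℕ k)) y) (sym (toℕ-inject₁ k))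
            (StepAt.balanced (step-D k com) (∉S′ ∘ fixed-vertebra k (StepAt.edge-at (step-D k com))))
        ; final = λ x com o → final x (over-compatible (over-a (fromℕ len)) (subst (λ w → Compatible unfolded (inj₁ w) (inj₁ w) x x)
              (pos-injective {v _} {a (fromℕ len)} (trans (pos-v _) (trans last (sym (posA-≥ j≤last))))) (to-unfolded com)))
            (trans (cong (λ F → F x) (sym (outAt-late {k = fromℕ len} (≤-trans j+δ≤j+shift (≤-trans (+-monoˡ-≤ shift j≤last) (≤-reflexive (sym last)))) (sym last)))) o)
        }
        where
        j≤last : β ≤ toℕ (fromℕ len)
        j≤last = ≤-trans j≤len (≤-reflexive (sym (toℕ-fromℕ len)))
        last : toℕ (fromℕ (Caterpillar.len D)) ≡ toℕ (fromℕ len) + shift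
        last = trans (toℕ-fromℕ _) (trans (unfoldsTo-len u) (cong (_+ shift) (sym (toℕ-fromℕ len))))

module _ (em : EM) {τ : Signature} (𝔹 : Structure τ) where

  open CaterpillarChains em 𝔹

  unfolding-derivation : ∀ {C D S} → Unfolding C S D → Derivation ⟦ C ⟧ inj₁ (_∈ₛ S) → ¬ (⟦ D ⟧ ⟶ 𝔹)
  unfolding-derivation done d = derivation⇒¬hom d
  unfolding-derivation {C} (step i j i<j fixes u S′ spec us) d =
    unfolding-derivation us (UnfoldedDerivation.unfolded-derivation em 𝔹 C i j i<j fixes d u S′ spec)

  module _ (b₀ : Carrier 𝔹) {n} (cd : ClosedUnderFoldings (suc n) (CSP 𝔹)) where

    -- Unfoldings can fix vertebrae but not legs, so the marks on legs are relocated to links first.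
    caterpillar-derivation : ∀ C → ¬ (⟦ C ⟧ ⟶ 𝔹) →
      Σ[ S ∈ Subset (Caterpillar.len C) ] ∣ S ∣ ≤ n × Derivation ⟦ C ⟧ inj₁ (_∈ₛ S)
    caterpillar-derivation C ¬hom = go (caterpillar-separable em 𝔹 b₀ cd C ¬hom)
      where
      open Caterpillar C
      go : _ → _
      go (ψ , ψ′ , ψ∈ , ψ′∈ , m , eq , marks≤n , U , V , chain , P⊆U , Q∩V) with relocate chain
      ... | m′ , eq′ , on , cases = finish cases
        where
        build : ∀ {U′} → Traces.#marks em 𝔹 m′ ≤ n → (∀ {b} → U b ≡ true → U′ b ≡ true) → Traces.Chain em 𝔹 m′ U′ V → _
        build {U′} le U⊆U′ ch =
          let S , count≡ , R = chain-sets len link legs (trans eq′ eq) on ch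
              open Sets R
          in S , subst (_≤ n) (sym count≡) le , record
            { In = In ; Out = Out
            ; initial = λ x com → trans (initial x) (U⊆U′ (P⊆U (compatible-leg C zero ψ∈ com)))
            ; pass = λ t x com → pass t x (λ i → compatible-leg C t i com)
            ; forward = λ k com → forward k (compatible-link C k com)
            ; balanced = λ k ∉S com → balanced k (not-in S k ∉S) (compatible-link C k com)
            ; final = λ x com o → Q∩V (compatible-leg C (fromℕ len) ψ′∈ com) (trans (sym (final x)) o)
            }
          where
          not-in : ∀ {m} (S : Subset m) k → ¬ (k ∈ₛ S) → lookup S k ≡ false
          not-in S k ∉S with lookup S k in e
          ... | false = refl
          ... | true  = contradiction (Vec.lookup⇒[]= k S e) ∉S
        finish : _ → _
        finish (inj₁ (le , ch)) = build (≤-trans le marks≤n) id ch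
        -- A mark still to be placed at the left end is dropped: the first set may be enlarged, as
        -- it only has to contain the values having the leg `ψ`.
        finish (inj₂ (le , U′ , U⊆U′ , ch)) = build (≤-trans (<⇒≤ le) marks≤n) U⊆U′ ch

-- Separating chains and caterpillar dualities

module Separation (em : EM) {τ : Signature} (𝔹 : Structure τ) where

  open Classical em
  open Words (Item τ)
  open Traces em 𝔹
  open CaterpillarChains em 𝔹 using (forgetMarks)

  PathIn : (𝔸 : Structure τ) → Word → Carrier 𝔸 → Carrier 𝔸 → Set
  PathIn 𝔸 = Traces.Path em 𝔸

  -- Every finite structure without a homomorphism to 𝔹 contains a path along
  -- some word on which the values in 𝔹 are used up, and only n letters of the
  -- word are passed irreversibly.
  SeparatedBy : ℕ → Set₁
  SeparatedBy n = (𝔸 : Structure τ) → Finite (Carrier 𝔸) → ¬ (𝔸 ⟶ 𝔹) →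
    ∃[ m ] #marks m ≤ n ×
    (∃₂ λ U V → Chain m U V × (∀ b → U b ≡ true) × (∀ b → V b ≡ false)) ×
    (∃₂ λ a a′ → PathIn 𝔸 (forgetMarks m) a a′)

  duality-caterpillar : ∀ {F} → IsCaterpillarDuality F 𝔹 → ∀ 𝔽 → F 𝔽 → ¬ (𝔽 ⟶ 𝔹)
  duality-caterpillar (cats , pair) 𝔽 F𝔽 =
    let C , iso = cats 𝔽 F𝔽
    in Equivalence.from (pair 𝔽 (finite-↔ (_≅_.bijection iso) (caterpillar-finite em C))) (𝔽 , F𝔽 , id-hom 𝔽)

  module _ (b₀ : Carrier 𝔹) {n : ℕ} where

    -- The end conditions are written into the word as letters: the leg `ψ` carries the full set
    -- exactly to `U`, and `ψ′` carries `V` exactly to the empty set. This adds no marks.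
    foldings⇒separated : HasCaterpillarDuality 𝔹 → ClosedUnderFoldings (suc n) (CSP 𝔹) → SeparatedBy n
    foldings⇒separated (F , duality) closed 𝔸 finite ¬hom
      with Equivalence.to (proj₂ duality 𝔸 finite) ¬hom
    ... | 𝔽 , F𝔽 , g with proj₁ duality 𝔽 F𝔽
    ... | C , iso with caterpillar-separable em 𝔹 b₀ closed C (λ h → duality-caterpillar duality 𝔽 F𝔽 (_∘ₕ_ {𝔸 = 𝔽} {⟦ C ⟧} {𝔹} h (≅-to iso)))
    ... | ψ , ψ′ , ψ∈ , ψ′∈ , m , eq , marks≤n , U , V , chain , P⊆U , Q∩V =
      m′ , ≤-trans (≤-reflexive marks≡) marks≤n ,
      ((λ _ → true) , (λ _ → false) , free first (Chain-++ chain (free {l = true , unary ψ′} last ([] λ _ → refl))) , (λ _ → refl) , (λ _ → refl)) ,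
      proj₁ h (inj₁ zero) , proj₁ h (inj₁ (fromℕ (Caterpillar.len C))) ,
      subst (λ w → PathIn 𝔸 w (proj₁ h (inj₁ zero)) (proj₁ h (inj₁ (fromℕ (Caterpillar.len C))))) (sym forget≡)
        (Path-padded⁺ em 𝔸 ψ ψ′ (word C) (hom-leg C 𝔸 h zero ψ∈) (hom-leg C 𝔸 h (fromℕ (Caterpillar.len C)) ψ′∈) (hom-Path em 𝔸 C h))
      where
      h : ⟦ C ⟧ ⟶ 𝔸
      h = _∘ₕ_ {𝔸 = ⟦ C ⟧} {𝔽} {𝔸} g (≅-from iso)
      m′ : MarkedWord
      m′ = (false , true , unary ψ) ∷ m ++ (false , true , unary ψ′) ∷ []
      marks≡ : #marks m′ ≡ #marks m
      marks≡ = trans (Foldings.#marks-++ em (sem 𝔹) (LegRel 𝔹 ψ) (LegRel 𝔹 ψ′) m _) (+-identityʳ _)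
      forget≡ : forgetMarks m′ ≡ padded ψ ψ′ (word C)
      forget≡ = cong (_ ∷_) (trans (List.map-++ proj₂ m _) (cong (_++ _) eq))
      first : BalancedStep (true , unary ψ) (λ _ → true) U
      first (refl , r) = sym (P⊆U r)
      last : BalancedStep (true , unary ψ′) V (λ _ → false)
      last {b} (refl , r) with V b in e
      ... | false = refl
      ... | true  = ⊥-elim (Q∩V r e)

    foldings⇒fixed-unfoldings : ClosedUnderFoldings (suc n) (CSP 𝔹) → ClosedUnderFixedUnfoldings n (coCSP 𝔹)
    foldings⇒fixed-unfoldings closed C ℂ iso (_ , ¬hom) =
      let S , S≤n , d = caterpillar-derivation em 𝔹 b₀ closed C (λ h → ¬hom (_∘ₕ_ {𝔸 = ℂ} {⟦ C ⟧} {𝔹} h (≅-to iso)))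
      in S , S≤n , λ {D} us 𝔻 iso′ →
        finite-↔ (_≅_.bijection iso′) (caterpillar-finite em D) ,
        λ h → unfolding-derivation em 𝔹 us d (_∘ₕ_ {𝔸 = ⟦ D ⟧} {𝔻} {𝔹} h (≅-from iso′))

  -- The obstruction set is enlarged to all caterpillars without a homomorphism to `𝔹`, which
  -- inherits the closure property from `coCSP 𝔹`.
  fixed-unfoldings⇒duality : ∀ {n} → HasCaterpillarDuality 𝔹 → ClosedUnderFixedUnfoldings n (coCSP 𝔹) →
                             HasFixedUnfoldedCaterpillarDuality n 𝔹
  fixed-unfoldings⇒duality (F , duality) closed =
    (λ 𝔽 → IsCaterpillar 𝔽 × ¬ (𝔽 ⟶ 𝔹)) ,
    ((λ _ → proj₁) , λ 𝔸 finite → mk⇔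
      (λ ¬hom → let 𝔽 , F𝔽 , g = Equivalence.to (proj₂ duality 𝔸 finite) ¬hom
                in 𝔽 , (proj₁ duality 𝔽 F𝔽 , duality-caterpillar duality 𝔽 F𝔽) , g)
      (λ (𝔽 , (_ , ¬hom) , g) h → ¬hom (_∘ₕ_ {𝔸 = 𝔽} {𝔸} {𝔹} h g))) ,
    λ C ℂ iso (_ , ¬hom) →
      let S , S≤n , f = closed C ℂ iso (finite-↔ (_≅_.bijection iso) (caterpillar-finite em C) , ¬hom)
      in S , S≤n , λ {D} us 𝔻 iso′ → (D , iso′) , proj₂ (f us 𝔻 iso′)

  -- Expansions of segments realized by unfoldings

  open Foldings em (sem 𝔹) (λ _ → ⊤) (λ _ → ⊤) hiding (#marks-++)

  -- The indices of the links that close the segments, that is, of the fixed vertebrae.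
  Position : ∀ {k} → Segments k → ℕ → Set
  Position ε           e = ⊥
  Position (s ▸ x ∙ c) e = Position s e ⊎ e ≡ #links (flat s x)

  LinksBetween : ∀ {k} → Segments k → Set
  LinksBetween ε           = ⊤
  LinksBetween (s ▸ x ∙ c) = LinksBetween s × ∃₂ λ σ φ → c ≡ (σ , binary φ)

  private
    #links-flat : ∀ {k} (s : Segments k) y → #links (flat s y) ≡ #links (flat s []) + #links y
    #links-flat s y = trans (cong #links (flat-++ s y)) (#links-++ (flat s []) y)

  position-bound : ∀ {k} (s : Segments k) {e} → LinksBetween s → Position s e → e < #links (flat s [])
  position-bound (s ▸ x ∙ _) {e} (_ , σ , φ , refl) (inj₂ refl) = ≤-reflexive (sym (begin
    #links (flat s (x ++ (σ , binary φ) ∷ [])) ≡⟨ #links-flat s _ ⟩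
    #links (flat s []) + #links (x ++ (σ , binary φ) ∷ []) ≡⟨ cong (#links (flat s []) +_) (trans (#links-++ x _) (+-comm _ 1)) ⟩
    #links (flat s []) + suc (#links x) ≡⟨ +-suc _ _ ⟩
    suc (#links (flat s []) + #links x) ≡⟨ cong suc (#links-flat s x) ⟨
    suc (#links (flat s x)) ∎))
    where open ≡-Reasoning
  position-bound (s ▸ x ∙ c) {e} (l , _) (inj₁ p) =
    <-≤-trans (position-bound s l p) (≤-trans (m≤m+n _ _) (≤-reflexive (sym (#links-flat s (x ++ c ∷ [])))))

  data Expansion : ∀ {k} → Segments k × Word → Segments k × Word → Set where
    here  : ∀ {k} {s : Segments k} {x x′} → x ⇝₁ x′ → Expansion (s , x) (s , x′)
    there : ∀ {k} {s s′ : Segments k} {x x′ c y} → Expansion (s , x) (s′ , x′) → Expansion (s ▸ x ∙ c , y) (s′ ▸ x′ ∙ c , y)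

  expansions : ∀ {k} {s s′ : Segments k} {x x′} → s ⇝ₛ s′ → x ⇝ x′ → Star Expansion (s , x) (s′ , x′)
  expansions {x = x} t u = inner t ◅◅ gmap (_ ,_) here u
    where
    inner : ∀ {k} {s s′ : Segments k} {y} → s ⇝ₛ s′ → Star Expansion (s , y) (s′ , y)
    inner ε           = ε
    inner (t ▸ u ∙ c) = gmap (λ (s , x) → s ▸ x ∙ c , _) there (expansions t u)

  -- What one expansion step does to the fixed vertebrae: those before the expanded factor stay, and
  -- those after it move by twice the length of the factor, just as in an unfolding.
  record Expanded {k} (s : Segments k) (x : Word) (s′ : Segments k) (x′ : Word) : Set where
    field
      A u B     : Word
      word≡     : flat s x ≡ A ++ u ++ B
      word′≡    : flat s′ x′ ≡ A ++ u ++ inv u ++ u ++ B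
      outside   : ∀ {e} → Position s e → e < #links A ⊎ #links A + #links u ≤ e
      kept      : ∀ {e} → Position s e → e < #links A → Position s′ e
      shifted   : ∀ {e} → Position s e → #links A + #links u ≤ e → Position s′ (e + (#links u + #links u))
      links     : LinksBetween s′

  expanded : ∀ {k} {s s′ : Segments k} {x x′} → LinksBetween s → Expansion (s , x) (s′ , x′) → Expanded s x s′ x′
  expanded {s = s} l (here (expand a u b)) = record
    { A = flat s [] ++ a ; u = u ; B = b
    ; word≡  = trans (flat-++ s _) (sym (++-assoc (flat s []) a _))
    ; word′≡ = trans (flat-++ s _) (sym (++-assoc (flat s []) a _))
    ; outside = λ p → inj₁ (early p)
    ; kept = λ p _ → p
    ; shifted = λ p ge → contradiction (early p) (≤⇒≯ (≤-trans (m≤m+n _ _) ge))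
    ; links = l
    }
    where
    early : ∀ {e} → Position s e → e < #links (flat s [] ++ a)
    early p = <-≤-trans (position-bound s l p) (≤-trans (m≤m+n _ _) (≤-reflexive (sym (#links-++ (flat s []) a))))
  expanded {s = s ▸ x ∙ c} {s′ ▸ x′ ∙ _} {y} (l , link-c) (there E) = record
    { A = A ; u = u ; B = B ++ c ∷ y
    ; word≡  = trans (tail s x) (trans (cong (_++ c ∷ y) word≡) (trans (++-assoc A _ _) (cong (A ++_) (++-assoc u B _))))
    ; word′≡ = trans (tail s′ x′) (trans (cong (_++ c ∷ y) word′≡) (trans (++-assoc A _ _) (cong (A ++_)
        (trans (++-assoc u _ _) (cong (u ++_) (trans (++-assoc (inv u) _ _) (cong (inv u ++_) (++-assoc u B _))))))))
    ; outside = λ { (inj₁ p) → outside p ; (inj₂ refl) → inj₂ late }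
    ; kept = λ { (inj₁ p) lt → inj₁ (kept p lt) ; (inj₂ refl) lt → contradiction lt (≤⇒≯ (≤-trans (m≤m+n _ _) late)) }
    ; shifted = λ { (inj₁ p) ge → inj₁ (shifted p ge) ; (inj₂ refl) ge → inj₂ (sym length′) }
    ; links = links , link-c
    }
    where
    open Expanded (expanded l E)
    tail : ∀ {k} (s : Segments k) x → flat s (x ++ c ∷ y) ≡ flat s x ++ c ∷ y
    tail s x = trans (flat-++ s _) (trans (sym (++-assoc (flat s []) x _)) (cong (_++ c ∷ y) (sym (flat-++ s x))))
    length≡ : #links (flat s x) ≡ #links A + (#links u + #links B)
    length≡ = trans (cong #links word≡) (trans (#links-++ A _) (cong (#links A +_) (#links-++ u B)))
    late : #links A + #links u ≤ #links (flat s x)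
    late = subst (#links A + #links u ≤_) (sym length≡) (+-monoʳ-≤ (#links A) (m≤m+n _ _))
    length′ : #links (flat s′ x′) ≡ #links (flat s x) + (#links u + #links u)
    length′ = begin
      #links (flat s′ x′) ≡⟨ trans (cong #links word′≡) (#links-++ A _) ⟩
      #links A + #links (u ++ inv u ++ u ++ B)
        ≡⟨ cong (#links A +_) (trans (#links-++ u _) (cong (#links u +_) (trans (#links-++ (inv u) _)
             (cong₂ _+_ (#links-inv u) (#links-++ u B))))) ⟩
      #links A + (#links u + (#links u + (#links u + #links B))) ≡⟨ rearrange (#links A) (#links u) (#links B) ⟩
      #links A + (#links u + #links B) + (#links u + #links u) ≡⟨ cong (_+ (#links u + #links u)) length≡ ⟨
      #links (flat s x) + (#links u + #links u) ∎
      where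
      open ≡-Reasoning
      rearrange : ∀ a u b → a + (u + (u + (u + b))) ≡ a + (u + b) + (u + u)
      rearrange = solve-∀

  -- Such a step only repeats legs at one joint, so the word still spells the same caterpillar.
  spells-legs-only : ∀ {C} A u B → #links u ≡ 0 → Spells C (A ++ u ++ B) → Spells C (A ++ u ++ inv u ++ u ++ B)
  spells-legs-only {C} A u B eq sp = record
    { length≡ = trans (trans (#links-++ A _) (cong (#links A +_) tail-length)) (trans (sym (#links-++ A (u ++ B))) (Spells.length≡ sp))
    ; links≡  = λ k → let σ , φ , nth , e = Spells.links≡ sp k in σ , φ , trans (nth-tail A (toℕ k)) nth , e
    ; legs⊆   = λ t i → legs-tail (toℕ t) (Spells.legs⊆ sp t i)
    }
    where
    eq′ : #links (inv u) ≡ 0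
    eq′ = trans (#links-inv u) eq
    drop-links : ∀ v w → #links v ≡ 0 → #links (v ++ w) ≡ #links w
    drop-links v w e = trans (#links-++ v w) (cong (_+ #links w) e)
    tail-length : #links (u ++ inv u ++ u ++ B) ≡ #links (u ++ B)
    tail-length = trans (drop-links u _ eq) (drop-links (inv u) _ eq′)
    drop-nth : ∀ v w t → #links v ≡ 0 → nthLink (v ++ w) t ≡ nthLink w t
    drop-nth v w t e = trans (cong (λ z → nthLink (v ++ w) (z + t)) (sym e)) (nthLink-++ʳ v w t)
    nth-tail : ∀ A t → nthLink (A ++ u ++ inv u ++ u ++ B) t ≡ nthLink (A ++ u ++ B) t
    nth-tail [] t = trans (drop-nth u _ t eq) (drop-nth (inv u) _ t eq′)
    nth-tail ((_ , unary _) ∷ A) t = nth-tail A t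
    nth-tail ((_ , binary _) ∷ A) zero = refl
    nth-tail ((_ , binary _) ∷ A) (suc t) = nth-tail A t
    at-zero : ∀ v w {ψ} t → #links v ≡ 0 → ψ ∈ legsOf w t → ψ ∈ legsOf (v ++ w) t
    at-zero v w {ψ} t e i = subst (λ z → ψ ∈ legsOf (v ++ w) (z + t)) e (∈legsOf-++ʳ v w t i)
    legs-tail : ∀ t {ψ} → ψ ∈ legsOf (A ++ u ++ B) t → ψ ∈ legsOf (A ++ u ++ inv u ++ u ++ B) t
    legs-tail t {ψ} i with ∈legsOf-++⁻ A (u ++ B) t i
    ... | inj₁ (i′ , _)        = ∈legsOf-++ˡ A _ t i′
    ... | inj₂ (s , refl , i′) = ∈legsOf-++ʳ A _ s (at-zero u _ s eq (at-zero (inv u) (u ++ B) s eq′ i′))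

  module UnfoldingStep (C : Caterpillar τ) (S : Subset (Caterpillar.len C)) (A u B : Word) (nonempty : #links u ≢ 0)
    (sp : Spells C (A ++ u ++ B))
    (outside : ∀ {l} → l ∈ₛ S → toℕ l < #links A ⊎ #links A + #links u ≤ toℕ l) where

    private
      bound : #links A + #links u ≤ Caterpillar.len C
      bound = subst₂ _≤_ (#links-++ A u) (trans (cong #links (++-assoc A u B)) (Spells.length≡ sp))
        (subst (#links (A ++ u) ≤_) (sym (#links-++ (A ++ u) B)) (m≤m+n _ _))

      i j : Joint C
      i = fromℕ< (s≤s (≤-trans (m≤m+n (#links A) (#links u)) bound))
      j = fromℕ< (s≤s bound)

      #A : #links A ≡ toℕ i
      #A = sym (toℕ-fromℕ< (s≤s (≤-trans (m≤m+n (#links A) (#links u)) bound)))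
      #u : #links A + #links u ≡ toℕ j
      #u = sym (toℕ-fromℕ< (s≤s bound))

      i<j : i Fin.< j
      i<j = subst₂ _<_ #A #u (m<m+n _ (ℕ.n≢0⇒n>0 nonempty))

    module _ (i j : Joint C) (i<j : i Fin.< j) (#A : #links A ≡ toℕ i) (#u : #links A + #links u ≡ toℕ j) where

      open UnfoldedSpine C i j i<j
      open Unfolded C i j i<j using (shift; posA; posA-≤; posA-≥; pos)
      open UnfoldedCaterpillar C i j i<j using (unfoldedCaterpillar)

      private
        fixes : Unfold.Fixes C i j i<j S
        fixes l l∈S with outside l∈S
        ... | inj₁ lt = inj₁ (subst₂ _<_ (sym (toℕ-inject₁ l)) #A lt)
        ... | inj₂ ge = inj₂ (subst₂ _≤_ #u (sym (toℕ-inject₁ l)) ge)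

        Survives : Fin (Caterpillar.len unfoldedCaterpillar) → Set
        Survives l′ = ∃[ l ] l ∈ₛ S × Unfold.UnfoldsTo.SameVertebra unfoldsTo l′ l

        survivors : Subset (Caterpillar.len unfoldedCaterpillar)
        survivors = tabulate (truth ∘ Survives)

        survivors-spec : ∀ l′ → l′ ∈ₛ survivors ⇔ Survives l′
        survivors-spec l′ =
          mk⇔ (λ l′∈ → truth⁻ (trans (sym (lookup∘tabulate (truth ∘ Survives) l′)) (Vec.[]=⇒lookup l′∈)))
              (λ p → Vec.lookup⇒[]= l′ survivors (trans (lookup∘tabulate (truth ∘ Survives) l′) (truth⁺ p)))

        shift≡ : shift ≡ #links u + #links u
        shift≡ = cong₂ _+_ δ≡ δ≡
          where
          δ≡ : toℕ j ∸ toℕ i ≡ #links u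
          δ≡ = trans (cong₂ _∸_ (sym #u) (sym #A)) (m+n∸m≡n (#links A) (#links u))

        survives-position : ∀ l′ l → Unfold.UnfoldsTo.SameVertebra unfoldsTo l′ l → toℕ l′ ≡ posA (toℕ l)
        survives-position l′ l (same , _) =
          let v , eq , pv = unfoldsTo-joint unfoldsTo (inject₁ l′)
              v≡ = inj₁-injective (trans (sym eq) same)
          in trans (sym (toℕ-inject₁ l′)) (trans (sym pv) (trans (cong pos v≡) (cong posA (toℕ-inject₁ l))))

      Unfolded-by : Set
      Unfolded-by = ∃[ D ] Σ[ S′ ∈ Subset (Caterpillar.len D) ]
        Spells D (A ++ u ++ inv u ++ u ++ B) ×
        (∀ {E} → Unfolding D S′ E → Unfolding C S E) ×
        (∀ {l′} → l′ ∈ₛ S′ → ∃[ l ] l ∈ₛ S ×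
          ((toℕ l < #links A × toℕ l′ ≡ toℕ l) ⊎
           (#links A + #links u ≤ toℕ l × toℕ l′ ≡ toℕ l + (#links u + #links u))))

      unfolded-by : Unfolded-by
      unfolded-by = unfoldedCaterpillar , survivors , spells-unfolded C i j i<j A u B sp #A #u ,
        step i j i<j fixes unfoldsTo survivors survivors-spec ,
        λ {l′} l′∈ → let l , l∈S , same = Equivalence.to (survivors-spec l′) l′∈
                         at = survives-position l′ l same
        in l , l∈S , (case outside l∈S of λ
          { (inj₁ lt) → inj₁ (lt , trans at (posA-≤ (<⇒≤ (subst (toℕ l <_) #A lt))))
          ; (inj₂ ge) → inj₂ (ge , trans at (trans (posA-≥ (subst (_≤ toℕ l) #u ge)) (cong (toℕ l +_) shift≡))) })

    unfolding-step : Unfolded-by i j i<j #A #u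
    unfolding-step = unfolded-by i j i<j #A #u

  -- Steps whose factor contains a link are carried out as unfoldings; the others leave the
  -- caterpillar as it is.
  realize : ∀ {k} {s s′ : Segments k} {x x′} → Star Expansion (s , x) (s′ , x′) → LinksBetween s →
            ∀ C S → Spells C (flat s x) → (∀ {l} → l ∈ₛ S → Position s (toℕ l)) →
            ∃[ D ] Unfolding C S D × Spells D (flat s′ x′)
  realize ε l C S sp S⊆ = C , done , sp
  realize {s = s} {s′} {x} {x′} (_◅_ {j = s₁ , x₁} E Es) l C S sp S⊆ = by-length (#links u ℕ.≟ 0)
    where
    open Expanded (expanded l E)
    Result : Set
    Result = ∃[ D ] Unfolding C S D × Spells D (flat s′ x′)
    sp₀ : Spells C (A ++ u ++ B)
    sp₀ = subst (Spells C) word≡ sp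
    by-length : Dec (#links u ≡ 0) → Result
    by-length (yes eq) = realize Es links C S
      (subst (Spells C) (sym word′≡) (spells-legs-only A u B eq sp₀))
      (λ {l} i → case outside (S⊆ i) of λ
        { (inj₁ lt) → kept (S⊆ i) lt
        ; (inj₂ ge) → subst (Position _) (trans (cong (toℕ l +_) (cong₂ _+_ eq eq)) (+-identityʳ _)) (shifted (S⊆ i) ge) })
    by-length (no ne) =
      let D , S₁ , sp₁ , extend , trace = UnfoldingStep.unfolding-step C S A u B ne sp₀ (λ i → outside (S⊆ i))
          E′ , us , sp′ = realize Es links D S₁ (subst (Spells D) (sym word′≡) sp₁)
            (λ i → case trace i of λ
              { (l , l∈S , inj₁ (lt , eq)) → subst (Position s₁) (sym eq) (kept (S⊆ l∈S) lt)
              ; (l , l∈S , inj₂ (ge , eq)) → subst (Position s₁) (sym eq) (shifted (S⊆ l∈S) ge) })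
      in E′ , extend us , sp′

  -- The word of a caterpillar is cut at the links in `S`; `x` is the part read since the last cut.
  segments-of : ∀ len (link : Fin len → Link τ) legs (S : Subset len) {k} (s : Segments k) x → LinksBetween s →
    Σ[ s′ ∈ Segments (∣ S ∣ + k) ] ∃[ x′ ] flat s′ x′ ≡ flat s (x ++ wordOf len link legs) × LinksBetween s′ ×
    (∀ {e} → Position s e → Position s′ e) × (∀ {l} → l ∈ₛ S → Position s′ (#links (flat s x) + toℕ l))
  segments-of zero link legs [] s x l = s , x ++ wordOf zero link legs , refl , l , id , λ { {()} }
  segments-of (suc len) link legs (b ∷ S) {k} s x l = go b
    where
    ψs = legWord (legs zero)
    c : Letter
    c = true , binary (link zero)
    word≡ : ∀ y → (x ++ ψs) ++ c ∷ y ≡ x ++ ψs ++ c ∷ y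
    word≡ y = ++-assoc x ψs (c ∷ y)
    #legs : #links (flat s (x ++ ψs)) ≡ #links (flat s x)
    #legs = trans (#links-flat s _) (trans (cong (#links (flat s []) +_) (trans (#links-++ x ψs)
      (trans (cong (#links x +_) (trans (cong #links (sym (++-identityʳ ψs))) (#links-legs (legs zero) []))) (+-identityʳ _))))
      (sym (#links-flat s x)))
    next : #links (flat s ((x ++ ψs) ++ c ∷ [])) ≡ suc (#links (flat s x))
    next = begin
      #links (flat s ((x ++ ψs) ++ c ∷ [])) ≡⟨ #links-flat s _ ⟩
      #links (flat s []) + #links ((x ++ ψs) ++ c ∷ []) ≡⟨ cong (#links (flat s []) +_) (trans (#links-++ (x ++ ψs) _) (+-comm _ 1)) ⟩
      #links (flat s []) + suc (#links (x ++ ψs)) ≡⟨ +-suc _ _ ⟩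
      suc (#links (flat s []) + #links (x ++ ψs)) ≡⟨ cong suc (trans (sym (#links-flat s _)) #legs) ⟩
      suc (#links (flat s x)) ∎
      where open ≡-Reasoning
    Result : ∀ {k′} → Subset (suc len) → Segments k′ → Set
    Result S s′ = ∃[ x′ ] flat s′ x′ ≡ flat s (x ++ ψs ++ c ∷ wordOf len (link ∘ suc) (legs ∘ suc)) × LinksBetween s′ ×
      (∀ {e} → Position s e → Position s′ e) × (∀ {l} → l ∈ₛ S → Position s′ (#links (flat s x) + toℕ l))
    member : ∀ {l} {b} → suc l ∈ₛ (b ∷ S) → l ∈ₛ S
    member (Vec.there i) = i
    go : ∀ b → Σ[ s′ ∈ Segments (∣ b ∷ S ∣ + k) ] Result (b ∷ S) s′
    go false =
      let s′ , x′ , eq , l′ , keep , pos = segments-of len (link ∘ suc) (legs ∘ suc) S s ((x ++ ψs) ++ c ∷ []) l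
      in s′ , x′ , trans eq (cong (flat s) (trans (++-assoc (x ++ ψs) _ _) (word≡ _))) , l′ , keep ,
         λ { {zero} () ; {suc l} i → subst (Position s′) (trans (cong (_+ toℕ l) next) (sym (+-suc _ (toℕ l)))) (pos (member i)) }
    go true =
      let s′ , x′ , eq , l′ , keep , pos = segments-of len (link ∘ suc) (legs ∘ suc) S (s ▸ (x ++ ψs) ∙ c) [] (l , true , link zero , refl)
          result : Result (true ∷ S) s′
          result = x′ , trans eq (cong (flat s) (word≡ _)) , l′ , (λ p → keep (inj₁ p)) ,
            λ { {zero} _ → subst (Position s′) (trans #legs (sym (+-identityʳ _))) (keep (inj₂ refl))
              ; {suc l} i → subst (Position s′) (trans (cong (_+ toℕ l) next) (sym (+-suc _ (toℕ l)))) (pos (member i)) }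
      in recast (+-suc ∣ S ∣ k) s′ result
      where
      recast : ∀ {k₁ k₂} → k₁ ≡ k₂ → (s′ : Segments k₁) → Result (true ∷ S) s′ → Σ[ s′ ∈ Segments k₂ ] Result (true ∷ S) s′
      recast refl s′ r = s′ , r

  -- A path in `𝔹` along an expansion of the segments would map the corresponding unfolding to `𝔹`,
  -- although it is an obstruction. The segments between the fixed vertebrae are thus free from the
  -- outset, without any greedy choice.
  fixed-duality⇒separated : ∀ {n} → HasFixedUnfoldedCaterpillarDuality n 𝔹 → SeparatedBy n
  fixed-duality⇒separated {n} (F , duality , closed) 𝔸 finite ¬hom =
    let 𝔽 , F𝔽 , g = Equivalence.to (proj₂ duality 𝔸 finite) ¬hom
        C , iso = proj₁ duality 𝔽 F𝔽
        S , S≤n , unfoldings = closed C 𝔽 iso F𝔽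
    in from-caterpillar C S S≤n
         (λ {D} us → duality-caterpillar duality ⟦ D ⟧ (unfoldings us ⟦ D ⟧ ≅-refl))
         (_∘ₕ_ {𝔸 = ⟦ C ⟧} {𝔽} {𝔸} g (≅-from iso))
    where
    from-caterpillar : ∀ C S → ∣ S ∣ ≤ n → (∀ {D} → Unfolding C S D → ¬ (⟦ D ⟧ ⟶ 𝔹)) → ⟦ C ⟧ ⟶ 𝔸 →
      ∃[ m ] #marks m ≤ n ×
      (∃₂ λ U V → Chain m U V × (∀ b → U b ≡ true) × (∀ b → V b ≡ false)) ×
      (∃₂ λ a a′ → PathIn 𝔸 (forgetMarks m) a a′)
    from-caterpillar C S S≤n ¬homs h =
      let s , x , eq , links , _ , positions =
            segments-of (Caterpillar.len C) (Caterpillar.link C) (Caterpillar.legs C) S ε [] tt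
          m , forget≡ , marks≤n , U , V , chain , U-full , V-empty =
            segments-separable s x (≤-trans (≤-reflexive (+-identityʳ ∣ S ∣)) S≤n) (isFree s x eq links positions)
      in m , marks≤n , (U , V , chain , (λ b → U-full tt) , λ b → Bool.¬-not (V-empty tt)) ,
         a , a′ , subst (λ w → PathIn 𝔸 w a a′) (sym (trans forget≡ eq)) (hom-Path em 𝔸 C h)
      where
      a  = proj₁ h (inj₁ zero)
      a′ = proj₁ h (inj₁ (fromℕ (Caterpillar.len C)))
      isFree : ∀ {k} (s : Segments k) x → flat s x ≡ word C → LinksBetween s →
               (∀ {l} → l ∈ₛ S → Position s (toℕ l)) → Free s x []
      isFree s x eq links positions {s′} {x′} t u (b , c , _ , _ , p) =
        let D , us , sp = realize (expansions t u) links C S (subst (Spells C) (sym eq) (spells-word C)) positions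
            trace = proj₁ (proj₂ (Path⇒Trace (flat s′ x′)
                      (subst (λ x → Path (flat s′ x) b c) (++-identityʳ x′) p)))
        in ¬homs us (spelled-hom em 𝔹 sp trace)

-- The canonical program

module _ {τ : Signature} where

  open Words (Item τ)

  letterSymbol : Letter → Symbol τ
  letterSymbol (_ , unary ψ)  = Leg.symbol ψ
  letterSymbol (_ , binary φ) = Link.symbol φ

  entry exit : (l : Letter) → Fin (arity τ (letterSymbol l))
  entry (_     , unary ψ)  = Leg.position ψ
  entry (true  , binary φ) = Link.source φ
  entry (false , binary φ) = Link.target φ
  exit  (_     , unary ψ)  = Leg.position ψ
  exit  (true  , binary φ) = Link.target φ
  exit  (false , binary φ) = Link.source φ

  module _ (em : EM) (𝔸 : Structure τ) where

    open Traces em 𝔸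

    tuple-step : ∀ l {r} → rel 𝔸 (letterSymbol l) r → Step l (lookup r (entry l)) (lookup r (exit l))
    tuple-step (true  , unary ψ)  {r} R = refl , r , R , refl
    tuple-step (false , unary ψ)  {r} R = refl , r , R , refl
    tuple-step (true  , binary φ) {r} R = r , R , refl , refl
    tuple-step (false , binary φ) {r} R = r , R , refl , refl

    step-tuple : ∀ l {x y} → Step l x y →
                 ∃[ r ] rel 𝔸 (letterSymbol l) r × lookup r (entry l) ≡ x × lookup r (exit l) ≡ y
    step-tuple (true  , unary ψ)  (refl , r , R , eq) = r , R , eq , eq
    step-tuple (false , unary ψ)  (refl , r , R , eq) = r , R , eq , eq
    step-tuple (true  , binary φ) (r , R , e , e′)    = r , R , e , e′
    step-tuple (false , binary φ) (r , R , e , e′)    = r , R , e′ , e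

arity≤maxArity : ∀ τ s → arity τ s ≤ maxArity τ
arity≤maxArity τ s = All.lookup (Extrema.xs≤max 0 _) (Mem.∈-map⁺ (arity τ) (Mem.∈-allFin s))

module _ (em : EM) {τ : Signature} (𝔹 : Structure τ) (finite : Finite (Carrier 𝔹)) where

  open Classical em
  open Words (Item τ)
  open Traces em 𝔹
  open Separation em 𝔹
  open CaterpillarChains em 𝔹 using (forgetMarks)
  open Canonical 𝔹 finite
  open Datalog τ ar
  open Inverse (proj₂ finite) using (to; from; strictlyInverseʳ)

  private
    subset : (Carrier 𝔹 → Bool) → Subset (proj₁ finite)
    subset U = tabulate (U ∘ from)

    lookup-subset : ∀ U b → lookup (subset U) (to b) ≡ U b
    lookup-subset U b = trans (lookup∘tabulate (U ∘ from) (to b)) (cong U (strictlyInverseʳ b))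

    ∈subset⁺ : ∀ {U b} → U b ≡ true → to b ∈ₛ subset U
    ∈subset⁺ {U} {b} e = Vec.lookup⇒[]= (to b) (subset U) (trans (lookup-subset U b) e)

    ∈subset⁻ : ∀ {U b} → to b ∈ₛ subset U → U b ≡ true
    ∈subset⁻ {U} {b} i = trans (sym (lookup-subset U b)) (Vec.[]=⇒lookup i)

    -- Starts a derivation with the full set. The rule has a variable, so it obeys the bound
    -- `maxArity τ` only if there is a symbol at all.
    beginRule : (Carrier 𝔹 → Bool) → Rule
    beginRule U = record { #vars = 1 ; head = unary (subset U) ⟪ zero ∷ [] ⟫ ; idbs = [] ; edbs = [] }

    letterRule : Letter → (V U : Carrier 𝔹 → Bool) → Rule
    letterRule l V U = record
      { #vars = arity τ (letterSymbol l)
      ; head  = unary (subset V) ⟪ exit l ∷ [] ⟫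
      ; idbs  = unary (subset U) ⟪ entry l ∷ [] ⟫ ∷ []
      ; edbs  = letterSymbol l ⟪ Vec.allFin _ ⟫ ∷ []
      }

    goalRule : (Carrier 𝔹 → Bool) → Rule
    goalRule V = record { #vars = 1 ; head = goal ⟪ [] ⟫ ; idbs = unary (subset V) ⟪ zero ∷ [] ⟫ ∷ [] ; edbs = [] }

    allFin-step : ∀ l {𝔸 : Structure τ} ρ → rel 𝔸 (letterSymbol l) (Vec.map ρ (Vec.allFin _)) →
                  Traces.Step em 𝔸 l (ρ (entry l)) (ρ (exit l))
    allFin-step l {𝔸} ρ R =
      subst₂ (Traces.Step em 𝔸 l) (lookup-map-tabulate ρ id (entry l)) (lookup-map-tabulate ρ id (exit l)) (tuple-step em 𝔸 l R)

    letterRule-lam : ∀ l {U V} → ForwardStep l U V → lam (letterRule l V U)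
    letterRule-lam l {U} {V} forward = arity≤maxArity τ _ , ≤-refl , ≤-refl ,
      λ { ρ (u ∷ []) (R ∷ []) → ∈subset⁺ {V} (forward (allFin-step l {𝔹} ρ R) (∈subset⁻ {U} u)) }

    reversed-lam : ∀ l {U V} → BalancedStep l U V →
                   ∃[ r′ ] Reversed (letterRule l V U) r′ × lam r′
    reversed-lam l {U} {V} balanced = _ , reversed , arity≤maxArity τ _ , ≤-refl , ≤-refl ,
      λ { ρ (v ∷ []) (R ∷ []) → ∈subset⁺ {U} (trans (balanced (allFin-step l {𝔹} ρ R)) (∈subset⁻ {V} v)) }

  module _ (n : ℕ) where

    open Copies n

    module _ (𝔸 : Structure τ) where

      DerivesC : ∀ Q → Vec (Carrier 𝔸) (arᶜ Q) → Set
      DerivesC = Datalog.Derives τ arᶜ snlam 𝔸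

      module _ (h : 𝔸 ⟶ 𝔹) where

        private
          edbs-sound : ∀ {k} (ρ : Fin k → Carrier 𝔸) {φs} → All (λ φ → rel 𝔸 ⊩ φ [ ρ ]) φs →
                       All (λ φ → rel 𝔹 ⊩ φ [ proj₁ h ∘ ρ ]) φs
          edbs-sound ρ = All.map λ {φ} R →
            subst (rel 𝔹 (Atom.symbol φ)) (sym (map-∘ (proj₁ h) ρ (Atom.args φ))) (proj₂ h _ _ R)

        derives-sound : ∀ {Q t} → DerivesC Q t → interpretation (proj₂ Q) (Vec.map (proj₁ h) t)
        idbs-sound : ∀ {k} (ρ : Fin k → Carrier 𝔸) i φs →
          All (λ φ → DerivesC (Atom.symbol φ) (Vec.map ρ (Atom.args φ))) (List.map (copyAtom i) φs) →
          All (λ φ → interpretation ⊩ φ [ proj₁ h ∘ ρ ]) φs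
        valid-sound : ∀ r → Valid r → (ρ : Fin (#vars r) → Carrier 𝔸) →
          All (λ φ → interpretation ⊩ φ [ proj₁ h ∘ ρ ]) (idbs r) → All (λ φ → rel 𝔸 ⊩ φ [ ρ ]) (edbs r) →
          interpretation (headIDB r) (Vec.map (proj₁ h) (Vec.map ρ (Atom.args (head r))))

        derives-sound (Datalog.fire _ (within r ((_ , _ , _ , valid) , _) i) ρ ds es) =
          valid-sound r valid ρ (idbs-sound ρ i (idbs r) ds) es
        derives-sound (Datalog.fire _ (between r (_ , _ , _ , valid) _ i) ρ ds es) =
          valid-sound r valid ρ (idbs-sound ρ (suc i) (idbs r) ds) es
        idbs-sound ρ i []       []       = []
        idbs-sound ρ i (φ ∷ φs) (d ∷ ds) =
          subst (interpretation _) (sym (map-∘ (proj₁ h) ρ (Atom.args φ))) (derives-sound d) ∷ idbs-sound ρ i φs ds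
        valid-sound r valid ρ is es =
          subst (interpretation _) (map-∘ (proj₁ h) ρ _) (valid (proj₁ h ∘ ρ) is (edbs-sound ρ es))

      private
        At : Fin (suc n) → (Carrier 𝔹 → Bool) → Carrier 𝔸 → Set
        At i U a = DerivesC (i , unary (subset U)) (a ∷ [])

        module _ (l : Letter) {U V : Carrier 𝔹 → Bool} {a c} (step : Traces.Step em 𝔸 l a c) where

          private
            r = proj₁ (step-tuple em 𝔸 l step)
            R = proj₁ (proj₂ (step-tuple em 𝔸 l step))
            edb : rel 𝔸 (letterSymbol l) (Vec.map (lookup r) (Vec.allFin _))
            edb = subst (rel 𝔸 _) (sym (Vec.map-lookup-allFin r)) R
            r-entry = proj₁ (proj₂ (proj₂ (step-tuple em 𝔸 l step)))
            r-exit  = proj₂ (proj₂ (proj₂ (step-tuple em 𝔸 l step)))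

          free-rule : BalancedStep l U V → ∀ i → At i U a → At i V c
          free-rule balanced i d = subst (At i V) r-exit (Datalog.fire _
            (within (letterRule l V U)
              (letterRule-lam l {U} {V} (λ s u → trans (sym (balanced s)) u) , inj₂ (inj₂ (reversed-lam l {U} {V} balanced))) i)
            (lookup r) (subst (At i U) (sym r-entry) d ∷ []) (edb ∷ []))

          fixed-rule : ForwardStep l U V → ∀ i → At (suc i) U a → At (inject₁ i) V c
          fixed-rule forward i d = subst (At (inject₁ i) V) r-exit (Datalog.fire _
            (between (letterRule l V U) (letterRule-lam l {U} {V} forward) (λ ()) i)
            (lookup r) (subst (At (suc i) U) (sym r-entry) d ∷ []) (edb ∷ []))

        -- Exact steps stay within a copy, and a marked letter leads to the copy below; from copy
        -- `n` there is room for `n` marks.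
        chain-derives : ∀ {m U V a c} → Chain m U V → PathIn 𝔸 (forgetMarks m) a c →
                        ∀ i → #marks m ≤ toℕ i → At i U a → ∃[ i′ ] At i′ V c
        chain-derives ([] e) refl i _ d =
          i , subst (λ S → DerivesC (i , unary S) _) (tabulate-cong (e ∘ from)) d
        chain-derives (free {l} {U = U} {V} b ch) (_ , s , p) i le d =
          chain-derives ch p i le (free-rule l {U} {V} s b i d)
        chain-derives (fixed {l} {U = U} {V} f ch) (_ , s , p) (suc i) (s≤s le) d =
          chain-derives ch p (inject₁ i) (subst (_ ≤_) (sym (toℕ-inject₁ i)) le) (fixed-rule l {U} {V} s f i d)

      full⇒goal : ∀ {m U V a c} → 1 ≤ maxArity τ → #marks m ≤ n → Chain m U V →
        (∀ b → U b ≡ true) → (∀ b → V b ≡ false) → PathIn 𝔸 (forgetMarks m) a c → ∃[ i ] DerivesC (i , goal) []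
      full⇒goal {m} {U} {V} {a} {c} 1≤ marks≤n ch full empty p =
        let i , d = chain-derives ch p (fromℕ n) (subst (#marks m ≤_) (sym (toℕ-fromℕ n)) marks≤n)
              (Datalog.fire _ (within (beginRule U)
                ((1≤ , z≤n , z≤n , λ _ _ _ → ∈subset⁺ {U} (full _)) , inj₁ refl) (fromℕ n)) (λ _ → a) [] [])
        in i , Datalog.fire _ (within (goalRule V)
                 ((1≤ , ≤-refl , z≤n , λ { ρ (v ∷ []) _ → case trans (sym (empty _)) (∈subset⁻ {V} v) of λ () }) , inj₂ (inj₁ refl)) i)
                 (λ _ → c) (d ∷ []) []

    separated⇒canonical : Carrier 𝔹 → SeparatedBy n → SolvedByCanonicalSnlam n 𝔹 finite
    separated⇒canonical b₀ separated 𝔸 finite𝔸 = mk⇔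
      (λ { ((_ , goal) , refl , [] , d) h → derives-sound 𝔸 h d })
      (λ ¬h → complete (separated 𝔸 finite𝔸 ¬h))
      where
      complete : _ → _
      -- An empty word would identify the full set with the empty one, against `b₀`. Any other word
      -- contains a symbol, so that rules with a variable are available.
      complete ([] , _ , (U , V , [] e , full , empty) , _) =
        case trans (sym (full b₀)) (trans (e b₀) (empty b₀)) of λ ()
      complete (m@((_ , l) ∷ _) , marks≤n , (U , V , ch , full , empty) , a , c , p) =
        let i , d = full⇒goal 𝔸 (≤-trans (>-nonZero⁻¹ _ {{arity-positive τ (letterSymbol l)}}) (arity≤maxArity τ (letterSymbol l))) marks≤n ch full empty p
        in _ , refl , _ , d

listable-Subset : ∀ m → Listable (Subset m)
listable-Subset m = listable-Vec m (true ∷ false ∷ [] , λ { true → here refl ; false → there (here refl) })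

module _ (em : EM) {τ : Signature} {IDB : Set} (ar : IDB → ℕ) (idbs-listable : Listable IDB) where

  open Classical em
  open Datalog τ ar

  bounded-rules-finite : ∀ K (P : Program) → (∀ r → P r → #vars r ≤ K × LinearRule r × ArcRule r) → FiniteProgram P
  bounded-rules-finite K P bounded = List.filter P? rules , λ r → mk⇔
    (λ p → let k≤K , l , a = bounded r p in Mem.∈-filter⁺ P? (∈rules k≤K l a) p)
    (λ i → proj₂ (Mem.∈-filter⁻ P? {xs = rules} i))
    where
    P? : ∀ r → Dec (P r)
    P? r = decide (P r)
    short : ∀ {A : Set} → Listable A → List (List A)
    short (as , _) = [] ∷ List.map List.[_] as
    ∈short : ∀ {A : Set} (l : Listable A) {xs} → length xs ≤ 1 → xs ∈ short l
    ∈short l {[]}     _ = here refl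
    ∈short l {x ∷ []} _ = there (Mem.∈-map⁺ List.[_] (proj₂ l x))
    ∈short l {_ ∷ _ ∷ _} (s≤s ())
    atoms : ∀ {S : Set} (ar : S → ℕ) k → Listable S → Listable (Atom ar (Fin k))
    atoms ar k l = listable-image (λ (s , xs) → s ⟪ xs ⟫) (λ { (s ⟪ xs ⟫) → (s , xs) , refl })
      (listable-Σ l λ s → listable-Vec (ar s) (listable-Fin k))
    heads : ∀ k → Listable (Atom ar (Fin k))
    heads k = atoms ar k idbs-listable
    edbAtoms : ∀ k → Listable (Atom (arity τ) (Fin k))
    edbAtoms k = atoms (arity τ) k (listable-Fin _)
    withEdbs : ∀ k → Atom ar (Fin k) → List (Atom ar (Fin k)) → List Rule
    withEdbs k h is = List.map (λ es → record { #vars = k ; head = h ; idbs = is ; edbs = es }) (short (edbAtoms k))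
    withHead : ∀ k → Atom ar (Fin k) → List Rule
    withHead k h = List.concatMap (withEdbs k h) (short (heads k))
    withVars : ℕ → List Rule
    withVars k = List.concatMap (withHead k) (proj₁ (heads k))
    rules : List Rule
    rules = List.concatMap withVars (List.upTo (suc K))
    ∈-concatMap : ∀ {A C : Set} (f : A → List C) {xs c} x → x ∈ xs → c ∈ f x → c ∈ List.concatMap f xs
    ∈-concatMap f {xs} x i j = Mem.∈-concatMap⁺ f {xs = xs} (Any.map (λ { refl → j }) i)
    ∈rules : ∀ {r} → #vars r ≤ K → LinearRule r → ArcRule r → r ∈ rules
    ∈rules {r} k≤K l a =
      ∈-concatMap withVars k (Mem.∈-upTo⁺ (s≤s k≤K)) (∈-concatMap (withHead k) (head r) (proj₂ (heads k) (head r))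
      (∈-concatMap (withEdbs k (head r)) (idbs r) (∈short (heads k) l) (Mem.∈-map⁺ _ (∈short (edbAtoms k) a))))
      where k = #vars r

module _ (em : EM) {τ : Signature} (𝔹 : Structure τ) (finite : Finite (Carrier 𝔹)) (n : ℕ) where

  open Canonical 𝔹 finite
  open Copies n
  open Datalog τ arᶜ

  private
    listable-copies : Listable (Fin (suc n) × IDB)
    listable-copies = listable-Σ (listable-Fin _) λ _ → goal ∷ List.map unary (proj₁ (listable-Subset _)) ,
      λ { goal → here refl ; (unary U) → there (Mem.∈-map⁺ unary (proj₂ (listable-Subset _) U)) }

    bounded : ∀ r → snlam r → #vars r ≤ maxArity τ × LinearRule r × ArcRule r
    bounded _ (within r ((k , l , a , _) , _) i) = k , subst (_≤ 1) (sym (List.length-map (copyAtom i) (Datalog.idbs r))) l , a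
    bounded _ (between r (k , l , a , _) _ i)    = k , subst (_≤ 1) (sym (List.length-map (copyAtom (suc i)) (Datalog.idbs r))) l , a

    _≼_ : Fin (suc n) × IDB → Fin (suc n) × IDB → Set
    (i , _) ≼ (j , _) = i Fin.≤ j

    chain-bound : ∀ Q Qs → Linked (λ Q Q′ → Q ≼ Q′ × ¬ (Q′ ≼ Q)) (Q ∷ Qs) → toℕ (proj₁ Q) + length (Q ∷ Qs) ≤ suc n
    chain-bound (i , _) []       [-]             = ≤-trans (≤-reflexive (+-comm (toℕ i) 1)) (toℕ<n i)
    chain-bound (i , _) (Q ∷ Qs) ((_ , ¬≤) ∷ ls) = ≤-trans (≤-reflexive (+-suc (toℕ i) _))
      (≤-trans (+-monoˡ-≤ (suc (length Qs)) (≰⇒> ¬≤)) (chain-bound Q Qs ls))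

    -- Between copies the order is strict, so nothing has to be reversed. Within a copy, the
    -- reversal of a rule for the goal is valid since `goal` is interpreted as empty.
    symmetric : ∀ r r′ → snlam r → Reversed r r′ →
                headIDB r ≼ headIDB r′ × (headIDB r′ ≼ headIDB r → snlam r′)
    symmetric _ _ (within r@(record { idbs = _ ∷ [] }) (_ , inj₁ ()) i) reversed
    symmetric _ _ (within r@(record { head = _ ⟪ [] ⟫ ; idbs = _ ∷ [] }) (lam-r@(k , _ , a , _) , inj₂ (inj₁ refl)) i) reversed =
      ≤-refl , λ _ → within _ ((k , ≤-refl , a , λ { ρ (() ∷ []) _ }) , inj₂ (inj₂ (r , Datalog.reversed , lam-r))) i
    symmetric _ _ (within r@(record { idbs = _ ∷ [] }) (lam-r , inj₂ (inj₂ (r′ , Datalog.reversed , lam-r′))) i) reversed =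
      ≤-refl , λ _ → within r′ (lam-r′ , inj₂ (inj₂ (r , Datalog.reversed , lam-r))) i
    symmetric _ _ (between r@(record { idbs = _ ∷ [] }) _ _ i) reversed =
      ≤-trans (≤-reflexive (toℕ-inject₁ i)) (n≤1+n _) ,
      λ le → contradiction (subst (suc (toℕ i) ≤_) (toℕ-inject₁ i) le) 1+n≰n

    -- A program has a single goal predicate. The goal is handed down to copy `zero` by rules that
    -- are valid because their body is never satisfied in `𝔹`.
    descend : ∀ {𝔸} i → Derives snlam 𝔸 (i , goal) [] → Derives snlam 𝔸 (zero , goal) []
    descend {𝔸} i d = go (toℕ i) i refl d
      where
      rule : Datalog.Rule τ ar
      rule = record { #vars = 0 ; head = goal ⟪ [] ⟫ ; idbs = goal ⟪ [] ⟫ ∷ [] ; edbs = [] }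
      go : ∀ m i → toℕ i ≡ m → Derives snlam 𝔸 (i , goal) [] → Derives snlam 𝔸 (zero , goal) []
      go zero    zero    _  d = d
      go (suc m) (suc i) eq d = go m (inject₁ i) (trans (toℕ-inject₁ i) (ℕ.suc-injective eq))
        (fire _ (between rule (z≤n , ≤-refl , z≤n , λ { ρ (() ∷ []) _ }) (λ ()) i) (λ ()) (d ∷ []) [])

  canonical⇒snlam : SolvedByCanonicalSnlam n 𝔹 finite → SolvedBySnlam n 𝔹
  canonical⇒snlam solves = _ , listable⇒finite em listable-copies , arᶜ , (zero , goal) , refl ,
    (λ { (_ , goal) → z≤n ; (_ , unary _) → ≤-refl }) ,
    snlam , bounded-rules-finite em arᶜ listable-copies (maxArity τ) snlam bounded ,
    (λ r p → proj₂ (proj₂ (bounded r p))) ,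
    ((λ r p → proj₁ (proj₂ (bounded r p))) , _≼_ ,
      record { isEquivalence = isEquivalence ; reflexive = λ { refl → ≤-refl } ; trans = ≤-trans } ,
      (λ { [] _ → z≤n ; (Q ∷ Qs) ls → ≤-trans (m≤n+m _ (toℕ (proj₁ Q))) (chain-bound Q Qs ls) }) , symmetric) ,
    λ 𝔸 finite𝔸 → mk⇔
      (λ { (_ , refl , t , d) → Equivalence.to (solves 𝔸 finite𝔸) (_ , refl , t , d) })
      (λ ¬h → case Equivalence.from (solves 𝔸 finite𝔸) ¬h of λ { ((i , goal) , refl , [] , d) → _ , refl , _ , descend i d })

-- A primitive positive power of a transitive tournament

module _ {σ : Signature} {k : ℕ} (𝔸 : Structure σ) (⊤′ : PP σ k) where

  ⋀ : List (PP σ k) → PP σ k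
  ⋀ = List.foldr _∧_ ⊤′

  ⊨⋀⁺ : ∀ {ρ} φs → 𝔸 ⊨ ⊤′ [ ρ ] → All (𝔸 ⊨_[ ρ ]) φs → 𝔸 ⊨ ⋀ φs [ ρ ]
  ⊨⋀⁺ []       t []       = t
  ⊨⋀⁺ (_ ∷ φs) t (s ∷ ss) = s , ⊨⋀⁺ φs t ss

  ⊨⋀⁻ : ∀ {ρ} φs → 𝔸 ⊨ ⋀ φs [ ρ ] → All (𝔸 ⊨_[ ρ ]) φs
  ⊨⋀⁻ []       _        = []
  ⊨⋀⁻ (_ ∷ φs) (s , ss) = s ∷ ⊨⋀⁻ φs ss

funToFin-cong : ∀ {m n} {f g : Fin m → Fin n} → f ≗ g → Fin.funToFin f ≡ Fin.funToFin g
funToFin-cong {zero}  eq = refl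
funToFin-cong {suc m} eq = cong₂ Fin.combine (eq zero) (funToFin-cong (eq ∘ suc))

-- The coordinates of the power are the functions from 𝔹 to the tournament, and
-- a relation holds if it satisfies all equalities and edges between
-- coordinates which the relation of 𝔹 imposes.
module TournamentPower (em : EM) {τ : Signature} (𝔹 : Structure τ)
                       (finite : Finite (Carrier 𝔹)) (n : ℕ) where

  open Classical em
  open Inverse (proj₂ finite) using (to; from; strictlyInverseʳ)

  Coordinate : Set
  Coordinate = Carrier 𝔹 → Fin (2 + n)

  dimension : ℕ
  dimension = (2 + n) ^ proj₁ finite

  instance
    dimension-nonZero : NonZero dimension
    dimension-nonZero = ℕ.m^n≢0 (2 + n) (proj₁ finite)

  decode : Fin dimension → Coordinate
  decode κ b = Fin.finToFun κ (to b)

  encode : Coordinate → Fin dimension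
  encode u = Fin.funToFin (u ∘ from)

  decode-encode : ∀ u b → decode (encode u) b ≡ u b
  decode-encode u b = trans (Fin.finToFun-funToFin (u ∘ from) (to b)) (cong u (strictlyInverseʳ b))

  encode-cong : ∀ {u u′} → u ≗ u′ → encode u ≡ encode u′
  encode-cong eq = funToFin-cong (eq ∘ from)

  Constraint : Symbol τ → Set
  Constraint s = (Fin (arity τ s) × Fin dimension) × (Fin (arity τ s) × Fin dimension)

  Forced : (Fin (2 + n) → Fin (2 + n) → Set) → ∀ s → Constraint s → Set
  Forced _~_ s ((p , κ) , (q , κ′)) = ∀ t → rel 𝔹 s t → decode κ (lookup t p) ~ decode κ′ (lookup t q)

  module _ (s : Symbol τ) where

    private
      variableOf : Fin (arity τ s) × Fin dimension → Fin (arity τ s * dimension)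
      variableOf (p , κ) = Fin.combine p κ

      trivial : PP digraph (arity τ s * dimension)
      trivial = x ≐ x
        where x = variableOf (fromℕ< (>-nonZero⁻¹ _ {{arity-positive τ s}}) , fromℕ< (>-nonZero⁻¹ dimension))

      guarded : Set → PP digraph (arity τ s * dimension) → PP digraph (arity τ s * dimension)
      guarded P φ = if truth P then φ else trivial

      constraints : Listable (Constraint s)
      constraints = listable-Σ places λ _ → places
        where places = listable-Σ (listable-Fin _) λ _ → listable-Fin _

      clause : Constraint s → PP digraph (arity τ s * dimension)
      clause c@(x , y) = guarded (Forced _≡_ s c) (variableOf x ≐ variableOf y)
                       ∧ guarded (Forced Fin._<_ s c) (atom zero (variableOf x ∷ variableOf y ∷ []))

      guarded⁺ : ∀ {P φ ρ} → (P → 𝕋 (2 + n) ⊨ φ [ ρ ]) → 𝕋 (2 + n) ⊨ guarded P φ [ ρ ]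
      guarded⁺ {P} f with decide P
      ... | yes p = f p
      ... | no _  = refl

      guarded⁻ : ∀ {P φ ρ} → 𝕋 (2 + n) ⊨ guarded P φ [ ρ ] → P → 𝕋 (2 + n) ⊨ φ [ ρ ]
      guarded⁻ {P} s p with decide P
      ... | yes _ = s
      ... | no ¬p = contradiction p ¬p

    formula : PP digraph (arity τ s * dimension)
    formula = ⋀ (𝕋 (2 + n)) trivial (List.map clause (proj₁ constraints))

    Satisfies : (Fin (2 + n) → Fin (2 + n) → Set) → Vec (Vec (Fin (2 + n)) dimension) (arity τ s) → Constraint s → Set
    Satisfies _~_ v ((p , κ) , (q , κ′)) = lookup (lookup v p) κ ~ lookup (lookup v q) κ′

    formula⁺ : ∀ v → (∀ c → Forced _≡_ s c → Satisfies _≡_ v c) → (∀ c → Forced Fin._<_ s c → Satisfies Fin._<_ v c) →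
               𝕋 (2 + n) ⊨ formula [ Vec.concat v ]
    formula⁺ v eqs lts = ⊨⋀⁺ (𝕋 (2 + n)) trivial (List.map clause (proj₁ constraints)) refl
      (All.map⁺ (All.universal (λ c → guarded⁺ (subst₂ _≡_ (sym (at (proj₁ c))) (sym (at (proj₂ c))) ∘ eqs c) ,
                                      guarded⁺ (subst₂ Fin._<_ (sym (at (proj₁ c))) (sym (at (proj₂ c))) ∘ lts c)) (proj₁ constraints)))
      where
      at : ∀ x → lookup (Vec.concat v) (variableOf x) ≡ lookup (lookup v (proj₁ x)) (proj₂ x)
      at (p , κ) = lookup-concat v p κ

    module _ (v : Vec (Vec (Fin (2 + n)) dimension) (arity τ s)) (sat : 𝕋 (2 + n) ⊨ formula [ Vec.concat v ]) where

      private
        at : ∀ x → lookup (Vec.concat v) (variableOf x) ≡ lookup (lookup v (proj₁ x)) (proj₂ x)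
        at (p , κ) = lookup-concat v p κ

        clauseAt : ∀ c → 𝕋 (2 + n) ⊨ clause c [ Vec.concat v ]
        clauseAt c = All.lookup (All.map⁻ (⊨⋀⁻ (𝕋 (2 + n)) trivial (List.map clause (proj₁ constraints)) sat)) (proj₂ constraints c)

      formula-equal : ∀ c → Forced _≡_ s c → Satisfies _≡_ v c
      formula-equal c f = subst₂ _≡_ (at (proj₁ c)) (at (proj₂ c)) (guarded⁻ (proj₁ (clauseAt c)) f)

      formula-below : ∀ c → Forced Fin._<_ s c → Satisfies Fin._<_ v c
      formula-below c f = subst₂ Fin._<_ (at (proj₁ c)) (at (proj₂ c)) (guarded⁻ (proj₂ (clauseAt c)) f)

  tournamentPower : Structure τ
  tournamentPower = ppPower (𝕋 (2 + n)) dimension formula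

  -- Evaluation at an element. The forced constraints are by definition those that hold for the
  -- evaluations of every tuple.
  embedding : 𝔹 ⟶ tournamentPower
  embedding = (λ b → tabulate (λ κ → decode κ b)) , λ s t r → formula⁺ s (Vec.map (λ b → tabulate (λ κ → decode κ b)) t)
    (λ ((p , κ) , (q , κ′)) f → subst₂ _≡_ (sym (value t p κ)) (sym (value t q κ′)) (f t r))
    (λ ((p , κ) , (q , κ′)) f → subst₂ Fin._<_ (sym (value t p κ)) (sym (value t q κ′)) (f t r))
    where
    value : ∀ {k} (t : Vec (Carrier 𝔹) k) p κ →
            lookup (lookup (Vec.map (λ b → tabulate (λ κ → decode κ b)) t) p) κ ≡ decode κ (lookup t p)
    value t p κ = trans (cong (λ v → lookup v κ) (lookup-map p _ t)) (lookup∘tabulate _ κ)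

-- Enough copies of each element, so that tuples may be assumed injective

module BlowUp (em : EM) {τ : Signature} (𝔽 𝔹 : Structure τ) (finite : Finite (Carrier 𝔹)) where

  open Classical em
  open Inverse (proj₂ finite) using (to; from; strictlyInverseʳ)

  blowUp : Structure τ
  blowUp = record
    { Carrier = Carrier 𝔽 × Vec (Fin (maxArity τ)) (proj₁ finite)
    ; rel     = λ s t → rel 𝔽 s (Vec.map proj₁ t) × (∀ {p q} → lookup t p ≡ lookup t q → p ≡ q)
    }

  -- If for each b some index i b is missing among the copies of v sent to b,
  -- then the copy (i b)_b is sent nowhere.
  frequent-value : (h : Carrier blowUp → Carrier 𝔹) (v : Carrier 𝔽) →
                   ∃[ b ] ∀ i → ∃[ c ] lookup c (to b) ≡ i × h (v , c) ≡ b
  frequent-value h v = stable λ ¬frequent →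
    let missing : ∀ b → ∃[ i ] ¬ (∃[ c ] lookup c (to b) ≡ i × h (v , c) ≡ b)
        missing b = ¬∀⇒∃ λ f → ¬frequent (b , f)
        c = tabulate (proj₁ ∘ missing ∘ from)
        b = h (v , c)
    in proj₂ (missing b) (c , trans (lookup∘tabulate _ (to b)) (cong (proj₁ ∘ missing) (strictlyInverseʳ b)) , refl)

  -- For the `p`-th entry of a tuple, a copy is chosen that is sent to the frequent value and has
  -- index `p` there. The index keeps the copies apart even where entries of the tuple coincide.
  blowUp-hom : blowUp ⟶ 𝔹 → 𝔽 ⟶ 𝔹
  blowUp-hom (h , hom) = value , λ s t r → subst (rel 𝔹 s) (spread-value s t)
    (hom s (spread s t) (subst (rel 𝔽 s) (spread-proj₁ s t) r , spread-injective s t))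
    where
    value : Carrier 𝔽 → Carrier 𝔹
    value v = proj₁ (frequent-value h v)
    copy : ∀ s (t : Vec (Carrier 𝔽) (arity τ s)) p → Vec (Fin (maxArity τ)) (proj₁ finite)
    copy s t p = proj₁ (proj₂ (frequent-value h (lookup t p)) (Fin.inject≤ p (arity≤maxArity τ s)))
    spread : ∀ s → Vec (Carrier 𝔽) (arity τ s) → Vec (Carrier blowUp) (arity τ s)
    spread s t = tabulate λ p → lookup t p , copy s t p
    spread-proj₁ : ∀ s t → t ≡ Vec.map proj₁ (spread s t)
    spread-proj₁ s t = lookup-ext λ p → sym (lookup-map-tabulate proj₁ _ p)
    spread-value : ∀ s t → Vec.map h (spread s t) ≡ Vec.map value t
    spread-value s t = lookup-ext λ p → trans (lookup-map-tabulate h _ p)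
      (trans (proj₂ (proj₂ (proj₂ (frequent-value h (lookup t p)) _))) (sym (lookup-map p value t)))
    spread-injective : ∀ s t {p q} → lookup (spread s t) p ≡ lookup (spread s t) q → p ≡ q
    spread-injective s t {p} {q} eq = Fin.inject≤-injective (arity≤maxArity τ s) (arity≤maxArity τ s) p q
      (trans (sym (index p)) (trans (cong₂ (λ v c → lookup c (to (value v))) (cong proj₁ eq′) (cong proj₂ eq′)) (index q)))
      where
      eq′ : (lookup t p , copy s t p) ≡ (lookup t q , copy s t q)
      eq′ = trans (sym (lookup∘tabulate _ p)) (trans eq (lookup∘tabulate _ q))
      index : ∀ p → lookup (copy s t p) (to (value (lookup t p))) ≡ Fin.inject≤ p (arity≤maxArity τ s)
      index p = proj₁ (proj₂ (proj₂ (frequent-value h (lookup t p)) _))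

  blowUp-finite : Listable (Carrier 𝔽) → Finite (Carrier blowUp)
  blowUp-finite l = listable⇒finite em (listable-Σ l λ _ → listable-Vec _ (listable-Fin _))

-- Extracting a homomorphism from the tournament power

greatest : ∀ (em : EM) (P : ℕ → Set) n → P 0 → (∀ k → P k → k ≤ n) →
           ∃[ k ] P k × k ≤ n × (∀ k′ → P k′ → k′ ≤ k)
greatest em P n p₀ bound = go n bound
  where
  open Classical em
  go : ∀ n → (∀ k → P k → k ≤ n) → ∃[ k ] P k × k ≤ n × (∀ k′ → P k′ → k′ ≤ k)
  go zero    b = 0 , p₀ , z≤n , b
  go (suc n) b with decide (P (suc n))
  ... | yes p = suc n , p , ≤-refl , b
  ... | no ¬p = let k , p , le , max = go n (λ k pk → ≤-pred (≤∧≢⇒< (b k pk) λ { refl → ¬p pk }))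
                in k , p , m≤n⇒m≤1+n le , max

module Colevel (em : EM) {Q : Set} (_≼_ : Q → Q → Set) (preorder : IsPreorder _≡_ _≼_) (n : ℕ)
  (bound : ∀ Qs → Linked (λ p q → p ≼ q × ¬ (q ≼ p)) Qs → length Qs ≤ suc n) where

  open Classical em

  private
    module ≼ = IsPreorder preorder

    _≺_ : Q → Q → Set
    p ≺ q = p ≼ q × ¬ (q ≼ p)

    Above : Q → ℕ → Set
    Above q k = ∃[ qs ] length qs ≡ k × Linked _≺_ (q ∷ qs)

    colevel′ : ∀ q → ∃[ k ] Above q k × k ≤ n × (∀ k′ → Above q k′ → k′ ≤ k)
    colevel′ q = greatest em (Above q) n ([] , refl , [-]) λ { k (qs , refl , l) → ≤-pred (bound (q ∷ qs) l) }

    lower-end : ∀ {p q} → p ≼ q → ∀ {qs} → Linked _≺_ (q ∷ qs) → Linked _≺_ (p ∷ qs)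
    lower-end le [-]             = [-]
    lower-end le ((l , ¬l) ∷ ls) = (≼.trans le l , λ l′ → ¬l (≼.trans l′ le)) ∷ ls

  -- The length of the longest strict chain above `q`. Heads lie below bodies in the order, so this
  -- number never decreases along a derivation, in step with the thresholds.
  colevel : Q → Fin (suc n)
  colevel q = fromℕ< (s≤s (proj₁ (proj₂ (proj₂ (colevel′ q)))))

  private
    toℕ-colevel : ∀ q → toℕ (colevel q) ≡ proj₁ (colevel′ q)
    toℕ-colevel q = toℕ-fromℕ< (s≤s (proj₁ (proj₂ (proj₂ (colevel′ q)))))

  colevel-antitone : ∀ {p q} → p ≼ q → colevel q Fin.≤ colevel p
  colevel-antitone {p} {q} le = subst₂ _≤_ (sym (toℕ-colevel q)) (sym (toℕ-colevel p))
    (let qs , eq , l = proj₁ (proj₂ (colevel′ q))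
     in proj₂ (proj₂ (proj₂ (colevel′ p))) _ (qs , eq , lower-end le l))

  colevel-strict : ∀ {p q} → p ≼ q → colevel q ≡ colevel p → q ≼ p
  colevel-strict {p} {q} le eq = stable λ ¬le →
    let qs , len , l = proj₁ (proj₂ (colevel′ q))
        longer = proj₂ (proj₂ (proj₂ (colevel′ p))) _ (q ∷ qs , cong suc len , (le , ¬le) ∷ l)
    in 1+n≰n (≤-trans longer (≤-reflexive (trans (sym (toℕ-colevel p)) (trans (cong toℕ (sym eq)) (toℕ-colevel q)))))

-- The arity of an abstract predicate does not compute; expressing its arguments by `replicate`
-- treats arities 0 and 1 uniformly.
arguments : ∀ {V : Set} {k} → k ≤ 1 → (xs : Vec V k) →
            (∃[ x ] k ≡ 1 × (∀ {A : Set} (f : V → A) → Vec.map f xs ≡ replicate k (f x))) ⊎ k ≡ 0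
arguments _         []       = inj₂ refl
arguments _         (x ∷ []) = inj₁ (x , refl , λ f → refl)
arguments (s≤s ()) (_ ∷ _ ∷ _)

replicate-empty : ∀ {A : Set} {k} → k ≡ 0 → (xs : Vec A k) (a : A) → xs ≡ replicate k a
replicate-empty refl [] a = refl

replicate-injective : ∀ {A : Set} {k} → k ≡ 1 → {a b : A} → replicate k a ≡ replicate k b → a ≡ b
replicate-injective refl refl = refl

module _ (em : EM) {τ : Signature} (𝔹 : Structure τ) (finite : Finite (Carrier 𝔹)) (b₀ : Carrier 𝔹) (n : ℕ) where

  open Classical em
  open TournamentPower em 𝔹 finite n
  open BlowUp em tournamentPower 𝔹 finite using (blowUp; blowUp-hom; blowUp-finite)

  private
    𝔽 = tournamentPower
    B = Carrier 𝔹
    F = Carrier 𝔽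

    value : F → Coordinate → Fin (2 + n)
    value v u = lookup v (encode u)

    value-cong : ∀ v {u u′} → u ≗ u′ → value v u ≡ value v u′
    value-cong v eq = cong (lookup v) (encode-cong eq)

    -- For two entries of a tuple in the power, `S` is the projection of the relation of `𝔹` to
    -- their positions, and all constraints forced by `S` hold.
    record Related (S : B → B → Set) (w v : F) : Set where
      field
        equals  : ∀ u u′ → (∀ {b c} → S b c → u b ≡ u′ c) → value w u ≡ value v u′
        smaller : ∀ u u′ → (∀ {b c} → S b c → u b Fin.< u′ c) → value w u Fin.< value v u′

    -- Holds for points that occur in some tuple; the coordinates of other points are arbitrary.
    Active : F → Set
    Active v = Related _≡_ v v

    active : ∀ v → (∀ u u′ → (∀ b → u b Fin.< u′ b) → value v u Fin.< value v u′) → Active v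
    active v lt = record
      { equals  = λ u u′ eq → value-cong v λ b → eq {b} refl
      ; smaller = λ u u′ f → lt u u′ λ b → f refl
      }

    threshold : (B → Set) → Fin (suc n) → Coordinate
    threshold U j b = if truth (U b) then suc j else inject₁ j

    High : F → (B → Set) → Fin (suc n) → Set
    High v U j = j Fin.< value v (threshold U j)

    threshold-< : ∀ {U V j k b c} → toℕ j ≡ toℕ k → (U b → V c) → threshold U j b Fin.< threshold V (suc k) c
    threshold-< {U} {V} {j} {k} {b} {c} eq f with decide (U b) | decide (V c)
    ... | yes u | no ¬v = contradiction (f u) ¬v
    ... | yes u | yes v = s≤s (s≤s (≤-reflexive eq))
    ... | no ¬u | yes v = s≤s (≤-trans (≤-reflexive (trans (toℕ-inject₁ j) eq)) (n≤1+n _))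
    ... | no ¬u | no ¬v = s≤s (≤-reflexive (trans (toℕ-inject₁ j) (trans eq (sym (toℕ-inject₁ k)))))

    -- The threshold map for `j` lies strictly below that for `j + 1` at every value, so the
    -- coordinate grows by at least one with each index.
    raise : ∀ {v U} → Active v → ∀ d {j k} → toℕ k ≡ d + toℕ j → High v U j → High v U k
    raise {v} {U} act zero eq h = subst (High v U) (sym (toℕ-injective eq)) h
    raise {v} {U} act (suc d) {j} {suc k} eq h =
      ≤-trans (s≤s (subst (_< toℕ (value v (threshold U (inject₁ k)))) k≡
          (raise {v} {U} act d (trans k≡ (ℕ.suc-injective eq)) h)))
        (Related.smaller act (threshold U (inject₁ k)) (threshold U (suc k)) λ { {b} refl → threshold-< {U} {U} {b = b} k≡ id })
      where
      k≡ : toℕ (inject₁ k) ≡ toℕ k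
      k≡ = toℕ-inject₁ k

    raise-≤ : ∀ {v U} → Active v → ∀ {j k} → j Fin.≤ k → High v U j → High v U k
    raise-≤ {v} {U} act le = raise {v} {U} act _ (sym (m∸n+n≡m le))

    high-full : ∀ {v U} → Active v → (∀ b → U b) → ∀ j → High v U j
    high-full {v} {U} act full j = raise-≤ {v} {U} act {zero} {j} z≤n (≤-<-trans z≤n
      (Related.smaller act (λ _ → zero) (threshold U zero) λ { {b} refl → positive b }))
      where
      positive : ∀ b → zero {suc n} Fin.< threshold U zero b
      positive b with decide (U b)
      ... | yes _ = s≤s z≤n
      ... | no ¬u = contradiction (full b) ¬u

    -- Raised to the index `n`, the coordinate of `w` would be at least `n + 1`. On the values
    -- concerned the threshold map lies below the constant `n + 1`, so `v` would need a coordinate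
    -- beyond the tournament.
    ¬high-empty : ∀ {S w v U j} → Active w → Related S w v → (∀ {b c} → S b c → ¬ U b) → ¬ High w U j
    ¬high-empty {S} {w} {v} {U} {j} act R empty h = 1+n≰n (≤-trans (≤-trans (s≤s n<) w<v) (≤-pred (toℕ<n _)))
      where
      n< : suc n ≤ toℕ (value w (threshold U (fromℕ n)))
      n< = subst (_< toℕ (value w (threshold U (fromℕ n)))) (toℕ-fromℕ n) (raise-≤ {w} {U} act (Fin.≤fromℕ j) h)
      below : ∀ {b c} → S b c → threshold U (fromℕ n) b Fin.< suc (fromℕ n)
      below {b} s with decide (U b)
      ... | yes u = contradiction u (empty s)
      ... | no _  = s≤s (≤-reflexive (toℕ-inject₁ (fromℕ n)))
      w<v : value w (threshold U (fromℕ n)) Fin.< value v (λ _ → suc (fromℕ n))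
      w<v = Related.smaller R _ _ below

    -- For equal indices, both inclusions together make the threshold maps agree along `S`, so the
    -- coordinates are equal. An increase of the index leaves room for a strict inequality, and one
    -- inclusion suffices for that.
    transport : ∀ {S w v U V j k} → Active w → Related S w v → (∀ {b c} → S b c → U b → V c) →
                (j ≡ k → ∀ {b c} → S b c → V c → U b) → j Fin.≤ k → High w U j → High v V k
    transport {S} {w} {v} {U} {V} {j} {k} act R forth back j≤k h with j Fin.≟ k
    ... | yes refl = subst (j Fin.<_) (Related.equals R (threshold U j) (threshold V j)
          λ s → cong (if_then suc j else inject₁ j) (truth-⇔ (forth s) (back refl s))) h
    ... | no j≢k   = strictly k j≤k j≢k
      where
      strictly : ∀ k → j Fin.≤ k → j ≢ k → High v V k
      strictly zero    le ne = contradiction (Fin.≤-antisym le z≤n) ne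
      strictly (suc k) le ne = ≤-trans
        (s≤s (subst (_< toℕ (value w (threshold U (inject₁ k)))) (toℕ-inject₁ k) (raise-≤ {w} {U} act {j} {inject₁ k}
          (subst (toℕ j ≤_) (sym (toℕ-inject₁ k)) (≤-pred (≤∧≢⇒< le (ne ∘ toℕ-injective)))) h)))
        (Related.smaller R (threshold U (inject₁ k)) (threshold V (suc k))
          λ {b} {c} s → threshold-< {U} {V} {b = b} {c} (toℕ-inject₁ k) (forth s))

    -- The EDB atoms in the body of an arc rule fired in the blow-up by ρ.
    record Extents {k} (ρ : Fin k → Carrier blowUp) (es : List (Atom (arity τ) (Fin k))) : Set₁ where
      field
        Tuple Pos : Set
        tuple₀    : Tuple
        at        : Tuple → Pos → B
        position  : Fin k → Maybe Pos

      assign : Tuple → (Fin k → B) → Fin k → B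
      assign t g z = Maybe.maybe′ (at t) (g z) (position z)

      field
        sat     : ∀ t g → All (λ φ → rel 𝔹 ⊩ φ [ assign t g ]) es
        related : ∀ {z z′ p p′} → position z ≡ just p → position z′ ≡ just p′ →
                  Related (λ b c → ∃[ t ] at t p ≡ b × at t p′ ≡ c) (proj₁ (ρ z)) (proj₁ (ρ z′))

      assign-at : ∀ t g {z p} → position z ≡ just p → assign t g z ≡ at t p
      assign-at t g eq = cong (Maybe.maybe′ (at t) _) eq

      assign-free : ∀ t g {z} → position z ≡ nothing → assign t g z ≡ g z
      assign-free t g eq = cong (Maybe.maybe′ (at t) _) eq

      position-active : ∀ {z p} → position z ≡ just p → Active (proj₁ (ρ z))
      position-active {z} {p} eq = active _ λ u u′ lt → Related.smaller (related eq eq) u u′ λ { (t , refl , refl) → lt _ }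

    extents : ∀ {k} (ρ : Fin k → Carrier blowUp) es → length es ≤ 1 → All (λ φ → rel blowUp ⊩ φ [ ρ ]) es → Extents ρ es
    extents ρ [] _ [] = record
      { Tuple = ⊤ ; Pos = ⊥ ; tuple₀ = tt ; at = λ _ () ; position = λ _ → nothing
      ; sat = λ _ _ → [] ; related = λ ()
      }
    extents {k} ρ (s ⟪ xs ⟫ ∷ []) _ ((r , inj) ∷ []) = record
      { Tuple    = ∃ (rel 𝔹 s)
      ; Pos      = Fin (arity τ s)
      ; tuple₀   = some-tuple
      ; at       = λ (t , _) p → lookup t p
      ; position = position
      ; sat      = λ (t , R) g → subst (rel 𝔹 s) (lookup-ext λ p → sym (trans (lookup-map p _ xs)
                     (cong (Maybe.maybe′ (lookup t) _) (position-lookup p)))) R ∷ []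
      ; related  = λ {z} {z′} {p} {p′} e e′ → record
          { equals  = λ u u′ f → subst₂ (λ v v′ → value v u ≡ value v′ u′) (value-at e) (value-at e′)
              (formula-equal s w r ((p , encode u) , (p′ , encode u′)) λ t R →
                trans (decode-encode u _) (trans (f ((t , R) , refl , refl)) (sym (decode-encode u′ _))))
          ; smaller = λ u u′ f → subst₂ (λ v v′ → value v u Fin.< value v′ u′) (value-at e) (value-at e′)
              (formula-below s w r ((p , encode u) , (p′ , encode u′)) λ t R →
                subst₂ Fin._<_ (sym (decode-encode u _)) (sym (decode-encode u′ _)) (f ((t , R) , refl , refl)))
          }
      }
      where
      w : Vec F (arity τ s)
      w = Vec.map proj₁ (Vec.map ρ xs)
      p₀ : Fin (arity τ s)
      p₀ = fromℕ< (>-nonZero⁻¹ _ {{arity-positive τ s}})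
      -- An empty relation would force every constraint, among them that a coordinate be smaller
      -- than itself.
      some-tuple : ∃ (rel 𝔹 s)
      some-tuple = stable λ none → <-irrefl refl
        (formula-below s w r ((p₀ , encode (λ _ → zero)) , (p₀ , encode (λ _ → zero))) λ t R → contradiction (t , R) none)
      position : Fin k → Maybe (Fin (arity τ s))
      position z with decide (∃[ p ] lookup xs p ≡ z)
      ... | yes (p , _) = just p
      ... | no _        = nothing
      lookup-position : ∀ {z p} → position z ≡ just p → lookup xs p ≡ z
      lookup-position {z} eq with decide (∃[ p ] lookup xs p ≡ z)
      lookup-position refl | yes (p , e) = e
      -- This is the purpose of the blow-up: its tuples are injective, so no variable occurs twice
      -- in the atom, and the variables can take the entries of any tuple of `𝔹`.
      position-lookup : ∀ p → position (lookup xs p) ≡ just p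
      position-lookup p with decide (∃[ q ] lookup xs q ≡ lookup xs p)
      ... | yes (q , e) = cong just (inj (trans (lookup-map q ρ xs) (trans (cong ρ e) (sym (lookup-map p ρ xs)))))
      ... | no ¬e       = contradiction (p , refl) ¬e
      value-at : ∀ {z p} → position z ≡ just p → lookup w p ≡ proj₁ (ρ z)
      value-at {z} {p} e = trans (lookup-map p proj₁ (Vec.map ρ xs))
        (cong proj₁ (trans (lookup-map p ρ xs) (cong ρ (lookup-position e))))
    extents ρ (_ ∷ _ ∷ _) (s≤s ()) _

  -- The invariant of derivations in the blow-up

  module _ {IDB : Set} (ar : IDB → ℕ) (monadic : Datalog.Monadic τ ar) (P : Datalog.Program τ ar)
           (arc : Datalog.Arc τ ar P) (almost : Datalog.AlmostSymmetric τ ar n P) where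

    open Datalog τ ar

    private
      linear : Linear P
      linear = proj₁ almost

      open Colevel em (proj₁ (proj₂ almost)) (proj₁ (proj₂ (proj₂ almost))) n (proj₁ (proj₂ (proj₂ (proj₂ almost))))

      Derived : IDB → B → Set
      Derived Q b = Derives P 𝔹 Q (replicate (ar Q) b)

      -- The facts of the blow-up are measured against what the program derives in `𝔹` itself. The
      -- first alternative covers predicates without arguments and facts about points that no tuple
      -- constrains.
      Invariant : ∀ Q → Vec (Carrier blowUp) (ar Q) → Set
      Invariant Q t = (∀ b → Derived Q b) ⊎
        (∃[ a ] t ≡ replicate (ar Q) a × ar Q ≡ 1 × Active (proj₁ a) × High (proj₁ a) (Derived Q) (colevel Q))

      module _ {k} (ρ : Fin k → Carrier blowUp) {es} (ex : Extents ρ es) (Q : IDB) (xs : Vec (Fin k) (ar Q)) where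

        open Extents ex

        -- If the head variable occurs in the EDB atom, every value at its position is derived, so
        -- the forced equalities do not distinguish the threshold map of `Derived Q` from that of
        -- the full set.
        unconditional : (∀ t g → Derives P 𝔹 Q (Vec.map (assign t g) xs)) → Invariant Q (Vec.map ρ xs)
        unconditional d with arguments (monadic Q) xs
        ... | inj₂ eq = inj₁ λ b → subst (Derives P 𝔹 Q) (replicate-empty eq _ b) (d tuple₀ (λ _ → b₀))
        ... | inj₁ (x , eq , map≡) with just-or-nothing (position x)
        ...   | inj₂ free = inj₁ λ b → subst (Derives P 𝔹 Q)
                (trans (map≡ _) (cong (replicate _) (assign-free tuple₀ (λ _ → b) free))) (d tuple₀ (λ _ → b))
        ...   | inj₁ (p , at-p) = inj₂ (ρ x , map≡ ρ , eq , position-active at-p ,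
                subst (toℕ (colevel Q) <_) (cong toℕ (sym same))
                  (high-full {U = λ _ → ⊤} (position-active at-p) (λ _ → tt) (colevel Q)))
          where
          all : ∀ t → Derived Q (at t p)
          all t = subst (Derives P 𝔹 Q) (trans (map≡ _) (cong (replicate _) (assign-at t (λ _ → b₀) at-p))) (d t (λ _ → b₀))
          same : value (proj₁ (ρ x)) (threshold (Derived Q) (colevel Q)) ≡ value (proj₁ (ρ x)) (threshold (λ _ → ⊤) (colevel Q))
          same = Related.equals (related at-p at-p) (threshold (Derived Q) (colevel Q)) (threshold (λ _ → ⊤) (colevel Q)) λ { (t , refl , refl) →
            cong (if_then suc (colevel Q) else inject₁ (colevel Q)) (truth-⇔ (λ _ → tt) (λ _ → all t)) }

        -- The rule Q xs :- R y ∧ es, when y is mapped to a.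
        module _ {R : IDB} (y : Fin k) {a : Carrier blowUp} (ρy : ρ y ≡ a) (act : Active (proj₁ a))
          (high : High (proj₁ a) (Derived R) (colevel R)) (R≤Q : colevel R Fin.≤ colevel Q)
          (forth : ∀ t g → Derived R (assign t g y) → Derives P 𝔹 Q (Vec.map (assign t g) xs))
          (back : colevel R ≡ colevel Q → ∀ t g → Derives P 𝔹 Q (Vec.map (assign t g) xs) → Derived R (assign t g y)) where

          private
            act′ : Active (proj₁ (ρ y))
            act′ = subst (Active ∘ proj₁) (sym ρy) act

            high′ : High (proj₁ (ρ y)) (Derived R) (colevel R)
            high′ = subst (λ a → High (proj₁ a) (Derived R) (colevel R)) (sym ρy) high

            -- Otherwise the body fact would be high for a set that is empty on all values
            -- concerned.
            body-satisfiable : ∃₂ λ t b → Derived R (assign t (λ _ → b) y)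
            body-satisfiable with just-or-nothing (position y)
            ... | inj₁ (q , at-q) = stable λ none → ¬high-empty {U = Derived R} act′ (related at-q at-q)
                  (λ { (t , refl , _) d → none (t , b₀ , subst (Derived R) (sym (assign-at t (λ _ → b₀) at-q)) d) }) high′
            ... | inj₂ free       = stable λ none → ¬high-empty {U = Derived R} act′ act′
                  (λ { {b} refl d → none (tuple₀ , b , subst (Derived R) (sym (assign-free tuple₀ (λ _ → b) free)) d) }) high′

            module _ {x : Fin k} (eq : ar Q ≡ 1) (map≡ : ∀ {A : Set} (f : Fin k → A) → Vec.map f xs ≡ replicate (ar Q) (f x)) where

              forth₁ : ∀ t g → Derived R (assign t g y) → Derived Q (assign t g x)
              forth₁ t g d = subst (Derives P 𝔹 Q) (map≡ _) (forth t g d)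

              back₁ : colevel R ≡ colevel Q → ∀ t g → Derived Q (assign t g x) → Derived R (assign t g y)
              back₁ e t g d = back e t g (subst (Derives P 𝔹 Q) (sym (map≡ _)) d)

              overwrite : B → (Fin k → B) → Fin k → B
              overwrite b g z with z Fin.≟ y
              ... | yes _ = b
              ... | no _  = g z

              overwrite-y : ∀ b g → overwrite b g y ≡ b
              overwrite-y b g with y Fin.≟ y
              ... | yes _ = refl
              ... | no ne = contradiction refl ne

              overwrite-other : ∀ b g {z} → z ≢ y → overwrite b g z ≡ g z
              overwrite-other b g {z} ne with z Fin.≟ y
              ... | yes e = contradiction e ne
              ... | no _  = refl

              unary-step : Invariant Q (Vec.map ρ xs)
              unary-step with just-or-nothing (position y) | just-or-nothing (position x)
              ... | inj₁ (q , at-q) | inj₁ (p , at-p) = inj₂ (ρ x , map≡ ρ , eq , position-active at-p ,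
                    transport {U = Derived R} {Derived Q} act′ (related at-q at-p)
                      (λ { (t , refl , refl) d → subst (Derived Q) (assign-at t (λ _ → b₀) at-p)
                             (forth₁ t (λ _ → b₀) (subst (Derived R) (sym (assign-at t (λ _ → b₀) at-q)) d)) })
                      (λ { e (t , refl , refl) d → subst (Derived R) (assign-at t (λ _ → b₀) at-q)
                             (back₁ e t (λ _ → b₀) (subst (Derived Q) (sym (assign-at t (λ _ → b₀) at-p)) d)) })
                      R≤Q high′)
              ... | inj₁ (q , at-q) | inj₂ free = inj₁ λ b → let t , b′ , d = body-satisfiable in
                    subst (Derived Q) (assign-free t (λ _ → b) free)
                      (forth₁ t (λ _ → b) (subst (Derived R) (trans (assign-at t (λ _ → b′) at-q) (sym (assign-at t (λ _ → b) at-q))) d))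
              ... | inj₂ free-y | _ with x Fin.≟ y
              ...   | yes refl = inj₂ (ρ x , map≡ ρ , eq , act′ ,
                      transport {U = Derived R} {Derived Q} act′ act′
                        (λ { {b} refl d → subst (Derived Q) (assign-free tuple₀ (λ _ → b) free-y)
                             (forth₁ tuple₀ (λ _ → b) (subst (Derived R) (sym (assign-free tuple₀ (λ _ → b) free-y)) d)) })
                        (λ { e {b} refl d → subst (Derived R) (assign-free tuple₀ (λ _ → b) free-y)
                             (back₁ e tuple₀ (λ _ → b) (subst (Derived Q) (sym (assign-free tuple₀ (λ _ → b) free-y)) d)) })
                        R≤Q high′)
              -- The head and the body are independent: `y` takes a value that satisfies the body,
              -- and all other variables remain arbitrary.
              ...   | no x≢y = unconditional λ t g → let t₁ , b , d = body-satisfiable in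
                      subst (Derives P 𝔹 Q) (trans (map≡ _) (trans (cong (replicate _) (cong (λ c → Maybe.maybe′ (at t) c (position x)) (overwrite-other b g x≢y))) (sym (map≡ _))))
                        (forth t (overwrite b g) (subst (Derived R)
                          (trans (assign-free t₁ (λ _ → b) free-y) (sym (trans (assign-free t (overwrite b g) free-y) (overwrite-y b g)))) d))

          conditional : Invariant Q (Vec.map ρ xs)
          conditional with arguments (monadic Q) xs
          ... | inj₁ (x , eq , map≡) = unary-step {x} eq map≡
          ... | inj₂ eq = inj₁ λ b → let t , b′ , d = body-satisfiable in
                subst (Derives P 𝔹 Q) (replicate-empty eq _ b) (forth t (λ _ → b′) d)

      rule-step : ∀ r → P r → (ρ : Fin (#vars r) → Carrier blowUp) →
             All (λ φ → Invariant (Atom.symbol φ) (Vec.map ρ (Atom.args φ))) (idbs r) →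
             All (λ φ → rel blowUp ⊩ φ [ ρ ]) (edbs r) →
             Invariant (headIDB r) (Vec.map ρ (Atom.args (head r)))
      rule-step r@(record { head = Q ⟪ xs ⟫ ; idbs = [] }) p ρ [] es =
        unconditional ρ ex Q xs λ t g → fire r p (Extents.assign ex t g) [] (Extents.sat ex t g)
        where ex = extents ρ (edbs r) (arc r p) es
      rule-step r@(record { head = Q ⟪ xs ⟫ ; idbs = R ⟪ ys ⟫ ∷ [] }) p ρ (inj₁ all ∷ []) es =
        unconditional ρ ex Q xs λ t g → fire r p (Extents.assign ex t g)
          (body (Extents.assign ex t g) ∷ []) (Extents.sat ex t g)
        where
        ex = extents ρ (edbs r) (arc r p) es
        body : ∀ σ → Derives P 𝔹 R (Vec.map σ ys)
        body σ with arguments (monadic R) ys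
        ... | inj₁ (y , _ , map≡) = subst (Derives P 𝔹 R) (sym (map≡ σ)) (all (σ y))
        ... | inj₂ eq             = subst (Derives P 𝔹 R) (sym (replicate-empty eq _ b₀)) (all b₀)
      rule-step r@(record { head = Q ⟪ xs ⟫ ; idbs = R ⟪ ys ⟫ ∷ [] }) p ρ (inj₂ (a , ρys , eq , act , high) ∷ []) es
        with arguments (monadic R) ys
      ... | inj₂ eq′ = case trans (sym eq) eq′ of λ ()
      ... | inj₁ (y , _ , map≡) =
        let Q≼R , backward = proj₂ (proj₂ (proj₂ (proj₂ almost))) r _ p reversed in
        conditional ρ ex Q xs {R} y (replicate-injective eq (trans (sym (map≡ ρ)) ρys)) act high (colevel-antitone Q≼R)
          (λ t g d → fire r p (Extents.assign ex t g) (subst (Derives P 𝔹 R) (sym (map≡ _)) d ∷ []) (Extents.sat ex t g))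
          -- At equal colevels the two predicates are equivalent in the order, so the reversed rule
          -- belongs to the program.
          (λ e t g d → subst (Derives P 𝔹 R) (map≡ _)
            (fire _ (backward (colevel-strict Q≼R e)) (Extents.assign ex t g) (d ∷ []) (Extents.sat ex t g)))
        where ex = extents ρ (edbs r) (arc r p) es
      rule-step r@(record { idbs = _ ∷ _ ∷ _ }) p = case linear r p of λ { (s≤s ()) }

      invariant  : ∀ {Q t} → Derives P blowUp Q t → Invariant Q t
      invariants : ∀ {k} (ρ : Fin k → Carrier blowUp) φs →
        All (λ φ → Derives P blowUp (Atom.symbol φ) (Vec.map ρ (Atom.args φ))) φs →
        All (λ φ → Invariant (Atom.symbol φ) (Vec.map ρ (Atom.args φ))) φs
      invariant (fire r p ρ ds es) = rule-step r p ρ (invariants ρ (idbs r) ds) es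
      invariants ρ []       []       = []
      invariants ρ (φ ∷ φs) (d ∷ ds) = invariant d ∷ invariants ρ φs ds

    -- Otherwise the goal is derived in the blow-up and, by the invariant, also in `𝔹`, which maps
    -- to itself.
    solved⇒retraction : ∀ G → ar G ≡ 0 → Solves P (_≡ G) 𝔹 → 𝔽 ⟶ 𝔹
    solved⇒retraction G ar-G solves = stable λ ¬hom →
      let _ , eq , t , d = Equivalence.from (solves blowUp (blowUp-finite (listable-Vec _ (listable-Fin _)))) (¬hom ∘ blowUp-hom)
      in refute eq t (invariant d)
      where
      refute : ∀ {Q} → Q ≡ G → (t : Vec _ (ar Q)) → Invariant Q t → ⊥
      refute refl t (inj₁ all) =
        Equivalence.to (solves 𝔹 finite) (G , refl , _ , all b₀) (id-hom 𝔹)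
      refute refl t (inj₂ (_ , _ , eq , _)) = case trans (sym eq) ar-G of λ ()

  snlam⇒ppConstructs : SolvedBySnlam n 𝔹 → 𝕋 (2 + n) PPConstructs 𝔹
  snlam⇒ppConstructs (_ , _ , ar , G , ar-G , monadic , P , _ , arc , almost , solves) =
    dimension , dimension-nonZero , formula , embedding , solved⇒retraction ar monadic P arc almost G ar-G solves

-- Polymorphisms

tuple-at : ∀ {A : Set} {m k} (t : Vec (Vec A m) k) → Fin m → Vec A k
tuple-at t i = Vec.map (λ v → lookup v i) t

module _ {τ : Signature} where

  projection-pol : (𝔹 : Structure τ) → ∀ {m} (i : Fin m) → Pol 𝔹 m (λ a → lookup a i)
  projection-pol 𝔹 i s t r = r i

  composition-pol : (𝔹 : Structure τ) → ∀ {m l} {f : Op (Carrier 𝔹) m} {g : Fin m → Op (Carrier 𝔹) l} →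
                    Pol 𝔹 m f → (∀ i → Pol 𝔹 l (g i)) → Pol 𝔹 l (λ a → f (tabulate (λ i → g i a)))
  composition-pol 𝔹 {f = f} {g} pf pg s t r = subst (rel 𝔹 s) (sym (map-∘ f (λ a → tabulate (λ i → g i a)) t))
    (pf s _ λ i → subst (rel 𝔹 s) (trans (map-cong (λ a → sym (lookup∘tabulate (λ i → g i a) i)) t)
      (map-∘ (λ v → lookup v i) (λ a → tabulate (λ i → g i a)) t)) (pg i s t r))

  minor-pol : (𝔹 : Structure τ) → ∀ {n m} {f : Op (Carrier 𝔹) n} (σ : Fin n → Fin m) → Pol 𝔹 n f → Pol 𝔹 m (minor σ f)
  minor-pol 𝔹 {f = f} σ pf = composition-pol 𝔹 {f = f} {λ i a → lookup a (σ i)} pf λ i → projection-pol 𝔹 (σ i)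

  respects-≗-pol : (𝔹 : Structure τ) → ∀ {m} {f g : Op (Carrier 𝔹) m} → f ≗ g → Pol 𝔹 m f → Pol 𝔹 m g
  respects-≗-pol 𝔹 eq pf s t r = subst (rel 𝔹 s) (map-cong eq t) (pf s t r)

  polClone : (𝔹 : Structure τ) → Clone (Carrier 𝔹)
  polClone 𝔹 = record
    { member      = Pol 𝔹
    ; projection  = projection-pol 𝔹
    ; composition = λ {m} {l} {f} {g} → composition-pol 𝔹 {m} {l} {f} {g}
    ; respects-≗  = λ {m} {f} {g} → respects-≗-pol 𝔹 {m} {f} {g}
    }

  conjugate-pol : {𝔸 𝔹 : Structure τ} (h : 𝔸 ⟶ 𝔹) (g : 𝔹 ⟶ 𝔸) → ∀ {m} {f : Op (Carrier 𝔸) m} →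
                  Pol 𝔸 m f → Pol 𝔹 m (λ b → proj₁ h (f (Vec.map (proj₁ g) b)))
  conjugate-pol {𝔸} {𝔹} (h , hom-h) (g , hom-g) {f = f} pf s t r =
    subst (rel 𝔹 s) (trans (cong (Vec.map h) (sym (map-∘ f (Vec.map g) t))) (sym (map-∘ h (f ∘ Vec.map g) t)))
      (hom-h s _ (pf s (Vec.map (Vec.map g) t) λ i →
        subst (rel 𝔸 s) (trans (sym (map-∘ g (λ v → lookup v i) t))
          (trans (map-cong (λ v → sym (lookup-map i g v)) t) (map-∘ (λ v → lookup v i) (Vec.map g) t))) (hom-g s _ (r i))))

  module _ (𝔸 : Structure τ) {m : ℕ} {f : Op (Carrier 𝔸) m} (pf : Pol 𝔸 m f) where

    pp-preserved : ∀ {k} (φ : PP τ k) (ρ : Vec (Vec (Carrier 𝔸) m) k) →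
                   (∀ i → 𝔸 ⊨ φ [ tuple-at ρ i ]) → 𝔸 ⊨ φ [ Vec.map f ρ ]
    pp-preserved (atom s xs) ρ sat = subst (rel 𝔸 s) (arrange f) (pf s _ λ i → subst (rel 𝔸 s) (sym (arrange (λ v → lookup v i))) (sat i))
      where
      arrange : (g : Vec (Carrier 𝔸) m → Carrier 𝔸) → Vec.map g (Vec.map (lookup ρ) xs) ≡ Vec.map (lookup (Vec.map g ρ)) xs
      arrange g = trans (sym (map-∘ g (lookup ρ) xs)) (map-cong (λ x → sym (lookup-map x g ρ)) xs)
    pp-preserved (x ≐ y) ρ sat = trans (lookup-map x f ρ) (trans (cong f (lookup-ext λ i →
      trans (sym (lookup-map x _ ρ)) (trans (sat i) (lookup-map y _ ρ)))) (sym (lookup-map y f ρ)))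
    pp-preserved (φ ∧ ψ) ρ sat = pp-preserved φ ρ (proj₁ ∘ sat) , pp-preserved ψ ρ (proj₂ ∘ sat)
    pp-preserved (∃∃ φ) ρ sat = f (tabulate (proj₁ ∘ sat)) , pp-preserved φ (tabulate (proj₁ ∘ sat) ∷ ρ) λ i →
      subst (λ a → 𝔸 ⊨ φ [ a ∷ tuple-at ρ i ]) (sym (lookup∘tabulate (proj₁ ∘ sat) i)) (proj₂ (sat i))

transposed : ∀ {A : Set} {m d} → Vec (Vec A d) m → Vec (Vec A m) d
transposed vs = tabulate λ j → Vec.map (λ v → lookup v j) vs

lookup-transposed : ∀ {A : Set} {m d} (vs : Vec (Vec A d) m) i j → lookup (lookup (transposed vs) j) i ≡ lookup (lookup vs i) j
lookup-transposed vs i j = trans (cong (λ v → lookup v i) (lookup∘tabulate (λ j → Vec.map (λ v → lookup v j) vs) j)) (lookup-map i (λ v → lookup v j) vs)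

coordinatewise : ∀ {A : Set} {m} d → Op A m → Op (Vec A d) m
coordinatewise d f vs = Vec.map f (transposed vs)

coordinatewise-pol : ∀ {σ τ : Signature} (𝔸 : Structure σ) d (φ : ∀ s → PP σ (arity τ s * d)) {m} {f : Op (Carrier 𝔸) m} →
                     Pol 𝔸 m f → Pol (ppPower {τ = τ} 𝔸 d φ) m (coordinatewise d f)
coordinatewise-pol 𝔸 d φ {m} {f} pf s t sat = subst (𝔸 ⊨ φ s [_]) (concat-map f) (pp-preserved 𝔸 {f = f} pf (φ s) (Vec.concat (Vec.map transposed t))
  λ i → subst (𝔸 ⊨ φ s [_]) (trans (cong Vec.concat (map-cong (λ vs → lookup-ext λ j →
    trans (sym (lookup-transposed vs i j)) (sym (lookup-map j _ (transposed vs)))) t)) (sym (concat-map (λ v → lookup v i)))) (sat i))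
  where
  concat-map : (g : Vec (Carrier 𝔸) m → Carrier 𝔸) →
               Vec.map g (Vec.concat (Vec.map transposed t)) ≡ Vec.concat (Vec.map (Vec.map g ∘ transposed) t)
  concat-map g = trans (Vec.map-concat g (Vec.map transposed t)) (cong Vec.concat (sym (map-∘ (Vec.map g) transposed t)))

-- Minors only rearrange arguments; this commutes with acting coordinatewise and with composing with
-- fixed maps on both sides.
ppConstructs⇒minionHom : ∀ {σ τ} {𝔸 : Structure σ} {𝔹 : Structure τ} → 𝔸 PPConstructs 𝔹 → MinionHom (Pol 𝔸) (Pol 𝔹)
ppConstructs⇒minionHom {τ = τ} {𝔸} {𝔹} (d , _ , φ , (g , hom-g) , (h , hom-h)) = record
  { map       = λ (f , pf) → (λ b → h (coordinatewise d f (Vec.map g b))) , image f pf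
  ; preserves = λ (f , _) (f′ , _) σ eq b → cong h (trans (map-cong eq (transposed (Vec.map g b)))
      (lookup-ext λ j → trans (lookup-map j (minor σ f) (transposed (Vec.map g b)))
        (trans (cong f (lookup-ext λ i → trans (lookup∘tabulate _ i)
          (trans (lookup-transposed (Vec.map g b) (σ i) j) (trans (cong (λ v → lookup v j)
            (trans (lookup-map (σ i) g b) (sym (lookup-map-tabulate g _ i))))
            (sym (lookup-transposed (Vec.map g (tabulate (λ i → lookup b (σ i)))) i j))))))
          (sym (lookup-map j f (transposed (Vec.map g (tabulate (λ i → lookup b (σ i))))))))))
  }
  where
  image : ∀ {m} (f : Op (Carrier 𝔸) m) → Pol 𝔸 m f → Pol 𝔹 m (λ b → h (coordinatewise d f (Vec.map g b)))
  image {m} f pf = conjugate-pol {𝔸 = ppPower 𝔸 d φ} {𝔹} (h , hom-h) (g , hom-g) {m} {coordinatewise d f}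
    (coordinatewise-pol {τ = τ} 𝔸 d φ {m} {f} pf)

-- Minor conditions

clamp : ∀ K → ℕ → Fin (suc K)
clamp K       zero    = zero
clamp zero    (suc k) = zero
clamp (suc K) (suc k) = suc (clamp K k)

toℕ-clamp : ∀ {K k} → k ≤ K → toℕ (clamp K k) ≡ k
toℕ-clamp z≤n      = refl
toℕ-clamp (s≤s le) = cong suc (toℕ-clamp le)

boundOf : ∀ {k} → Vec ℕ k → ℕ
boundOf = Vec.foldr′ _⊔_ 0

lookup≤boundOf : ∀ {k} (xs : Vec ℕ k) i → lookup xs i ≤ boundOf xs
lookup≤boundOf (x ∷ xs) zero    = ℕ.m≤m⊔n x _
lookup≤boundOf (x ∷ xs) (suc i) = ≤-trans (lookup≤boundOf xs i) (ℕ.m≤n⊔m x _)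

tabulate-lookup-map : ∀ {A C : Set} {k} (f : A → C) (xs : Vec A k) → tabulate (λ i → f (lookup xs i)) ≡ Vec.map f xs
tabulate-lookup-map f xs = trans (Vec.tabulate-∘ f (lookup xs)) (cong (Vec.map f) (Vec.tabulate∘lookup xs))

-- An identity says that two minors coincide. The image of this common minor `h`, whose arguments
-- are the variables up to `K`, is compared with both sides.
minionHom⇒satisfies : ∀ {σ τ} {𝔸 : Structure σ} {𝔹 : Structure τ} → MinionHom (Pol 𝔸) (Pol 𝔹) →
                      ∀ Γ → Pol 𝔸 Satisfies Γ → Pol 𝔹 Satisfies Γ
minionHom⇒satisfies {𝔸 = 𝔸} {𝔹} ξ Γ (⟦_⟧ , pol , ids) =
  (λ f → proj₁ (image f)) , (λ f → proj₂ (image f)) , All.map (λ {ι} → holds ι) ids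
  where
  open MinorCondition Γ
  open MinionHom ξ
  image : ∀ f → Σ (Op (Carrier 𝔹) (ar f)) (Pol 𝔹 (ar f))
  image f = map {{ar-positive f}} (⟦ f ⟧ , pol f)
  Holds : ∀ {A : Set} → (∀ f → Op A (ar f)) → Identity ar → Set
  Holds {A} i (f ⟨ xs ⟩≈ g ⟨ ys ⟩) = ∀ (ρ : ℕ → A) → i f (Vec.map ρ xs) ≡ i g (Vec.map ρ ys)
  holds : ∀ ι → Holds ⟦_⟧ ι → Holds (proj₁ ∘ image) ι
  holds (f ⟨ xs ⟩≈ g ⟨ ys ⟩) eq ρ = trans (sym (value f xs xs≤ (λ a → refl))) (value g ys ys≤ common)
    where
    K = boundOf xs ⊔ boundOf ys
    xs≤ : ∀ i → lookup xs i ≤ K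
    xs≤ i = ≤-trans (lookup≤boundOf xs i) (ℕ.m≤m⊔n _ _)
    ys≤ : ∀ i → lookup ys i ≤ K
    ys≤ i = ≤-trans (lookup≤boundOf ys i) (ℕ.m≤n⊔m (boundOf xs) _)
    renaming′ : ∀ {k} → Vec ℕ k → Fin k → Fin (suc K)
    renaming′ zs i = clamp K (lookup zs i)
    h : Σ (Op (Carrier 𝔸) (suc K)) (Pol 𝔸 (suc K))
    h = minor (renaming′ xs) ⟦ f ⟧ , minor-pol 𝔸 {f = ⟦ f ⟧} (renaming′ xs) (pol f)
    common : proj₁ h ≗ minor (renaming′ ys) ⟦ g ⟧
    common a = trans (cong ⟦ f ⟧ (tabulate-lookup-map (lookup a ∘ clamp K) xs))
      (trans (eq (lookup a ∘ clamp K)) (cong ⟦ g ⟧ (sym (tabulate-lookup-map (lookup a ∘ clamp K) ys))))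
    value : ∀ k (zs : Vec ℕ (ar k)) → (∀ i → lookup zs i ≤ K) → proj₁ h ≗ minor (renaming′ zs) ⟦ k ⟧ →
            proj₁ (map h) (tabulate (ρ ∘ toℕ)) ≡ proj₁ (image k) (Vec.map ρ zs)
    value k zs zs≤ eq′ = trans (preserves {{ar-positive k}} (⟦ k ⟧ , pol k) h (renaming′ zs) eq′ (tabulate (ρ ∘ toℕ)))
      (cong (proj₁ (image k)) (trans (tabulate-cong λ i → trans (lookup∘tabulate (ρ ∘ toℕ) (renaming′ zs i)) (cong ρ (toℕ-clamp (zs≤ i))))
        (tabulate-lookup-map ρ zs)))

-- Hagemann–Mitschke chains

pairing : ∀ {A : Set} → A → A → ℕ → A
pairing a b zero    = a
pairing a b (suc _) = b

tournament-strict : ∀ {m k} {f : Op (Fin m) k} → Pol (𝕋 m) k f → ∀ a b → (∀ i → lookup a i Fin.< lookup b i) → f a Fin.< f b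
tournament-strict pf a b = pf zero (a ∷ b ∷ [])

-- By induction pᵢ₊₁(i+1, i, i) ≥ i + 1, so that pₙ₊₁ maps n to n + 1.
¬tournament-HM : ∀ n → ¬ (Pol (𝕋 (2 + n)) Satisfies HM n)
¬tournament-HM zero (f , pol , eq ∷ []) = <-irrefl (cong toℕ (trans (eq (pairing zero zero)) (sym (eq (pairing (suc zero) zero)))))
  (tournament-strict {f = f zero} (pol zero) (zero ∷ []) (suc zero ∷ []) λ { zero → s≤s z≤n })
¬tournament-HM (suc m) (f , pol , first ∷ last ∷ mid) =
  1+n≰n (≤-trans (≤-trans (s≤s (≤-trans (s≤s (increase (fromℕ m))) (≤-trans end (≤-reflexive (cong toℕ (last (pairing top y)))))))
    (tournament-strict {f = f (suc zero)} (pol (suc zero)) (y ∷ []) (top ∷ []) λ { zero → ≤-reflexive (cong suc toℕ-y) }))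
    (≤-trans (≤-pred (toℕ<n (f (suc zero) (top ∷ [])))) (≤-reflexive (cong (2 +_) (sym (toℕ-fromℕ m))))))
  where
  N = suc m
  p : Fin (suc m) → Op (Fin (2 + N)) 3
  p i = f (suc (suc i))
  high low : Fin (suc m) → Fin (2 + N)
  high i = suc (inject₁ i)
  low i  = inject₁ (inject₁ i)
  toℕ-low : ∀ i → toℕ (low i) ≡ toℕ i
  toℕ-low i = trans (toℕ-inject₁ (inject₁ i)) (toℕ-inject₁ i)
  toℕ-high : ∀ i → toℕ (high i) ≡ suc (toℕ i)
  toℕ-high i = cong suc (toℕ-inject₁ i)
  strict₃ : ∀ i {a b a′ b′ c′} → a Fin.< a′ → b Fin.< b′ → b Fin.< c′ → p i (a ∷ b ∷ b ∷ []) Fin.< p i (a′ ∷ b′ ∷ c′ ∷ [])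
  strict₃ i l₀ l₁ l₂ = tournament-strict {f = p i} (pol (suc (suc i))) _ _ λ { zero → l₀ ; (suc zero) → l₁ ; (suc (suc zero)) → l₂ }
  increase : ∀ i → suc (toℕ i) ≤ toℕ (p i (high i ∷ low i ∷ low i ∷ []))
  increase = Fin.<-weakInduction (λ i → suc (toℕ i) ≤ toℕ (p i (high i ∷ low i ∷ low i ∷ [])))
    (≤-trans (s≤s z≤n) (subst (f zero (zero ∷ []) Fin.<_) (first (pairing (suc zero) zero))
      (tournament-strict {f = f zero} (pol zero) (zero ∷ []) (suc zero ∷ []) λ { zero → s≤s z≤n })))
    λ i le → ≤-trans (s≤s (≤-trans (≤-reflexive (cong suc (sym (toℕ-inject₁ i)))) le))
      (subst (p (inject₁ i) (high (inject₁ i) ∷ low (inject₁ i) ∷ low (inject₁ i) ∷ []) Fin.<_)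
        (All.lookup (All.map⁻ mid) (Mem.∈-allFin i) (pairing (high (suc i)) (low (suc i))))
        (strict₃ (inject₁ i)
          (s≤s (s≤s (≤-reflexive (trans (toℕ-inject₁ (inject₁ i)) refl))))
          (s≤s (≤-trans (≤-reflexive (trans (toℕ-inject₁ (inject₁ (inject₁ i))) (toℕ-inject₁ (inject₁ i)))) (n≤1+n _)))
          (s≤s (≤-reflexive (toℕ-inject₁ (inject₁ (inject₁ i)))))))
  top y : Fin (2 + N)
  top = suc (suc (fromℕ m))
  y   = suc (inject₁ (fromℕ m))
  toℕ-y : toℕ y ≡ suc (toℕ (fromℕ m))
  toℕ-y = toℕ-high (fromℕ m)
  end : suc (toℕ (p (fromℕ m) (high (fromℕ m) ∷ low (fromℕ m) ∷ low (fromℕ m) ∷ []))) ≤ toℕ (p (fromℕ m) (top ∷ top ∷ y ∷ []))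
  end = strict₃ (fromℕ m)
    (s≤s (s≤s (≤-reflexive (toℕ-inject₁ (fromℕ m)))))
    (s≤s (≤-trans (≤-reflexive (toℕ-low (fromℕ m))) (n≤1+n _)))
    (s≤s (≤-reflexive (trans (toℕ-low (fromℕ m)) (sym (toℕ-inject₁ (fromℕ m))))))

member-minor : ∀ {A : Set} (C : Clone A) {n m} {f : Op A n} .{{_ : NonZero n}} .{{_ : NonZero m}} (σ : Fin n → Fin m) →
               Clone.member C n f → Clone.member C m (minor σ f)
member-minor C {f = f} σ = λ mf → Clone.composition C {f = f} {λ i a → lookup a (σ i)} mf λ i → Clone.projection C (σ i)

-- The digraph of the members of arity n + 2 of a clone that is freely generated by the tournament.
module FreeDigraph (em : EM) {A : Set} (C : Clone A) (n : ℕ) where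

  open Classical em
  open Clone C

  Vertex : Set
  Vertex = Op A (2 + n)

  -- A member of the clone applied to a tuple of edges of the tournament, which itself sits in the
  -- digraph as the projections.
  record Edge (h h′ : Vertex) : Set where
    constructor edge
    field
      {degree}     : ℕ
      {{positive}} : NonZero degree
      operation    : Op A degree
      isMember     : member degree operation
      source target : Fin degree → Fin (2 + n)
      ascending    : ∀ i → source i Fin.< target i
      source-minor : h ≗ minor source operation
      target-minor : h′ ≗ minor target operation

  Walk : ℕ → Vertex → Set
  Walk k h = Σ[ hs ∈ (ℕ → Vertex) ] (∀ i → i < k → Edge (hs i) (hs (suc i))) × hs k ≗ h

  private
    extend : ∀ {k h h′} → Walk k h → Edge h h′ → Walk (suc k) h′
    extend {k} {h} {h′} (hs , edges , end) e = hs′ , edges′ , λ a → cong-app-≡ (after (suc k) ≤-refl) a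
      where
      hs′ : ℕ → Vertex
      hs′ i with i ≤? k
      ... | yes _ = hs i
      ... | no _  = h′
      before : ∀ i → i ≤ k → hs′ i ≡ hs i
      before i le with i ≤? k
      ... | yes _ = refl
      ... | no ¬le = contradiction le ¬le
      after : ∀ i → k < i → hs′ i ≡ h′
      after i lt with i ≤? k
      ... | yes le = contradiction lt (≤⇒≯ le)
      ... | no _   = refl
      cong-app-≡ : ∀ {f g : Vertex} → f ≡ g → ∀ a → f a ≡ g a
      cong-app-≡ refl a = refl
      source-≗ : ∀ {h₁ h₂ h₃} → h₁ ≗ h₂ → Edge h₂ h₃ → Edge h₁ h₃
      source-≗ eq e = record { Edge e ; source-minor = λ a → trans (eq a) (Edge.source-minor e a) }
      edges′ : ∀ i → i < suc k → Edge (hs′ i) (hs′ (suc i))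
      edges′ i lt with ℕ.m≤n⇒m<n∨m≡n (≤-pred lt)
      ... | inj₁ i<k  = subst₂ Edge (sym (before i (<⇒≤ i<k))) (sym (before (suc i) i<k)) (edges i i<k)
      ... | inj₂ refl = subst₂ Edge (sym (before k ≤-refl)) (sym (after (suc k) ≤-refl)) (source-≗ end e)

    Walk-≗ : ∀ {k h h′} → h ≗ h′ → Walk k h → Walk k h′
    Walk-≗ eq (hs , edges , end) = hs , edges , λ a → trans (end a) (eq a)

  LongWalk : Set
  LongWalk = Σ[ hs ∈ (ℕ → Vertex) ] ∀ i → i < 2 + n → Edge (hs i) (hs (suc i))

  module _ (no-walk : ¬ LongWalk) where

    private
      longest : ∀ h → ∃[ k ] Walk k h × k ≤ suc n × (∀ k′ → Walk k′ h → k′ ≤ k)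
      longest h = greatest em (λ k → Walk k h) (suc n) ((λ _ → h) , (λ _ ()) , λ _ → refl) bound
        where
        bound : ∀ k → Walk k h → k ≤ suc n
        bound k (hs , edges , _) with k ≤? suc n
        ... | yes le = le
        ... | no ¬le = contradiction (hs , λ i lt → edges i (<-≤-trans lt (≰⇒> ¬le))) no-walk

    -- The length of the longest walk ending in `h`. It increases along edges, which makes it a
    -- homomorphism to the tournament.
    level : Vertex → Fin (2 + n)
    level h = fromℕ< (s≤s (proj₁ (proj₂ (proj₂ (longest h)))))

    private
      toℕ-level : ∀ h → toℕ (level h) ≡ proj₁ (longest h)
      toℕ-level h = toℕ-fromℕ< (s≤s (proj₁ (proj₂ (proj₂ (longest h)))))

    level-edge : ∀ {h h′} → Edge h h′ → level h Fin.< level h′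
    level-edge {h} {h′} e = subst₂ _<_ (sym (toℕ-level h)) (sym (toℕ-level h′))
      (proj₂ (proj₂ (proj₂ (longest h′))) _ (extend (proj₁ (proj₂ (longest h))) e))

    level-≗ : ∀ {h h′} → h ≗ h′ → level h ≡ level h′
    level-≗ {h} {h′} eq = toℕ-injective (trans (toℕ-level h) (trans (≤-antisym
      (proj₂ (proj₂ (proj₂ (longest h′))) _ (Walk-≗ eq (proj₁ (proj₂ (longest h)))))
      (proj₂ (proj₂ (proj₂ (longest h))) _ (Walk-≗ (sym ∘ eq) (proj₁ (proj₂ (longest h′)))))) (sym (toℕ-level h′))))

    -- A tuple of elements of the tournament selects a minor of `⟦ f ⟧`, hence a vertex. The two
    -- sides of an identity select the same vertex and so have the same level.
    level-satisfies : ∀ Γ → member Satisfies Γ → Pol (𝕋 (2 + n)) Satisfies Γ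
    level-satisfies Γ (⟦_⟧ , mem , ids) = polymorphism , pol , All.map (λ {ι} → holds ι) ids
      where
      open MinorCondition Γ
      polymorphism : ∀ f → Op (Fin (2 + n)) (ar f)
      polymorphism f a = level (minor (lookup a) ⟦ f ⟧)
      pol : ∀ f → Pol (𝕋 (2 + n)) (ar f) (polymorphism f)
      pol f zero (a ∷ b ∷ []) lt = level-edge (edge {{ar-positive f}} ⟦ f ⟧ (mem f) (lookup a) (lookup b) lt (λ _ → refl) (λ _ → refl))
      Holds : ∀ {A : Set} → (∀ f → Op A (ar f)) → Identity ar → Set
      Holds {A} i (f ⟨ xs ⟩≈ g ⟨ ys ⟩) = ∀ (ρ : ℕ → A) → i f (Vec.map ρ xs) ≡ i g (Vec.map ρ ys)
      holds : ∀ ι → Holds ⟦_⟧ ι → Holds polymorphism ι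
      holds (f ⟨ xs ⟩≈ g ⟨ ys ⟩) eq ρ = level-≗ λ a →
        trans (cong ⟦ f ⟧ (args a xs)) (trans (eq (lookup a ∘ ρ)) (cong ⟦ g ⟧ (sym (args a ys))))
        where
        args : ∀ {k} (a : Vec A (2 + n)) (zs : Vec ℕ k) →
               tabulate (λ i → lookup a (lookup (Vec.map ρ zs) i)) ≡ Vec.map (lookup a ∘ ρ) zs
        args a zs = trans (tabulate-lookup-map (lookup a) (Vec.map ρ zs)) (sym (map-∘ (lookup a) ρ zs))

  side : ℕ → A → A → Fin (2 + n) → A
  side t x y k = if ⌊ toℕ k <? t ⌋ then y else x

  split : ℕ → A → A → Vec A (2 + n)
  split t x y = tabulate (side t x y)

  private
    if-dec : ∀ {P Q : Set} (p : Dec P) (q : Dec Q) {x y : A} → (P → Q) → (Q → P) →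
             (if ⌊ p ⌋ then y else x) ≡ (if ⌊ q ⌋ then y else x)
    if-dec (yes _) (yes _) f g = refl
    if-dec (no _)  (no _)  f g = refl
    if-dec (yes p) (no ¬q) f g = contradiction (f p) ¬q
    if-dec (no ¬p) (yes q) f g = contradiction (g q) ¬p

    minor-split : ∀ {h : Vertex} {r} {g : Op A r} {σ : Fin r → Fin (2 + n)} → h ≗ minor σ g → ∀ t x y →
                  h (split t x y) ≡ g (tabulate λ j → if ⌊ toℕ (σ j) <? t ⌋ then y else x)
    minor-split {g = g} {σ} eq t x y = trans (eq _) (cong g (tabulate-cong λ j → lookup∘tabulate (side t x y) (σ j)))

    minor-splits : ∀ {h : Vertex} {r} {g : Op A r} {σ : Fin r → Fin (2 + n)} → h ≗ minor σ g → ∀ t t′ →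
                   (∀ j → toℕ (σ j) < t → toℕ (σ j) < t′) → (∀ j → toℕ (σ j) < t′ → toℕ (σ j) < t) →
                   ∀ x y → h (split t x y) ≡ h (split t′ x y)
    minor-splits {g = g} {σ} eq t t′ f f′ x y = trans (minor-split {g = g} {σ} eq t x y) (trans
      (cong g (tabulate-cong λ j → if-dec (toℕ (σ j) <? t) (toℕ (σ j) <? t′) (f j) (f′ j)))
      (sym (minor-split {g = g} {σ} eq t′ x y)))

  module _ (walk : LongWalk) where

    private
      hs    = proj₁ walk
      edges = proj₂ walk

      module E (i : ℕ) (i< : i < 2 + n) = Edge (edges i i<)

      -- The vertex `hs 1` is the target of an edge, and targets are at least 1, so its argument
      -- number 0 is a dummy. Dually, the last argument of `hs (suc n)` is one.
      h₁-first : ∀ x y → hs 1 (split 1 x y) ≡ hs 1 (split 0 x y)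
      h₁-first = minor-splits {g = operation} {target} target-minor 1 0
        (λ j lt → contradiction (≤-trans (s≤s z≤n) (ascending j)) (≤⇒≯ (≤-pred lt))) (λ j ())
        where open E 0 (s≤s z≤n)

      hₙ₊₁-last : ∀ x y → hs (suc n) (split (suc n) x y) ≡ hs (suc n) (split (2 + n) x y)
      hₙ₊₁-last = minor-splits {g = operation} {source} source-minor (suc n) (2 + n)
        (λ j lt → m≤n⇒m≤1+n lt) (λ j _ → <-≤-trans (ascending j) (≤-pred (toℕ<n (target j))))
        where open E (suc n) ≤-refl

      split-full : ∀ x y → split (2 + n) x y ≡ Vec.map (λ _ → y) (split 0 x y)
      split-full x y = trans (tabulate-cong λ k → full (toℕ k <? 2 + n) (toℕ<n k)) (Vec.tabulate-∘ (λ _ → y) (side 0 x y))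
        where
        full : ∀ {P : Set} (p : Dec P) → P → (if ⌊ p ⌋ then y else x) ≡ y
        full (yes _) _ = refl
        full (no ¬p) p = contradiction p ¬p

      diagonal : ℕ → Op A 1
      diagonal i a = hs i (tabulate λ _ → lookup a zero)

      diagonal-0 : ∀ i x y → hs i (split 0 x y) ≡ diagonal i (x ∷ [])
      diagonal-0 i x y = cong (hs i) (tabulate-cong {f = side 0 x y} λ k → refl)

      diagonal-full : ∀ i x y → hs i (split (2 + n) x y) ≡ diagonal i (y ∷ [])
      diagonal-full i x y = cong (hs i) (trans (split-full x y) (lookup-ext λ k → trans (lookup-map k _ (split 0 x y)) (sym (lookup∘tabulate (λ _ → y) k))))

      vertex-member : ∀ i → suc i < 3 + n → member (2 + n) (hs (suc i))
      vertex-member i (s≤s i<) = respects-≗ (sym ∘ target-minor) (member-minor C {f = operation} {{positive}} target isMember)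
        where open E i i<

      diagonal-member : ∀ i → suc i < 3 + n → member 1 (diagonal (suc i))
      diagonal-member i i< = member-minor C {f = hs (suc i)} (λ _ → zero) (vertex-member i i<)

      -- The edge from h i to h (1 + i), with y put in the places whose source is below i.
      module Term (i : ℕ) (i< : i < 2 + n) where

        open E i i<

        -- The middle variable takes the arguments whose edge starts below `i` and ends above `i`:
        -- they receive `y` in the source minor and `x` in the target minor.
        place : Fin degree → Fin 3
        place j = if ⌊ toℕ (target j) <? suc i ⌋ then suc (suc zero) else (if ⌊ toℕ (source j) <? i ⌋ then suc zero else zero)

        term : Op A 3
        term = minor place operation

        term-member : member 3 term
        term-member = member-minor C {f = operation} {{positive}} place isMember

        below : ∀ j → toℕ (target j) < suc i → toℕ (source j) < i
        below j lt = <-≤-trans (ascending j) (≤-pred lt)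

        term-source : ∀ x y → term (x ∷ y ∷ y ∷ []) ≡ hs i (split i x y)
        term-source x y = trans (cong operation (tabulate-cong λ j → choose (toℕ (target j) <? suc i) (toℕ (source j) <? i) (below j)))
          (sym (minor-split {g = operation} {source} source-minor i x y))
          where
          choose : ∀ {P Q : Set} (p : Dec P) (q : Dec Q) → (P → Q) →
            lookup (x ∷ y ∷ y ∷ []) (if ⌊ p ⌋ then suc (suc zero) else (if ⌊ q ⌋ then suc zero else zero)) ≡ (if ⌊ q ⌋ then y else x)
          choose (yes _) (yes _) _ = refl
          choose (no _)  (yes _) _ = refl
          choose (no _)  (no _)  _ = refl
          choose (yes p) (no ¬q) f = contradiction (f p) ¬q

        term-target : ∀ x y → term (x ∷ x ∷ y ∷ []) ≡ hs (suc i) (split (suc i) x y)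
        term-target x y = trans (cong operation (tabulate-cong λ j → choose (toℕ (target j) <? suc i) (toℕ (source j) <? i)))
          (sym (minor-split {g = operation} {target} target-minor (suc i) x y))
          where
          choose : ∀ {P Q : Set} (p : Dec P) (q : Dec Q) →
            lookup (x ∷ x ∷ y ∷ []) (if ⌊ p ⌋ then suc (suc zero) else (if ⌊ q ⌋ then suc zero else zero)) ≡ (if ⌊ p ⌋ then y else x)
          choose (yes _) _       = refl
          choose (no _)  (yes _) = refl
          choose (no _)  (no _)  = refl

      bounded : ∀ {k} → k ≡ n → (i : Fin k) → suc (toℕ i) < 2 + n
      bounded refl i = s≤s (m≤n⇒m≤1+n (toℕ<n i))

      terms : ∀ {k} → k ≡ n → (f : Fin (2 + k)) → Op A (MinorCondition.ar (HM k) f)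
      terms eq zero          = diagonal 1
      terms eq (suc zero)    = diagonal (suc n)
      terms eq (suc (suc i)) = Term.term (suc (toℕ i)) (bounded eq i)

      terms-member : ∀ {k} (eq : k ≡ n) f → member (MinorCondition.ar (HM k) f) (terms eq f)
      terms-member eq zero          = diagonal-member 0 (s≤s (s≤s z≤n))
      terms-member eq (suc zero)    = diagonal-member n (s≤s (n≤1+n _))
      terms-member eq (suc (suc i)) = Term.term-member (suc (toℕ i)) (bounded eq i)

    -- The `n` inner edges of the walk provide the ternary terms, and the outermost ones the dummy
    -- arguments at both ends. The index `k` allows a case distinction that is impossible on the
    -- parameter `n`.
    longWalk⇒HM : ∀ {k} → k ≡ n → member Satisfies HM k
    longWalk⇒HM {zero} refl = terms refl , terms-member refl , (λ ρ → begin
      diagonal 1 (ρ 0 ∷ [])      ≡⟨ diagonal-0 1 (ρ 0) (ρ 1) ⟨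
      hs 1 (split 0 (ρ 0) (ρ 1)) ≡⟨ h₁-first (ρ 0) (ρ 1) ⟨
      hs 1 (split 1 (ρ 0) (ρ 1)) ≡⟨ hₙ₊₁-last (ρ 0) (ρ 1) ⟩
      hs 1 (split 2 (ρ 0) (ρ 1)) ≡⟨ diagonal-full 1 (ρ 0) (ρ 1) ⟩
      diagonal 1 (ρ 1 ∷ [])      ∎) ∷ []
      where open ≡-Reasoning
    longWalk⇒HM {suc m} refl = terms refl , terms-member refl ,
      (λ ρ → trans (sym (diagonal-0 1 (ρ 0) (ρ 1))) (trans (sym (h₁-first (ρ 0) (ρ 1))) (sym (Term.term-source 1 _ (ρ 0) (ρ 1))))) ∷
      (λ ρ → trans (Term.term-target (suc (toℕ (fromℕ m))) _ (ρ 0) (ρ 1))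
        (trans (cong (λ t → hs (2 + t) (split (2 + t) (ρ 0) (ρ 1))) (toℕ-fromℕ m))
          (trans (hₙ₊₁-last (ρ 0) (ρ 1)) (diagonal-full (suc n) (ρ 0) (ρ 1))))) ∷
      All.map⁺ (All.universal (λ i ρ → trans (Term.term-target (suc (toℕ (inject₁ i))) _ (ρ 0) (ρ 1))
        (trans (cong (λ t → hs (2 + t) (split (2 + t) (ρ 0) (ρ 1))) (toℕ-inject₁ i)) (sym (Term.term-source (2 + toℕ i) _ (ρ 0) (ρ 1))))) (allFin m))

module _ (em : EM) {τ : Signature} (𝔹 : Structure τ) (n : ℕ) where

  open Classical em

  tournament-minimal⇒HM : (∀ Γ → Pol (𝕋 (2 + n)) Satisfies Γ → Pol 𝔹 Satisfies Γ) →
                          ∀ Γ → ¬ (Pol 𝔹 Satisfies Γ) → Γ ImpliesForFiniteClones HM n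
  tournament-minimal⇒HM minimal Γ ¬Γ finite C C⊨Γ = stable λ ¬HM →
    ¬Γ (minimal Γ (level-satisfies (λ walk → ¬HM (longWalk⇒HM walk refl)) Γ C⊨Γ))
    where open FreeDigraph em C n

  HM⇒tournament-minimal : (∀ Γ → ¬ (Pol 𝔹 Satisfies Γ) → Γ ImpliesForFiniteClones HM n) →
                          ∀ Γ → Pol (𝕋 (2 + n)) Satisfies Γ → Pol 𝔹 Satisfies Γ
  HM⇒tournament-minimal implies Γ T⊨Γ = stable λ ¬Γ →
    ¬tournament-HM n (implies Γ ¬Γ (2 + n , mk↔ₛ′ id id (λ _ → refl) (λ _ → refl)) (polClone (𝕋 (2 + n))) T⊨Γ)

-- Elevator chains

insertTwice-map : ∀ {A C : Set} {n} (g : A → C) (xs : Vec A n) p z →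
                  Vec.map g (insertTwice xs p z) ≡ insertTwice (Vec.map g xs) p (g z)
insertTwice-map g xs p z = trans (Vec.map-insertAt g z (insertAt xs p z) (inject₁ p))
  (cong (λ v → insertAt v (inject₁ p) (g z)) (Vec.map-insertAt g z xs p))

module _ {A C : Set} (g : A → C) where

  map-⊆ᵉ : ∀ {k} {S T : Vec A k} → S ⊆ᵉ T → Vec.map g S ⊆ᵉ Vec.map g T
  map-⊆ᵉ {S = S} {T} S⊆T i =
    subst (VecMem._∈ Vec.map g T) (sym (trans (VecAny.lookup-index i) (lookup-map (VecAny.index i) g S)))
      (VecMem.∈-map⁺ g (S⊆T (VecMem.∈-lookup (VecAny.index i) S)))

  map-⊑ : ∀ {ℓ k} {Ss Ts : Vec (Vec A k) ℓ} → Ss ⊑ Ts → Vec.map (Vec.map g) Ss ⊑ Vec.map (Vec.map g) Ts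
  map-⊑ {Ss = Ss} {Ts} S⊑T i with S⊑T i
  ... | l , S⊆T , T⊆S = l , subst₂ _≈ᵉ_ (sym (lookup-map i _ Ss)) (sym (lookup-map l _ Ts)) (map-⊆ᵉ S⊆T , map-⊆ᵉ T⊆S)

-- F f is computed by f in each of the directions π j.
module Transfer {A A′ J : Set} (π : J → A′ → A) (F : ∀ {m} → Op A m → Op A′ m)
  (determined : ∀ {k l} (f : Op A k) (g : Op A l) v w →
                (∀ j → f (Vec.map (π j) v) ≡ g (Vec.map (π j) w)) → F f v ≡ F g w)
  {M : OpSet A} {M′ : OpSet A′} (members : ∀ {m} (f : Op A m) → M m f → M′ m (F f)) where

  elevator-transfer : ∀ {n} → ElevatorChain[1+ n ] M → ElevatorChain[1+ n ] M′
  elevator-transfer chain = record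
    { e-first = F e-first ; e-last = F e-last ; e = F ∘ e
    ; e-first∈M = members e-first e-first∈M ; e-last∈M = members e-last e-last∈M ; e∈M = λ i → members (e i) (e∈M i)
    ; start = λ xs z → determined e-first (e zero) xs (insertTwice xs (suc zero) z) λ j →
        trans (start (Vec.map (π j) xs) (π j z)) (cong (e zero) (sym (insertTwice-map (π j) xs (suc zero) z)))
    ; climb = λ i xs y z → determined (e (inject₁ i)) (e (suc i)) (insertTwice xs (inject₁ (inject₁ i)) y) (insertTwice xs (suc (suc i)) z) λ j →
        trans (cong (e (inject₁ i)) (insertTwice-map (π j) xs _ y)) (trans (climb i (Vec.map (π j) xs) (π j y) (π j z))
          (cong (e (suc i)) (sym (insertTwice-map (π j) xs (suc (suc i)) z))))
    ; end = λ xs y → determined (e (fromℕ _)) e-last (insertTwice xs (inject₁ (fromℕ _)) y) xs λ j →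
        trans (cong (e (fromℕ _)) (insertTwice-map (π j) xs _ y)) (end (Vec.map (π j) xs) (π j y))
    }
    where open ElevatorChain[1+_] chain

  private
    on-blocks : ∀ {ℓ k} (f : Op A (ℓ * k)) (Ss Ts : Vec (Vec A′ k) ℓ) →
      (∀ j → f (Vec.concat (Vec.map (Vec.map (π j)) Ss)) ≡ f (Vec.concat (Vec.map (Vec.map (π j)) Ts))) →
      F f (Vec.concat Ss) ≡ F f (Vec.concat Ts)
    on-blocks f Ss Ts eq = determined f f (Vec.concat Ss) (Vec.concat Ts) λ j →
      trans (cong f (Vec.map-concat (π j) Ss)) (trans (eq j) (cong f (sym (Vec.map-concat (π j) Ts))))

  absorptive-transfer : HasAbsorptive M → HasAbsorptive M′
  absorptive-transfer has ℓ k with has ℓ k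
  ... | f , mf , sets , absorbs = F f , members f mf ,
        (λ Ss Ts p q → on-blocks f Ss Ts λ j → sets (Vec.map (Vec.map (π j)) Ss) (Vec.map (Vec.map (π j)) Ts) (map-⊑ (π j) {Ss = Ss} {Ts} p) (map-⊑ (π j) {Ss = Ts} {Ss} q)) , absorb ℓ f absorbs
    where
    absorb : ∀ ℓ (f : Op A (ℓ * k)) → AbsorbsSupersets ℓ k f → AbsorbsSupersets ℓ k (F f)
    absorb 0             f _ = tt
    absorb 1             f _ = tt
    absorb (suc (suc ℓ)) f h S₁ S₂ Ss S₂⊆S₁ =
      on-blocks f (S₁ ∷ S₂ ∷ Ss) (S₂ ∷ S₂ ∷ Ss) λ j → h (Vec.map (π j) S₁) (Vec.map (π j) S₂) (Vec.map (Vec.map (π j)) Ss) (map-⊆ᵉ (π j) S₂⊆S₁)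

-- Counting operations on the tournament

leading : ∀ {P : ℕ → Set} (P? : ∀ s → Dec (P s)) → (s₀ fuel : ℕ) → ℕ
leading P? s zero       = 0
leading P? s (suc fuel) = if ⌊ P? s ⌋ then suc (leading P? (suc s) fuel) else 0

leading≤ : ∀ {P : ℕ → Set} (P? : ∀ s → Dec (P s)) s fuel → leading P? s fuel ≤ fuel
leading≤ P? s zero       = z≤n
leading≤ P? s (suc fuel) with P? s
... | yes _ = s≤s (leading≤ P? (suc s) fuel)
... | no _  = z≤n

leading-cong : ∀ {P Q : ℕ → Set} (P? : ∀ s → Dec (P s)) (Q? : ∀ s → Dec (Q s)) → (∀ s → P s → Q s) → (∀ s → Q s → P s) →
               ∀ s fuel → leading P? s fuel ≡ leading Q? s fuel
leading-cong P? Q? f g s zero       = refl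
leading-cong P? Q? f g s (suc fuel) with P? s | Q? s
... | yes _ | yes _ = cong suc (leading-cong P? Q? f g (suc s) fuel)
... | no _  | no _  = refl
... | yes p | no ¬q = contradiction (f s p) ¬q
... | no ¬p | yes q = contradiction (g s q) ¬p

-- Every place of the first run reappears one place later in the second, which has an additional
-- first place; the first run stops before the fuel is used up.
leading-< : ∀ {P Q : ℕ → Set} (P? : ∀ s → Dec (P s)) (Q? : ∀ s → Dec (Q s)) →
            (∀ s → P s → Q (suc s)) → ∀ s fuel → Q s → ¬ P (s + fuel) → leading P? s (suc fuel) < leading Q? s (suc fuel)
leading-< {P} P? Q? f s fuel q ¬p with P? s | Q? s
... | _     | no ¬q = contradiction q ¬q
... | no _  | yes _ = s≤s z≤n
... | yes p | yes _ = s≤s (go fuel ¬p)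
  where
  go : ∀ fuel → ¬ P (s + fuel) → leading P? (suc s) fuel < leading Q? (suc s) fuel
  go zero       ¬p = contradiction (subst P (sym (+-identityʳ s)) p) ¬p
  go (suc fuel) ¬p = leading-< P? Q? f (suc s) fuel (f s p) (¬p ∘ subst P (sym (+-suc s fuel)))

bit : Bool → ℕ
bit b = if b then 1 else 0

module _ {A : Set} (g : A → Bool) where

  count : ∀ {m} → Vec A m → ℕ
  count []       = 0
  count (a ∷ as) = bit (g a) + count as

  -- Parity acts as a minority operation on three arguments: two equal neighbours cancel, on
  -- whichever side of the third they stand.
  tripleCount : ∀ {m} → Fin m → Vec A (2 + m) → ℕ
  tripleCount zero    (a ∷ b ∷ c ∷ as) = bit (g a xor (g b xor g c)) + count as
  tripleCount (suc k) (a ∷ as)         = bit (g a) + tripleCount k as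

  private
    xor-pairˡ : ∀ x y → (y xor (y xor x)) ≡ x
    xor-pairˡ x true  = Bool.not-involutive x
    xor-pairˡ x false = refl

    xor-pairʳ : ∀ x z → (x xor (z xor z)) ≡ x
    xor-pairʳ x true  = Bool.xor-identityʳ x
    xor-pairʳ x false = Bool.xor-identityʳ x

  tripleCount-before : ∀ {m} (xs : Vec A m) k y → tripleCount k (insertTwice xs (inject₁ k) y) ≡ count xs
  tripleCount-before (x ∷ xs) zero    y = cong (λ b → bit b + count xs) (xor-pairˡ (g x) (g y))
  tripleCount-before (x ∷ xs) (suc k) y = cong (bit (g x) +_) (tripleCount-before xs k y)

  tripleCount-after : ∀ {m} (xs : Vec A m) k z → tripleCount k (insertTwice xs (suc k) z) ≡ count xs
  tripleCount-after (x ∷ xs) zero    z = cong (λ b → bit b + count xs) (xor-pairʳ (g x) (g z))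
  tripleCount-after (x ∷ xs) (suc k) z = cong (bit (g x) +_) (tripleCount-after xs k z)

-- Parity is not monotone, so a larger set may have a count that is smaller by one. This loss is
-- made up by moving on to the next threshold.
record IsCount {A : Set} {m : ℕ} (N : ℕ) (c : (A → Bool) → Vec A m → ℕ) : Set where
  field
    increase : ∀ g g′ v v′ → (∀ i → g (lookup v i) ≡ true → g′ (lookup v′ i) ≡ true) → c g v ≤ suc (c g′ v′)
    all   : ∀ g v → (∀ i → g (lookup v i) ≡ true) → c g v ≡ N
    none  : ∀ g v → (∀ i → g (lookup v i) ≡ false) → c g v ≡ 0

private
  bit≤1 : ∀ b → bit b ≤ 1
  bit≤1 true  = ≤-refl
  bit≤1 false = z≤n

  bit-mono : ∀ {b c} → (b ≡ true → c ≡ true) → bit b ≤ bit c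
  bit-mono {false} _ = z≤n
  bit-mono {true}  f rewrite f refl = ≤-refl

  count-mono : ∀ {A : Set} {m} (g g′ : A → Bool) (v v′ : Vec A m) →
               (∀ i → g (lookup v i) ≡ true → g′ (lookup v′ i) ≡ true) → count g v ≤ count g′ v′
  count-mono g g′ []      []        f = z≤n
  count-mono g g′ (_ ∷ v) (_ ∷ v′) f = +-mono-≤ (bit-mono (f zero)) (count-mono g g′ v v′ (f ∘ suc))

isCount-count : ∀ {A : Set} m → IsCount m (λ g → count {A} g {m})
isCount-count {A} m = record { increase = λ g g′ v v′ f → m≤n⇒m≤1+n (count-mono g g′ v v′ f) ; all = all ; none = none }
  where
  all : ∀ {m} g (v : Vec A m) → (∀ i → g (lookup v i) ≡ true) → count g v ≡ m
  all g []      _ = refl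
  all g (_ ∷ v) t rewrite t zero = cong suc (all g v (t ∘ suc))
  none : ∀ {m} g (v : Vec A m) → (∀ i → g (lookup v i) ≡ false) → count g v ≡ 0
  none g []      _ = refl
  none g (_ ∷ v) t rewrite t zero = none g v (t ∘ suc)

isCount-tripleCount : ∀ {A : Set} {m} (k : Fin m) → IsCount m (λ g → tripleCount {A} g k)
isCount-tripleCount zero = record
  { increase = λ { g g′ (a ∷ b ∷ c ∷ v) (a′ ∷ b′ ∷ c′ ∷ v′) f → ≤-trans
      (+-mono-≤ (bit≤1 (g a xor (g b xor g c))) (count-mono g g′ v v′ (λ i → f (suc (suc (suc i)))))) (s≤s (m≤n+m _ _)) }
  ; all  = λ { g (a ∷ b ∷ c ∷ v) t → cong₂ _+_ (cong bit (cong₂ _xor_ (t zero) (cong₂ _xor_ (t (suc zero)) (t (suc (suc zero))))))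
      (IsCount.all (isCount-count _) g v (λ i → t (suc (suc (suc i))))) }
  ; none = λ { g (a ∷ b ∷ c ∷ v) t → cong₂ _+_ (cong bit (cong₂ _xor_ (t zero) (cong₂ _xor_ (t (suc zero)) (t (suc (suc zero))))))
      (IsCount.none (isCount-count _) g v (λ i → t (suc (suc (suc i))))) }
  }
isCount-tripleCount (suc k) = record
  { increase = λ { g g′ (a ∷ v) (a′ ∷ v′) f → ≤-trans (+-mono-≤ (bit-mono (f zero)) (increase g g′ v v′ (f ∘ suc)))
      (≤-reflexive (+-suc (bit (g′ a′)) _)) }
  ; all  = λ { g (a ∷ v) t → cong₂ _+_ (cong bit (t zero)) (all g v (t ∘ suc)) }
  ; none = λ { g (a ∷ v) t → cong₂ _+_ (cong bit (t zero)) (none g v (t ∘ suc)) }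
  }
  where open IsCount (isCount-tripleCount k)

module TournamentElevator (n : ℕ) where

  private
    N = suc n

    atLeast : ℕ → Fin (suc N) → Bool
    atLeast s a = ⌊ s ≤? toℕ a ⌋

    atLeast⁺ : ∀ {s a} → s ≤ toℕ a → atLeast s a ≡ true
    atLeast⁺ {s} {a} le with s ≤? toℕ a
    ... | yes _  = refl
    ... | no ¬le = contradiction le ¬le

    atLeast⁻ : ∀ {s a} → atLeast s a ≡ true → s ≤ toℕ a
    atLeast⁻ {s} {a} eq with s ≤? toℕ a
    ... | yes le = le

    Enough : ℕ → ℕ → Set
    Enough c s = suc N ≤ s + c

    threshold? : ∀ (c : ℕ → ℕ) s → Dec (Enough (c s) s)
    threshold? c s = suc N ≤? s + c s

  -- The value is the number of s = 1, 2, … up to the first which less than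
  -- N + 1 - s of the entries reach.
  thresholdOp : ∀ {m} → ((Fin (suc N) → Bool) → Vec (Fin (suc N)) m → ℕ) → Op (Fin (suc N)) m
  thresholdOp c v = fromℕ< (s≤s (leading≤ (threshold? (λ s → c (atLeast s) v)) 1 N))

  private
    toℕ-thresholdOp : ∀ {m} (c : (Fin (suc N) → Bool) → Vec (Fin (suc N)) m → ℕ) v →
                      toℕ (thresholdOp c v) ≡ leading (threshold? (λ s → c (atLeast s) v)) 1 N
    toℕ-thresholdOp c v = toℕ-fromℕ< (s≤s (leading≤ (threshold? (λ s → c (atLeast s) v)) 1 N))

  thresholdOp-pol : ∀ {m} {c : (Fin (suc N) → Bool) → Vec (Fin (suc N)) m → ℕ} → IsCount N c → Pol (𝕋 (suc N)) m (thresholdOp c)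
  thresholdOp-pol {m} {c} isCount zero (v ∷ w ∷ []) v<w = subst₂ _<_ (sym (toℕ-thresholdOp c v)) (sym (toℕ-thresholdOp c w))
    (leading-< (threshold? (λ s → c (atLeast s) v)) (threshold? (λ s → c (atLeast s) w))
      (λ s enough → ≤-trans enough (≤-trans (+-monoʳ-≤ s (increase (atLeast s) (atLeast (suc s)) v w
        λ i t → atLeast⁺ (≤-trans (s≤s (atLeast⁻ t)) (v<w i)))) (≤-reflexive (+-suc s _))))
      1 n
      (s≤s (≤-reflexive (sym (all (atLeast 1) w λ i → atLeast⁺ (≤-trans (s≤s z≤n) (v<w i))))))
      -- Each entry of `v` lies below an entry of `w`, so none of them is `N`, and the run for `v`
      -- stops in time.
      (λ enough → 1+n≰n (≤-trans enough (≤-reflexive (trans (cong (N +_)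
        (none (atLeast N) v λ i → Bool.¬-not λ t → 1+n≰n (≤-trans (s≤s (atLeast⁻ {N} t)) (≤-trans (v<w i) (≤-pred (toℕ<n (lookup w i))))))) (+-identityʳ N))))))
    where open IsCount isCount

  private
    thresholdOp-cong : ∀ {m k} (c : (Fin (suc N) → Bool) → Vec (Fin (suc N)) m → ℕ) (d : (Fin (suc N) → Bool) → Vec (Fin (suc N)) k → ℕ)
                       v w → (∀ g → c g v ≡ d g w) → thresholdOp c v ≡ thresholdOp d w
    thresholdOp-cong c d v w eq = toℕ-injective (trans (toℕ-thresholdOp c v) (trans
      (leading-cong (threshold? (λ s → c (atLeast s) v)) (threshold? (λ s → d (atLeast s) w))
        (λ s → subst (λ k → Enough k s) (eq (atLeast s))) (λ s → subst (λ k → Enough k s) (sym (eq (atLeast s)))) 1 N)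
      (sym (toℕ-thresholdOp d w))))

    first : Op (Fin (suc N)) N
    first = thresholdOp (λ g → count g)

    e : Fin N → Op (Fin (suc N)) (2 + N)
    e k = thresholdOp (λ g → tripleCount g k)

    before : ∀ k xs y → e k (insertTwice xs (inject₁ k) y) ≡ first xs
    before k xs y = thresholdOp-cong (λ g → tripleCount g k) (λ g → count g) _ xs λ g → tripleCount-before g xs k y

    after : ∀ k xs z → e k (insertTwice xs (suc k) z) ≡ first xs
    after k xs z = thresholdOp-cong (λ g → tripleCount g k) (λ g → count g) _ xs λ g → tripleCount-after g xs k z

  tournamentElevator : ElevatorChain[1+ n ] (Pol (𝕋 (suc N)))
  tournamentElevator = record
    { e-first = first ; e-last = first ; e = e
    ; e-first∈M = thresholdOp-pol (isCount-count N) ; e-last∈M = thresholdOp-pol (isCount-count N)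
    ; e∈M = λ k → thresholdOp-pol (isCount-tripleCount k)
    ; start = λ xs z → sym (after zero xs z)
    ; climb = λ i xs y z → trans (before (inject₁ i) xs y) (sym (after (suc i) xs z))
    ; end   = λ xs y → before (fromℕ n) xs y
    }

-- Lattices

binaryOp : ∀ {A : Set} → Op₂ A → Op A 2
binaryOp _·_ (x ∷ y ∷ []) = x · y

module TournamentLattice (m : ℕ) where

  open Max (Fin.≤-totalOrder m) using (maxOperator; x≤x⊔y; x≤y⊔x; ⊔-sel) renaming (_⊔_ to _∨_) public
  open Min (Fin.≤-totalOrder m) using (minOperator; x⊓y≤x; x⊓y≤y; ⊓-sel) renaming (_⊓_ to _∧′_) public

  ∨-∧-isDistributiveLattice : IsDistributiveLattice _≡_ _∨_ _∧′_
  ∨-∧-isDistributiveLattice = MinMax.⊔-⊓-isDistributiveLattice minOperator maxOperator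

  ∨-pol : Pol (𝕋 m) 2 (binaryOp _∨_)
  ∨-pol zero ((a ∷ b ∷ []) ∷ (a′ ∷ b′ ∷ []) ∷ []) lt with ⊔-sel a b
  ... | inj₁ eq = subst (λ c → c Fin.< a′ ∨ b′) (sym eq) (<-≤-trans (lt zero) (x≤x⊔y a′ b′))
  ... | inj₂ eq = subst (λ c → c Fin.< a′ ∨ b′) (sym eq) (<-≤-trans (lt (suc zero)) (x≤y⊔x a′ b′))

  ∧′-pol : Pol (𝕋 m) 2 (binaryOp _∧′_)
  ∧′-pol zero ((a ∷ b ∷ []) ∷ (a′ ∷ b′ ∷ []) ∷ []) lt with ⊓-sel a′ b′
  ... | inj₁ eq = subst (λ c → a ∧′ b Fin.< c) (sym eq) (≤-<-trans (x⊓y≤x a b) (lt zero))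
  ... | inj₂ eq = subst (λ c → a ∧′ b Fin.< c) (sym eq) (≤-<-trans (x⊓y≤y a b) (lt (suc zero)))

zipWith-isDistributiveLattice : ∀ {A : Set} {_∨_ _∧′_ : Op₂ A} → IsDistributiveLattice _≡_ _∨_ _∧′_ →
  ∀ d → IsDistributiveLattice (_≡_ {A = Vec A d}) (Vec.zipWith _∨_) (Vec.zipWith _∧′_)
zipWith-isDistributiveLattice {_∨_ = _∨_} {_∧′_} L d = record
  { isLattice = record
    { isEquivalence = isEquivalence
    ; ∨-comm  = Vec.zipWith-comm ∨-comm
    ; ∨-assoc = Vec.zipWith-assoc ∨-assoc
    ; ∨-cong  = cong₂ (Vec.zipWith _∨_)
    ; ∧-comm  = Vec.zipWith-comm ∧-comm
    ; ∧-assoc = Vec.zipWith-assoc ∧-assoc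
    ; ∧-cong  = cong₂ (Vec.zipWith _∧′_)
    ; absorptive = absorbs ∨-absorbs-∧ , absorbs ∧-absorbs-∨
    }
  ; ∨-distrib-∧ = Vec.zipWith-distribˡ ∨-distribˡ-∧ , Vec.zipWith-distribʳ ∨-distribʳ-∧
  ; ∧-distrib-∨ = Vec.zipWith-distribˡ ∧-distribˡ-∨ , Vec.zipWith-distribʳ ∧-distribʳ-∨
  }
  where
  open IsDistributiveLattice L using (∨-comm; ∨-assoc; ∧-comm; ∧-assoc; ∨-absorbs-∧; ∧-absorbs-∨; ∨-distribˡ-∧; ∨-distribʳ-∧; ∧-distribˡ-∨; ∧-distribʳ-∨)
  absorbs : ∀ {_+_ _*_ : Op₂ _} → (∀ x y → x + (x * y) ≡ x) →
            ∀ {d} (u v : Vec _ d) → Vec.zipWith _+_ u (Vec.zipWith _*_ u v) ≡ u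
  absorbs h []      []      = refl
  absorbs h (x ∷ u) (y ∷ v) = cong₂ _∷_ (h x y) (absorbs h u v)

coordinatewise-binary : ∀ {A : Set} (_·_ : Op₂ A) d → coordinatewise d (binaryOp _·_) ≗ binaryOp (Vec.zipWith _·_)
coordinatewise-binary _·_ d (u ∷ v ∷ []) = lookup-ext λ j → trans (lookup-map j (binaryOp _·_) (transposed (u ∷ v ∷ [])))
  (trans (cong (binaryOp _·_) (lookup∘tabulate _ j)) (sym (Vec.lookup-zipWith _·_ j u v)))

ppConstructs⇒distributiveLattice : ∀ (em : EM) n {τ} {𝔹 : Structure τ} → 𝕋 (2 + n) PPConstructs 𝔹 →
  Σ[ 𝔹′ ∈ Structure τ ] Finite (Carrier 𝔹′) × 𝔹 ⟷ 𝔹′ × ElevatorChain[1+ n ] (Pol 𝔹′) × HasDistributiveLatticePol 𝔹′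
ppConstructs⇒distributiveLattice em n {τ} (d , _ , φ , equivalent) =
  𝔹′ , listable⇒finite em (listable-Vec d (listable-Fin (2 + n))) , equivalent ,
  Transfer.elevator-transfer (λ j v → lookup v j) (coordinatewise d) determined
    (λ {m} f pf → coordinatewise-pol {τ = τ} (𝕋 (2 + n)) d φ {m} {f} pf) (TournamentElevator.tournamentElevator n) ,
  Vec.zipWith _∨_ , Vec.zipWith _∧′_ , polymorphism {_∨_} ∨-pol , polymorphism {_∧′_} ∧′-pol ,
  zipWith-isDistributiveLattice ∨-∧-isDistributiveLattice d
  where
  open TournamentLattice (2 + n)
  𝔹′ = ppPower {τ = τ} (𝕋 (2 + n)) d φ
  determined : ∀ {k l} (f : Op (Fin (2 + n)) k) (g : Op (Fin (2 + n)) l) v w →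
    (∀ (j : Fin d) → f (Vec.map (λ u → lookup u j) v) ≡ g (Vec.map (λ u → lookup u j) w)) → coordinatewise d f v ≡ coordinatewise d g w
  determined f g v w eq = lookup-ext λ j → trans (lookup-map-tabulate f _ j) (trans (eq j) (sym (lookup-map-tabulate g _ j)))
  polymorphism : ∀ {_·_ : Op₂ (Fin (2 + n))} → Pol (𝕋 (2 + n)) 2 (binaryOp _·_) → IsPolymorphism₂ 𝔹′ (Vec.zipWith _·_)
  polymorphism {_·_} p = respects-≗-pol 𝔹′ {f = coordinatewise d (binaryOp _·_)}
    (λ { (u ∷ v ∷ []) → coordinatewise-binary _·_ d (u ∷ v ∷ []) })
    (coordinatewise-pol {τ = τ} (𝕋 (2 + n)) d φ {2} {binaryOp _·_} p)

module LatticeAbsorption {A : Set} {_∨_ _∧′_ : Op₂ A} (L : IsLattice _≡_ _∨_ _∧′_) where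

  private
    lattice : Lattice 0ℓ 0ℓ
    lattice = record { isLattice = L }

    module O = OrderLattice (LatticeProperties.∨-∧-orderTheoreticLattice lattice)
    open O using () renaming (_≤_ to _⊴_)

    meet join : ∀ {k} → Vec A (suc k) → A
    meet = Vec.foldr₁ _∧′_
    join = Vec.foldr₁ _∨_

    meet-lower : ∀ {k} (v : Vec A (suc k)) i → meet v ⊴ lookup v i
    meet-lower (x ∷ [])     zero    = O.refl
    meet-lower (x ∷ y ∷ v) zero    = O.x∧y≤x x _
    meet-lower (x ∷ y ∷ v) (suc i) = O.trans (O.x∧y≤y x _) (meet-lower (y ∷ v) i)

    meet-greatest : ∀ {k} (v : Vec A (suc k)) {a} → (∀ i → a ⊴ lookup v i) → a ⊴ meet v
    meet-greatest (x ∷ [])     le = le zero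
    meet-greatest (x ∷ y ∷ v) le = O.∧-greatest (le zero) (meet-greatest (y ∷ v) (le ∘ suc))

    join-upper : ∀ {k} (v : Vec A (suc k)) i → lookup v i ⊴ join v
    join-upper (x ∷ [])     zero    = O.refl
    join-upper (x ∷ y ∷ v) zero    = O.x≤x∨y x _
    join-upper (x ∷ y ∷ v) (suc i) = O.trans (join-upper (y ∷ v) i) (O.y≤x∨y x _)

    join-least : ∀ {k} (v : Vec A (suc k)) {a} → (∀ i → lookup v i ⊴ a) → join v ⊴ a
    join-least (x ∷ [])     le = le zero
    join-least (x ∷ y ∷ v) le = O.∨-least (le zero) (join-least (y ∷ v) (le ∘ suc))

    meet-⊆ : ∀ {k} {S T : Vec A (suc k)} → S ⊆ᵉ T → meet T ⊴ meet S
    meet-⊆ {S = S} {T} S⊆T = meet-greatest S λ i → let p = S⊆T (VecMem.∈-lookup i S) in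
      subst (meet T ⊴_) (sym (VecAny.lookup-index p)) (meet-lower T (VecAny.index p))

    joinOfMeets : ∀ {ℓ k} → Vec (Vec A (suc k)) (suc ℓ) → A
    joinOfMeets Ss = join (Vec.map meet Ss)

    joinOfMeets-mono : ∀ {ℓ k} {Ss Ts : Vec (Vec A (suc k)) (suc ℓ)} →
                       (∀ i → ∃[ j ] lookup Ts j ⊆ᵉ lookup Ss i) → joinOfMeets Ss ⊴ joinOfMeets Ts
    joinOfMeets-mono {Ss = Ss} {Ts} f = join-least (Vec.map meet Ss) λ i → let j , T⊆S = f i in
      subst (_⊴ joinOfMeets Ts) (sym (lookup-map i meet Ss)) (O.trans (meet-⊆ T⊆S)
        (subst (_⊴ joinOfMeets Ts) (lookup-map j meet Ts) (join-upper (Vec.map meet Ts) j)))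

    block : ∀ ℓ k → Vec A (ℓ * k) → Fin ℓ → Vec A k
    block ℓ k v i = tabulate λ j → lookup v (Fin.combine i j)

    -- The join of the meets of the blocks. A block that contains another one has a smaller meet,
    -- which the join absorbs.
    absorptiveOp : ∀ ℓ k → Op A (suc ℓ * suc k)
    absorptiveOp ℓ k v = join (tabulate λ i → meet (block (suc ℓ) (suc k) v i))

    block-concat : ∀ {ℓ k} (Ss : Vec (Vec A k) ℓ) i → block ℓ k (Vec.concat Ss) i ≡ lookup Ss i
    block-concat Ss i = trans (tabulate-cong (lookup-concat Ss i)) (Vec.tabulate∘lookup (lookup Ss i))

    absorptiveOp-concat : ∀ {ℓ k} (Ss : Vec (Vec A (suc k)) (suc ℓ)) → absorptiveOp ℓ k (Vec.concat Ss) ≡ joinOfMeets Ss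
    absorptiveOp-concat {ℓ} {k} Ss = cong join {tabulate (λ i → meet (block (suc ℓ) (suc k) (Vec.concat Ss) i))}
      (trans (tabulate-cong λ i → cong meet (block-concat Ss i)) (tabulate-lookup-map meet Ss))

    on-blocks : ∀ {ℓ k} {Ss Ts : Vec (Vec A (suc k)) (suc ℓ)} →
      (∀ i → ∃[ j ] lookup Ts j ⊆ᵉ lookup Ss i) → (∀ i → ∃[ j ] lookup Ss j ⊆ᵉ lookup Ts i) →
      absorptiveOp ℓ k (Vec.concat Ss) ≡ absorptiveOp ℓ k (Vec.concat Ts)
    on-blocks {Ss = Ss} {Ts} f g = trans (absorptiveOp-concat Ss)
      (trans (O.antisym (joinOfMeets-mono {Ss = Ss} {Ts} f) (joinOfMeets-mono {Ss = Ts} {Ss} g)) (sym (absorptiveOp-concat Ts)))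

    absorbs : ∀ ℓ k → AbsorbsSupersets (suc ℓ) (suc k) (absorptiveOp ℓ k)
    absorbs zero    k = tt
    absorbs (suc ℓ) k S₁ S₂ Ss S₂⊆S₁ = on-blocks {Ss = S₁ ∷ S₂ ∷ Ss} {S₂ ∷ S₂ ∷ Ss}
      (λ { zero → zero , S₂⊆S₁ ; (suc i) → suc i , id }) (λ { zero → suc zero , id ; (suc i) → suc i , id })

  module _ {M : OpSet A} (binary-closed : ∀ {_·_ : Op₂ A} {m} {f g : Op A m} → _·_ ≡ _∨_ ⊎ _·_ ≡ _∧′_ →
                                          M m f → M m g → M m (λ a → f a · g a))
           (projections : ∀ {m} (i : Fin m) → M m (λ a → lookup a i)) where

    private
      fold-member : ∀ {_·_ : Op₂ A} {m} l (g : Fin (suc l) → Op A m) → _·_ ≡ _∨_ ⊎ _·_ ≡ _∧′_ → (∀ i → M m (g i)) →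
                    M m (λ a → Vec.foldr₁ _·_ (tabulate λ i → g i a))
      fold-member zero    g c ms = ms zero
      fold-member (suc l) g c ms = binary-closed c (ms zero) (fold-member l (g ∘ suc) c (ms ∘ suc))

    lattice⇒absorptive : HasAbsorptive M
    lattice⇒absorptive (suc ℓ) (suc k) = absorptiveOp ℓ k ,
      fold-member ℓ (λ i v → meet (block (suc ℓ) (suc k) v i)) (inj₁ refl)
        (λ i → fold-member k (λ j v → lookup v (Fin.combine i j)) (inj₂ refl) λ j → projections (Fin.combine i j)) ,
      (λ Ss Ts S⊑T T⊑S → on-blocks {Ss = Ss} {Ts} (λ i → let j , _ , T⊆S = S⊑T i in j , T⊆S) (λ i → let j , _ , S⊆T = T⊑S i in j , S⊆T)) ,
      absorbs ℓ k

latticePol⇒absorptive : ∀ {τ} (𝔹 : Structure τ) → HasLatticePol 𝔹 → HasAbsorptive (Pol 𝔹)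
latticePol⇒absorptive 𝔹 (_∨_ , _∧′_ , ∨-pol , ∧-pol , L) = LatticeAbsorption.lattice⇒absorptive L {Pol 𝔹} closed (projection-pol 𝔹)
  where
  compose : ∀ {_·_ : Op₂ (Carrier 𝔹)} {m} {f g : Op (Carrier 𝔹) m} → IsPolymorphism₂ 𝔹 _·_ →
            Pol 𝔹 m f → Pol 𝔹 m g → Pol 𝔹 m (λ a → f a · g a)
  compose {_·_} {f = f} {g} p pf pg = respects-≗-pol 𝔹 (λ a → refl)
    (composition-pol 𝔹 {f = λ { (x ∷ y ∷ []) → x · y }} {λ { zero → f ; (suc _) → g }}
      (respects-≗-pol 𝔹 (λ { (x ∷ y ∷ []) → refl }) p) λ { zero → pf ; (suc _) → pg })
  closed : ∀ {_·_ : Op₂ (Carrier 𝔹)} {m} {f g : Op (Carrier 𝔹) m} → _·_ ≡ _∨_ ⊎ _·_ ≡ _∧′_ →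
           Pol 𝔹 m f → Pol 𝔹 m g → Pol 𝔹 m (λ a → f a · g a)
  closed {f = f} {g} (inj₁ refl) = compose {_∨_} {f = f} {g} ∨-pol
  closed {f = f} {g} (inj₂ refl) = compose {_∧′_} {f = f} {g} ∧-pol

latticeEquivalent⇒polymorphisms : ∀ {n τ} {𝔹 𝔹′ : Structure τ} → 𝔹 ⟷ 𝔹′ → ElevatorChain[1+ n ] (Pol 𝔹′) → HasLatticePol 𝔹′ →
  ElevatorChain[1+ n ] (Pol 𝔹) × HasAbsorptive (Pol 𝔹)
latticeEquivalent⇒polymorphisms {𝔹 = 𝔹} {𝔹′} (g , h) chain L =
  elevator-transfer chain , absorptive-transfer (latticePol⇒absorptive 𝔹′ L)
  where
  open Transfer {J = ⊤} (λ _ → proj₁ g) (λ f b → proj₁ h (f (Vec.map (proj₁ g) b)))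
    (λ f f′ v w eq → cong (proj₁ h) (eq tt)) {Pol 𝔹′} {Pol 𝔹} (λ {m} f pf → conjugate-pol {𝔸 = 𝔹′} {𝔹} h g {m} {f} pf)

-- Elevator chains and absorptive operations as minor conditions

valuation : ∀ {A : Set} {m} → Vec A m → (ℕ → A) → ℕ → A
valuation []       f k       = f k
valuation (x ∷ xs) f zero    = x
valuation (x ∷ xs) f (suc k) = valuation xs f k

valuation-toℕ : ∀ {A : Set} {m} (xs : Vec A m) f i → valuation xs f (toℕ i) ≡ lookup xs i
valuation-toℕ (x ∷ xs) f zero    = refl
valuation-toℕ (x ∷ xs) f (suc i) = valuation-toℕ xs f i

valuation-+ : ∀ {A : Set} {m} (xs : Vec A m) f k → valuation xs f (m + k) ≡ f k
valuation-+ []       f k = refl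
valuation-+ (x ∷ xs) f k = valuation-+ xs f k

names : ∀ m → Vec ℕ m
names m = tabulate toℕ

valuation-names : ∀ {A : Set} {m} (xs : Vec A m) f → Vec.map (valuation xs f) (names m) ≡ xs
valuation-names xs f = lookup-ext λ i → trans (lookup-map-tabulate (valuation xs f) toℕ i) (valuation-toℕ xs f i)

module _ (n : ℕ) where

  private
    N = suc n

    ar : Fin (2 + N) → ℕ
    ar zero          = N
    ar (suc zero)    = N
    ar (suc (suc _)) = 2 + N

    xs : Vec ℕ N
    xs = names N

    climbing : Fin n → Identity ar
    climbing i = suc (suc (inject₁ i)) ⟨ insertTwice xs (inject₁ (inject₁ i)) (N + 1) ⟩≈
                 suc (suc (suc i)) ⟨ insertTwice xs (suc (suc i)) (N + 0) ⟩

  -- The variables `N + 0` and `N + 1`, which are not among the names `xs`, are those inserted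
  -- twice.
  elevatorCondition : MinorCondition
  elevatorCondition = record
    { #functions   = 2 + N
    ; ar           = ar
    ; ar-positive  = λ { zero → _ ; (suc zero) → _ ; (suc (suc _)) → _ }
    ; identities   = (zero ⟨ xs ⟩≈ suc (suc zero) ⟨ insertTwice xs (suc zero) (N + 0) ⟩)
                   ∷ (suc (suc (fromℕ n)) ⟨ insertTwice xs (inject₁ (fromℕ n)) (N + 0) ⟩≈ suc zero ⟨ xs ⟩)
                   ∷ List.map climbing (allFin n)
    }

  module _ {A : Set} {M : OpSet A} where

    elevator⇒condition : ElevatorChain[1+ n ] M → M Satisfies elevatorCondition
    elevator⇒condition chain =
      (λ { zero → e-first ; (suc zero) → e-last ; (suc (suc i)) → e i }) ,
      (λ { zero → e-first∈M ; (suc zero) → e-last∈M ; (suc (suc i)) → e∈M i }) ,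
      (λ ρ → trans (start (Vec.map ρ xs) (ρ (N + 0))) (cong (e zero) (sym (insertTwice-map ρ xs (suc zero) (N + 0))))) ∷
      (λ ρ → trans (cong (e (fromℕ n)) (insertTwice-map ρ xs (inject₁ (fromℕ n)) (N + 0))) (end (Vec.map ρ xs) (ρ (N + 0)))) ∷
      All.map⁺ (All.universal (λ i ρ → trans (cong (e (inject₁ i)) (insertTwice-map ρ xs (inject₁ (inject₁ i)) (N + 1)))
        (trans (climb i (Vec.map ρ xs) (ρ (N + 1)) (ρ (N + 0)))
          (cong (e (suc i)) (sym (insertTwice-map ρ xs (suc (suc i)) (N + 0)))))) (allFin n))
      where open ElevatorChain[1+_] chain

    condition⇒elevator : M Satisfies elevatorCondition → ElevatorChain[1+ n ] M
    condition⇒elevator (f , f∈M , start ∷ end ∷ climb) = record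
      { e-first = f zero ; e-last = f (suc zero) ; e = λ i → f (suc (suc i))
      ; e-first∈M = f∈M zero ; e-last∈M = f∈M (suc zero) ; e∈M = λ i → f∈M (suc (suc i))
      ; start = λ as z → trans (cong (f zero) (sym (plain as z z))) (trans (start (valuation as (pairing z z)))
          (cong (f (suc (suc zero))) (inserted as z z (suc zero) 0)))
      ; climb = λ i as y z → trans (cong (f (suc (suc (inject₁ i)))) (sym (inserted as z y (inject₁ (inject₁ i)) 1)))
          (trans (All.lookup (All.map⁻ climb) (Mem.∈-allFin i) (valuation as (pairing z y)))
            (cong (f (suc (suc (suc i)))) (inserted as z y (suc (suc i)) 0)))
      ; end   = λ as y → trans (cong (f (suc (suc (fromℕ n)))) (sym (inserted as y y (inject₁ (fromℕ n)) 0)))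
          (trans (end (valuation as (pairing y y))) (cong (f (suc zero)) (plain as y y)))
      }
      where
      plain : ∀ as z y → Vec.map (valuation as (pairing z y)) xs ≡ as
      plain as z y = valuation-names as (pairing z y)
      inserted : ∀ as z y p k → Vec.map (valuation as (pairing z y)) (insertTwice xs p (N + k)) ≡ insertTwice as p (pairing z y k)
      inserted as z y p k = trans (insertTwice-map (valuation as (pairing z y)) xs p (N + k))
        (cong₂ (λ v → insertTwice v p) (plain as z y) (valuation-+ as (pairing z y) k))

data Absorbs {A : Set} {k : ℕ} : ∀ {ℓ} → Vec (Vec A k) ℓ → Vec (Vec A k) ℓ → Set where
  absorbs : ∀ {ℓ} {S₁ S₂ : Vec A k} {Ss : Vec (Vec A k) ℓ} → S₂ ⊆ᵉ S₁ → Absorbs (S₁ ∷ S₂ ∷ Ss) (S₂ ∷ S₂ ∷ Ss)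

Identified : ∀ {A : Set} {ℓ k} → Vec (Vec A k) ℓ → Vec (Vec A k) ℓ → Set
Identified Ss Ts = (Ss ⊑ Ts × Ts ⊑ Ss) ⊎ Absorbs Ss Ts

module _ {A : Set} where

  map-Identified : ∀ {C : Set} (g : C → A) {ℓ k} {Ss Ts : Vec (Vec C k) ℓ} →
                   Identified Ss Ts → Identified (Vec.map (Vec.map g) Ss) (Vec.map (Vec.map g) Ts)
  map-Identified g {Ss = Ss} {Ts} (inj₁ (p , q)) = inj₁ (map-⊑ g {Ss = Ss} {Ts} p , map-⊑ g {Ss = Ts} {Ss} q)
  map-Identified g (inj₂ (absorbs S₂⊆S₁))        = inj₂ (absorbs (map-⊆ᵉ g S₂⊆S₁))

  absorptive⇒identified : ∀ {ℓ k} {f : Op A (ℓ * k)} → Absorptive ℓ k f → {Ss Ts : Vec (Vec A k) ℓ} →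
                          Identified Ss Ts → f (Vec.concat Ss) ≡ f (Vec.concat Ts)
  absorptive⇒identified (sets , _) {Ss} {Ts} (inj₁ (p , q)) = sets Ss Ts p q
  absorptive⇒identified (_ , absorb) (inj₂ (absorbs {S₁ = S₁} {S₂} {Ss} S₂⊆S₁)) = absorb S₁ S₂ Ss S₂⊆S₁

  identified⇒absorptive : ∀ ℓ k {f : Op A (ℓ * k)} → ((Ss Ts : Vec (Vec A k) ℓ) → Identified Ss Ts → f (Vec.concat Ss) ≡ f (Vec.concat Ts)) →
                          Absorptive ℓ k f
  identified⇒absorptive ℓ k {f} h = (λ Ss Ts p q → h Ss Ts (inj₁ (p , q))) , supersets ℓ f h
    where
    supersets : ∀ ℓ (f : Op A (ℓ * k)) → ((Ss Ts : Vec (Vec A k) ℓ) → Identified Ss Ts → f (Vec.concat Ss) ≡ f (Vec.concat Ts)) → AbsorbsSupersets ℓ k f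
    supersets 0             f h = tt
    supersets 1             f h = tt
    supersets (suc (suc ℓ)) f h = λ S₁ S₂ Ss S₂⊆S₁ → h (S₁ ∷ S₂ ∷ Ss) (S₂ ∷ S₂ ∷ Ss) (inj₂ (absorbs S₂⊆S₁))

map-concat-map : ∀ {A B C : Set} (g : B → C) (f : A → B) {ℓ k} (Ss : Vec (Vec A k) ℓ) →
                 Vec.map g (Vec.concat (Vec.map (Vec.map f) Ss)) ≡ Vec.concat (Vec.map (Vec.map (g ∘ f)) Ss)
map-concat-map g f Ss = trans (Vec.map-concat g (Vec.map (Vec.map f) Ss))
  (cong Vec.concat (trans (sym (map-∘ (Vec.map g) (Vec.map f) Ss)) (map-cong (λ S → sym (map-∘ g f S)) Ss)))

module _ (em : EM) (N ℓ k : ℕ) where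

  open Classical em

  private
    Blocks : Set
    Blocks = Vec (Vec (Fin N) (suc k)) (suc ℓ)

    ar : Fin 1 → ℕ
    ar _ = suc ℓ * suc k

    pairs : Listable (Blocks × Blocks)
    pairs = listable-Σ blocks λ _ → blocks
      where blocks = listable-Vec (suc ℓ) (listable-Vec (suc k) (listable-Fin N))

    SamePair : Blocks × Blocks → Set
    SamePair (Ss , Ts) = Identified {Fin N} {suc ℓ} {suc k} Ss Ts

    identified? : ∀ p → Dec (SamePair p)
    identified? p = decide (SamePair p)

    equation : Blocks × Blocks → Identity ar
    equation (Ss , Ts) = zero ⟨ Vec.concat (Vec.map (Vec.map toℕ) Ss) ⟩≈ zero ⟨ Vec.concat (Vec.map (Vec.map toℕ) Ts) ⟩

  -- Over a domain of `N` elements, absorptivity amounts to identities in `N` variables, one for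
  -- each element; of these there are only finitely many.
  absorptiveCondition : MinorCondition
  absorptiveCondition = record
    { #functions  = 1
    ; ar          = ar
    ; ar-positive = λ _ → _
    ; identities  = List.map equation (List.filter identified? (proj₁ pairs))
    }

  absorptive⇒condition : ∀ {A : Set} {M : OpSet A} → HasAbsorptive M → M Satisfies absorptiveCondition
  absorptive⇒condition {A} has =
    let f , f∈M , absorptive = has (suc ℓ) (suc k) in
    (λ _ → f) , (λ _ → f∈M) , All.map⁺ (All.map (λ {p} → holds f absorptive p) (All.all-filter identified? (proj₁ pairs)))
    where
    holds : ∀ f → Absorptive (suc ℓ) (suc k) f → ∀ p → SamePair p → (ρ : ℕ → A) →
            f (Vec.map ρ (Identity.lhsArgs (equation p))) ≡ f (Vec.map ρ (Identity.rhsArgs (equation p)))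
    holds f absorptive (Ss , Ts) identified ρ = trans (cong f (map-concat-map ρ toℕ Ss))
      (trans (absorptive⇒identified absorptive {Vec.map (Vec.map (ρ ∘ toℕ)) Ss} {Vec.map (Vec.map (ρ ∘ toℕ)) Ts}
        (map-Identified (ρ ∘ toℕ) {Ss = Ss} {Ts} identified))
        (cong f (sym (map-concat-map ρ toℕ Ts))))

  condition⇒absorptive : ∀ {A : Set} {M : OpSet A} → A → (bij : A ↔ Fin N) → M Satisfies absorptiveCondition →
                         ∃[ f ] M (suc ℓ * suc k) f × Absorptive (suc ℓ) (suc k) f
  condition⇒absorptive {A} a₀ bij (f , f∈M , ids) = f zero , f∈M zero , identified⇒absorptive (suc ℓ) (suc k) λ Ss Ts identified →
    trans (cong (f zero) (sym (decode Ss))) (trans (All.lookup (All.map⁻ ids)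
      (Mem.∈-filter⁺ identified? (proj₂ pairs (codes Ss , codes Ts)) (map-Identified to {Ss = Ss} {Ts} identified)) ρ)
      (cong (f zero) (decode Ts)))
    where
    open Inverse bij using (to; from; strictlyInverseʳ)
    codes : Vec (Vec A (suc k)) (suc ℓ) → Blocks
    codes = Vec.map (Vec.map to)
    ρ : ℕ → A
    ρ = valuation (tabulate from) (λ _ → a₀)
    decode : ∀ Ss → Vec.map ρ (Vec.concat (Vec.map (Vec.map toℕ) (codes Ss))) ≡ Vec.concat Ss
    decode Ss = trans (map-concat-map ρ toℕ (codes Ss)) (cong Vec.concat (begin
      Vec.map (Vec.map (ρ ∘ toℕ)) (Vec.map (Vec.map to) Ss) ≡⟨ map-∘ _ _ Ss ⟨
      Vec.map (Vec.map (ρ ∘ toℕ) ∘ Vec.map to) Ss           ≡⟨ map-cong (λ S → trans (sym (map-∘ (ρ ∘ toℕ) to S))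
                                                                 (trans (map-cong value S) (Vec.map-id S))) Ss ⟩
      Vec.map id Ss                                         ≡⟨ Vec.map-id Ss ⟩
      Ss                                                    ∎))
      where
      open ≡-Reasoning
      value : ∀ a → ρ (toℕ (to a)) ≡ a
      value a = trans (valuation-toℕ (tabulate from) _ (to a)) (trans (lookup∘tabulate from (to a)) (strictlyInverseʳ a))

tournamentAbsorptive : ∀ m → HasAbsorptive (Pol (𝕋 m))
tournamentAbsorptive m = latticePol⇒absorptive (𝕋 m) (_∨_ , _∧′_ ,
  respects-≗-pol (𝕋 m) (λ { (x ∷ y ∷ []) → refl }) ∨-pol , respects-≗-pol (𝕋 m) (λ { (x ∷ y ∷ []) → refl }) ∧′-pol ,
  IsDistributiveLattice.isLattice ∨-∧-isDistributiveLattice)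
  where open TournamentLattice m

tournament-minimal⇒polymorphisms : EM → ∀ n {τ} {𝔹 : Structure τ} → Finite (Carrier 𝔹) → Carrier 𝔹 →
  (∀ Γ → Pol (𝕋 (2 + n)) Satisfies Γ → Pol 𝔹 Satisfies Γ) → ElevatorChain[1+ n ] (Pol 𝔹) × HasAbsorptive (Pol 𝔹)
tournament-minimal⇒polymorphisms em n {𝔹 = 𝔹} (N , bij) b₀ minimal =
  condition⇒elevator n (minimal (elevatorCondition n) (elevator⇒condition n (TournamentElevator.tournamentElevator n))) , has
  where
  has : HasAbsorptive (Pol 𝔹)
  has (suc ℓ) (suc k) = condition⇒absorptive em N ℓ k {M = Pol 𝔹} b₀ bij
    (minimal (absorptiveCondition em N ℓ k) (absorptive⇒condition em N ℓ k {M = Pol (𝕋 (2 + n))} (tournamentAbsorptive (2 + n))))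

-- Elevator chains fold caterpillars

expandAt : ∀ {A : Set} {m} → Vec A m → Fin m → A → A → A → Vec A (2 + m)
expandAt (_ ∷ xs) zero    p q r = p ∷ q ∷ r ∷ xs
expandAt (x ∷ xs) (suc k) p q r = x ∷ expandAt xs k p q r

expandAt-after : ∀ {A : Set} {m} (xs : Vec A m) k z → expandAt xs k (lookup xs k) z z ≡ insertTwice xs (suc k) z
expandAt-after (x ∷ xs) zero    z = refl
expandAt-after (x ∷ xs) (suc k) z = cong (x ∷_) (expandAt-after xs k z)

expandAt-before : ∀ {A : Set} {m} (xs : Vec A m) k y → expandAt xs k y y (lookup xs k) ≡ insertTwice xs (inject₁ k) y
expandAt-before (x ∷ xs) zero    y = refl
expandAt-before (x ∷ xs) (suc k) y = cong (x ∷_) (expandAt-before xs k y)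

expandAt-related : ∀ {A B : Set} (R : A → B → Set) {m} (xs : Vec A m) (ys : Vec B m) k {p q r p′ q′ r′} →
  (∀ l → l ≢ k → R (lookup xs l) (lookup ys l)) → R p p′ → R q q′ → R r r′ →
  ∀ l → R (lookup (expandAt xs k p q r) l) (lookup (expandAt ys k p′ q′ r′) l)
expandAt-related R (_ ∷ xs) (_ ∷ ys) zero    f p q r zero                = p
expandAt-related R (_ ∷ xs) (_ ∷ ys) zero    f p q r (suc zero)          = q
expandAt-related R (_ ∷ xs) (_ ∷ ys) zero    f p q r (suc (suc zero))    = r
expandAt-related R (_ ∷ xs) (_ ∷ ys) zero    f p q r (suc (suc (suc l))) = f (suc l) λ ()
expandAt-related R (_ ∷ xs) (_ ∷ ys) (suc k) f p q r zero                = f zero λ ()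
expandAt-related R (_ ∷ xs) (_ ∷ ys) (suc k) f p q r (suc l)             =
  expandAt-related R xs ys k (λ l ne → f (suc l) (ne ∘ Fin.suc-injective)) p q r l

-- The operation eₖ₊₁ takes the same values with y,y before as with z,z after
-- its (k+1)-st argument, since both are attained at a common tuple.
module ElevatorValues {n : ℕ} {A : Set} {M : OpSet A} (chain : ElevatorChain[1+ n ] M) where

  open ElevatorChain[1+_] chain

  private
    before-irrelevant : ∀ k xs y y′ → e k (insertTwice xs (inject₁ k) y) ≡ e k (insertTwice xs (inject₁ k) y′)
    before-irrelevant k xs y y′ with Top.view k
    ... | Top.‵fromℕ     = trans (end xs y) (sym (end xs y′))
    ... | Top.‵inject₁ i = trans (climb i xs y y) (sym (climb i xs y′ y))

    before-after : ∀ k xs y → e k (insertTwice xs (inject₁ k) y) ≡ e k (insertTwice xs (suc k) (lookup xs k))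
    before-after k xs y = trans (before-irrelevant k xs y (lookup xs k))
      (cong (e k) (trans (sym (expandAt-before xs k (lookup xs k))) (expandAt-after xs k (lookup xs k))))

  after-first : ∀ k xs z → e k (insertTwice xs (suc k) z) ≡ e-first xs
  after-first = Fin.<-weakInduction (λ k → ∀ xs z → e k (insertTwice xs (suc k) z) ≡ e-first xs)
    (λ xs z → sym (start xs z))
    (λ i hyp xs z → trans (sym (climb i xs z z)) (trans (before-after (inject₁ i) xs z) (hyp xs _)))

  before-first : ∀ k xs y → e k (insertTwice xs (inject₁ k) y) ≡ e-first xs
  before-first k xs y = trans (before-after k xs y) (after-first k xs _)

module _ {τ : Signature} (𝔹 : Structure τ) where

  private
    columns : ∀ {B : Set} {m r} → (Fin m → Vec B r) → Vec (Vec B m) r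
    columns ts = tabulate λ p → tabulate λ l → lookup (ts l) p

    tuple-at-columns : ∀ {B : Set} {m r} (ts : Fin m → Vec B r) l → tuple-at (columns ts) l ≡ ts l
    tuple-at-columns ts l = lookup-ext λ p → trans (lookup-map-tabulate (λ v → lookup v l) _ p) (lookup∘tabulate _ l)

  columns-pol : ∀ {m} {f : Op (Carrier 𝔹) m} → Pol 𝔹 m f → ∀ s (ts : Fin m → Vec (Carrier 𝔹) (arity τ s)) →
                (∀ l → rel 𝔹 s (ts l)) → rel 𝔹 s (tabulate λ p → f (tabulate λ l → lookup (ts l) p))
  columns-pol {f = f} pf s ts R = subst (rel 𝔹 s) (sym (Vec.tabulate-∘ f _))
    (pf s (columns ts) λ l → subst (rel 𝔹 s) (sym (tuple-at-columns ts l)) (R l))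

  LinkRel-pol : ∀ {m} {f : Op (Carrier 𝔹) m} → Pol 𝔹 m f → ∀ φ v w →
                (∀ l → LinkRel 𝔹 φ (lookup v l) (lookup w l)) → LinkRel 𝔹 φ (f v) (f w)
  LinkRel-pol {f = f} pf φ v w links = _ , columns-pol {f = f} pf _ (proj₁ ∘ links) (proj₁ ∘ proj₂ ∘ links) ,
    trans (lookup∘tabulate _ (Link.source φ)) (cong f (lookup-ext λ l → trans (lookup∘tabulate _ l) (proj₁ (proj₂ (proj₂ (links l)))))) ,
    trans (lookup∘tabulate _ (Link.target φ)) (cong f (lookup-ext λ l → trans (lookup∘tabulate _ l) (proj₂ (proj₂ (proj₂ (links l))))))

  LegRel-pol : ∀ {m} {f : Op (Carrier 𝔹) m} → Pol 𝔹 m f → ∀ ψ v → (∀ l → LegRel 𝔹 ψ (lookup v l)) → LegRel 𝔹 ψ (f v)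
  LegRel-pol {f = f} pf ψ v legs = _ , columns-pol {f = f} pf _ (proj₁ ∘ legs) (proj₁ ∘ proj₂ ∘ legs) ,
    trans (lookup∘tabulate _ (Leg.position ψ)) (cong f (lookup-ext λ l → trans (lookup∘tabulate _ l) (proj₂ (proj₂ (legs l)))))

  module UnfoldedValues (C : Caterpillar τ) (i j : Joint C) (i<j : i Fin.< j) where

    open Caterpillar C
    open Unfold C i j i<j

    module _ (h : unfolded ⟶ 𝔹) where

      private
        h′ : Var → Carrier 𝔹
        h′ = proj₁ h ∘ inj₁

        satisfied : ∀ c → Satisfied 𝔹 (conj c) h′
        satisfied = Database.hom-satisfies conj 𝔹 h

      outer : Joint C → Carrier 𝔹
      outer x = h′ (a x)

      copy₁ copy₂ copy₃ : (x : Joint C) → .(i Fin.≤ x) → .(x Fin.≤ j) → Carrier 𝔹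
      copy₁ x p q = h′ (seq₁ x p q)
      copy₂ x p q = h′ (seq₂ x p q)
      copy₃ x p q = h′ (seq₃ x p q)

      copy₁-start : .(p : i Fin.≤ i) .(q : i Fin.≤ j) → copy₁ i p q ≡ outer i
      copy₁-start p q with i Fin.<? i
      ... | yes lt = contradiction lt (<-irrefl refl)
      ... | no _   = refl

      copy₂₃-start : .(p : i Fin.≤ i) .(q : i Fin.≤ j) → copy₂ i p q ≡ copy₃ i p q
      copy₂₃-start p q with i Fin.<? i | i Fin.<? j
      ... | yes lt | _       = contradiction lt (<-irrefl refl)
      ... | no _   | yes _   = refl
      ... | no _   | no ¬lt = contradiction i<j ¬lt

      copy₁₂-end : .(p : i Fin.≤ j) .(q : j Fin.≤ j) → copy₁ j p q ≡ copy₂ j p q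
      copy₁₂-end p q with i Fin.<? j | j Fin.<? j
      ... | no ¬lt | _      = contradiction i<j ¬lt
      ... | yes _  | yes lt = contradiction lt (<-irrefl refl)
      ... | yes _  | no _   = refl

      copy₃-end : .(p : i Fin.≤ j) .(q : j Fin.≤ j) → copy₃ j p q ≡ outer j
      copy₃-end p q with j Fin.<? j
      ... | yes lt = contradiction lt (<-irrefl refl)
      ... | no _   = refl

      outer-link : ∀ x → inject₁ x Fin.< i ⊎ j Fin.≤ inject₁ x → LinkRel 𝔹 (link x) (outer (inject₁ x)) (outer (suc x))
      outer-link x p = link-satisfied 𝔹 (link x) h′ (satisfied (link-fixed x p))

      outer-leg : ∀ x → x Fin.≤ i ⊎ j Fin.≤ x → ∀ {ψ} → ψ ∈ legs x → LegRel 𝔹 ψ (outer x)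
      outer-leg x p ψ∈ with Any.index ψ∈ | Any.lookup-index ψ∈
      ... | l | refl = leg-satisfied 𝔹 _ h′ (satisfied (leg-fixed x p l))

      module _ (x : Fin len) (p : i Fin.≤ inject₁ x) (q : suc x Fin.≤ j) where

        private
          q′ : inject₁ x Fin.≤ j
          q′ = ≤-trans (<⇒≤ (Fin.≤̄⇒inject₁< {i = x} ≤-refl)) q
          p′ : i Fin.≤ suc x
          p′ = ≤-trans p (<⇒≤ (Fin.≤̄⇒inject₁< {i = x} ≤-refl))

        copy₁-link : LinkRel 𝔹 (link x) (copy₁ (inject₁ x) p q′) (copy₁ (suc x) p′ q)
        copy₁-link = link-satisfied 𝔹 (link x) h′ (satisfied (link₁ x p q))

        copy₂-link : LinkRel 𝔹 (link x) (copy₂ (inject₁ x) p q′) (copy₂ (suc x) p′ q)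
        copy₂-link = link-satisfied 𝔹 (link x) h′ (satisfied (link₂ x p q))

        copy₃-link : LinkRel 𝔹 (link x) (copy₃ (inject₁ x) p q′) (copy₃ (suc x) p′ q)
        copy₃-link = link-satisfied 𝔹 (link x) h′ (satisfied (link₃ x p q))

      module _ (x : Joint C) (p : i Fin.< x) (q : x Fin.< j) {ψ : Leg τ} (ψ∈ : ψ ∈ legs x) where

        private
          at : (y : Fin (length (legs x)) → Index) (v : Var) →
               (∀ l → conj (y l) ≡ legAt (List.lookup (legs x) l) v) → LegRel 𝔹 ψ (h′ v)
          at y v eq with Any.index ψ∈ | Any.lookup-index ψ∈
          ... | l | refl = leg-satisfied 𝔹 _ h′ (subst (λ κ → Satisfied 𝔹 κ h′) (eq l) (satisfied (y l)))

        copy₁-leg : .(p′ : i Fin.≤ x) .(q′ : x Fin.≤ j) → LegRel 𝔹 ψ (copy₁ x p′ q′)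
        copy₁-leg p′ q′ with i Fin.<? x
        ... | yes _  = at (leg′ x p q) (a′ x p (<⇒≤ q)) λ _ → refl
        ... | no ¬lt = contradiction p ¬lt

        copy₂-leg : .(p′ : i Fin.≤ x) .(q′ : x Fin.≤ j) → LegRel 𝔹 ψ (copy₂ x p′ q′)
        copy₂-leg p′ q′ with i Fin.<? x | x Fin.<? j
        ... | yes _  | yes _  = at (leg x p q) (a x) λ _ → refl
        ... | no ¬lt | _      = contradiction p ¬lt
        ... | yes _  | no ¬lt = contradiction q ¬lt

        copy₃-leg : .(p′ : i Fin.≤ x) .(q′ : x Fin.≤ j) → LegRel 𝔹 ψ (copy₃ x p′ q′)
        copy₃-leg p′ q′ with x Fin.<? j
        ... | yes _  = at (leg″ x p q) (a″ x (<⇒≤ p) q) λ _ → refl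
        ... | no ¬lt = contradiction q ¬lt

  module Folded (em : EM) {n : ℕ} (chain : ElevatorChain[1+ n ] (Pol 𝔹)) (C : Caterpillar τ)
    (i j : Fin (suc n) → Joint C) (i<j : ∀ k → i k Fin.< j k) (ordered : ∀ {k l} → k Fin.< l → j k Fin.≤ i l)
    (h : ∀ k → Unfold.unfolded C (i k) (j k) (i<j k) ⟶ 𝔹) where

    open Classical em
    open Caterpillar C
    open ElevatorChain[1+_] chain
    open ElevatorValues chain

    private
      module V (k : Fin (suc n)) = UnfoldedValues C (i k) (j k) (i<j k)

      outers : Joint C → Vec (Carrier 𝔹) (suc n)
      outers x = tabulate λ k → V.outer k (h k) x

      lookup-outers : ∀ x k → lookup (outers x) k ≡ V.outer k (h k) x
      lookup-outers x k = lookup∘tabulate (λ k → V.outer k (h k) x) k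

      -- Inside the `k`-th interval, the homomorphism of the `k`-th unfolding has three values over
      -- `x`. They enter `e k` side by side, in the place of the single value outside the interval.
      inner : ∀ k x → .(i k Fin.≤ x) → .(x Fin.≤ j k) → Carrier 𝔹
      inner k x p q = e k (expandAt (outers x) k (V.copy₁ k (h k) x p q) (V.copy₂ k (h k) x p q) (V.copy₃ k (h k) x p q))

      Inside : Joint C → Set
      Inside x = ∃[ k ] i k Fin.< x × x Fin.< j k

      value′ : ∀ x → Dec (Inside x) → Carrier 𝔹
      value′ x (yes (k , p , q)) = inner k x (<⇒≤ p) (<⇒≤ q)
      value′ x (no _)            = e-first (outers x)

      value : Joint C → Carrier 𝔹
      value x = value′ x (decide (Inside x))

      disjoint : ∀ {k l} (x : Joint C) → i k Fin.≤ x → x Fin.≤ j k → i l Fin.< x → x Fin.< j l → k ≡ l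
      disjoint {k} {l} x p q p′ q′ with Fin.<-cmp k l
      ... | tri< k<l _ _ = contradiction (<-≤-trans p′ (≤-trans q (ordered k<l))) (<-irrefl refl)
      ... | tri≈ _ eq _  = eq
      ... | tri> _ _ l<k = contradiction (<-≤-trans q′ (≤-trans (ordered l<k) p)) (<-irrefl refl)

      -- At `i k` the second and third copies coincide, at `j k` the first and second. The elevator
      -- identities delete such a pair, so the values fit together with `e-first` at both ends.
      inner-start : ∀ k .(p : i k Fin.≤ i k) .(q : i k Fin.≤ j k) → inner k (i k) p q ≡ e-first (outers (i k))
      inner-start k p q = trans (cong (e k) (trans
        (cong₂ (λ u v → expandAt (outers (i k)) k u v (V.copy₃ k (h k) (i k) p q))
          (trans (V.copy₁-start k (h k) p q) (sym (lookup-outers (i k) k))) (V.copy₂₃-start k (h k) p q))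
        (expandAt-after (outers (i k)) k _))) (after-first k (outers (i k)) _)

      inner-end : ∀ k .(p : i k Fin.≤ j k) .(q : j k Fin.≤ j k) → inner k (j k) p q ≡ e-first (outers (j k))
      inner-end k p q = trans (cong (e k) (trans
        (cong₂ (λ u v → expandAt (outers (j k)) k u (V.copy₂ k (h k) (j k) p q) v)
          (V.copy₁₂-end k (h k) p q) (trans (V.copy₃-end k (h k) p q) (sym (lookup-outers (j k) k))))
        (expandAt-before (outers (j k)) k _))) (before-first k (outers (j k)) _)

      value-inner : ∀ k x (p : i k Fin.≤ x) (q : x Fin.≤ j k) → value x ≡ inner k x p q
      value-inner k x p q with decide (Inside x)
      ... | yes (l , p′ , q′) with disjoint x p q p′ q′
      ...   | refl = refl
      value-inner k x p q | no ¬inside with i k Fin.≟ x | x Fin.≟ j k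
      ...   | yes refl | _        = sym (inner-start k p q)
      ...   | no _     | yes refl = sym (inner-end k p q)
      ...   | no i≢x   | no x≢j   = contradiction (k , Fin.≤∧≢⇒< p i≢x , Fin.≤∧≢⇒< q x≢j) ¬inside

      value-outer : ∀ x → ¬ Inside x → value x ≡ e-first (outers x)
      value-outer x ¬inside with decide (Inside x)
      ... | yes inside = contradiction inside ¬inside
      ... | no _       = refl

      outer-link : ∀ x l → inject₁ x Fin.< i l ⊎ j l Fin.≤ inject₁ x →
                   LinkRel 𝔹 (link x) (lookup (outers (inject₁ x)) l) (lookup (outers (suc x)) l)
      outer-link x l p = subst₂ (LinkRel 𝔹 (link x)) (sym (lookup-outers (inject₁ x) l)) (sym (lookup-outers (suc x) l))
        (V.outer-link l (h l) x p)

      inject₁<suc : ∀ (x : Fin len) → inject₁ x Fin.< suc x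
      inject₁<suc x = Fin.≤̄⇒inject₁< {i = x} ≤-refl

      links : ∀ x → LinkRel 𝔹 (link x) (value (inject₁ x)) (value (suc x))
      links x with decide (∃[ k ] i k Fin.≤ inject₁ x × suc x Fin.≤ j k)
      ... | yes (k , p , q) = subst₂ (LinkRel 𝔹 (link x))
            (sym (value-inner k (inject₁ x) p (≤-trans (<⇒≤ (inject₁<suc x)) q))) (sym (value-inner k (suc x) (≤-trans p (<⇒≤ (inject₁<suc x))) q))
            (LinkRel-pol (e∈M k) (link x) _ _ (expandAt-related (LinkRel 𝔹 (link x)) (outers (inject₁ x)) (outers (suc x)) k
              (λ l l≢k → outer-link x l (elsewhere l l≢k))
              (V.copy₁-link k (h k) x p q) (V.copy₂-link k (h k) x p q) (V.copy₃-link k (h k) x p q)))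
        where
        elsewhere : ∀ l → l ≢ k → inject₁ x Fin.< i l ⊎ j l Fin.≤ inject₁ x
        elsewhere l l≢k with Fin.<-cmp k l
        ... | tri< k<l _ _ = inj₁ (<-≤-trans (inject₁<suc x) (≤-trans q (ordered k<l)))
        ... | tri≈ _ eq _  = contradiction (sym eq) l≢k
        ... | tri> _ _ l<k = inj₂ (≤-trans (ordered l<k) p)
      ... | no none = subst₂ (LinkRel 𝔹 (link x))
            (sym (value-outer (inject₁ x) λ (l , p , q) → none (l , <⇒≤ p , subst (_≤ toℕ (j l)) (cong suc (toℕ-inject₁ x)) q)))
            (sym (value-outer (suc x) λ (l , p , q) → none (l , ≤-pred (subst (toℕ (i l) <_) (cong suc (sym (toℕ-inject₁ x))) p) , <⇒≤ q)))
            (LinkRel-pol e-first∈M (link x) _ _ λ l → outer-link x l (outside l))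
        where
        outside : ∀ l → inject₁ x Fin.< i l ⊎ j l Fin.≤ inject₁ x
        outside l with i l Fin.≤? inject₁ x | suc x Fin.≤? j l
        ... | no i≰x | _      = inj₁ (≰⇒> i≰x)
        ... | yes p  | yes q  = contradiction (l , p , q) none
        ... | yes _  | no x≰j = inj₂ (subst (toℕ (j l) ≤_) (sym (toℕ-inject₁ x)) (≤-pred (≰⇒> x≰j)))

      outer-leg : ∀ x l → x Fin.≤ i l ⊎ j l Fin.≤ x → ∀ {ψ} → ψ ∈ legs x → LegRel 𝔹 ψ (lookup (outers x) l)
      outer-leg x l p {ψ} ψ∈ = subst (LegRel 𝔹 ψ) (sym (lookup-outers x l)) (V.outer-leg l (h l) x p ψ∈)

      not-inside : ∀ (x : Joint C) l → ¬ (i l Fin.< x × x Fin.< j l) → x Fin.≤ i l ⊎ j l Fin.≤ x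
      not-inside x l ¬in with i l Fin.<? x | x Fin.<? j l
      ... | yes p  | yes q  = contradiction (p , q) ¬in
      ... | no ¬p  | _      = inj₁ (≮⇒≥ ¬p)
      ... | yes _  | no ¬q  = inj₂ (≮⇒≥ ¬q)

      legs⊨ : ∀ x {ψ} → ψ ∈ legs x → LegRel 𝔹 ψ (value x)
      legs⊨ x {ψ} ψ∈ with decide (Inside x)
      ... | yes (k , p , q) = LegRel-pol (e∈M k) ψ _ (expandAt-related (λ b _ → LegRel 𝔹 ψ b) (outers x) (outers x) k
            {p′ = value x} {value x} {value x}
            (λ l l≢k → outer-leg x l (not-inside x l λ (p′ , q′) → l≢k (sym (disjoint x (<⇒≤ p) (<⇒≤ q) p′ q′))) ψ∈)
            (V.copy₁-leg k (h k) x p q ψ∈ _ _) (V.copy₂-leg k (h k) x p q ψ∈ _ _) (V.copy₃-leg k (h k) x p q ψ∈ _ _))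
      ... | no ¬inside = LegRel-pol e-first∈M ψ _ λ l → outer-leg x l (not-inside x l λ (p , q) → ¬inside (l , p , q)) ψ∈

    folded : ⟦ C ⟧ ⟶ 𝔹
    folded = hom-caterpillar C 𝔹 value links legs⊨

  elevator⇒foldings : ∀ (em : EM) {n} → ElevatorChain[1+ n ] (Pol 𝔹) → ClosedUnderFoldings (suc n) (CSP 𝔹)
  elevator⇒foldings em chain C i j i<j ordered ℂ ℂs iso isos homs =
    finite-↔ (_≅_.bijection iso) (caterpillar-finite em C) ,
    _∘ₕ_ {𝔸 = ℂ} {⟦ C ⟧} {𝔹} (Folded.folded em chain C i j i<j ordered λ k →
      _∘ₕ_ {𝔸 = Unfold.unfolded C (i k) (j k) (i<j k)} {ℂs k} {𝔹} (proj₂ (homs k)) (≅-from (isos k))) (≅-to iso)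

-- Absorptive operations

-- The sets S₀, …, S_L, the first one being repeated twice so that there is
-- room to bring any two of them to the front.
module Absorption (em : EM) {A : Set} {L k : ℕ} {f : Op A ((3 + L) * k)} (absorptive : Absorptive (3 + L) k f) where

  open Classical em

  Blocks : Set
  Blocks = Fin (suc L) → Vec A k

  value : Blocks → A
  value S = f (Vec.concat (S zero ∷ S zero ∷ tabulate S))

  private
    record Row : Set where
      constructor row
      field
        first second : Vec A k
        others       : Blocks

      blocks : Vec (Vec A k) (3 + L)
      blocks = first ∷ second ∷ tabulate others

    open Row using (blocks)

    doubled : Blocks → Row
    doubled S = row (S zero) (S zero) S

    Present : Vec A k → Row → Set
    Present V r = ∃[ j ] V ≈ᵉ lookup (blocks r) j

    in-others : ∀ r l → Present (Row.others r l) r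
    in-others (row V T S) l = suc (suc l) , subst (S l ≈ᵉ_) (sym (lookup∘tabulate S l)) (id , id)

    _⊑ʳ_ : Row → Row → Set
    row V T S ⊑ʳ r = Present V r × Present T r × (∀ l → Present (S l) r)

    same-sets : ∀ r r′ → r ⊑ʳ r′ → r′ ⊑ʳ r → f (Vec.concat (blocks r)) ≡ f (Vec.concat (blocks r′))
    same-sets r r′ p q = proj₁ absorptive (blocks r) (blocks r′) (all-present r r′ p) (all-present r′ r q)
      where
      all-present : ∀ r r′ → r ⊑ʳ r′ → blocks r ⊑ blocks r′
      all-present r           r′ (p , _ , _) zero          = p
      all-present r           r′ (_ , q , _) (suc zero)    = q
      all-present (row V T S) r′ (_ , _ , s) (suc (suc l)) = subst (λ V → Present V r′) (sym (lookup∘tabulate S l)) (s l)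

    -- `S j` and `S m` are brought to the front, absorption replaces the former by the latter, and
    -- the rearrangement is undone since only the set of blocks matters.
    replace-block : ∀ S S′ j m → (∀ l → l ≢ j → S′ l ≡ S l) → S′ j ≡ S m → S m ⊆ᵉ S j → value S ≡ value S′
    replace-block S S′ j m other at-j Sm⊆Sj = begin
      value S                                   ≡⟨ same-sets (doubled S) (row (S j) (S m) S′) (old zero , old zero , old)
                                                     (in-others (doubled S) j , in-others (doubled S) m , new) ⟩
      f (Vec.concat (blocks (row (S j) (S m) S′))) ≡⟨ proj₂ absorptive (S j) (S m) (tabulate S′) Sm⊆Sj ⟩
      f (Vec.concat (blocks (row (S m) (S m) S′))) ≡⟨ same-sets (row (S m) (S m) S′) (doubled S′)
                                                        (Sm , Sm , in-others (doubled S′))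
                                                        (in-others (row (S m) (S m) S′) zero , in-others (row (S m) (S m) S′) zero , in-others (row (S m) (S m) S′)) ⟩
      value S′                                  ∎
      where
      open ≡-Reasoning
      old : ∀ l → Present (S l) (row (S j) (S m) S′)
      old l with l Fin.≟ j
      ... | yes refl = zero , id , id
      ... | no l≢j   = subst (λ V → Present V (row (S j) (S m) S′)) (other l l≢j) (in-others (row (S j) (S m) S′) l)
      new : ∀ l → Present (S′ l) (doubled S)
      new l with l Fin.≟ j
      ... | yes refl = subst (λ V → Present V (doubled S)) (sym at-j) (in-others (doubled S) m)
      ... | no l≢j   = subst (λ V → Present V (doubled S)) (sym (other l l≢j)) (in-others (doubled S) l)
      Sm : Present (S m) (doubled S′)
      Sm = subst (λ V → Present V (doubled S′)) at-j (in-others (doubled S′) j)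

    value-cong : ∀ {S S′} → S ≗ S′ → value S ≡ value S′
    value-cong eq = cong f (cong Vec.concat (cong₂ _∷_ (eq zero) (cong₂ _∷_ (eq zero) (tabulate-cong eq))))

  -- Each block of G outside H is replaced by a block of G inside H which it
  -- contains.
  module _ (H G : Blocks) (H⊆G : ∀ i → ∃[ m ] H i ≈ᵉ G m) (below : ∀ l → ∃[ i ] H i ⊆ᵉ G l) where

    private
      Kept : Fin (suc L) → Set
      Kept l = ∃[ i ] H i ≈ᵉ G l

      target′ : ∀ l → Dec (Kept l) → Fin (suc L)
      target′ l (yes _) = l
      target′ l (no _)  = proj₁ (H⊆G (proj₁ (below l)))

      target : Fin (suc L) → Fin (suc L)
      target l = target′ l (decide (Kept l))

      target-fixed : ∀ l → Kept l → target l ≡ l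
      target-fixed l kept with decide (Kept l)
      ... | yes _    = refl
      ... | no ¬kept = contradiction kept ¬kept

      target-kept : ∀ l → Kept (target l)
      target-kept l with decide (Kept l)
      ... | yes kept = kept
      ... | no _     = _ , proj₂ (H⊆G (proj₁ (below l)))

      target-⊆ : ∀ l → G (target l) ⊆ᵉ G l
      target-⊆ l with decide (Kept l)
      ... | yes _ = id
      ... | no _  = proj₂ (below l) ∘ proj₂ (proj₂ (H⊆G (proj₁ (below l))))

      partial′ : ∀ {P : Set} → Dec P → Fin (suc L) → Fin (suc L)
      partial′ (yes _) l = target l
      partial′ (no _)  l = l

      partial : ℕ → Fin (suc L) → Fin (suc L)
      partial c l = partial′ (toℕ l <? c) l

      partial-yes : ∀ {P : Set} (d : Dec P) → P → ∀ l → partial′ d l ≡ target l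
      partial-yes (yes _) _ l = refl
      partial-yes (no ¬p) p l = contradiction p ¬p

      partial-no : ∀ {P : Set} (d : Dec P) → ¬ P → ∀ l → partial′ d l ≡ l
      partial-no (no _)  _  l = refl
      partial-no (yes p) ¬p l = contradiction p ¬p

      partial-⇔ : ∀ {P Q : Set} (d : Dec P) (e : Dec Q) → (P → Q) → (Q → P) → ∀ l → partial′ d l ≡ partial′ e l
      partial-⇔ (yes p) e f g l = sym (partial-yes e (f p) l)
      partial-⇔ (no ¬p) e f g l = sym (partial-no e (¬p ∘ g) l)

      partial-target : ∀ {P : Set} (d : Dec P) l → partial′ d (target l) ≡ target l
      partial-target (yes _) l = target-fixed (target l) (target-kept l)
      partial-target (no _)  l = refl

      replaced : ∀ c → c ≤ suc L → value G ≡ value (G ∘ partial c)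
      replaced zero    _  = value-cong λ l → cong G (sym (partial-no (toℕ l <? 0) (λ ()) l))
      replaced (suc c) c< = trans (replaced c (<⇒≤ c<)) (replace-block (G ∘ partial c) (G ∘ partial (suc c)) j (target j)
        (λ l l≢j → cong G (partial-⇔ (toℕ l <? suc c) (toℕ l <? c)
          (λ lt → ≤∧≢⇒< (≤-pred lt) λ eq → l≢j (toℕ-injective (trans eq (sym toℕ-j)))) m≤n⇒m≤1+n l))
        (cong G (trans (partial-yes (toℕ j <? suc c) (s≤s (≤-reflexive toℕ-j)) j) (sym (partial-target (toℕ (target j) <? c) j))))
        (subst₂ (λ x y → G x ⊆ᵉ G y) (sym (partial-target (toℕ (target j) <? c) j))
          (sym (partial-no (toℕ j <? c) (λ lt → <-irrefl toℕ-j lt) j)) (target-⊆ j)))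
        where
        j : Fin (suc L)
        j = fromℕ< c<
        toℕ-j : toℕ j ≡ c
        toℕ-j = toℕ-fromℕ< c<

    absorption : value G ≡ value H
    absorption = trans (replaced (suc L) ≤-refl)
      (trans (value-cong λ l → cong G (partial-yes (toℕ l <? suc L) (toℕ<n l) l))
        (same-sets (doubled (G ∘ target)) (doubled H) (to-H zero , to-H zero , to-H) (to-G zero , to-G zero , to-G)))
      where
      to-H : ∀ l → Present (G (target l)) (doubled H)
      to-H l = let i , H⊆ , ⊆H = target-kept l ; m , p , q = in-others (doubled H) i in m , p ∘ ⊆H , H⊆ ∘ q
      to-G : ∀ i → Present (H i) (doubled (G ∘ target))
      to-G i = let m , H⊆ , ⊆H = H⊆G i
                   eq = target-fixed m (i , H⊆ , ⊆H)
                   m′ , p , q = subst (λ l → Present (G l) (doubled (G ∘ target))) eq (in-others (doubled (G ∘ target)) m)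
               in m′ , p ∘ H⊆ , ⊆H ∘ q

module _ {τ : Signature} (𝔹 : Structure τ) (em : EM) {L k : ℕ} {f : Op (Carrier 𝔹) ((3 + L) * k)}
         (absorptive : Absorptive (3 + L) k f) (pf : Pol 𝔹 ((3 + L) * k) f) where

  open Absorption em {f = f} absorptive

  value-pol : ∀ s (ts : Fin (suc L) → Fin k → Vec (Carrier 𝔹) (arity τ s)) → (∀ l j → rel 𝔹 s (ts l j)) →
              rel 𝔹 s (tabulate λ p → value (λ l → tabulate λ j → lookup (ts l j) p))
  value-pol s ts R = subst (rel 𝔹 s) (tabulate-cong λ p → cong f (lookup-ext λ c → trans
      (lookup∘tabulate (λ c → lookup (column c) p) c) (sym (entries p c))))
    (columns-pol 𝔹 {f = f} pf s column λ c → R _ _)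
    where
    pad : Fin (3 + L) → Fin (suc L)
    pad zero          = zero
    pad (suc zero)    = zero
    pad (suc (suc l)) = l
    column : Fin ((3 + L) * k) → Vec (Carrier 𝔹) (arity τ s)
    column c = ts (pad (proj₁ (Fin.remQuot {3 + L} k c))) (proj₂ (Fin.remQuot {3 + L} k c))
    module _ (p : Fin (arity τ s)) where
      S : Fin (suc L) → Vec (Carrier 𝔹) k
      S l = tabulate λ j → lookup (ts l j) p
      block-pad : ∀ l → lookup (S zero ∷ S zero ∷ tabulate S) l ≡ S (pad l)
      block-pad zero          = refl
      block-pad (suc zero)    = refl
      block-pad (suc (suc l)) = lookup∘tabulate S l
      entries : ∀ c → lookup (Vec.concat (S zero ∷ S zero ∷ tabulate S)) c ≡ lookup (column c) p
      entries c = let l , j = Fin.remQuot {3 + L} k c in begin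
        lookup (Vec.concat (S zero ∷ S zero ∷ tabulate S)) c                  ≡⟨ cong (lookup (Vec.concat (S zero ∷ S zero ∷ tabulate S))) (Fin.combine-remQuot {3 + L} k c) ⟨
        lookup (Vec.concat (S zero ∷ S zero ∷ tabulate S)) (Fin.combine l j) ≡⟨ lookup-concat (S zero ∷ S zero ∷ tabulate S) l j ⟩
        lookup (lookup (S zero ∷ S zero ∷ tabulate S) l) j                    ≡⟨ cong (λ v → lookup v j) (block-pad l) ⟩
        lookup (S (pad l)) j                                                  ≡⟨ lookup∘tabulate _ j ⟩
        lookup (ts (pad l) j) p                                               ∎
        where open ≡-Reasoning

-- Caterpillar duality from absorptive polymorphisms

module _ {τ : Signature} where

  open Words (Item τ)

  -- A link needs distinct positions; passing a tuple from a position to itself is a leg.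
  letterAt : ∀ s (p q : Fin (arity τ s)) → Dec (p ≡ q) → Letter
  letterAt s p q (yes _)  = true , unary (record { symbol = s ; position = p })
  letterAt s p q (no p≢q) = true , binary (record { symbol = s ; source = p ; target = q ; distinct = p≢q })

  module _ (em : EM) (𝔻 : Structure τ) where

    open Traces em 𝔻

    letterAt⁺ : ∀ s p q (d : Dec (p ≡ q)) {r} → rel 𝔻 s r → Step (letterAt s p q d) (lookup r p) (lookup r q)
    letterAt⁺ s p q (yes refl) {r} R = refl , r , R , refl
    letterAt⁺ s p q (no _)     {r} R = r , R , refl , refl

    letterAt⁻ : ∀ s p q (d : Dec (p ≡ q)) {x y} → Step (letterAt s p q d) x y → ∃[ r ] rel 𝔻 s r × lookup r p ≡ x × lookup r q ≡ y
    letterAt⁻ s p q (yes refl) (refl , r , R , eq) = r , R , eq , eq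
    letterAt⁻ s p q (no _)     st                = st

    last-leg : ∀ l w {a b} → Path (l ∷ w) a b → ∃[ ψ ] LegRel 𝔻 ψ b
    last-leg l (l′ ∷ w) (_ , _ , p)    = last-leg l′ w p
    last-leg l []       (_ , s , refl) =
      let r , R , _ , eq = step-tuple em 𝔻 l s in record { symbol = letterSymbol l ; position = exit l } , r , R , eq

    first-leg : ∀ l {a b} → Step l a b → ∃[ ψ ] LegRel 𝔻 ψ a
    first-leg l s = let r , R , eq , _ = step-tuple em 𝔻 l s in record { symbol = letterSymbol l ; position = entry l } , r , R , eq

module AbsorptiveDuality (em : EM) {τ : Signature} (𝔹 : Structure τ) (finite : Finite (Carrier 𝔹))
  (b₀ : Carrier 𝔹) (has : HasAbsorptive (Pol 𝔹)) where

  open Classical em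
  open Words (Item τ)
  open Traces em 𝔹
  open Separation em 𝔹 using (PathIn; duality-caterpillar)
  open Inverse (proj₂ finite) using (to; from; strictlyInverseʳ)

  private
    B = Carrier 𝔹
    N = proj₁ finite
    K = maxArity τ

    holds : Subset N → B → Set
    holds V b = lookup V (to b) ≡ true

    code : (B → Set) → Subset N
    code P = tabulate (truth ∘ P ∘ from)

    lookup-code : ∀ P b → lookup (code P) (to b) ≡ truth (P b)
    lookup-code P b = trans (lookup∘tabulate (truth ∘ P ∘ from) (to b)) (cong (truth ∘ P) (strictlyInverseʳ b))

    code⁺ : ∀ {P b} → P b → holds (code P) b
    code⁺ {P} {b} p = trans (lookup-code P b) (truth⁺ p)

    code⁻ : ∀ {P b} → holds (code P) b → P b
    code⁻ {P} {b} h = truth⁻ (trans (sym (lookup-code P b)) h)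

    -- Sets of values and sets of tuples are indexed by the same type, so that both families have
    -- the same number of blocks. The position is relevant for tuples only.
    Index Entries : Set
    Index   = Fin (suc K) × Subset N
    Entries = Vec B (suc K)

    indices : Listable Index
    indices = listable-Σ (listable-Fin (suc K)) λ _ → listable-Subset N

    entries : Listable Entries
    entries = listable-Vec (suc K) (finite⇒listable finite)

    L k : ℕ
    L = length (proj₁ indices)
    k = suc (length (proj₁ entries))

    index : Fin (suc L) → Index
    index zero    = zero , replicate N true
    index (suc l) = List.lookup (proj₁ indices) l

    entriesAt : Fin k → Entries
    entriesAt zero    = replicate (suc K) b₀
    entriesAt (suc j) = List.lookup (proj₁ entries) j

    index-onto : ∀ u → ∃[ l ] index l ≡ u
    index-onto u = suc (Any.index (proj₂ indices u)) , sym (Any.lookup-index (proj₂ indices u))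

    entriesAt-onto : ∀ x → ∃[ j ] entriesAt j ≡ x
    entriesAt-onto x = suc (Any.index (proj₂ entries x)) , sym (Any.lookup-index (proj₂ entries x))

    f : Op B ((3 + L) * k)
    f = proj₁ (has (3 + L) k)

    open Absorption em {f = f} (proj₂ (proj₂ (has (3 + L) k)))

    pick : ∀ {A : Set} (P : A → Set) → ∃ P → A → A
    pick P (w , _) x with decide (P x)
    ... | yes _ = x
    ... | no _  = w

    pick-sound : ∀ {A : Set} (P : A → Set) w x → P (pick P w x)
    pick-sound P (w , pw) x with decide (P x)
    ... | yes p = p
    ... | no _  = pw

    pick-fixed : ∀ {A : Set} (P : A → Set) w {x} → P x → pick P w x ≡ x
    pick-fixed P w {x} p with decide (P x)
    ... | yes _ = refl
    ... | no ¬p = contradiction p ¬p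

    ∈-tabulate⁻ : ∀ {A : Set} {m} (g : Fin m → A) {a} → a VecMem.∈ tabulate g → ∃[ j ] a ≡ g j
    ∈-tabulate⁻ g i = VecAny.index i , trans (VecAny.lookup-index i) (lookup∘tabulate g (VecAny.index i))

    ∈-tabulate⁺ : ∀ {A : Set} {m} (g : Fin m → A) j {a} → g j ≡ a → a VecMem.∈ tabulate g
    ∈-tabulate⁺ g j refl = VecMem.∈-tabulate⁺ g j

  module _ (𝔸 : Structure τ) (reach : ∀ w {a₀ a} → PathIn 𝔸 w a₀ a → ∃₂ λ b c → Path w b c) where

    private
      Reached : Word → B → Set
      Reached w c = ∃[ b ] Path w b c

      -- A homomorphism maps a to the value of the operation at the family of the
      -- sets that are reached in 𝔹 along the words leading to a in 𝔸.
      Family : Carrier 𝔸 → (B → Set) → Set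
      Family a P = ∃[ w ] (∃[ a₀ ] PathIn 𝔸 w a₀ a) × (∀ {c} → P c → Reached w c) × (∀ {c} → Reached w c → P c)

      family-inhabited : ∀ {a P} → Family a P → ∃ P
      family-inhabited (w , (_ , p) , _ , g) = let b , c , q = reach w p in c , g (b , q)

      family-code : ∀ {a P} → Family a P → Family a (holds (code P))
      family-code (w , p , f , g) = w , p , f ∘ code⁻ , code⁺ ∘ g

      -- A set outside the family is replaced by all of `𝔹`, which contains other blocks and is
      -- therefore absorbed.
      Member : Carrier 𝔸 → Index → B → Set
      Member a (_ , V) b = Family a (holds V) → holds V b

      member-inhabited : ∀ a u → ∃ (Member a u)
      member-inhabited a (_ , V) with decide (Family a (holds V))
      ... | yes F = let b , h = family-inhabited F in b , λ _ → h
      ... | no ¬F = b₀ , λ F → contradiction F ¬F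

      memberAt : ∀ a l → Fin k → B
      memberAt a l j = pick (Member a (index l)) (member-inhabited a (index l)) (Vec.head (entriesAt j))

      family : Carrier 𝔸 → Blocks
      family a l = tabulate (memberAt a l)

      family⁻ : ∀ a l {b} → b VecMem.∈ family a l → Member a (index l) b
      family⁻ a l i = let j , eq = ∈-tabulate⁻ (memberAt a l) i in
        subst (Member a (index l)) (sym eq) (pick-sound (Member a (index l)) (member-inhabited a (index l)) (Vec.head (entriesAt j)))

      family⁺ : ∀ a l {b} → Member a (index l) b → b VecMem.∈ family a l
      family⁺ a l {b} m = let j , eq = entriesAt-onto (replicate (suc K) b) in
        ∈-tabulate⁺ (memberAt a l) j (trans (cong (pick (Member a (index l)) (member-inhabited a (index l)) ∘ Vec.head) eq)
          (pick-fixed (Member a (index l)) (member-inhabited a (index l)) m))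

      hom : Carrier 𝔸 → B
      hom a = value (family a)

      module _ (s : Symbol τ) (t : Vec (Carrier 𝔸) (arity τ s)) (Rt : rel 𝔸 s t) where

        r = arity τ s

        r≤K : r ≤ suc K
        r≤K = m≤n⇒m≤1+n (arity≤maxArity τ s)

        letter : Fin r → Fin r → Letter
        letter p q = letterAt s p q (p Fin.≟ q)

        -- The tuples whose entry at the position given by the index lies in
        -- the set given by it, if that is in the family.
        Tuples : Index → Vec B r → Set
        Tuples (p , V) v = rel 𝔹 s v × (∀ q → toℕ q ≡ toℕ p → Family (lookup t q) (holds V) → holds V (lookup v q))

        Image : Index → Fin r → B → Set
        Image u q c = ∃[ v ] Tuples u v × lookup v q ≡ c

        -- If `V` is what is reached along a word at the entry with position `p`, the tuples through
        -- `V` are reached at `q` along that word and one more letter. If there is no such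
        -- restriction, the leg at `q` alone is the required word.
        image-family : ∀ u q → Family (lookup t q) (Image u q)
        image-family (p , V) q with decide (∃[ q₀ ] toℕ q₀ ≡ toℕ p × Family (lookup t q₀) (holds V))
        ... | yes (q₀ , eq , w , (a₀ , path) , f , g) = w ++ letter q₀ q ∷ [] ,
              (a₀ , Traces.Path-++⁺ em 𝔸 w path (_ , letterAt⁺ em 𝔸 s q₀ q (q₀ Fin.≟ q) Rt , refl)) ,
              (λ { (v , (Rv , h) , refl) →
                let b , path′ = f (h q₀ eq (w , (a₀ , path) , f , g))
                in b , Path-++⁺ w path′ (_ , letterAt⁺ em 𝔹 s q₀ q (q₀ Fin.≟ q) Rv , refl) }) ,
              λ (b , path′) → extend (Path-++⁻ w path′)
              where
              extend : ∀ {b c} → ∃[ d ] Path w b d × Path (letter q₀ q ∷ []) d c → Image (p , V) q c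
              extend (d , path₁ , _ , st , refl) with letterAt⁻ em 𝔹 s q₀ q (q₀ Fin.≟ q) st
              ... | v , Rv , refl , eq′ = v , (Rv , λ q₁ e _ →
                    subst (λ q → holds V (lookup v q)) (toℕ-injective (trans eq (sym e))) (g (_ , path₁))) , eq′
        ... | no none = letter q q ∷ [] , (_ , _ , letterAt⁺ em 𝔸 s q q (q Fin.≟ q) Rt , refl) ,
              (λ { (v , (Rv , _) , refl) → _ , _ , letterAt⁺ em 𝔹 s q q (q Fin.≟ q) Rv , refl }) ,
              λ { (b , _ , st , refl) → let v , Rv , _ , eq = letterAt⁻ em 𝔹 s q q (q Fin.≟ q) st in
                  v , (Rv , λ q₀ e F → contradiction (q₀ , e , F) none) , eq }

        tuples-inhabited : ∀ u → ∃ (Tuples u)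
        tuples-inhabited u = let _ , v , T , _ = family-inhabited (image-family u (fromℕ< (>-nonZero⁻¹ r {{arity-positive τ s}}))) in v , T

        tuples : Fin (suc L) → Fin k → Vec B r
        tuples l j = pick (Tuples (index l)) (tuples-inhabited (index l)) (Vec.truncate r≤K (entriesAt j))

        images : Fin r → Blocks
        images q l = tabulate λ j → lookup (tuples l j) q

        images⁻ : ∀ q l {c} → c VecMem.∈ images q l → Image (index l) q c
        images⁻ q l i = let j , eq = ∈-tabulate⁻ (λ j → lookup (tuples l j) q) i in
          tuples l j , pick-sound (Tuples (index l)) (tuples-inhabited (index l)) (Vec.truncate r≤K (entriesAt j)) , sym eq

        images⁺ : ∀ q l {c} → Image (index l) q c → c VecMem.∈ images q l
        images⁺ q l (v , T , eq) = let j , eq′ = entriesAt-onto (Vec.padRight r≤K b₀ v) in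
          ∈-tabulate⁺ (λ j → lookup (tuples l j) q) j (trans (cong (λ v → lookup v q)
            (trans (cong (pick (Tuples (index l)) (tuples-inhabited (index l))) (trans (cong (Vec.truncate r≤K) eq′) (Vec.truncate-padRight r≤K b₀ v)))
              (pick-fixed (Tuples (index l)) (tuples-inhabited (index l)) T))) eq)

        -- The images belong to the family at entry `q`, and every block there contains one of them,
        -- namely the image of the tuples restricted at `q` itself. Absorption thus replaces all
        -- blocks by columns of tuples, to which the polymorphism applies.
        family-value : ∀ q → value (family (lookup t q)) ≡ value (images q)
        family-value q = absorption (images q) (family (lookup t q)) images-in-family below
          where
          images-in-family : ∀ i → ∃[ l ] images q i ≈ᵉ family (lookup t q) l
          images-in-family i = let l , eq = index-onto (zero , code (Image (index i) q)) in
            l , (λ {c} c∈ → family⁺ (lookup t q) l (subst (λ u → Member (lookup t q) u c) (sym eq) λ _ → code⁺ (images⁻ q i c∈))) ,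
            λ {c} c∈ → images⁺ q i (code⁻ (subst (λ u → Member (lookup t q) u c) eq (family⁻ (lookup t q) l c∈)
              (family-code (image-family (index i) q))))
          below : ∀ l → ∃[ i ] images q i ⊆ᵉ family (lookup t q) l
          below l = let i , eq = index-onto (Fin.inject≤ q r≤K , proj₂ (index l)) in
            i , λ {c} c∈ → family⁺ (lookup t q) l (member (proj₂ (index l)) (subst (λ u → Image u q c) eq (images⁻ q i c∈)))
            where
            member : ∀ V {c} → Image (Fin.inject≤ q r≤K , V) q c → Family (lookup t q) (holds V) → holds V c
            member V (v , (_ , h) , refl) = h q (sym (Fin.toℕ-inject≤ q r≤K))

        hom-tuple : rel 𝔹 s (Vec.map hom t)
        hom-tuple = subst (rel 𝔹 s)
          (trans (tabulate-cong λ q → sym (family-value q)) (tabulate-lookup-map hom t))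
          (value-pol 𝔹 em {f = f} (proj₂ (proj₂ (has (3 + L) k))) (proj₁ (proj₂ (has (3 + L) k))) s tuples
            λ l j → proj₁ (pick-sound (Tuples (index l)) (tuples-inhabited (index l)) (Vec.truncate r≤K (entriesAt j))))

    reach⇒hom : 𝔸 ⟶ 𝔹
    reach⇒hom = hom , hom-tuple

  private
    -- The first and the last tuple on a nonempty path provide the legs which turn its word into a
    -- caterpillar.
    word-reached : (𝔸 : Structure τ) → (∀ C → ⟦ C ⟧ ⟶ 𝔸 → ⟦ C ⟧ ⟶ 𝔹) → ∀ w {a₀ a} → PathIn 𝔸 w a₀ a → ∃₂ λ b c → Path w b c
    word-reached 𝔸 homs []      _                    = b₀ , b₀ , refl
    word-reached 𝔸 homs (l ∷ w) path@(_ , st , _) =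
      let ψ  , r  = first-leg em 𝔸 l st
          ψ′ , r′ = last-leg em 𝔸 l w path
          _ , trace , _ = Traces.Path⇒Trace em 𝔸 (padded ψ ψ′ (l ∷ w)) (Path-padded⁺ em 𝔸 ψ ψ′ (l ∷ w) r r′ path)
          g = homs (caterpillar ψ ψ′ (l ∷ w)) (spelled-hom em 𝔸 (spells-caterpillar ψ ψ′ (l ∷ w)) trace)
          b , c , path′ = caterpillar-Path em 𝔹 ψ ψ′ (l ∷ w) g
      in b , c , proj₂ (proj₂ (Path-padded⁻ em 𝔹 ψ ψ′ (l ∷ w) path′))

  absorptive⇒duality : HasCaterpillarDuality 𝔹
  absorptive⇒duality = (λ 𝔽 → IsCaterpillar 𝔽 × ¬ (𝔽 ⟶ 𝔹)) , (λ _ → proj₁) , λ 𝔸 _ → mk⇔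
    (λ ¬hom → decidable-stable em λ none → ¬hom (reach⇒hom 𝔸 λ w → word-reached 𝔸
      (λ C g → stable λ ¬h → none (⟦ C ⟧ , ((C , ≅-refl) , ¬h) , g)) w))
    λ (𝔽 , (_ , ¬hom) , g) h → ¬hom (_∘ₕ_ {𝔸 = 𝔽} {𝔸} {𝔹} h g)

-- The implications between the conditions

module Equivalences (em : EM) (n : ℕ) {τ : Signature} (𝔹 : Structure τ) (finite : Finite (Carrier 𝔹)) (b₀ : Carrier 𝔹) where

  open Separation em 𝔹

  polymorphisms⇒foldings : ElevatorChain[1+ n ] (Pol 𝔹) × HasAbsorptive (Pol 𝔹) →
                           HasCaterpillarDuality 𝔹 × ClosedUnderFoldings (suc n) (CSP 𝔹)
  polymorphisms⇒foldings (chain , has) = AbsorptiveDuality.absorptive⇒duality em 𝔹 finite b₀ has , elevator⇒foldings 𝔹 em chain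

  polymorphisms⇒separated : ElevatorChain[1+ n ] (Pol 𝔹) × HasAbsorptive (Pol 𝔹) → SeparatedBy n
  polymorphisms⇒separated p = let duality , closed = polymorphisms⇒foldings p in foldings⇒separated b₀ duality closed

  pp⇒minion : 𝕋 (2 + n) PPConstructs 𝔹 → MinionHom (Pol (𝕋 (2 + n))) (Pol 𝔹)
  pp⇒minion = ppConstructs⇒minionHom {𝔸 = 𝕋 (2 + n)} {𝔹}

  minion⇒minimal : MinionHom (Pol (𝕋 (2 + n))) (Pol 𝔹) → ∀ Γ → Pol (𝕋 (2 + n)) Satisfies Γ → Pol 𝔹 Satisfies Γ
  minion⇒minimal = minionHom⇒satisfies {𝔸 = 𝕋 (2 + n)} {𝔹}

  minimal⇒polymorphisms : (∀ Γ → Pol (𝕋 (2 + n)) Satisfies Γ → Pol 𝔹 Satisfies Γ) → ElevatorChain[1+ n ] (Pol 𝔹) × HasAbsorptive (Pol 𝔹)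
  minimal⇒polymorphisms = tournament-minimal⇒polymorphisms em n {𝔹 = 𝔹} finite b₀

  minimal⇒separated : (∀ Γ → Pol (𝕋 (2 + n)) Satisfies Γ → Pol 𝔹 Satisfies Γ) → SeparatedBy n
  minimal⇒separated = polymorphisms⇒separated ∘ minimal⇒polymorphisms

  ppConstructs⇒separated : 𝕋 (2 + n) PPConstructs 𝔹 → SeparatedBy n
  ppConstructs⇒separated pp = minimal⇒separated (minion⇒minimal (pp⇒minion pp))

  separated⇒ppConstructs : SeparatedBy n → 𝕋 (2 + n) PPConstructs 𝔹
  separated⇒ppConstructs = snlam⇒ppConstructs em 𝔹 finite b₀ n ∘ canonical⇒snlam em 𝔹 finite n ∘ separated⇒canonical em 𝔹 finite n b₀

  separated⇒minimal : SeparatedBy n → ∀ Γ → Pol (𝕋 (2 + n)) Satisfies Γ → Pol 𝔹 Satisfies Γ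
  separated⇒minimal = minion⇒minimal ∘ pp⇒minion ∘ separated⇒ppConstructs

  separated⇒polymorphisms : SeparatedBy n → ElevatorChain[1+ n ] (Pol 𝔹) × HasAbsorptive (Pol 𝔹)
  separated⇒polymorphisms = minimal⇒polymorphisms ∘ separated⇒minimal

  separated⇒fixed-unfoldings : SeparatedBy n → HasCaterpillarDuality 𝔹 × ClosedUnderFixedUnfoldings n (coCSP 𝔹)
  separated⇒fixed-unfoldings s =
    let duality , closed = polymorphisms⇒foldings (separated⇒polymorphisms s)
    in duality , foldings⇒fixed-unfoldings b₀ closed

  LatticeEquivalent DistributiveLatticeEquivalent : Set₁
  LatticeEquivalent = Σ[ 𝔹′ ∈ Structure τ ] Finite (Carrier 𝔹′) × 𝔹 ⟷ 𝔹′ × ElevatorChain[1+ n ] (Pol 𝔹′) × HasLatticePol 𝔹′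
  DistributiveLatticeEquivalent =
    Σ[ 𝔹′ ∈ Structure τ ] Finite (Carrier 𝔹′) × 𝔹 ⟷ 𝔹′ × ElevatorChain[1+ n ] (Pol 𝔹′) × HasDistributiveLatticePol 𝔹′

  distributive⇒lattice : DistributiveLatticeEquivalent → LatticeEquivalent
  distributive⇒lattice (𝔹′ , fin , equivalent , chain , _ , _ , p , q , L) =
    𝔹′ , fin , equivalent , chain , _ , _ , p , q , IsDistributiveLattice.isLattice L

  lattice⇒separated : LatticeEquivalent → SeparatedBy n
  lattice⇒separated (_ , _ , equivalent , chain , L) = polymorphisms⇒separated (latticeEquivalent⇒polymorphisms equivalent chain L)

  separated⇒distributive : SeparatedBy n → DistributiveLatticeEquivalent
  separated⇒distributive = ppConstructs⇒distributiveLattice em n ∘ separated⇒ppConstructs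

hub⇒TFAE : ∀ {X : Set₁} {Ps} → All (λ P → (P → X) × (X → P)) Ps → TFAE Ps
hub⇒TFAE equivalences i j p =
  proj₂ (All.lookup equivalences (Mem.∈-lookup j)) (proj₁ (All.lookup equivalences (Mem.∈-lookup i)) p)

theorem4p1 : ExcludedMiddle (lsuc 0ℓ) →
    (n : ℕ) (τ : Signature) (𝔹 : Structure τ) (finite : Finite (Carrier 𝔹)) → Carrier 𝔹 →
    TFAE
    ( Lift _ (ElevatorChain[1+ n ] (Pol 𝔹) × HasAbsorptive (Pol 𝔹))
    ∷ (HasCaterpillarDuality 𝔹 × ClosedUnderFoldings (suc n) (CSP 𝔹))
    ∷ SolvedByCanonicalSnlam n 𝔹 finite
    ∷ SolvedBySnlam n 𝔹
    ∷ (HasCaterpillarDuality 𝔹 × ClosedUnderFixedUnfoldings n (coCSP 𝔹))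
    ∷ HasFixedUnfoldedCaterpillarDuality n 𝔹
    ∷ (∀ Γ → ¬ (Pol 𝔹 Satisfies Γ) → Γ ImpliesForFiniteClones HM n)
    ∷ Lift _ (∀ Γ → Pol (𝕋 (2 + n)) Satisfies Γ → Pol 𝔹 Satisfies Γ)
    ∷ Lift _ (MinionHom (Pol (𝕋 (2 + n))) (Pol 𝔹))
    ∷ Lift _ (𝕋 (2 + n) PPConstructs 𝔹)
    ∷ (Σ[ 𝔹′ ∈ Structure τ ] Finite (Carrier 𝔹′) × 𝔹 ⟷ 𝔹′ ×
    ElevatorChain[1+ n ] (Pol 𝔹′) × HasLatticePol 𝔹′)
    ∷ (Σ[ 𝔹′ ∈ Structure τ ] Finite (Carrier 𝔹′) × 𝔹 ⟷ 𝔹′ ×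
    ElevatorChain[1+ n ] (Pol 𝔹′) × HasDistributiveLatticePol 𝔹′)
    ∷ [])
theorem4p1 em n τ 𝔹 finite b₀ = hub⇒TFAE (
      (polymorphisms⇒separated ∘ lower , lift ∘ separated⇒polymorphisms)
    ∷ ((λ (duality , closed) → foldings⇒separated b₀ duality closed) , polymorphisms⇒foldings ∘ separated⇒polymorphisms)
    ∷ (ppConstructs⇒separated ∘ snlam⇒ppConstructs em 𝔹 finite b₀ n ∘ canonical⇒snlam em 𝔹 finite n , separated⇒canonical em 𝔹 finite n b₀)
    ∷ (ppConstructs⇒separated ∘ snlam⇒ppConstructs em 𝔹 finite b₀ n , canonical⇒snlam em 𝔹 finite n ∘ separated⇒canonical em 𝔹 finite n b₀)
    ∷ ((λ (duality , closed) → fixed-duality⇒separated (fixed-unfoldings⇒duality duality closed)) , separated⇒fixed-unfoldings)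
    ∷ (fixed-duality⇒separated , λ s → let duality , closed = separated⇒fixed-unfoldings s in fixed-unfoldings⇒duality duality closed)
    ∷ (minimal⇒separated ∘ HM⇒tournament-minimal em 𝔹 n , tournament-minimal⇒HM em 𝔹 n ∘ separated⇒minimal)
    ∷ (minimal⇒separated ∘ lower , lift ∘ separated⇒minimal)
    ∷ ((λ ξ → minimal⇒separated (minion⇒minimal (lower ξ))) , lift ∘ pp⇒minion ∘ separated⇒ppConstructs)
    ∷ (ppConstructs⇒separated ∘ lower , lift ∘ separated⇒ppConstructs)
    ∷ (lattice⇒separated , distributive⇒lattice ∘ separated⇒distributive)
    ∷ (lattice⇒separated ∘ distributive⇒lattice , separated⇒distributive)
    ∷ [])
  where
  open Separation em 𝔹
  open Equivalences em n 𝔹 finite b₀
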